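{- Let $a\neq\pm1$ be a square free rational integer, $u\in\{3,5,7\}$, $m=a^u$, let $\alpha$ be a root of $f(x)=x^8-m$ and $K=\mathbb Q(\alpha)$ with ring of integers $\mathbb Z_K$. Then: (1) If $a\not\equiv 1\pmod 4$, then $K$ is monogenic and $\mathbb Z_K=\mathbb Z[\theta]$ with $\theta=\frac{\alpha^x}{a^y}$, where $(x,y)$ is the unique solution in non-negative integers of $ux-8y=1$ with $x<8$. (2) If $a\equiv 1\pmod 4$ and $a\neq -3$, then $K$ is not monogenic.
   Context: $K$ is monogenic if $\mathbb Z_K=\mathbb Z[\theta]$ for some $\theta\in\mathbb Z_K$. -}

module Defs where

open import Data.Nat as ℕ using (ℕ; zero; suc)
open import Data.Integer as ℤ using (ℤ; +_; ∣_∣)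
open import Data.Integer.Divisibility as ℤD using ()
open import Data.Nat.Divisibility as ℕD using ()
open import Data.Rational as ℚ using (ℚ; 0ℚ; 1ℚ; _+_; _*_)
open import Data.Vec using (Vec; []; _∷_; replicate; zipWith; map)
open import Data.List using (List; []; _∷_; length)
open import Data.Product using (Σ; ∃; _×_)
open import Relation.Binary.PropositionalEquality using (_≡_)
open import Relation.Nullary using (¬_)

-- Square-free integer: no square of a natural number d ≠ 1 divides it
-- (this excludes a = 0, since 0*0 ∣ 0).
SquareFree : ℤ → Set
SquareFree a = ∀ (d : ℕ) → (d ℕ.* d) ℕD.∣ ∣ a ∣ → d ≡ 1

-- The field K = ℚ(α), α^8 = m, is modelled as ℚ[x]/(x^8 - m):
-- an element is its coordinate vector (c₀,…,c₇) w.r.t. 1, α, …, α⁷.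
K : Set
K = Vec ℚ 8

ι : ℤ → ℚ
ι z = z ℚ./ 1

𝟘 : K
𝟘 = replicate 8 0ℚ

𝟙 : K
𝟙 = 1ℚ ∷ replicate 7 0ℚ

αK : K
αK = 0ℚ ∷ 1ℚ ∷ replicate 6 0ℚ

_⊕_ : K → K → K
_⊕_ = zipWith _+_

scale : ℚ → K → K
scale c = map (c *_)

-- multiplication by α, using α^8 = m
mulα : ℤ → K → K
mulα m (c₀ ∷ c₁ ∷ c₂ ∷ c₃ ∷ c₄ ∷ c₅ ∷ c₆ ∷ c₇ ∷ []) =
  (ι m * c₇) ∷ c₀ ∷ c₁ ∷ c₂ ∷ c₃ ∷ c₄ ∷ c₅ ∷ c₆ ∷ []

mulAux : ℤ → List ℚ → K → K
mulAux m [] v = 𝟘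
mulAux m (c ∷ cs) v = scale c v ⊕ mulAux m cs (mulα m v)

mulK : ℤ → K → K → K
mulK m (c₀ ∷ c₁ ∷ c₂ ∷ c₃ ∷ c₄ ∷ c₅ ∷ c₆ ∷ c₇ ∷ []) v =
  mulAux m (c₀ ∷ c₁ ∷ c₂ ∷ c₃ ∷ c₄ ∷ c₅ ∷ c₆ ∷ c₇ ∷ []) v

powK : ℤ → K → ℕ → K
powK m θ zero = 𝟙
powK m θ (suc k) = mulK m θ (powK m θ k)

evalℤ : ℤ → List ℤ → K → K
evalℤ m [] θ = 𝟘
evalℤ m (c ∷ cs) θ = scale (ι c) 𝟙 ⊕ mulK m θ (evalℤ m cs θ)

IsIntegral : ℤ → K → Set
IsIntegral m β = ∃ λ (cs : List ℤ) → powK m β (length cs) ⊕ evalℤ m cs β ≡ 𝟘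

InZ[_] : ℤ → K → K → Set
InZ[ m ] θ β = ∃ λ (cs : List ℤ) → evalℤ m cs θ ≡ β

RingOfIntegersIs : ℤ → K → Set
RingOfIntegersIs m θ =
  (∀ β → IsIntegral m β → InZ[ m ] θ β) × (∀ β → InZ[ m ] θ β → IsIntegral m β)

Monogenic : ℤ → Set
Monogenic m = ∃ λ (θ : K) → RingOfIntegersIs m θ

module Submission where

{- Adjoin to ℚ an element θ with θ⁸ = a and a primitive eighth root of unity ζ, with the automorphism σ : θ ↦ ζθ. An element is integral
   when all its powers have a common denominator; K embeds by α ↦ θᵘ.

   If a ≢ 1 (mod 4), traces bound the denominators of an integral element of K by 8a in the basis θʲ. The prime factors of a are removed
   because θ is a uniformiser there, and 2 because θ (for even a) or θ − 1 (for a ≡ 3 mod 4) is one.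

   If a ≡ 1 (mod 4) and ℤ_K = ℤ[t], then every difference of conjugates σⁱt − σʲt divides the corresponding differences for (1 + √a)/2 and θ.
   Hence r₀, the resultant of the minimal polynomials q and σq of t and σt over L = ℚ(a^{1/4}), satisfies r₀ · σ²r₀ = aε with a unit
   ε = x + y√-a, so x² + ay² = ±1, and t − σ⁴t = 2Bθ with 2B dividing 2. For (a − 1)/4 ≢ 0 (mod 4) the coefficients of q force B to be
   a unit; then x ≡ -4 (mod a), which leaves a = -3 and a = 5, and a = 5 fails modulo 8. For a ≡ 1 (mod 16) the three homomorphisms from the
   integers of L to 𝔽₂ compete for the two roots of q modulo 2; this contradicts the equations modulo 8 if a ≡ 1 (mod 32). If a ≡ 17 (mod 32),
   the norm of 2B excludes a < 0, and for a > 0 one has ε = ±1 although r₀ · σ²r₀ ≡ √-1 modulo 2. -}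

open import Data.Bool using (true; false)
open import Data.Empty using (⊥; ⊥-elim)
import Data.Integer
open import Data.Integer as ℤ using (ℤ; -[1+_]; 0ℤ; 1ℤ) renaming (+_ to pos)
import Data.Integer.Divisibility as ℤ∣
import Data.Integer.Properties as ℤₚ
open import Data.Integer.Tactic.RingSolver using (solve-∀)
open import Data.List using (List; []; _∷_; length)
open import Data.List.Relation.Unary.All using ([]; _∷_)
open import Data.Nat as ℕ using (ℕ; zero; suc)
import Data.Nat.Divisibility as ℕ∣
import Data.Nat.Properties as ℕₚ
open import Data.Product using (Σ; ∃; _×_; _,_; proj₁; proj₂; uncurry)
open import Data.Rational as ℚ using (ℚ; 0ℚ; 1ℚ)
import Data.Rational.Properties as ℚₚ
open import Data.Sum using (_⊎_; inj₁; inj₂)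
open import Data.Vec as Vec using (Vec; []; _∷_)
open import Relation.Binary.PropositionalEquality
open import Relation.Nullary using (¬_)
open import Relation.Nullary.Decidable using (from-no)

open import Defs

-- The five square roots of the tower, of -1, i, a, √a and ⁴√a, are adjoined formally, present or
-- not; for a = 2 the result has zero divisors. So no irreducibility is proved anywhere: traces show
-- that K embeds, conjugation by powers of σ separates coordinates, and only divisors of nonzero
-- integers, such as θ, are cancelled. Integrality by common denominators makes sense in such a
-- ring, passes to sums and products by mere expansion, and means ℤ inside ℚ; the way back from
-- denominators to a monic polynomial is never taken. In part (2) the denominators of t divide 8, so
-- its coordinates lie in ℤ[1/2] and the odd number a can be cancelled from integrality statements.
-- The congruence x ≡ -4 comes from the prime θ: there t - σʲt behaves like u₁(1 - ζʲ)θ, hence r₀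
-- like u₁⁴(1 - ζ²)²ρ = -2i u₁⁴ρ and ε like (-2i)²u₁⁸ = -4u₁⁸, while u₁⁸ ≡ 1 when B is a unit. Then
-- 16 ≡ x² ≡ ±1 (mod a) makes a a divisor of 15 or 17.

module Algebras where
  open import Algebra.Bundles using (RawRing; CommutativeRing)
  open import Algebra.Structures using (IsCommutativeRing)
  open import Data.Bool.Base using (Bool; true; false; T)
  open import Data.Fin.Base using (Fin; _↑ˡ_; _↑ʳ_)
  open import Data.Maybe.Base using (nothing)
  open import Data.Product using (Σ; ∃; _×_; _,_; proj₁; proj₂)
  import Data.Rational.Unnormalised as ℚᵘ
  import Data.Rational.Unnormalised.Properties as ℚᵘₚ
  open import Data.Vec using (Vec; []; _∷_; lookup; _++_; map; tabulate)
  open import Data.Vec.N-ary using (N-ary; _$ⁿ_)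
  import Data.Vec.Properties as Vecₚ
  open import Function using (_∘_)
  open import Level using (0ℓ)
  open import Tactic.RingSolver.Core.AlmostCommutativeRing
    using (AlmostCommutativeRing; fromCommutativeRing; _-Raw-AlmostCommutative⟶_)
  open import Tactic.RingSolver.Core.Polynomial.Parameters using (Homomorphism)

  -- The integers inside ℚ, and ℚ-algebras with a ring solver.

  ι≃ : ∀ z → ℚ.toℚᵘ (ι z) ℚᵘ.≃ ℚᵘ.mkℚᵘ z 0
  ι≃ z = ℚₚ.toℚᵘ-fromℚᵘ (ℚᵘ.mkℚᵘ z 0)

  ι-+ : ∀ x y → ι (x ℤ.+ y) ≡ ι x ℚ.+ ι y
  ι-+ x y = ℚₚ.toℚᵘ-injective (begin
    ℚ.toℚᵘ (ι (x ℤ.+ y))                   ≈⟨ ι≃ (x ℤ.+ y) ⟩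
    ℚᵘ.mkℚᵘ (x ℤ.+ y) 0                    ≈⟨ ℚᵘ.*≡* (cong (ℤ._* pos 1) (cong₂ ℤ._+_ (sym (ℤₚ.*-identityʳ x)) (sym (ℤₚ.*-identityʳ y)))) ⟩
    ℚᵘ.mkℚᵘ x 0 ℚᵘ.+ ℚᵘ.mkℚᵘ y 0           ≈⟨ ℚᵘₚ.+-cong (ℚᵘₚ.≃-sym (ι≃ x)) (ℚᵘₚ.≃-sym (ι≃ y)) ⟩
    ℚ.toℚᵘ (ι x) ℚᵘ.+ ℚ.toℚᵘ (ι y)         ≈⟨ ℚᵘₚ.≃-sym (ℚₚ.toℚᵘ-homo-+ (ι x) (ι y)) ⟩
    ℚ.toℚᵘ (ι x ℚ.+ ι y)                   ∎)
    where open ℚᵘₚ.≃-Reasoning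

  ι-* : ∀ x y → ι (x ℤ.* y) ≡ ι x ℚ.* ι y
  ι-* x y = ℚₚ.toℚᵘ-injective (begin
    ℚ.toℚᵘ (ι (x ℤ.* y))                   ≈⟨ ι≃ (x ℤ.* y) ⟩
    ℚᵘ.mkℚᵘ x 0 ℚᵘ.* ℚᵘ.mkℚᵘ y 0           ≈⟨ ℚᵘₚ.*-cong (ℚᵘₚ.≃-sym (ι≃ x)) (ℚᵘₚ.≃-sym (ι≃ y)) ⟩
    ℚ.toℚᵘ (ι x) ℚᵘ.* ℚ.toℚᵘ (ι y)         ≈⟨ ℚᵘₚ.≃-sym (ℚₚ.toℚᵘ-homo-* (ι x) (ι y)) ⟩
    ℚ.toℚᵘ (ι x ℚ.* ι y)                   ∎)
    where open ℚᵘₚ.≃-Reasoning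

  ι-inj : ∀ {x y} → ι x ≡ ι y → x ≡ y
  ι-inj {x} {y} e with ℚᵘₚ.≃-trans (ℚᵘₚ.≃-sym (ι≃ x)) (ℚᵘₚ.≃-trans (ℚᵘₚ.≃-reflexive (cong ℚ.toℚᵘ e)) (ι≃ y))
  ... | ℚᵘ.*≡* p = trans (sym (ℤₚ.*-identityʳ x)) (trans p (ℤₚ.*-identityʳ y))

  denominator : ∀ r → ι (ℚ.↧ r) ℚ.* r ≡ ι (ℚ.↥ r)
  denominator r@record{} = ℚₚ.toℚᵘ-injective (begin
    ℚ.toℚᵘ (ι (ℚ.↧ r) ℚ.* r)              ≈⟨ ℚₚ.toℚᵘ-homo-* (ι (ℚ.↧ r)) r ⟩
    ℚ.toℚᵘ (ι (ℚ.↧ r)) ℚᵘ.* ℚ.toℚᵘ r      ≈⟨ ℚᵘₚ.*-cong (ι≃ (ℚ.↧ r)) (ℚᵘₚ.≃-refl {ℚ.toℚᵘ r}) ⟩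
    ℚᵘ.mkℚᵘ (ℚ.↧ r) 0 ℚᵘ.* ℚ.toℚᵘ r       ≈⟨ ℚᵘ.*≡* (trans (ℤₚ.*-identityʳ _) (trans (ℤₚ.*-comm (ℚ.↧ r) (ℚ.↥ r)) (cong (ℚ.↥ r ℤ.*_) (sym (ℤₚ.*-identityˡ (ℚ.↧ r)))))) ⟩
    ℚᵘ.mkℚᵘ (ℚ.↥ r) 0                     ≈⟨ ℚᵘₚ.≃-sym (ι≃ (ℚ.↥ r)) ⟩
    ℚ.toℚᵘ (ι (ℚ.↥ r))                    ∎)
    where open ℚᵘₚ.≃-Reasoning

  IsInt : ℚ → Set
  IsInt r = ∃ λ z → r ≡ ι z

  -- A commutative ℚ-algebra with a distinguished subring Λ of integral coordinates.
  record Algebraᴸ : Set₁ where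
    infixl 6 _+_ _-_
    infixl 7 _*_
    infix  8 -_
    infixr 8 _^_
    field
      Carrier : Set
      _+_ _*_ : Carrier → Carrier → Carrier
      -_      : Carrier → Carrier
      0# 1#   : Carrier
      isCommutativeRing : IsCommutativeRing _≡_ _+_ _*_ -_ 0# 1#
      q      : ℚ → Carrier
      q-+    : ∀ r s → q (r ℚ.+ s) ≡ q r + q s
      q-*    : ∀ r s → q (r ℚ.* s) ≡ q r * q s
      q-1    : q 1ℚ ≡ 1#
      q-inj  : ∀ {r s} → q r ≡ q s → r ≡ s
      ⟪_⟫    : ℤ → Carrier
      ⟪⟫-q   : ∀ z → ⟪ z ⟫ ≡ q (ι z)
      Λ      : Carrier → Set
      Λ-+    : ∀ {x y} → Λ x → Λ y → Λ (x + y)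
      Λ-*    : ∀ {x y} → Λ x → Λ y → Λ (x * y)
      Λ-ι    : ∀ z → Λ ⟪ z ⟫
      Λ-q    : ∀ {r} → Λ (q r) → IsInt r
      Λ-den  : ∀ x → ∃ λ d → d ≢ 0ℤ × Λ (⟪ d ⟫ * x)

    open IsCommutativeRing isCommutativeRing public
      using (+-assoc; +-comm; +-identityˡ; +-identityʳ; *-assoc; *-comm; *-identityˡ; *-identityʳ; distribˡ; distribʳ; zeroˡ; zeroʳ; -‿inverseˡ; -‿inverseʳ)

    commutativeRing : CommutativeRing 0ℓ 0ℓ
    commutativeRing = record { isCommutativeRing = isCommutativeRing }

    _-_ : Carrier → Carrier → Carrier
    x - y = x + - y

    _^_ : Carrier → ℕ → Carrier
    x ^ zero  = 1#
    x ^ suc n = x * x ^ n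

  -- Solver terms have two layers, polynomials in integer variables and, above them, polynomials in
  -- ring variables. An embedded integer expression is thereby normalised together with the ring
  -- expression around it.
  data ZExpr (k : ℕ) : Set where
    zvar : Fin k → ZExpr k
    con  : ℤ → ZExpr k
    _:+_ _:*_ _:-_ : ZExpr k → ZExpr k → ZExpr k
    :-_  : ZExpr k → ZExpr k
    _:^_ : ZExpr k → ℕ → ZExpr k

  data Expr (k n : ℕ) : Set where
    var  : Fin n → Expr k n
    emb  : ZExpr k → Expr k n
    :0 :1 : Expr k n
    _:+_ _:*_ _:-_ : Expr k n → Expr k n → Expr k n
    :-_  : Expr k n → Expr k n
    _:^_ : Expr k n → ℕ → Expr k n

  infixl 6 _:+_ _:-_
  infixl 7 _:*_
  infix  8 :-_
  infixr 8 _:^_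
  infix  3 _⊜_

  pattern _⊜_ x y = x , y

  lit : ∀ {k n} → ℕ → Expr k n
  lit n = emb (con (pos n))

  module Solver (R : Algebraᴸ) where
    open Algebraᴸ R
    open import Algebra.Properties.Ring (CommutativeRing.ring commutativeRing)
      using (-‿involutive; -‿distribˡ-*; -‿+-comm; +-cancelˡ; -0#≈0#)

    ⟪⟫-+ : ∀ x y → ⟪ x ℤ.+ y ⟫ ≡ ⟪ x ⟫ + ⟪ y ⟫
    ⟪⟫-+ x y = trans (⟪⟫-q (x ℤ.+ y)) (trans (cong q (ι-+ x y)) (trans (q-+ (ι x) (ι y)) (sym (cong₂ _+_ (⟪⟫-q x) (⟪⟫-q y)))))

    ⟪⟫-* : ∀ x y → ⟪ x ℤ.* y ⟫ ≡ ⟪ x ⟫ * ⟪ y ⟫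
    ⟪⟫-* x y = trans (⟪⟫-q (x ℤ.* y)) (trans (cong q (ι-* x y)) (trans (q-* (ι x) (ι y)) (sym (cong₂ _*_ (⟪⟫-q x) (⟪⟫-q y)))))

    ⟪0⟫ : ⟪ 0ℤ ⟫ ≡ 0#
    ⟪0⟫ = +-cancelˡ ⟪ 0ℤ ⟫ ⟪ 0ℤ ⟫ 0# (trans (sym (⟪⟫-+ 0ℤ 0ℤ)) (sym (+-identityʳ ⟪ 0ℤ ⟫)))

    ⟪1⟫ : ⟪ 1ℤ ⟫ ≡ 1#
    ⟪1⟫ = trans (⟪⟫-q 1ℤ) q-1

    ⟪⟫-neg : ∀ x → ⟪ ℤ.- x ⟫ ≡ - ⟪ x ⟫
    ⟪⟫-neg x = +-cancelˡ ⟪ x ⟫ ⟪ ℤ.- x ⟫ (- ⟪ x ⟫) (begin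
      ⟪ x ⟫ + ⟪ ℤ.- x ⟫   ≡⟨ ⟪⟫-+ x (ℤ.- x) ⟨
      ⟪ x ℤ.+ ℤ.- x ⟫     ≡⟨ cong ⟪_⟫ (ℤₚ.+-inverseʳ x) ⟩
      ⟪ 0ℤ ⟫              ≡⟨ ⟪0⟫ ⟩
      0#                  ≡⟨ -‿inverseʳ ⟪ x ⟫ ⟨
      ⟪ x ⟫ + - ⟪ x ⟫     ∎)
      where open ≡-Reasoning

    ⟪⟫-- : ∀ x y → ⟪ x ℤ.- y ⟫ ≡ ⟪ x ⟫ - ⟪ y ⟫
    ⟪⟫-- x y = trans (⟪⟫-+ x (ℤ.- y)) (cong (⟪ x ⟫ +_) (⟪⟫-neg y))

    private
      acr : AlmostCommutativeRing 0ℓ 0ℓ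
      acr = fromCommutativeRing commutativeRing (λ _ → nothing)

      isZero : ℤ → Bool
      isZero (pos zero) = true
      isZero _        = false

      zero-hom : ∀ x → T (isZero x) → 0# ≡ ⟪ x ⟫
      zero-hom (pos zero) _ = sym ⟪0⟫

      homo : Homomorphism 0ℓ 0ℓ 0ℓ 0ℓ
      homo = record
        { from = record { rawRing = CommutativeRing.rawRing ℤₚ.+-*-commutativeRing ; isZero = isZero }
        ; to = acr
        ; morphism = record
            { ⟦_⟧ = ⟪_⟫ ; +-homo = ⟪⟫-+ ; *-homo = ⟪⟫-* ; -‿homo = ⟪⟫-neg ; 0-homo = ⟪0⟫ ; 1-homo = ⟪1⟫ }
        ; Zero-C⟶Zero-R = zero-hom
        }

      open import Tactic.RingSolver.Core.Polynomial.Base (Homomorphism.from homo) using (Poly; κ; _⊞_; _⊠_; ⊟_)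
        renaming (ι to pvar)
      open import Tactic.RingSolver.Core.Polynomial.Semantics homo using () renaming (⟦_⟧ to ⟦_⟧ₚ)
      open import Tactic.RingSolver.Core.Polynomial.Homomorphism homo

      pow : ∀ {n} → Poly n → ℕ → Poly n
      pow p zero    = κ 1ℤ
      pow p (suc n) = p ⊠ pow p n

      zev : ∀ {k} → ZExpr k → Vec ℤ k → ℤ
      zev (zvar i) ρ = lookup ρ i
      zev (con z)  ρ = z
      zev (e :+ f) ρ = zev e ρ ℤ.+ zev f ρ
      zev (e :* f) ρ = zev e ρ ℤ.* zev f ρ
      zev (e :- f) ρ = zev e ρ ℤ.- zev f ρ
      zev (:- e)   ρ = ℤ.- zev e ρ
      zev (e :^ n) ρ = zev e ρ ℤ.^ n

      ev : ∀ {k n} → Expr k n → Vec ℤ k → Vec Carrier n → Carrier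
      ev (var i)  zs ρ = lookup ρ i
      ev (emb e)  zs ρ = ⟪ zev e zs ⟫
      ev :0       zs ρ = 0#
      ev :1       zs ρ = 1#
      ev (e :+ f) zs ρ = ev e zs ρ + ev f zs ρ
      ev (e :* f) zs ρ = ev e zs ρ * ev f zs ρ
      ev (e :- f) zs ρ = ev e zs ρ - ev f zs ρ
      ev (:- e)   zs ρ = - ev e zs ρ
      ev (e :^ n) zs ρ = ev e zs ρ ^ n

      znorm : ∀ {k} n → ZExpr k → Poly (k ℕ.+ n)
      znorm n (zvar i) = pvar (i ↑ˡ n)
      znorm n (con z)  = κ z
      znorm n (e :+ f) = znorm n e ⊞ znorm n f
      znorm n (e :* f) = znorm n e ⊠ znorm n f
      znorm n (e :- f) = znorm n e ⊞ (⊟ znorm n f)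
      znorm n (:- e)   = ⊟ znorm n e
      znorm n (e :^ m) = pow (znorm n e) m

      norm : ∀ {k n} → Expr k n → Poly (k ℕ.+ n)
      norm {k} (var i)  = pvar (k ↑ʳ i)
      norm {n = n} (emb e) = znorm n e
      norm :0       = κ 0ℤ
      norm :1       = κ 1ℤ
      norm (e :+ f) = norm e ⊞ norm f
      norm (e :* f) = norm e ⊠ norm f
      norm (e :- f) = norm e ⊞ (⊟ norm f)
      norm (:- e)   = ⊟ norm e
      norm (e :^ m) = pow (norm e) m

      pow-hom : ∀ {n} (p : Poly n) m ρ → ⟦ pow p m ⟧ₚ ρ ≡ ⟦ p ⟧ₚ ρ ^ m
      pow-hom p zero    ρ = trans (κ-hom 1ℤ ρ) ⟪1⟫
      pow-hom p (suc m) ρ = trans (⊠-hom p (pow p m) ρ) (cong (⟦ p ⟧ₚ ρ *_) (pow-hom p m ρ))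

      ⟪⟫-^ : ∀ x m → ⟪ x ⟫ ^ m ≡ ⟪ x ℤ.^ m ⟫
      ⟪⟫-^ x zero    = sym ⟪1⟫
      ⟪⟫-^ x (suc m) = trans (cong (⟪ x ⟫ *_) (⟪⟫-^ x m)) (sym (⟪⟫-* x (x ℤ.^ m)))

      env : ∀ {k n} → Vec ℤ k → Vec Carrier n → Vec Carrier (k ℕ.+ n)
      env zs ρ = map ⟪_⟫ zs ++ ρ

      zcorrect : ∀ {k n} (e : ZExpr k) zs (ρ : Vec Carrier n) → ⟦ znorm n e ⟧ₚ (env zs ρ) ≡ ⟪ zev e zs ⟫
      zcorrect (zvar i) zs ρ = trans (ι-hom (i ↑ˡ _) (env zs ρ)) (trans (Vecₚ.lookup-++ˡ (map ⟪_⟫ zs) ρ i) (Vecₚ.lookup-map i ⟪_⟫ zs))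
      zcorrect (con z)  zs ρ = κ-hom z (env zs ρ)
      zcorrect {n = n} (e :+ f) zs ρ = trans (⊞-hom (znorm n e) (znorm n f) (env zs ρ)) (trans (cong₂ _+_ (zcorrect e zs ρ) (zcorrect f zs ρ)) (sym (⟪⟫-+ (zev e zs) (zev f zs))))
      zcorrect {n = n} (e :* f) zs ρ = trans (⊠-hom (znorm n e) (znorm n f) (env zs ρ)) (trans (cong₂ _*_ (zcorrect e zs ρ) (zcorrect f zs ρ)) (sym (⟪⟫-* (zev e zs) (zev f zs))))
      zcorrect {n = n} (e :- f) zs ρ = trans (⊞-hom (znorm n e) (⊟ znorm n f) (env zs ρ)) (trans (cong₂ _+_ (zcorrect e zs ρ) (trans (⊟-hom (znorm n f) (env zs ρ)) (cong -_ (zcorrect f zs ρ)))) (sym (⟪⟫-- (zev e zs) (zev f zs))))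
      zcorrect {n = n} (:- e)   zs ρ = trans (⊟-hom (znorm n e) (env zs ρ)) (trans (cong -_ (zcorrect e zs ρ)) (sym (⟪⟫-neg (zev e zs))))
      zcorrect {n = n} (e :^ m) zs ρ = trans (pow-hom (znorm n e) m (env zs ρ)) (trans (cong (_^ m) (zcorrect e zs ρ)) (⟪⟫-^ (zev e zs) m))

      correct : ∀ {k n} (e : Expr k n) zs ρ → ⟦ norm e ⟧ₚ (env zs ρ) ≡ ev e zs ρ
      correct {k} (var i) zs ρ = trans (ι-hom (k ↑ʳ i) (env zs ρ)) (Vecₚ.lookup-++ʳ (map ⟪_⟫ zs) ρ i)
      correct (emb e)  zs ρ = zcorrect e zs ρ
      correct :0       zs ρ = trans (κ-hom 0ℤ (env zs ρ)) ⟪0⟫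
      correct :1       zs ρ = trans (κ-hom 1ℤ (env zs ρ)) ⟪1⟫
      correct (e :+ f) zs ρ = trans (⊞-hom (norm e) (norm f) (env zs ρ)) (cong₂ _+_ (correct e zs ρ) (correct f zs ρ))
      correct (e :* f) zs ρ = trans (⊠-hom (norm e) (norm f) (env zs ρ)) (cong₂ _*_ (correct e zs ρ) (correct f zs ρ))
      correct (e :- f) zs ρ = trans (⊞-hom (norm e) (⊟ norm f) (env zs ρ)) (cong₂ _+_ (correct e zs ρ) (trans (⊟-hom (norm f) (env zs ρ)) (cong -_ (correct f zs ρ))))
      correct (:- e)   zs ρ = trans (⊟-hom (norm e) (env zs ρ)) (cong -_ (correct e zs ρ))
      correct (e :^ m) zs ρ = trans (pow-hom (norm e) m (env zs ρ)) (cong (_^ m) (correct e zs ρ))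

      lhs rhs : ∀ k n → N-ary k (ZExpr k) (N-ary n (Expr k n) (Expr k n × Expr k n)) → Expr k n
      lhs k n f = proj₁ (_$ⁿ_ {n = n} (_$ⁿ_ {n = k} f (tabulate zvar)) (tabulate var))
      rhs k n f = proj₂ (_$ⁿ_ {n = n} (_$ⁿ_ {n = k} f (tabulate zvar)) (tabulate var))

    -- The argument about `norm` is always `refl`: both sides are normalised as polynomials over ℤ
    -- in k + n variables, and the homomorphism `⟪_⟫` carries the equality into the algebra.
    ring : ∀ {k n} (zs : Vec ℤ k) (ρ : Vec Carrier n) (f : N-ary k (ZExpr k) (N-ary n (Expr k n) (Expr k n × Expr k n))) →
           norm (lhs k n f) ≡ norm (rhs k n f) → ev (lhs k n f) zs ρ ≡ ev (rhs k n f) zs ρ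
    ring {k} {n} zs ρ f e = trans (sym (correct (lhs k n f) zs ρ)) (trans (cong (λ p → ⟦ p ⟧ₚ (env zs ρ)) e) (correct (rhs k n f) zs ρ))

open Algebras

-- Integrality through a common denominator of all powers.

module Integrality where
  open import Algebra.Bundles using (CommutativeRing)
  open import Algebra.Structures using (IsCommutativeRing)
  open import Data.Empty using (⊥-elim)
  import Data.Nat.Coprimality as Coprime
  open Coprime using (Coprime)
  open import Data.Product using (Σ; ∃; _×_; _,_; proj₁; proj₂)
  open import Data.Vec using ([]; _∷_)

  coprime-*ˡ : ∀ {m n o} → Coprime m o → Coprime n o → Coprime (m ℕ.* n) o
  coprime-*ˡ {m} cm cn {d} (d∣mn , d∣o) =
    cn (Coprime.coprime-divisor (λ { (e∣d , e∣m) → cm (e∣m , ℕ∣.∣-trans e∣d d∣o) }) d∣mn , d∣o)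

  coprime-^ˡ : ∀ {m o} → Coprime m o → ∀ k → Coprime (m ℕ.^ k) o
  coprime-^ˡ c zero    = Coprime.1-coprimeTo _
  coprime-^ˡ c (suc k) = coprime-*ˡ c (coprime-^ˡ c k)

  coprime-divisor-^ : ∀ {m n o} → Coprime m n → ∀ k → m ℕ∣.∣ o ℕ.* n ℕ.^ k → m ℕ∣.∣ o
  coprime-divisor-^ {m} {n} {o} c zero    d = subst (m ℕ∣.∣_) (ℕₚ.*-identityʳ o) d
  coprime-divisor-^ {m} {n} {o} c (suc k) d = coprime-divisor-^ c k (Coprime.coprime-divisor c
    (subst (m ℕ∣.∣_) (trans (sym (ℕₚ.*-assoc o n (n ℕ.^ k))) (trans (cong (ℕ._* n ℕ.^ k) (ℕₚ.*-comm o n)) (ℕₚ.*-assoc n o (n ℕ.^ k)))) d))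

  n<2^n : ∀ n → n ℕ.< 2 ℕ.^ n
  n<2^n zero    = ℕ.s≤s ℕ.z≤n
  n<2^n (suc n) = ℕₚ.≤-trans (ℕₚ.+-mono-≤ (ℕₚ.m^n>0 2 n) (n<2^n n)) (ℕₚ.≤-reflexive (cong (2 ℕ.^ n ℕ.+_) (sym (ℕₚ.+-identityʳ (2 ℕ.^ n)))))

  -- For d ≥ 2 the single exponent m already fails, since m < 2^m ≤ d^m.
  bounded-powers : ∀ d m → m ≢ 0 → (∀ k → d ℕ.^ k ℕ∣.∣ m) → d ℕ.≤ 1
  bounded-powers zero          m m≢0 h = ℕ.z≤n
  bounded-powers (suc zero)    m m≢0 h = ℕ.s≤s ℕ.z≤n
  bounded-powers (suc (suc d)) zero m≢0 h = ⊥-elim (m≢0 refl)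
  bounded-powers (suc (suc d)) m@(suc _) m≢0 h =
    ⊥-elim (ℕₚ.<-irrefl refl (ℕₚ.<-≤-trans (n<2^n m) (ℕₚ.≤-trans (ℕₚ.^-monoˡ-≤ m (ℕ.s≤s (ℕ.s≤s ℕ.z≤n))) (ℕ∣.∣⇒≤ (h m)))))

  infixr 8 _^ℚ_
  _^ℚ_ : ℚ → ℕ → ℚ
  r ^ℚ zero  = 1ℚ
  r ^ℚ suc k = r ℚ.* r ^ℚ k

  ι-^ : ∀ z k → ι z ^ℚ k ≡ ι (z ℤ.^ k)
  ι-^ z zero    = refl
  ι-^ z (suc k) = trans (cong (ι z ℚ.*_) (ι-^ z k)) (sym (ι-* z (z ℤ.^ k)))

  ^ℚ-* : ∀ r s k → (r ℚ.* s) ^ℚ k ≡ r ^ℚ k ℚ.* s ^ℚ k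
  ^ℚ-* r s zero    = refl
  ^ℚ-* r s (suc k) = trans (cong ((r ℚ.* s) ℚ.*_) (^ℚ-* r s k)) (interchange r s (r ^ℚ k) (s ^ℚ k))
    where open import Algebra.Properties.CommutativeSemigroup (CommutativeRing.*-commutativeSemigroup ℚₚ.+-*-commutativeRing)

  ∣^∣ : ∀ z k → ℤ.∣ z ℤ.^ k ∣ ≡ ℤ.∣ z ∣ ℕ.^ k
  ∣^∣ z zero    = refl
  ∣^∣ z (suc k) = trans (ℤₚ.abs-* z (z ℤ.^ k)) (cong (ℤ.∣ z ∣ ℕ.*_) (∣^∣ z k))

  -- In lowest terms r = n/d, and clearing denominators gives that d^k divides m n^k, hence m, for
  -- every k. Only d = 1 has all its powers dividing a nonzero integer.
  bounded-denominator : ∀ {m r} → m ≢ 0ℤ → (∀ k → IsInt (ι m ℚ.* r ^ℚ k)) → IsInt r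
  bounded-denominator {m} {r@(ℚ.mkℚ n d-1 c)} m≢0 h = n , r≡n
    where
    d = suc d-1

    cleared : ∀ k → ∃ λ z → m ℤ.* n ℤ.^ k ≡ z ℤ.* pos d ℤ.^ k
    cleared k with h k
    ... | z , e = z , ι-inj (begin
      ι (m ℤ.* n ℤ.^ k)                              ≡⟨ ι-* m (n ℤ.^ k) ⟩
      ι m ℚ.* ι (n ℤ.^ k)                            ≡⟨ cong (ι m ℚ.*_) (ι-^ n k) ⟨
      ι m ℚ.* ι n ^ℚ k                               ≡⟨ cong (λ s → ι m ℚ.* s ^ℚ k) (trans (ℚₚ.*-comm r (ι (pos d))) (denominator r)) ⟨
      ι m ℚ.* (r ℚ.* ι (pos d)) ^ℚ k                 ≡⟨ cong (ι m ℚ.*_) (^ℚ-* r (ι (pos d)) k) ⟩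
      ι m ℚ.* (r ^ℚ k ℚ.* ι (pos d) ^ℚ k)            ≡⟨ ℚₚ.*-assoc (ι m) (r ^ℚ k) (ι (pos d) ^ℚ k) ⟨
      ι m ℚ.* r ^ℚ k ℚ.* ι (pos d) ^ℚ k              ≡⟨ cong₂ ℚ._*_ e (ι-^ (pos d) k) ⟩
      ι z ℚ.* ι (pos d ℤ.^ k)                        ≡⟨ ι-* z (pos d ℤ.^ k) ⟨
      ι (z ℤ.* pos d ℤ.^ k)                          ∎)
      where open ≡-Reasoning

    d^k∣m : ∀ k → d ℕ.^ k ℕ∣.∣ ℤ.∣ m ∣
    d^k∣m k with cleared k
    ... | z , e = coprime-divisor-^ (coprime-^ˡ (Coprime.sym (Coprime.recompute c)) k) k
      (ℕ∣.divides ℤ.∣ z ∣ (begin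
        ℤ.∣ m ∣ ℕ.* ℤ.∣ n ∣ ℕ.^ k    ≡⟨ cong (ℤ.∣ m ∣ ℕ.*_) (∣^∣ n k) ⟨
        ℤ.∣ m ∣ ℕ.* ℤ.∣ n ℤ.^ k ∣    ≡⟨ ℤₚ.abs-* m (n ℤ.^ k) ⟨
        ℤ.∣ m ℤ.* n ℤ.^ k ∣          ≡⟨ cong ℤ.∣_∣ e ⟩
        ℤ.∣ z ℤ.* pos d ℤ.^ k ∣      ≡⟨ ℤₚ.abs-* z (pos d ℤ.^ k) ⟩
        ℤ.∣ z ∣ ℕ.* ℤ.∣ pos d ℤ.^ k ∣ ≡⟨ cong (ℤ.∣ z ∣ ℕ.*_) (∣^∣ (pos d) k) ⟩
        ℤ.∣ z ∣ ℕ.* d ℕ.^ k          ∎))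
      where open ≡-Reasoning

    d≡1 : d ≡ 1
    d≡1 = ℕₚ.≤-antisym (bounded-powers d ℤ.∣ m ∣ (λ e → m≢0 (ℤₚ.∣i∣≡0⇒i≡0 e)) d^k∣m) (ℕ.s≤s ℕ.z≤n)

    r≡n : r ≡ ι n
    r≡n = trans (sym (ℚₚ.*-identityˡ r)) (trans (cong (λ e → ι (pos e) ℚ.* r) (sym d≡1)) (denominator r))

  module _ (A : Algebraᴸ) where
    open Algebraᴸ A
    open Solver A

    eval : List ℤ → Carrier → Carrier
    eval []       t = 0#
    eval (c ∷ cs) t = ⟪ c ⟫ + t * eval cs t

    ^-+ : ∀ x m n → x ^ (m ℕ.+ n) ≡ x ^ m * x ^ n
    ^-+ x zero    n = sym (*-identityˡ (x ^ n))
    ^-+ x (suc m) n = trans (cong (x *_) (^-+ x m n)) (sym (*-assoc x (x ^ m) (x ^ n)))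

    ^-* : ∀ x y n → (x * y) ^ n ≡ x ^ n * y ^ n
    ^-* x y zero    = sym (*-identityˡ 1#)
    ^-* x y (suc n) = trans (cong (x * y *_) (^-* x y n)) (ring [] (x ∷ y ∷ x ^ n ∷ y ^ n ∷ []) (λ x y u v → x :* y :* (u :* v) ⊜ x :* u :* (y :* v)) refl)

    q-^ : ∀ r k → q (r ^ℚ k) ≡ q r ^ k
    q-^ r zero    = q-1
    q-^ r (suc k) = trans (q-* r (r ^ℚ k)) (cong (q r *_) (q-^ r k))

    record Integral (x : Carrier) : Set where
      constructor integral
      field
        d   : ℤ
        d≢0 : d ≢ 0ℤ
        Λ-^ : ∀ k → Λ (⟪ d ⟫ * x ^ k)

    Λ-neg : ∀ {x} → Λ x → Λ (- x)
    Λ-neg {x} h = subst Λ (ring [] (x ∷ []) (λ x → emb (con (ℤ.- 1ℤ)) :* x ⊜ :- x) refl) (Λ-* (Λ-ι (ℤ.- 1ℤ)) h)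

    *-≢0 : ∀ {x y} → x ≢ 0ℤ → y ≢ 0ℤ → x ℤ.* y ≢ 0ℤ
    *-≢0 {x} p q e with ℤₚ.i*j≡0⇒i≡0∨j≡0 x e
    ... | inj₁ x≡0 = p x≡0
    ... | inj₂ y≡0 = q y≡0

    abstract
      I-ι : ∀ z → Integral ⟪ z ⟫
      I-ι z = integral 1ℤ (λ ()) (λ k → Λ-* (Λ-ι 1ℤ) (pow k))
        where
        pow : ∀ k → Λ (⟪ z ⟫ ^ k)
        pow zero    = subst Λ ⟪1⟫ (Λ-ι 1ℤ)
        pow (suc k) = Λ-* (Λ-ι z) (pow k)

      I-* : ∀ {x y} → Integral x → Integral y → Integral (x * y)
      I-* {x} {y} (integral d d≢0 f) (integral e e≢0 g) = integral (d ℤ.* e) (*-≢0 d≢0 e≢0) λ k →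
        subst Λ (trans (ring (d ∷ e ∷ []) (x ^ k ∷ y ^ k ∷ []) (λ d e u v → emb d :* u :* (emb e :* v) ⊜ emb (d :* e) :* (u :* v)) refl)
                       (cong (⟪ d ℤ.* e ⟫ *_) (sym (^-* x y k))))
                (Λ-* (f k) (g k))

      -- The product of the two denominators serves for the powers of the sum. Binomial coefficients
      -- are avoided by `go`, which carries the factors x^i and y^j chosen so far and expands one
      -- factor x + y at a time.
      I-+ : ∀ {x y} → Integral x → Integral y → Integral (x + y)
      I-+ {x} {y} (integral d d≢0 f) (integral e e≢0 g) = integral (d ℤ.* e) (*-≢0 d≢0 e≢0) λ k →
        subst Λ (ring (d ∷ e ∷ []) ((x + y) ^ k ∷ []) (λ d e u → emb d :* :1 :* (emb e :* :1) :* u ⊜ emb (d :* e) :* u) refl) (go k 0 0)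
        where
        go : ∀ k i j → Λ (⟪ d ⟫ * x ^ i * (⟪ e ⟫ * y ^ j) * (x + y) ^ k)
        go zero    i j = subst Λ (sym (*-identityʳ _)) (Λ-* (f i) (g j))
        go (suc k) i j = subst Λ
          (ring (d ∷ e ∷ []) (x ∷ y ∷ x ^ i ∷ y ^ j ∷ (x + y) ^ k ∷ [])
            (λ d e x y u v w → emb d :* (x :* u) :* (emb e :* v) :* w :+ emb d :* u :* (emb e :* (y :* v)) :* w
                             ⊜ emb d :* u :* (emb e :* v) :* ((x :+ y) :* w)) refl)
          (Λ-+ (go k (suc i) j) (go k i (suc j)))

      I-neg : ∀ {x} → Integral x → Integral (- x)
      I-neg {x} h = subst Integral (ring [] (x ∷ []) (λ x → emb (con (ℤ.- 1ℤ)) :* x ⊜ :- x) refl) (I-* (I-ι (ℤ.- 1ℤ)) h)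

      I-- : ∀ {x y} → Integral x → Integral y → Integral (x - y)
      I-- h k = I-+ h (I-neg k)

      I-q : ∀ {r} → Integral (q r) → IsInt r
      I-q {r} (integral d d≢0 f) = bounded-denominator d≢0 λ k →
        Λ-q (subst Λ (trans (cong₂ _*_ (⟪⟫-q d) (sym (q-^ r k))) (sym (q-* (ι d) (r ^ℚ k)))) (f k))

      common-denominator : ∀ t n → ∃ λ d → d ≢ 0ℤ × (∀ j → j ℕ.< n → Λ (⟪ d ⟫ * t ^ j))
      common-denominator t zero = 1ℤ , (λ ()) , λ j ()
      common-denominator t (suc n) with common-denominator t n | Λ-den (t ^ n)
      ... | d , d≢0 , f | e , e≢0 , g = d ℤ.* e , *-≢0 d≢0 e≢0 , h
        where
        h : ∀ j → j ℕ.< suc n → Λ (⟪ d ℤ.* e ⟫ * t ^ j)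
        h j j<sn with ℕₚ.m≤n⇒m<n∨m≡n (ℕₚ.≤-pred j<sn)
        ... | inj₁ j<n  = subst Λ (ring (d ∷ e ∷ []) (t ^ j ∷ []) (λ d e u → emb e :* (emb d :* u) ⊜ emb (d :* e) :* u) refl) (Λ-* (Λ-ι e) (f j j<n))
        ... | inj₂ refl = subst Λ (ring (d ∷ e ∷ []) (t ^ n ∷ []) (λ d e u → emb d :* (emb e :* u) ⊜ emb (d :* e) :* u) refl) (Λ-* (Λ-ι d) g)

      -- A window of consecutive powers of t with common denominator d slides upwards: the monic
      -- relation writes the next power as an integer combination of the window, so d never has to
      -- grow.
      I-monic : ∀ t cs → t ^ length cs + eval cs t ≡ 0# → Integral t
      I-monic t cs e with common-denominator t (length cs)
      ... | d , d≢0 , f = integral d d≢0 (λ k → subst (λ j → Λ (⟪ d ⟫ * t ^ j)) (ℕₚ.+-identityʳ k) (all k))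
        where
        window : ∀ k as → (∀ j → j ℕ.< length as → Λ (⟪ d ⟫ * t ^ (k ℕ.+ j))) → Λ (⟪ d ⟫ * (t ^ k * eval as t))
        window k []       h = subst Λ (ring (d ∷ []) (t ^ k ∷ []) (λ d u → emb (con 0ℤ) ⊜ emb d :* (u :* :0)) refl) (Λ-ι 0ℤ)
        window k (a ∷ as) h = subst Λ
          (ring (d ∷ a ∷ []) (t ∷ t ^ k ∷ eval as t ∷ []) (λ d a t u v → emb a :* (emb d :* u) :+ emb d :* (t :* u :* v) ⊜ emb d :* (u :* (emb a :+ t :* v))) refl)
          (Λ-+ (Λ-* (Λ-ι a) (subst (λ j → Λ (⟪ d ⟫ * t ^ j)) (ℕₚ.+-identityʳ k) (h 0 (ℕ.s≤s ℕ.z≤n))))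
               (window (suc k) as (λ j j<n → subst (λ i → Λ (⟪ d ⟫ * t ^ i)) (ℕₚ.+-suc k j) (h (suc j) (ℕ.s≤s j<n)))))

        t^n : t ^ length cs ≡ - eval cs t
        t^n = trans (ring [] (t ^ length cs ∷ eval cs t ∷ []) (λ x y → x ⊜ (x :+ y) :- y) refl) (trans (cong (_- eval cs t) e) (+-identityˡ _))

        next : ∀ k → (∀ j → j ℕ.< length cs → Λ (⟪ d ⟫ * t ^ (k ℕ.+ j))) → Λ (⟪ d ⟫ * t ^ (k ℕ.+ length cs))
        next k h = subst Λ (trans (ring (d ∷ []) (t ^ k ∷ eval cs t ∷ []) (λ d u v → :- (emb d :* (u :* v)) ⊜ emb d :* (u :* (:- v))) refl)
                            (cong (⟪ d ⟫ *_) (trans (cong (t ^ k *_) (sym t^n)) (sym (^-+ t k (length cs))))))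
                     (Λ-neg (window k cs h))

        -- The bound is one more than the degree, so that the newly computed power belongs to the
        -- window and becomes the last entry of the next one.
        windows : ∀ k j → j ℕ.< suc (length cs) → Λ (⟪ d ⟫ * t ^ (k ℕ.+ j))
        windows k j j<sn with ℕₚ.m≤n⇒m<n∨m≡n (ℕₚ.≤-pred j<sn)
        windows zero    j j<sn | inj₁ j<n = f j j<n
        windows (suc k) j j<sn | inj₁ j<n = subst (λ i → Λ (⟪ d ⟫ * t ^ i)) (ℕₚ.+-suc k j) (windows k (suc j) (ℕ.s≤s j<n))
        windows zero    j j<sn | inj₂ refl = next 0 f
        windows (suc k) j j<sn | inj₂ refl = next (suc k) λ i i<n → subst (λ i → Λ (⟪ d ⟫ * t ^ i)) (ℕₚ.+-suc k i) (windows k (suc i) (ℕ.s≤s i<n))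

        all : ∀ k → Λ (⟪ d ⟫ * t ^ (k ℕ.+ 0))
        all k = windows k 0 (ℕ.s≤s ℕ.z≤n)

-- Formal adjunction of square roots and the octic tower.

module Towers where
  open Integrality

  open import Algebra.Bundles using (CommutativeRing)
  open import Algebra.Structures using (IsCommutativeRing)
  open import Data.Product using (Σ; ∃; _×_; _,_; proj₁; proj₂)
  open import Data.Vec using ([]; _∷_)

  isCommutativeRing≡ : ∀ {C : Set} {_+_ _*_ : C → C → C} { -_ : C → C} {0# 1# : C} →
    (∀ x y z → (x + y) + z ≡ x + (y + z)) → (∀ x → 0# + x ≡ x) → (∀ x → (- x) + x ≡ 0#) → (∀ x y → x + y ≡ y + x) →
    (∀ x y z → (x * y) * z ≡ x * (y * z)) → (∀ x → 1# * x ≡ x) → (∀ x y z → x * (y + z) ≡ (x * y) + (x * z)) → (∀ x y → x * y ≡ y * x) →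
    IsCommutativeRing _≡_ _+_ _*_ -_ 0# 1#
  isCommutativeRing≡ {_+_ = _+_} {_*_} { -_} {0#} +-assoc +-id +-inv +-comm *-assoc *-id distrib *-comm = record
    { isRing = record
      { +-isAbelianGroup = record
        { isGroup = record
          { isMonoid = record
            { isSemigroup = record { isMagma = record { isEquivalence = isEquivalence ; ∙-cong = cong₂ _+_ } ; assoc = +-assoc }
            ; identity = +-id , λ x → trans (+-comm x 0#) (+-id x) }
          ; inverse = +-inv , λ x → trans (+-comm x (- x)) (+-inv x)
          ; ⁻¹-cong = cong -_ }
        ; comm = +-comm }
      ; *-cong = cong₂ _*_
      ; *-assoc = *-assoc
      ; *-identity = *-id , λ x → trans (*-comm x _) (*-id x)
      ; distrib = distrib , λ x y z → trans (*-comm (y + z) x) (trans (distrib x y z) (cong₂ _+_ (*-comm x y) (*-comm x z))) }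
    ; *-comm = *-comm }

  ℚ-algebra : Algebraᴸ
  ℚ-algebra = record
    { isCommutativeRing = CommutativeRing.isCommutativeRing ℚₚ.+-*-commutativeRing
    ; q = λ r → r ; q-+ = λ _ _ → refl ; q-* = λ _ _ → refl ; q-1 = refl ; q-inj = λ e → e
    ; ⟪_⟫ = ι ; ⟪⟫-q = λ _ → refl
    ; Λ = IsInt
    ; Λ-+ = λ { (x , p) (y , q) → x ℤ.+ y , trans (cong₂ ℚ._+_ p q) (sym (ι-+ x y)) }
    ; Λ-* = λ { (x , p) (y , q) → x ℤ.* y , trans (cong₂ ℚ._*_ p q) (sym (ι-* x y)) }
    ; Λ-ι = λ z → z , refl
    ; Λ-q = λ h → h
    ; Λ-den = λ r → ℚ.↧ r , ↧≢0 r , ℚ.↥ r , denominator r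
    }
    where
    ↧≢0 : ∀ r → ℚ.↧ r ≢ 0ℤ
    ↧≢0 (ℚ.mkℚ _ _ _) ()

  record Endomorphismᴸ (A : Algebraᴸ) : Set where
    open Algebraᴸ A
    field
      σ   : Carrier → Carrier
      σ-+ : ∀ x y → σ (x + y) ≡ σ x + σ y
      σ-* : ∀ x y → σ (x * y) ≡ σ x * σ y
      σ-q : ∀ r → σ (q r) ≡ q r
      σ-Λ : ∀ {x} → Λ x → Λ (σ x)

  identityᴸ : ∀ A → Endomorphismᴸ A
  identityᴸ A = record { σ = λ x → x ; σ-+ = λ _ _ → refl ; σ-* = λ _ _ → refl ; σ-q = λ _ → refl ; σ-Λ = λ h → h }

  module AdjoinRoot (A : Algebraᴸ) (d : Algebraᴸ.Carrier A) (Λd : Algebraᴸ.Λ A d) where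
    open Algebraᴸ A
    open Solver A

    Pair : Set
    Pair = Carrier × Carrier

    mul : Pair → Pair → Pair
    mul (x , y) (z , w) = x * z + d * (y * w) , x * w + y * z

    -- The pair (x , y) stands for x + y√d. Nothing asks d to be a non-square, so zero divisors may
    -- appear; Λ + Λ√d is a ring because d lies in Λ.
    adjoin : Algebraᴸ
    adjoin = record
      { Carrier = Pair
      ; _+_ = λ { (x , y) (z , w) → x + z , y + w }
      ; _*_ = mul
      ; -_ = λ { (x , y) → - x , - y }
      ; 0# = 0# , 0#
      ; 1# = 1# , 0#
      ; isCommutativeRing = isCommutativeRing≡
          (λ { (x , y) (z , w) (u , v) → cong₂ _,_ (+-assoc x z u) (+-assoc y w v) })
          (λ { (x , y) → cong₂ _,_ (+-identityˡ x) (+-identityˡ y) })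
          (λ { (x , y) → cong₂ _,_ (-‿inverseˡ x) (-‿inverseˡ y) })
          (λ { (x , y) (z , w) → cong₂ _,_ (+-comm x z) (+-comm y w) })
          (λ { (x , y) (z , w) (u , v) → cong₂ _,_
            (ring [] (d ∷ x ∷ y ∷ z ∷ w ∷ u ∷ v ∷ []) (λ d x y z w u v →
              (x :* z :+ d :* (y :* w)) :* u :+ d :* ((x :* w :+ y :* z) :* v) ⊜ x :* (z :* u :+ d :* (w :* v)) :+ d :* (y :* (z :* v :+ w :* u))) refl)
            (ring [] (d ∷ x ∷ y ∷ z ∷ w ∷ u ∷ v ∷ []) (λ d x y z w u v →
              (x :* z :+ d :* (y :* w)) :* v :+ (x :* w :+ y :* z) :* u ⊜ x :* (z :* v :+ w :* u) :+ y :* (z :* u :+ d :* (w :* v))) refl) })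
          (λ { (x , y) → cong₂ _,_
            (ring [] (d ∷ x ∷ y ∷ []) (λ d x y → :1 :* x :+ d :* (:0 :* y) ⊜ x) refl)
            (ring [] (d ∷ x ∷ y ∷ []) (λ d x y → :1 :* y :+ :0 :* x ⊜ y) refl) })
          (λ { (x , y) (z , w) (u , v) → cong₂ _,_
            (ring [] (d ∷ x ∷ y ∷ z ∷ w ∷ u ∷ v ∷ []) (λ d x y z w u v →
              x :* (z :+ u) :+ d :* (y :* (w :+ v)) ⊜ x :* z :+ d :* (y :* w) :+ (x :* u :+ d :* (y :* v))) refl)
            (ring [] (d ∷ x ∷ y ∷ z ∷ w ∷ u ∷ v ∷ []) (λ d x y z w u v →
              x :* (w :+ v) :+ y :* (z :+ u) ⊜ x :* w :+ y :* z :+ (x :* v :+ y :* u)) refl) })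
          (λ { (x , y) (z , w) → cong₂ _,_
            (ring [] (d ∷ x ∷ y ∷ z ∷ w ∷ []) (λ d x y z w → x :* z :+ d :* (y :* w) ⊜ z :* x :+ d :* (w :* y)) refl)
            (ring [] (d ∷ x ∷ y ∷ z ∷ w ∷ []) (λ d x y z w → x :* w :+ y :* z ⊜ z :* y :+ w :* x) refl) })
      ; q = λ r → q r , 0#
      ; q-+ = λ r s → cong₂ _,_ (q-+ r s) (sym (+-identityˡ 0#))
      ; q-* = λ r s → cong₂ _,_
          (trans (q-* r s) (ring [] (d ∷ q r ∷ q s ∷ []) (λ d r s → r :* s ⊜ r :* s :+ d :* (:0 :* :0)) refl))
          (ring [] (q r ∷ q s ∷ []) (λ r s → :0 ⊜ r :* :0 :+ :0 :* s) refl)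
      ; q-1 = cong (_, 0#) q-1
      ; q-inj = λ e → q-inj (cong proj₁ e)
      ; ⟪_⟫ = λ z → ⟪ z ⟫ , 0#
      ; ⟪⟫-q = λ z → cong (_, 0#) (⟪⟫-q z)
      ; Λ = λ { (x , y) → Λ x × Λ y }
      ; Λ-+ = λ { (x , y) (z , w) → Λ-+ x z , Λ-+ y w }
      ; Λ-* = λ { (x , y) (z , w) → Λ-+ (Λ-* x z) (Λ-* Λd (Λ-* y w)) , Λ-+ (Λ-* x w) (Λ-* y z) }
      ; Λ-ι = λ z → Λ-ι z , subst Λ ⟪0⟫ (Λ-ι 0ℤ)
      ; Λ-q = λ { (h , _) → Λ-q h }
      ; Λ-den = λ { (x , y) → den x y (Λ-den x) (Λ-den y) }
      }
      where
      den : ∀ x y → (∃ λ e → e ≢ 0ℤ × Λ (⟪ e ⟫ * x)) → (∃ λ e → e ≢ 0ℤ × Λ (⟪ e ⟫ * y)) →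
            ∃ λ e → e ≢ 0ℤ × Λ (⟪ e ⟫ * x + d * (0# * y)) × Λ (⟪ e ⟫ * y + 0# * x)
      den x y (e , e≢0 , h) (f , f≢0 , k) = e ℤ.* f , *-≢0 A e≢0 f≢0
        , subst Λ (ring (e ∷ f ∷ []) (d ∷ x ∷ y ∷ []) (λ e f d x y → emb f :* (emb e :* x) ⊜ emb (e :* f) :* x :+ d :* (:0 :* y)) refl) (Λ-* (Λ-ι f) h)
        , subst Λ (ring (e ∷ f ∷ []) (x ∷ y ∷ []) (λ e f x y → emb e :* (emb f :* y) ⊜ emb (e :* f) :* y :+ :0 :* x) refl) (Λ-* (Λ-ι e) k)

    root : Pair
    root = 0# , 1#

    root² : mul root root ≡ (d , 0#)
    root² = cong₂ _,_ (ring [] (d ∷ []) (λ d → :0 :* :0 :+ d :* (:1 :* :1) ⊜ d) refl) (ring [] [] (:0 :* :1 :+ :1 :* :0 ⊜ :0) refl)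

    Λ-root : Algebraᴸ.Λ adjoin root
    Λ-root = subst Λ ⟪0⟫ (Λ-ι 0ℤ) , subst Λ ⟪1⟫ (Λ-ι 1ℤ)

    Λ-base : ∀ {x} → Λ x → Algebraᴸ.Λ adjoin (x , 0#)
    Λ-base h = h , subst Λ ⟪0⟫ (Λ-ι 0ℤ)

    σ-0 : (h : Endomorphismᴸ A) → Endomorphismᴸ.σ h 0# ≡ 0#
    σ-0 h = trans (cong (Endomorphismᴸ.σ h) (sym (trans (sym (⟪⟫-q 0ℤ)) ⟪0⟫))) (trans (Endomorphismᴸ.σ-q h (ι 0ℤ)) (trans (sym (⟪⟫-q 0ℤ)) ⟪0⟫))

    -- x + y √d ↦ h x + h y z √d, a homomorphism because (z √d)² = z² d = h d.
    lift : (h : Endomorphismᴸ A) → ∀ z → Λ z → Endomorphismᴸ.σ h d ≡ d * (z * z) → Endomorphismᴸ adjoin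
    lift h z Λz e = record
      { σ = λ { (x , y) → σ x , σ y * z }
      ; σ-+ = λ { (x , y) (u , v) → cong₂ _,_ (σ-+ x u) (trans (cong (_* z) (σ-+ y v)) (distribʳ z (σ y) (σ v))) }
      ; σ-* = λ { (x , y) (u , v) → cong₂ _,_
          (trans (σ-+ (x * u) (d * (y * v))) (trans (cong₂ _+_ (σ-* x u) (trans (σ-* d (y * v)) (cong₂ _*_ e (σ-* y v))))
            (ring [] (d ∷ z ∷ σ x ∷ σ y ∷ σ u ∷ σ v ∷ []) (λ d z x y u v → x :* u :+ d :* (z :* z) :* (y :* v) ⊜ x :* u :+ d :* (y :* z :* (v :* z))) refl)))
          (trans (cong (_* z) (trans (σ-+ (x * v) (y * u)) (cong₂ _+_ (σ-* x v) (σ-* y u))))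
            (ring [] (z ∷ σ x ∷ σ y ∷ σ u ∷ σ v ∷ []) (λ z x y u v → (x :* v :+ y :* u) :* z ⊜ x :* (v :* z) :+ y :* z :* u) refl)) }
      ; σ-q = λ r → cong₂ _,_ (σ-q r) (trans (cong (_* z) (σ-0 h)) (zeroˡ z))
      ; σ-Λ = λ { (x , y) → σ-Λ x , Λ-* (σ-Λ y) Λz }
      }
      where
      open Endomorphismᴸ h

  -- The interface behind which the pairs disappear: `rootExtension` is abstract, so computations at
  -- the top of the tower meet these laws and not pairs nested five deep.
  record RootExtension (A : Algebraᴸ) (d : Algebraᴸ.Carrier A) : Set₁ where
    private
      module A = Algebraᴸ A
    field
      B     : Algebraᴸ
      embed : A.Carrier → Algebraᴸ.Carrier B
    open Algebraᴸ B
    field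
      embed-*  : ∀ x y → embed (x A.* y) ≡ embed x * embed y
      embed-⟪⟫ : ∀ z → embed A.⟪ z ⟫ ≡ ⟪ z ⟫
      embed-Λ  : ∀ {x} → A.Λ x → Λ (embed x)
      √        : Carrier
      √²       : √ * √ ≡ embed d
      Λ-√      : Λ √
      extend   : (h : Endomorphismᴸ A) → ∀ z → A.Λ z → Endomorphismᴸ.σ h d ≡ d A.* (z A.* z) →
                 Σ (Endomorphismᴸ B) λ k → (∀ x → Endomorphismᴸ.σ k (embed x) ≡ embed (Endomorphismᴸ.σ h x)) × Endomorphismᴸ.σ k √ ≡ embed z * √

  abstract
    rootExtension : ∀ A d → Algebraᴸ.Λ A d → RootExtension A d
    rootExtension A d Λd = record
      { B = adjoin
      ; embed = λ x → x , 0#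
      ; embed-* = λ x y → cong₂ _,_ (ring [] (d ∷ x ∷ y ∷ []) (λ d x y → x :* y ⊜ x :* y :+ d :* (:0 :* :0)) refl) (ring [] (x ∷ y ∷ []) (λ x y → :0 ⊜ x :* :0 :+ :0 :* y) refl)
      ; embed-⟪⟫ = λ z → refl
      ; embed-Λ = Λ-base
      ; √ = root
      ; √² = root²
      ; Λ-√ = Λ-root
      ; extend = λ h z Λz e → lift h z Λz e
          , (λ x → cong (Endomorphismᴸ.σ h x ,_) (trans (cong (_* z) (σ-0 h)) (zeroˡ z)))
          , cong₂ _,_ (trans (σ-0 h) (ring [] (d ∷ z ∷ []) (λ d z → :0 ⊜ z :* :0 :+ d :* (:0 :* :1)) refl))
                      (trans (cong (_* z) (trans (cong (Endomorphismᴸ.σ h) (sym q-1)) (trans (Endomorphismᴸ.σ-q h 1ℚ) q-1)))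
                             (ring [] (z ∷ []) (λ z → :1 :* z ⊜ z :* :1 :+ :0 :* :0) refl))
      }
      where
      open AdjoinRoot A d Λd
      open Algebraᴸ A
      open Solver A

  -- ζ is a primitive eighth root of unity, and σ the automorphism θ ↦ ζθ fixing ζ.
  record OcticTower (a : ℤ) : Set₁ where
    field
      algebra : Algebraᴸ
      endo    : Endomorphismᴸ algebra
    open Algebraᴸ algebra public
    open Endomorphismᴸ endo public
    field
      θ ζ : Carrier
      θ⁸  : θ ^ 8 ≡ ⟪ a ⟫
      ζ⁴  : ζ ^ 4 ≡ ⟪ ℤ.- 1ℤ ⟫
      σ-θ : σ θ ≡ ζ * θ
      σ-ζ : σ ζ ≡ ζ
      Λ-θ : Λ θ
      Λ-ζ : Λ ζ

  module _ (a : ℤ) where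

    private
      -- The successive roots are i, then ζ with ζ² = i, then √a, ⁴√a and θ.
      module I = RootExtension (rootExtension ℚ-algebra (Algebraᴸ.⟪_⟫ ℚ-algebra (ℤ.- 1ℤ)) (Algebraᴸ.Λ-ι ℚ-algebra (ℤ.- 1ℤ)))
      module Iₐ = Algebraᴸ I.B
      module Z = RootExtension (rootExtension I.B I.√ I.Λ-√)
      module Zₐ = Algebraᴸ Z.B
      module P = RootExtension (rootExtension Z.B Zₐ.⟪ a ⟫ (Zₐ.Λ-ι a))
      module Pₐ = Algebraᴸ P.B
      module F = RootExtension (rootExtension P.B P.√ P.Λ-√)
      module Fₐ = Algebraᴸ F.B
      module T = RootExtension (rootExtension F.B F.√ F.Λ-√)
      module Tₐ = Algebraᴸ T.B

      i²  = trans I.√² (I.embed-⟪⟫ (ℤ.- 1ℤ))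
      iᶻ  = Z.embed I.√
      iᴾ  = P.embed iᶻ
      ζᴾ  = P.embed Z.√
      ζᶠ  = F.embed ζᴾ

      iᴾ² : iᴾ Pₐ.* iᴾ ≡ Pₐ.⟪ ℤ.- 1ℤ ⟫
      iᴾ² = trans (sym (P.embed-* iᶻ iᶻ)) (trans (cong P.embed (trans (sym (Z.embed-* I.√ I.√)) (trans (cong Z.embed i²) (Z.embed-⟪⟫ (ℤ.- 1ℤ))))) (P.embed-⟪⟫ (ℤ.- 1ℤ)))

      ζᶠ² : ζᶠ Fₐ.* ζᶠ ≡ F.embed iᴾ
      ζᶠ² = trans (sym (F.embed-* ζᴾ ζᴾ)) (cong F.embed (trans (sym (P.embed-* Z.√ Z.√)) (cong P.embed Z.√²)))

      -- σ is the identity up to ζ. The factors by which it multiplies √a, ⁴√a and θ are -1, i and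
      -- ζ, each the square of the next, which is the condition under which `extend` applies.
      extᴾ = P.extend (identityᴸ Z.B) Zₐ.⟪ ℤ.- 1ℤ ⟫ (Zₐ.Λ-ι (ℤ.- 1ℤ))
        (Solver.ring Z.B (a ∷ []) [] (λ a → emb a ⊜ emb a :* (emb (con (ℤ.- 1ℤ)) :* emb (con (ℤ.- 1ℤ)))) refl)
      extᶠ = F.extend (proj₁ extᴾ) iᴾ (P.embed-Λ (Z.embed-Λ I.Λ-√))
        (trans (proj₂ (proj₂ extᴾ)) (trans (cong (Pₐ._* P.√) (P.embed-⟪⟫ (ℤ.- 1ℤ))) (trans (Pₐ.*-comm Pₐ.⟪ ℤ.- 1ℤ ⟫ P.√) (cong (P.√ Pₐ.*_) (sym iᴾ²)))))
      extᵀ = T.extend (proj₁ extᶠ) ζᶠ (F.embed-Λ (P.embed-Λ Z.Λ-√))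
        (trans (proj₂ (proj₂ extᶠ)) (trans (Fₐ.*-comm (F.embed iᴾ) F.√) (cong (F.√ Fₐ.*_) (sym ζᶠ²))))

    octicTower : OcticTower a
    octicTower = record
      { algebra = T.B
      ; endo = proj₁ extᵀ
      ; θ = T.√
      ; ζ = T.embed ζᶠ
      ; θ⁸ = trans (fourth-power² T.√ (trans (cong₂ Tₐ._*_ T.√² T.√²) (trans (sym (T.embed-* F.√ F.√)) (cong T.embed F.√²))))
                   (trans (sym (T.embed-* (F.embed P.√) (F.embed P.√)))
                          (trans (cong T.embed (trans (sym (F.embed-* P.√ P.√)) (trans (cong F.embed (trans P.√² (P.embed-⟪⟫ a))) (F.embed-⟪⟫ a)))) (T.embed-⟪⟫ a)))
      ; ζ⁴ = trans (Solver.ring T.B [] (T.embed ζᶠ ∷ []) (λ z → z :^ 4 ⊜ (z :* z) :* (z :* z)) refl)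
                   (trans (cong (λ w → w Tₐ.* w) (trans (sym (T.embed-* ζᶠ ζᶠ)) (cong T.embed ζᶠ²)))
                          (trans (sym (T.embed-* (F.embed iᴾ) (F.embed iᴾ)))
                                 (trans (cong T.embed (trans (sym (F.embed-* iᴾ iᴾ)) (trans (cong F.embed iᴾ²) (F.embed-⟪⟫ (ℤ.- 1ℤ))))) (T.embed-⟪⟫ (ℤ.- 1ℤ)))))
      ; σ-θ = proj₂ (proj₂ extᵀ)
      ; σ-ζ = trans (proj₁ (proj₂ extᵀ) ζᶠ) (cong T.embed (trans (proj₁ (proj₂ extᶠ) ζᴾ) (cong F.embed (proj₁ (proj₂ extᴾ) Z.√))))
      ; Λ-θ = T.Λ-√
      ; Λ-ζ = T.embed-Λ (F.embed-Λ (P.embed-Λ Z.Λ-√))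
      }
      where
      fourth-power² : ∀ x {y} → (x Tₐ.* x) Tₐ.* (x Tₐ.* x) ≡ y → x Tₐ.^ 8 ≡ y Tₐ.* y
      fourth-power² x e = trans (Solver.ring T.B [] (x ∷ []) (λ x → x :^ 8 ⊜ (x :* x :* (x :* x)) :* (x :* x :* (x :* x))) refl) (cong₂ Tₐ._*_ e e)

open Towers
open Integrality hiding (eval; Integral; integral; I-ι; I-*; I-+; I-neg; I--; I-q; I-monic; ^-+; ^-*; *-≢0)

-- Square-free divisors and parity of integers.

module Divisibility where
  open import Data.Integer as ℤ using (ℤ; -[1+_]; 0ℤ; 1ℤ; ∣_∣; _+_; _*_; _-_; -_; _^_) renaming (+_ to pos)
  import Data.Integer.DivMod as ℤD
  import Data.Integer.Divisibility.Signed as Signed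
  open import Data.Integer.Tactic.RingSolver using (solve; solve-∀)
  open import Data.List using (List; []; _∷_)
  import Data.Nat.Coprimality as Coprime
  open import Data.Nat.Coprimality using (Coprime)
  import Data.Nat.GCD as GCD
  open import Data.Product using (Σ; ∃; _×_; _,_; proj₁; proj₂)

  infix 4 _∣_
  record _∣_ (d z : ℤ) : Set where
    constructor divides
    field
      quotient : ℤ
      equation : z ≡ d * quotient

  ∣-abs : ∀ {d z} → ∣ d ∣ ℕ∣.∣ ∣ z ∣ → d ∣ z
  ∣-abs {d} h with Signed.∣ᵤ⇒∣ h
  ... | Signed.divides k e = divides k (trans e (ℤₚ.*-comm k d))

  abs-∣ : ∀ {d z} → d ∣ z → ∣ d ∣ ℕ∣.∣ ∣ z ∣
  abs-∣ {d} (divides k refl) = ℕ∣.divides ∣ k ∣ (trans (ℤₚ.abs-* d k) (ℕₚ.*-comm ∣ d ∣ ∣ k ∣))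

  -- With g the gcd, n = n′g and x = x′g, the cofactors are coprime. From n′g dividing x′²g² follows
  -- that n′ divides g, so n′² divides n and n′ = 1; thus n = g.
  squareFree-∣² : ∀ {n} x → (∀ d → d ℕ.* d ℕ∣.∣ n → d ≡ 1) → n ℕ∣.∣ x ℕ.* x → n ℕ∣.∣ x
  squareFree-∣² {n} x sf n∣x² with GCD.mkGCD n x
  ... | g , gcd@(GCD.GCD.is (ℕ∣.divides n′ n≡ , ℕ∣.divides x′ x≡) _) = subst (ℕ∣._∣ x) (sym n≡g) (ℕ∣.divides x′ x≡)
    where
    n≢0 : n ≢ 0
    n≢0 refl with sf 2 (ℕ∣.divides 0 refl)
    ... | ()

    g≢0 : g ≢ 0
    g≢0 refl = n≢0 (trans n≡ (ℕₚ.*-zeroʳ n′))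

    instance _ = ℕ.≢-nonZero g≢0

    n′-x′ : Coprime n′ x′
    n′-x′ {d} (ℕ∣.divides i n′≡ , ℕ∣.divides j x′≡) = ℕₚ.*-cancelʳ-≡ d 1 g (trans (ℕ∣.∣-antisym dg∣g (ℕ∣.divides d refl)) (sym (ℕₚ.*-identityˡ g)))
      where
      dg∣g : d ℕ.* g ℕ∣.∣ g
      dg∣g = GCD.GCD.greatest gcd
        ( ℕ∣.divides i (trans n≡ (trans (cong (ℕ._* g) n′≡) (ℕₚ.*-assoc i d g)))
        , ℕ∣.divides j (trans x≡ (trans (cong (ℕ._* g) x′≡) (ℕₚ.*-assoc j d g))))

    n′∣g : n′ ℕ∣.∣ g
    n′∣g = Coprime.coprime-divisor n′-x′ (Coprime.coprime-divisor n′-x′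
      (ℕ∣.*-cancelʳ-∣ g (subst₂ ℕ∣._∣_ n≡ (trans (cong₂ ℕ._*_ x≡ x≡) (rearrange x′ g)) n∣x²)))
      where
      rearrange : ∀ x g → x ℕ.* g ℕ.* (x ℕ.* g) ≡ x ℕ.* (x ℕ.* g) ℕ.* g
      rearrange x g = trans (ℕₚ.*-comm (x ℕ.* g) (x ℕ.* g)) (trans (sym (ℕₚ.*-assoc (x ℕ.* g) x g)) (cong (ℕ._* g) (ℕₚ.*-comm (x ℕ.* g) x)))

    n′≡1 : n′ ≡ 1
    n′≡1 = sf n′ (subst (n′ ℕ.* n′ ℕ∣.∣_) (sym n≡) (ℕ∣.*-monoʳ-∣ n′ n′∣g))

    n≡g : n ≡ g
    n≡g = trans n≡ (trans (cong (ℕ._* g) n′≡1) (ℕₚ.*-identityˡ g))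

  squareFree-root : ∀ a → SquareFree a → ∀ {x} → a ∣ x * x → a ∣ x
  squareFree-root a sf {x} h = ∣-abs (squareFree-∣² ∣ x ∣ sf (subst (_ ℕ∣.∣_) (ℤₚ.abs-* x x) (abs-∣ h)))

  squareFree-root⁸ : ∀ a → SquareFree a → ∀ {x} → a ∣ x ^ 8 → a ∣ x
  squareFree-root⁸ a sf {x} (divides k e) = r {x} (r {x * x} (r {x * x * (x * x)} (divides k (trans (eighth x) e))))
    where
    r : ∀ {x} → a ∣ x * x → a ∣ x
    r = squareFree-root a sf
    eighth : ∀ x → x * x * (x * x) * (x * x * (x * x)) ≡ x * (x * (x * (x * (x * (x * (x * (x * 1ℤ)))))))
    eighth = solve-∀

  squareFree⇒≢0 : ∀ a → SquareFree a → a ≢ 0ℤ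
  squareFree⇒≢0 a sf refl with sf 2 (ℕ∣.divides 0 refl)
  ... | ()

  Even Odd : ℤ → Set
  Even z = ∃ λ k → z ≡ pos 2 * k
  Odd  z = ∃ λ k → z ≡ pos 2 * k + 1ℤ

  parity : ∀ z → Even z ⊎ Odd z
  parity z with z ℤD.%ℕ 2 | ℤD.a≡a%ℕn+[a/ℕn]*n z 2 | ℤD.n%ℕd<d z 2
  ... | 0 | e | _ = inj₁ (z ℤD./ℕ 2 , trans e (even (z ℤD./ℕ 2)))
    where
    even : ∀ k → pos 0 + k * pos 2 ≡ pos 2 * k
    even = solve-∀
  ... | 1 | e | _ = inj₂ (z ℤD./ℕ 2 , trans e (odd (z ℤD./ℕ 2)))
    where
    odd : ∀ k → pos 1 + k * pos 2 ≡ pos 2 * k + 1ℤ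
    odd = solve-∀
  ... | suc (suc _) | _ | ℕ.s≤s (ℕ.s≤s ())

  1-not-even : ∀ k → 1ℤ ≢ pos 2 * k
  1-not-even k e with ℕₚ.m*n≡1⇒m≡1 2 ∣ k ∣ (sym (trans (cong ∣_∣ e) (ℤₚ.abs-* (pos 2) k)))
  ... | ()

  even-odd : ∀ {z} → Even z → Odd z → ⊥
  even-odd (k , refl) (j , e) = 1-not-even (k - j) (trans (step₁ j) (trans (cong (_- pos 2 * j) (sym e)) (step₂ k j)))
    where
    step₁ : ∀ j → 1ℤ ≡ pos 2 * j + 1ℤ - pos 2 * j
    step₁ = solve-∀
    step₂ : ∀ k j → pos 2 * k - pos 2 * j ≡ pos 2 * (k - j)
    step₂ = solve-∀

  odd-* : ∀ {x y} → Odd x → Odd y → Odd (x * y)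
  odd-* (k , refl) (j , refl) = pos 2 * k * j + k + j , step k j
    where
    step : ∀ k j → (pos 2 * k + 1ℤ) * (pos 2 * j + 1ℤ) ≡ pos 2 * (pos 2 * k * j + k + j) + 1ℤ
    step = solve-∀

  odd-^ : ∀ {x} → Odd x → ∀ n → Odd (x ^ n)
  odd-^ o zero    = 0ℤ , refl
  odd-^ o (suc n) = odd-* o (odd-^ o n)

  odd⇒≢0 : ∀ {x} → Odd x → x ≢ 0ℤ
  odd⇒≢0 o refl = even-odd (0ℤ , refl) o

  even-root : ∀ {g o n k} → Odd o → pos 2 * k ≡ g ^ n * o → Even g
  even-root {g} {n = n} {k} o e with parity g
  ... | inj₁ even = even
  ... | inj₂ odd  = ⊥-elim (even-odd (k , sym e) (odd-* (odd-^ odd n) o))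

open Divisibility renaming (_∣_ to _∣ᶻ_)

-- Congruences modulo 2, decided by truth tables.

module Parity where
  open import Data.Bool as Bool using (Bool; true; false; not; _∧_; _xor_; T)
  import Data.Bool.Properties as Boolₚ
  open import Data.Integer as ℤ using (ℤ; -[1+_]; 0ℤ; 1ℤ; _+_; _*_; _-_; -_; _^_) renaming (+_ to pos)
  open import Data.List using (List; []; _∷_; all)
  open import Data.List.Relation.Unary.All using (All; []; _∷_)
  open import Data.Product using (Σ; ∃; _×_; _,_; proj₁; proj₂)
  open import Data.Vec as Vec using (Vec; []; _∷_; lookup)
  open import Data.Vec.N-ary using (N-ary; _$ⁿ_)
  import Data.Vec.Properties as Vecₚ

  IsBit : ℤ → Bool → Set
  IsBit z false = Even z
  IsBit z true  = Odd z

  bit : ∀ z → ∃ (IsBit z)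
  bit z with parity z
  ... | inj₁ e = false , e
  ... | inj₂ o = true , o

  bit-+ : ∀ {x y} b c → IsBit x b → IsBit y c → IsBit (x + y) (b xor c)
  bit-+ false false (k , refl) (j , refl) = k + j , lem k j
    where lem : ∀ k j → pos 2 * k + pos 2 * j ≡ pos 2 * (k + j)
          lem = solve-∀
  bit-+ false true  (k , refl) (j , refl) = k + j , lem k j
    where lem : ∀ k j → pos 2 * k + (pos 2 * j + 1ℤ) ≡ pos 2 * (k + j) + 1ℤ
          lem = solve-∀
  bit-+ true  false (k , refl) (j , refl) = k + j , lem k j
    where lem : ∀ k j → pos 2 * k + 1ℤ + pos 2 * j ≡ pos 2 * (k + j) + 1ℤ
          lem = solve-∀
  bit-+ true  true  (k , refl) (j , refl) = k + j + 1ℤ , lem k j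
    where lem : ∀ k j → pos 2 * k + 1ℤ + (pos 2 * j + 1ℤ) ≡ pos 2 * (k + j + 1ℤ)
          lem = solve-∀

  bit-* : ∀ {x y} b c → IsBit x b → IsBit y c → IsBit (x * y) (b ∧ c)
  bit-* {y = y} false c (k , refl) _ = k * y , lem k y
    where lem : ∀ k y → pos 2 * k * y ≡ pos 2 * (k * y)
          lem = solve-∀
  bit-* {x} true false _ (k , refl) = x * k , lem x k
    where lem : ∀ x k → x * (pos 2 * k) ≡ pos 2 * (x * k)
          lem = solve-∀
  bit-* true  true  o p = odd-* o p

  bit-neg : ∀ {x} b → IsBit x b → IsBit (- x) b
  bit-neg false (k , refl) = - k , lem k
    where lem : ∀ k → - (pos 2 * k) ≡ pos 2 * (- k)
          lem = solve-∀
  bit-neg true (k , refl) = - k - 1ℤ , lem k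
    where lem : ∀ k → - (pos 2 * k + 1ℤ) ≡ pos 2 * (- k - 1ℤ) + 1ℤ
          lem = solve-∀

  zeval : ∀ {k} → ZExpr k → Vec ℤ k → ℤ
  zeval (zvar i) ρ = lookup ρ i
  zeval (con z)  ρ = z
  zeval (e :+ f) ρ = zeval e ρ + zeval f ρ
  zeval (e :* f) ρ = zeval e ρ * zeval f ρ
  zeval (e :- f) ρ = zeval e ρ - zeval f ρ
  zeval (:- e)   ρ = - zeval e ρ
  zeval (e :^ n) ρ = zeval e ρ ^ n

  beval : ∀ {k} → ZExpr k → Vec Bool k → Bool
  beval (zvar i) ρ = lookup ρ i
  beval (con z)  ρ = proj₁ (bit z)
  beval (e :+ f) ρ = beval e ρ xor beval f ρ
  beval (e :* f) ρ = beval e ρ ∧ beval f ρ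
  beval (e :- f) ρ = beval e ρ xor beval f ρ
  beval (:- e)   ρ = beval e ρ
  beval (e :^ zero)  ρ = true
  beval (e :^ suc n) ρ = beval e ρ ∧ beval (e :^ n) ρ

  beval-bit : ∀ {k} (e : ZExpr k) ρ → IsBit (zeval e ρ) (beval e (Vec.map (λ z → proj₁ (bit z)) ρ))
  beval-bit (zvar i) ρ = subst (IsBit (lookup ρ i)) (sym (Vecₚ.lookup-map i _ ρ)) (proj₂ (bit (lookup ρ i)))
  beval-bit (con z)  ρ = proj₂ (bit z)
  beval-bit (e :+ f) ρ = bit-+ _ _ (beval-bit e ρ) (beval-bit f ρ)
  beval-bit (e :* f) ρ = bit-* _ _ (beval-bit e ρ) (beval-bit f ρ)
  beval-bit (e :- f) ρ = bit-+ _ _ (beval-bit e ρ) (bit-neg _ (beval-bit f ρ))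
  beval-bit (:- e)   ρ = bit-neg _ (beval-bit e ρ)
  beval-bit (e :^ zero)  ρ = 0ℤ , refl
  beval-bit (e :^ suc n) ρ = bit-* _ _ (beval-bit e ρ) (beval-bit (e :^ n) ρ)

  even⇒false : ∀ {z} b → IsBit z b → Even z → b ≡ false
  even⇒false false _ _ = refl
  even⇒false true  o e = ⊥-elim (even-odd e o)

  everywhere : ∀ k → (Vec Bool k → Bool) → Bool
  everywhere zero    p = p []
  everywhere (suc k) p = everywhere k (λ v → p (false ∷ v)) ∧ everywhere k (λ v → p (true ∷ v))

  everywhere-sound : ∀ k (p : Vec Bool k → Bool) → everywhere k p ≡ true → ∀ v → p v ≡ true
  everywhere-sound zero    p h []          = h
  everywhere-sound (suc k) p h (false ∷ v) = everywhere-sound k _ (Boolₚ.∧-conicalˡ _ _ h) v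
  everywhere-sound (suc k) p h (true ∷ v)  = everywhere-sound k _ (Boolₚ.∧-conicalʳ (everywhere k (λ v → p (false ∷ v))) _ h) v

  implies : ∀ {k} → List (ZExpr k) → ZExpr k → Vec Bool k → Bool
  implies []       g v = not (beval g v)
  implies (h ∷ hs) g v = Bool.if beval h v then true else implies hs g v

  -- Parity of integer polynomials, decided over 𝔽₂.
  mod2 : ∀ {k} (ρ : Vec ℤ k) (hs : List (ZExpr k)) (g : ZExpr k) → everywhere k (implies hs g) ≡ true →
         All (λ h → Even (zeval h ρ)) hs → Even (zeval g ρ)
  mod2 {k} ρ hs g check evens = go hs evens (everywhere-sound k (implies hs g) check (Vec.map (λ z → proj₁ (bit z)) ρ))
    where
    go : ∀ hs → All (λ h → Even (zeval h ρ)) hs → implies hs g (Vec.map (λ z → proj₁ (bit z)) ρ) ≡ true → Even (zeval g ρ)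
    go [] [] e with beval g (Vec.map (λ z → proj₁ (bit z)) ρ) | beval-bit g ρ
    ... | false | b = b
    go (h ∷ hs) (p ∷ ps) e with beval h (Vec.map (λ z → proj₁ (bit z)) ρ) | beval-bit h ρ
    ... | false | _ = go hs ps e
    ... | true  | o = ⊥-elim (even-odd p o)

  halve : ∀ {x y} → pos 2 * x ≡ pos 2 * y → x ≡ y
  halve {x} {y} e = Data.Integer.Properties.*-cancelˡ-≡ (pos 2) x y e
    where import Data.Integer.Properties

  -- `f` writes the hypotheses and the conclusion as polynomials, and `refl` checks the implication
  -- on all assignments of bits. Terms with an even coefficient vanish by themselves, so equations
  -- can be quoted in full.
  parity-of : ∀ {k} (ρ : Vec ℤ k) (f : N-ary k (ZExpr k) (List (ZExpr k) × ZExpr k)) →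
    let hs = proj₁ (_$ⁿ_ {n = k} f (Vec.tabulate zvar)) ; g = proj₂ (_$ⁿ_ {n = k} f (Vec.tabulate zvar)) in
    everywhere k (implies hs g) ≡ true → All (λ h → Even (zeval h ρ)) hs → Even (zeval g ρ)
  parity-of {k} ρ f = mod2 ρ (proj₁ (_$ⁿ_ {n = k} f (Vec.tabulate zvar))) (proj₂ (_$ⁿ_ {n = k} f (Vec.tabulate zvar)))

  -- For b = 2j + 1, multiplying bx + 2^k y = 1 by b - 2j = 1 turns 2^k y into b·(2^k y) - 2^(k+1) j
  -- y, which is of the required shape for k + 1.
  bezout-2^ : ∀ {b} → Odd b → ∀ k → ∃ λ x → ∃ λ y → b * x + pos 2 ^ k * y ≡ 1ℤ
  bezout-2^ {b} o zero = 0ℤ , 1ℤ , lem b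
    where lem : ∀ b → b * 0ℤ + 1ℤ * 1ℤ ≡ 1ℤ
          lem = solve-∀
  bezout-2^ {b} o@(j , b≡) (suc k) with bezout-2^ o k
  ... | x , y , e = x * (b - pos 2 * j) + pos 2 ^ k * y , - j * y ,
    trans (lem b j (pos 2 ^ k) x y) (trans (cong (_* (b - pos 2 * j)) e) (trans (cong (λ z → 1ℤ * (z - pos 2 * j)) b≡) (lem₂ j)))
    where
    lem : ∀ b j p x y → b * (x * (b - pos 2 * j) + p * y) + pos 2 * p * (- j * y) ≡ (b * x + p * y) * (b - pos 2 * j)
    lem = solve-∀
    lem₂ : ∀ j → 1ℤ * (pos 2 * j + 1ℤ - pos 2 * j) ≡ 1ℤ
    lem₂ = solve-∀

open Parity

-- Arithmetic of small quadratic forms over ℤ.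

ι-inverse : ∀ {n} → n ≢ 0ℤ → ∃ λ r → r ℚ.* ι n ≡ 1ℚ
ι-inverse {n} n≢0 = ℚ.1/ ι n , ℚₚ.*-inverseˡ (ι n)
  where instance _ = ℚ.≢-nonZero (λ e → n≢0 (ι-inj e))

^-≢0 : ∀ {a} → a ≢ 0ℤ → ∀ k → a ℤ.^ k ≢ 0ℤ
^-≢0 a≢0 zero    ()
^-≢0 {a} a≢0 (suc k) e with ℤₚ.i*j≡0⇒i≡0∨j≡0 a e
... | inj₁ p = a≢0 p
... | inj₂ p = ^-≢0 a≢0 k p

-- This turns information modulo 4 into a congruence modulo 2: a first congruence is substituted
-- into the equation, and what remains has the shape 2x + 4y = 4m.
quarter : ∀ {x y m} → pos 2 ℤ.* x ℤ.+ pos 4 ℤ.* y ≡ pos 4 ℤ.* m → Even x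
quarter {x} {y} {m} e = m ℤ.- y , ℤₚ.*-cancelˡ-≡ (pos 2) x (pos 2 ℤ.* (m ℤ.- y)) (trans (lem₁ x y) (trans (cong (ℤ._- pos 4 ℤ.* y) e) (lem₂ m y)))
  where
  lem₁ : ∀ x y → pos 2 ℤ.* x ≡ pos 2 ℤ.* x ℤ.+ pos 4 ℤ.* y ℤ.- pos 4 ℤ.* y
  lem₁ = solve-∀
  lem₂ : ∀ m y → pos 4 ℤ.* m ℤ.- pos 4 ℤ.* y ≡ pos 2 ℤ.* (pos 2 ℤ.* (m ℤ.- y))
  lem₂ = solve-∀

four⇒even : ∀ {x m} → x ≡ pos 4 ℤ.* m → Even x
four⇒even {m = m} e = pos 2 ℤ.* m , trans e (lem m)
  where
  lem : ∀ m → pos 4 ℤ.* m ≡ pos 2 ℤ.* (pos 2 ℤ.* m)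
  lem = solve-∀

even-difference : ∀ x y → Even (x ℤ.- y) → ∃ λ v → x ≡ y ℤ.+ pos 2 ℤ.* v
even-difference x y (v , e) = v , trans (lem x y) (cong (λ s → y ℤ.+ s) e)
  where
  lem : ∀ x y → x ≡ y ℤ.+ (x ℤ.- y)
  lem = solve-∀

-- p₀ + p₁ω + (q₀ + q₁ω)φ is twice an integer of ℚ(⁴√a): the norm condition modulo 4.
relative-integer : ∀ c p₀ p₁ q₀ q₁ m₀ m₁ →
  p₀ ℤ.* p₀ ℤ.+ c ℤ.* (p₁ ℤ.* p₁) ℤ.+ (q₀ ℤ.* q₀ ℤ.+ c ℤ.* (q₁ ℤ.* q₁)) ℤ.- pos 2 ℤ.* c ℤ.* (pos 2 ℤ.* q₀ ℤ.* q₁ ℤ.+ q₁ ℤ.* q₁) ≡ pos 4 ℤ.* m₀ →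
  pos 2 ℤ.* p₀ ℤ.* p₁ ℤ.+ p₁ ℤ.* p₁ ℤ.- (pos 2 ℤ.* (q₀ ℤ.* q₀ ℤ.+ c ℤ.* (q₁ ℤ.* q₁)) ℤ.+ (pos 2 ℤ.* q₀ ℤ.* q₁ ℤ.+ q₁ ℤ.* q₁)) ≡ pos 4 ℤ.* m₁ →
  Even p₀ × Even q₀ × Even (p₁ ℤ.- q₁) × Even (c ℤ.* q₁)
relative-integer c p₀ p₁ q₀ q₁ m₀ m₁ e₁ e₂ = Ep₀ , Eq₀ , d₁ , Ecq₁
  where
  d₁ : Even (p₁ ℤ.- q₁)
  d₁ = parity-of (c ∷ p₀ ∷ p₁ ∷ q₀ ∷ q₁ ∷ []) (λ c p₀ p₁ q₀ q₁ →
    (con (pos 2) :* p₀ :* p₁ :+ p₁ :* p₁ :- (con (pos 2) :* (q₀ :* q₀ :+ c :* (q₁ :* q₁)) :+ (con (pos 2) :* q₀ :* q₁ :+ q₁ :* q₁)) ∷ []) , (p₁ :- q₁)) refl (four⇒even e₂ ∷ [])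
  d₀ : Even (p₀ ℤ.- q₀)
  d₀ = parity-of (c ∷ p₀ ∷ p₁ ∷ q₀ ∷ q₁ ∷ []) (λ c p₀ p₁ q₀ q₁ →
    (p₁ :- q₁ ∷ p₀ :* p₀ :+ c :* (p₁ :* p₁) :+ (q₀ :* q₀ :+ c :* (q₁ :* q₁)) :- con (pos 2) :* c :* (con (pos 2) :* q₀ :* q₁ :+ q₁ :* q₁) ∷ []) , (p₀ :- q₀)) refl (d₁ ∷ four⇒even e₁ ∷ [])
  -- Modulo 2 the equations only say that pᵢ ≡ qᵢ. Substituting pᵢ = qᵢ + 2(...) makes them
  -- divisible by 2 once more, and the quotients give the remaining congruences.
  v = proj₁ (even-difference p₀ q₀ d₀)
  w = proj₁ (even-difference p₁ q₁ d₁)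
  lem₁ : ∀ c q₀ q₁ v w → let p₀ = q₀ ℤ.+ pos 2 ℤ.* v ; p₁ = q₁ ℤ.+ pos 2 ℤ.* w in
    pos 2 ℤ.* (q₀ ℤ.* q₀) ℤ.+ pos 4 ℤ.* (q₀ ℤ.* v ℤ.+ v ℤ.* v ℤ.+ c ℤ.* (q₁ ℤ.* w ℤ.+ w ℤ.* w) ℤ.- c ℤ.* q₀ ℤ.* q₁) ≡
    p₀ ℤ.* p₀ ℤ.+ c ℤ.* (p₁ ℤ.* p₁) ℤ.+ (q₀ ℤ.* q₀ ℤ.+ c ℤ.* (q₁ ℤ.* q₁)) ℤ.- pos 2 ℤ.* c ℤ.* (pos 2 ℤ.* q₀ ℤ.* q₁ ℤ.+ q₁ ℤ.* q₁)
  lem₁ = solve-∀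
  lem₂ : ∀ c q₀ q₁ v w → let p₀ = q₀ ℤ.+ pos 2 ℤ.* v ; p₁ = q₁ ℤ.+ pos 2 ℤ.* w in
    pos 2 ℤ.* (ℤ.- (q₀ ℤ.* q₀ ℤ.+ c ℤ.* (q₁ ℤ.* q₁))) ℤ.+ pos 4 ℤ.* (q₀ ℤ.* w ℤ.+ v ℤ.* q₁ ℤ.+ pos 2 ℤ.* v ℤ.* w ℤ.+ q₁ ℤ.* w ℤ.+ w ℤ.* w) ≡
    pos 2 ℤ.* p₀ ℤ.* p₁ ℤ.+ p₁ ℤ.* p₁ ℤ.- (pos 2 ℤ.* (q₀ ℤ.* q₀ ℤ.+ c ℤ.* (q₁ ℤ.* q₁)) ℤ.+ (pos 2 ℤ.* q₀ ℤ.* q₁ ℤ.+ q₁ ℤ.* q₁))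
  lem₂ = solve-∀
  Eq₀² : Even (q₀ ℤ.* q₀)
  Eq₀² = quarter {y = q₀ ℤ.* v ℤ.+ v ℤ.* v ℤ.+ c ℤ.* (q₁ ℤ.* w ℤ.+ w ℤ.* w) ℤ.- c ℤ.* q₀ ℤ.* q₁} {m₀} (trans (lem₁ c q₀ q₁ v w)
    (trans (cong₂ (λ p₀ p₁ → p₀ ℤ.* p₀ ℤ.+ c ℤ.* (p₁ ℤ.* p₁) ℤ.+ (q₀ ℤ.* q₀ ℤ.+ c ℤ.* (q₁ ℤ.* q₁)) ℤ.- pos 2 ℤ.* c ℤ.* (pos 2 ℤ.* q₀ ℤ.* q₁ ℤ.+ q₁ ℤ.* q₁))
      (sym (proj₂ (even-difference p₀ q₀ d₀))) (sym (proj₂ (even-difference p₁ q₁ d₁)))) e₁))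
  Es : Even (ℤ.- (q₀ ℤ.* q₀ ℤ.+ c ℤ.* (q₁ ℤ.* q₁)))
  Es = quarter {y = q₀ ℤ.* w ℤ.+ v ℤ.* q₁ ℤ.+ pos 2 ℤ.* v ℤ.* w ℤ.+ q₁ ℤ.* w ℤ.+ w ℤ.* w} {m₁} (trans (lem₂ c q₀ q₁ v w)
    (trans (cong₂ (λ p₀ p₁ → pos 2 ℤ.* p₀ ℤ.* p₁ ℤ.+ p₁ ℤ.* p₁ ℤ.- (pos 2 ℤ.* (q₀ ℤ.* q₀ ℤ.+ c ℤ.* (q₁ ℤ.* q₁)) ℤ.+ (pos 2 ℤ.* q₀ ℤ.* q₁ ℤ.+ q₁ ℤ.* q₁)))
      (sym (proj₂ (even-difference p₀ q₀ d₀))) (sym (proj₂ (even-difference p₁ q₁ d₁)))) e₂))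
  Eq₀ : Even q₀
  Eq₀ = parity-of (q₀ ∷ []) (λ q → (q :* q ∷ []) , q) refl (Eq₀² ∷ [])
  Ep₀ : Even p₀
  Ep₀ = parity-of (p₀ ∷ q₀ ∷ []) (λ p q → (q ∷ p :- q ∷ []) , p) refl (Eq₀ ∷ d₀ ∷ [])
  Ecq₁ : Even (c ℤ.* q₁)
  Ecq₁ = parity-of (c ∷ q₀ ∷ q₁ ∷ []) (λ c q₀ q₁ → (q₀ ∷ :- (q₀ :* q₀ :+ c :* (q₁ :* q₁)) ∷ []) , (c :* q₁)) refl (Eq₀ ∷ Es ∷ [])

unit⇒±1 : ∀ {m z} → m ℤ.* z ≡ 1ℤ → m ≡ 1ℤ ⊎ m ≡ ℤ.- 1ℤ
unit⇒±1 {m} {z} e with ℕₚ.m*n≡1⇒m≡1 ℤ.∣ m ∣ ℤ.∣ z ∣ (trans (sym (ℤₚ.abs-* m z)) (cong ℤ.∣_∣ e))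
unit⇒±1 {pos 1}      {z} e | refl = inj₁ refl
unit⇒±1 { -[1+ 0 ]}  {z} e | refl = inj₂ refl

-- The values of c for which 4c + 1 divides 15 or 17, namely 4c + 1 = 1, 5, -3, -15, 17. The numbers
-- 15 and 17 are 16 ∓ 1, that is (-4)² ∓ 1.
Exceptional : ℤ → Set
Exceptional c = c ≡ 0ℤ ⊎ c ≡ 1ℤ ⊎ c ≡ ℤ.- 1ℤ ⊎ c ≡ ℤ.- pos 4 ⊎ c ≡ pos 4

small-divisors : ∀ c {k} → k ≡ 15 ⊎ k ≡ 17 → pos 4 ℤ.* c ℤ.+ 1ℤ ∣ᶻ pos k → Exceptional c
small-divisors c {k} k≡ h = go c (abs-∣ h)
  where
  k≤17 : k ≡ 15 ⊎ k ≡ 17 → k ℕ.≤ 17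
  k≤17 (inj₁ refl) = ℕₚ.m≤m+n 15 2
  k≤17 (inj₂ refl) = ℕₚ.≤-refl
  k≢0 : k ≡ 15 ⊎ k ≡ 17 → ℕ.NonZero k
  k≢0 (inj₁ refl) = _
  k≢0 (inj₂ refl) = _
  not : ∀ d → ¬ (d ℕ∣.∣ 15) → ¬ (d ℕ∣.∣ 17) → k ≡ 15 ⊎ k ≡ 17 → ¬ (d ℕ∣.∣ k)
  not d p q (inj₁ refl) = p
  not d p q (inj₂ refl) = q
  large : ∀ {d} → 17 ℕ.< d → d ℕ∣.∣ k → ⊥
  large 17<d d∣k = ℕₚ.<⇒≱ 17<d (ℕₚ.≤-trans (ℕ∣.∣⇒≤ {{k≢0 k≡}} d∣k) (k≤17 k≡))
  negative : ∀ n → ℤ.∣ pos 4 ℤ.* (ℤ.- pos n) ℤ.+ 1ℤ ∣ ℕ.+ 1 ℕ.≥ 4 ℕ.* n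
  negative n = ℕₚ.≤-trans (ℕₚ.≤-reflexive (sym (trans (cong ℤ.∣_∣ (lem (pos n))) (trans (ℤₚ.∣-i∣≡∣i∣ (pos 4 ℤ.* pos n)) (ℤₚ.abs-* (pos 4) (pos n)))))) (ℤₚ.∣i-j∣≤∣i∣+∣j∣ (pos 4 ℤ.* (ℤ.- pos n) ℤ.+ 1ℤ) 1ℤ)
    where
    lem : ∀ n → pos 4 ℤ.* (ℤ.- n) ℤ.+ 1ℤ ℤ.- 1ℤ ≡ ℤ.- (pos 4 ℤ.* n)
    lem = solve-∀
  go : ∀ c → ℤ.∣ pos 4 ℤ.* c ℤ.+ 1ℤ ∣ ℕ∣.∣ k → Exceptional c
  go (pos 0) h = inj₁ refl
  go (pos 1) h = inj₂ (inj₁ refl)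
  go (pos 2) h = ⊥-elim (not 9 (from-no (9 ℕ∣.∣? 15)) (from-no (9 ℕ∣.∣? 17)) k≡ h)
  go (pos 3) h = ⊥-elim (not 13 (from-no (13 ℕ∣.∣? 15)) (from-no (13 ℕ∣.∣? 17)) k≡ h)
  go (pos 4) h = inj₂ (inj₂ (inj₂ (inj₂ refl)))
  go (pos (suc (suc (suc (suc (suc n)))))) h = ⊥-elim (large (ℕₚ.≤-trans (ℕₚ.m≤m+n 18 3) (ℕₚ.+-monoˡ-≤ 1 (ℕₚ.*-monoʳ-≤ 4 (ℕₚ.m≤m+n 5 n)))) h)
  go -[1+ 0 ] h = inj₂ (inj₂ (inj₁ refl))
  go -[1+ 1 ] h = ⊥-elim (not 7 (from-no (7 ℕ∣.∣? 15)) (from-no (7 ℕ∣.∣? 17)) k≡ h)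
  go -[1+ 2 ] h = ⊥-elim (not 11 (from-no (11 ℕ∣.∣? 15)) (from-no (11 ℕ∣.∣? 17)) k≡ h)
  go -[1+ 3 ] h = inj₂ (inj₂ (inj₂ (inj₁ refl)))
  go -[1+ suc (suc (suc (suc n))) ] h = ⊥-elim (large (ℕₚ.+-cancelʳ-≤ 1 18 _ (ℕₚ.≤-trans (ℕₚ.m≤m+n 19 1) (ℕₚ.≤-trans (ℕₚ.*-monoʳ-≤ 4 (ℕₚ.m≤m+n 5 n)) (negative (5 ℕ.+ n))))) h)

-- The coordinates of s² − φ y² = k p for s = (a₀ + a₁ω) + (b₀ + b₁ω)φ, y = (e₀ + e₁ω) + (f₀ + f₁ω)φ.
NormEquations : (k c a₀ a₁ b₀ b₁ e₀ e₁ f₀ f₁ l₀ l₁ l₂ l₃ : ℤ) → Set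
NormEquations k c a₀ a₁ b₀ b₁ e₀ e₁ f₀ f₁ l₀ l₁ l₂ l₃ =
  let open Data.Integer using (_+_; _*_; _-_)
      B₀ = b₀ * b₀ + c * (b₁ * b₁) ; B₁ = b₀ * b₁ + b₁ * b₀ + b₁ * b₁
      D₀ = e₀ * f₀ + c * (e₁ * f₁) ; D₁ = e₀ * f₁ + e₁ * f₀ + e₁ * f₁
      I₀ = f₀ * f₀ + c * (f₁ * f₁) ; I₁ = f₀ * f₁ + f₁ * f₀ + f₁ * f₁
  in a₀ * a₀ + c * (a₁ * a₁) + (pos 2 * c * B₁ - B₀) - pos 2 * (pos 2 * c * D₁ - D₀) ≡ k * l₀ ×
     a₀ * a₁ + a₁ * a₀ + a₁ * a₁ + (pos 2 * B₀ + B₁) - pos 2 * (pos 2 * D₀ + D₁) ≡ k * l₁ ×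
     pos 2 * (a₀ * b₀ + c * (a₁ * b₁)) - (e₀ * e₀ + c * (e₁ * e₁)) - (pos 2 * c * I₁ - I₀) ≡ k * l₂ ×
     pos 2 * (a₀ * b₁ + a₁ * b₀ + a₁ * b₁) - (e₀ * e₁ + e₁ * e₀ + e₁ * e₁) - (pos 2 * I₀ + I₁) ≡ k * l₃

-- Parities of the coordinates when c is odd.

module OddParities where
  open Data.Integer using (_+_; _*_; _-_; -_)

  open import Data.List.Relation.Unary.All using (All; []; _∷_)
  open import Relation.Nullary using (¬_; yes; no)

  -- The general equations are written for doubled coordinates. For odd c these are all even, and a
  -- factor 4 comes out of both sides.
  halve-equations : ∀ c a₀ a₁ b₀ b₁ e₀ e₁ f₀ f₁ {l₀ l₁ l₂ l₃} → let two = λ x → pos 2 * x in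
    NormEquations (pos 8) c (two a₀) (two a₁) (two b₀) (two b₁) (two e₀) (two e₁) (two f₀) (two f₁) (two l₀) (two l₁) (two l₂) (two l₃) →
    NormEquations (pos 4) c a₀ a₁ b₀ b₁ e₀ e₁ f₀ f₁ l₀ l₁ l₂ l₃
  halve-equations c a₀ a₁ b₀ b₁ e₀ e₁ f₀ f₁ {l₀} {l₁} {l₂} {l₃} (h₀ , h₁ , h₂ , h₃) =
    quartered l₀ (lem₀ c a₀ a₁ b₀ b₁ e₀ e₁ f₀ f₁) h₀ , quartered l₁ (lem₁ c a₀ a₁ b₀ b₁ e₀ e₁ f₀ f₁) h₁ ,
    quartered l₂ (lem₂ c a₀ a₁ b₀ b₁ e₀ e₁ f₀ f₁) h₂ , quartered l₃ (lem₃ c a₀ a₁ b₀ b₁ e₀ e₁ f₀ f₁) h₃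
    where
    lem : ∀ l → pos 8 * (pos 2 * l) ≡ pos 4 * (pos 4 * l)
    lem = solve-∀
    quartered : ∀ {x y} l → pos 4 * y ≡ x → x ≡ pos 8 * (pos 2 * l) → y ≡ pos 4 * l
    quartered {x} {y} l p q = ℤₚ.*-cancelˡ-≡ (pos 4) y (pos 4 * l) (trans p (trans q (lem l)))
    lem₀ : ∀ c a₀ a₁ b₀ b₁ e₀ e₁ f₀ f₁ → pos 4 * (a₀ * a₀ + c * (a₁ * a₁) + (pos 2 * c * (b₀ * b₁ + b₁ * b₀ + b₁ * b₁) - (b₀ * b₀ + c * (b₁ * b₁))) - pos 2 * (pos 2 * c * (e₀ * f₁ + e₁ * f₀ + e₁ * f₁) - (e₀ * f₀ + c * (e₁ * f₁)))) ≡
      (pos 2 * a₀) * (pos 2 * a₀) + c * ((pos 2 * a₁) * (pos 2 * a₁)) + (pos 2 * c * ((pos 2 * b₀) * (pos 2 * b₁) + (pos 2 * b₁) * (pos 2 * b₀) + (pos 2 * b₁) * (pos 2 * b₁)) - ((pos 2 * b₀) * (pos 2 * b₀) + c * ((pos 2 * b₁) * (pos 2 * b₁)))) - pos 2 * (pos 2 * c * ((pos 2 * e₀) * (pos 2 * f₁) + (pos 2 * e₁) * (pos 2 * f₀) + (pos 2 * e₁) * (pos 2 * f₁)) - ((pos 2 * e₀) * (pos 2 * f₀) + c * ((pos 2 * e₁) * (pos 2 * f₁))))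
    lem₀ = solve-∀
    lem₁ : ∀ c a₀ a₁ b₀ b₁ e₀ e₁ f₀ f₁ → pos 4 * (a₀ * a₁ + a₁ * a₀ + a₁ * a₁ + (pos 2 * (b₀ * b₀ + c * (b₁ * b₁)) + (b₀ * b₁ + b₁ * b₀ + b₁ * b₁)) - pos 2 * (pos 2 * (e₀ * f₀ + c * (e₁ * f₁)) + (e₀ * f₁ + e₁ * f₀ + e₁ * f₁))) ≡
      (pos 2 * a₀) * (pos 2 * a₁) + (pos 2 * a₁) * (pos 2 * a₀) + (pos 2 * a₁) * (pos 2 * a₁) + (pos 2 * ((pos 2 * b₀) * (pos 2 * b₀) + c * ((pos 2 * b₁) * (pos 2 * b₁))) + ((pos 2 * b₀) * (pos 2 * b₁) + (pos 2 * b₁) * (pos 2 * b₀) + (pos 2 * b₁) * (pos 2 * b₁))) - pos 2 * (pos 2 * ((pos 2 * e₀) * (pos 2 * f₀) + c * ((pos 2 * e₁) * (pos 2 * f₁))) + ((pos 2 * e₀) * (pos 2 * f₁) + (pos 2 * e₁) * (pos 2 * f₀) + (pos 2 * e₁) * (pos 2 * f₁)))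
    lem₁ = solve-∀
    lem₂ : ∀ c a₀ a₁ b₀ b₁ e₀ e₁ f₀ f₁ → pos 4 * (pos 2 * (a₀ * b₀ + c * (a₁ * b₁)) - (e₀ * e₀ + c * (e₁ * e₁)) - (pos 2 * c * (f₀ * f₁ + f₁ * f₀ + f₁ * f₁) - (f₀ * f₀ + c * (f₁ * f₁)))) ≡
      pos 2 * ((pos 2 * a₀) * (pos 2 * b₀) + c * ((pos 2 * a₁) * (pos 2 * b₁))) - ((pos 2 * e₀) * (pos 2 * e₀) + c * ((pos 2 * e₁) * (pos 2 * e₁))) - (pos 2 * c * ((pos 2 * f₀) * (pos 2 * f₁) + (pos 2 * f₁) * (pos 2 * f₀) + (pos 2 * f₁) * (pos 2 * f₁)) - ((pos 2 * f₀) * (pos 2 * f₀) + c * ((pos 2 * f₁) * (pos 2 * f₁))))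
    lem₂ = solve-∀
    lem₃ : ∀ c a₀ a₁ b₀ b₁ e₀ e₁ f₀ f₁ → pos 4 * (pos 2 * (a₀ * b₁ + a₁ * b₀ + a₁ * b₁) - (e₀ * e₁ + e₁ * e₀ + e₁ * e₁) - (pos 2 * (f₀ * f₀ + c * (f₁ * f₁)) + (f₀ * f₁ + f₁ * f₀ + f₁ * f₁))) ≡
      pos 2 * ((pos 2 * a₀) * (pos 2 * b₁) + (pos 2 * a₁) * (pos 2 * b₀) + (pos 2 * a₁) * (pos 2 * b₁)) - ((pos 2 * e₀) * (pos 2 * e₁) + (pos 2 * e₁) * (pos 2 * e₀) + (pos 2 * e₁) * (pos 2 * e₁)) - (pos 2 * ((pos 2 * f₀) * (pos 2 * f₀) + c * ((pos 2 * f₁) * (pos 2 * f₁))) + ((pos 2 * f₀) * (pos 2 * f₁) + (pos 2 * f₁) * (pos 2 * f₀) + (pos 2 * f₁) * (pos 2 * f₁)))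
    lem₃ = solve-∀

  -- The equations say that s² - φy² is divisible by 4. Modulo 2 they give b ≡ a and f ≡ e;
  -- substituting this and dividing by 2 leaves four forms in a₀, a₁, e₀, e₁ whose only common zero
  -- over 𝔽₂ is the origin when c is odd.
  even-coordinates : ∀ {c a₀ a₁ b₀ b₁ e₀ e₁ f₀ f₁ l₀ l₁ l₂ l₃} → Odd c → NormEquations (pos 4) c a₀ a₁ b₀ b₁ e₀ e₁ f₀ f₁ l₀ l₁ l₂ l₃ →
    (Even a₀ × Even a₁ × Even b₀ × Even b₁) × (Even e₀ × Even e₁ × Even f₀ × Even f₁)
  even-coordinates {c} {a₀} {a₁} {b₀} {b₁} {e₀} {e₁} {f₀} {f₁} {l₀} {l₁} {l₂} {l₃} (m , c≡) (h₀ , h₁ , h₂ , h₃) =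
    build (even-difference b₀ a₀ (proj₁ (proj₁ mod-2))) (even-difference b₁ a₁ (proj₂ (proj₁ mod-2)))
          (even-difference f₀ e₀ (proj₁ (proj₂ mod-2))) (even-difference f₁ e₁ (proj₂ (proj₂ mod-2)))
    where
    c-1 : Even (c - 1ℤ)
    c-1 = m , trans (cong (_- 1ℤ) c≡) (lem m)
      where lem : ∀ m → pos 2 * m + 1ℤ - 1ℤ ≡ pos 2 * m
            lem = solve-∀
    mod-2 : (Even (b₀ - a₀) × Even (b₁ - a₁)) × (Even (f₀ - e₀) × Even (f₁ - e₁))
    mod-2 = (b₀a₀ , b₁a₁) , (f₀e₀ , f₁e₁)
      where
      b₁a₁ : Even (b₁ - a₁)
      b₁a₁ = parity-of (c ∷ a₀ ∷ a₁ ∷ b₀ ∷ b₁ ∷ e₀ ∷ e₁ ∷ f₀ ∷ f₁ ∷ []) (λ c a₀ a₁ b₀ b₁ e₀ e₁ f₀ f₁ →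
          (a₀ :* a₁ :+ a₁ :* a₀ :+ a₁ :* a₁ :+ (con (pos 2) :* (b₀ :* b₀ :+ c :* (b₁ :* b₁)) :+ (b₀ :* b₁ :+ b₁ :* b₀ :+ b₁ :* b₁)) :- con (pos 2) :* (con (pos 2) :* (e₀ :* f₀ :+ c :* (e₁ :* f₁)) :+ (e₀ :* f₁ :+ e₁ :* f₀ :+ e₁ :* f₁)) ∷ []) , (b₁ :- a₁)) refl (four⇒even h₁ ∷ [])
      b₀a₀ : Even (b₀ - a₀)
      b₀a₀ = parity-of (c ∷ a₀ ∷ a₁ ∷ b₀ ∷ b₁ ∷ e₀ ∷ e₁ ∷ f₀ ∷ f₁ ∷ []) (λ c a₀ a₁ b₀ b₁ e₀ e₁ f₀ f₁ →
          (b₁ :- a₁ ∷ a₀ :* a₀ :+ c :* (a₁ :* a₁) :+ (con (pos 2) :* c :* (b₀ :* b₁ :+ b₁ :* b₀ :+ b₁ :* b₁) :- (b₀ :* b₀ :+ c :* (b₁ :* b₁))) :- con (pos 2) :* (con (pos 2) :* c :* (e₀ :* f₁ :+ e₁ :* f₀ :+ e₁ :* f₁) :- (e₀ :* f₀ :+ c :* (e₁ :* f₁))) ∷ []) , (b₀ :- a₀)) refl (b₁a₁ ∷ four⇒even h₀ ∷ [])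
      f₁e₁ : Even (f₁ - e₁)
      f₁e₁ = parity-of (c ∷ a₀ ∷ a₁ ∷ b₀ ∷ b₁ ∷ e₀ ∷ e₁ ∷ f₀ ∷ f₁ ∷ []) (λ c a₀ a₁ b₀ b₁ e₀ e₁ f₀ f₁ →
          (con (pos 2) :* (a₀ :* b₁ :+ a₁ :* b₀ :+ a₁ :* b₁) :- (e₀ :* e₁ :+ e₁ :* e₀ :+ e₁ :* e₁) :- (con (pos 2) :* (f₀ :* f₀ :+ c :* (f₁ :* f₁)) :+ (f₀ :* f₁ :+ f₁ :* f₀ :+ f₁ :* f₁)) ∷ []) , (f₁ :- e₁)) refl (four⇒even h₃ ∷ [])
      f₀e₀ : Even (f₀ - e₀)
      f₀e₀ = parity-of (c ∷ a₀ ∷ a₁ ∷ b₀ ∷ b₁ ∷ e₀ ∷ e₁ ∷ f₀ ∷ f₁ ∷ []) (λ c a₀ a₁ b₀ b₁ e₀ e₁ f₀ f₁ →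
          (f₁ :- e₁ ∷ con (pos 2) :* (a₀ :* b₀ :+ c :* (a₁ :* b₁)) :- (e₀ :* e₀ :+ c :* (e₁ :* e₁)) :- (con (pos 2) :* c :* (f₀ :* f₁ :+ f₁ :* f₀ :+ f₁ :* f₁) :- (f₀ :* f₀ :+ c :* (f₁ :* f₁))) ∷ []) , (f₀ :- e₀)) refl (f₁e₁ ∷ four⇒even h₂ ∷ [])
    build : (∃ λ r → b₀ ≡ a₀ + pos 2 * r) → (∃ λ r → b₁ ≡ a₁ + pos 2 * r) → (∃ λ r → f₀ ≡ e₀ + pos 2 * r) → (∃ λ r → f₁ ≡ e₁ + pos 2 * r) →
      (Even a₀ × Even a₁ × Even b₀ × Even b₁) × (Even e₀ × Even e₁ × Even f₀ × Even f₁)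
    build (r₀ , refl) (r₁ , refl) (s₀ , refl) (s₁ , refl) = (Ea₀ , Ea₁ , even-sum {a₀} {r₀} Ea₀ , even-sum {a₁} {r₁} Ea₁) , (Ee₀ , Ee₁ , even-sum {e₀} {s₀} Ee₀ , even-sum {e₁} {s₁} Ee₁)
      where
      even-sum : ∀ {x y} → Even x → Even (x + pos 2 * y)
      even-sum {x} {y} e = parity-of (x ∷ y ∷ []) (λ x y → (x ∷ []) , (x :+ con (pos 2) :* y)) refl (e ∷ [])
      lem₀ : ∀ c a₀ a₁ e₀ e₁ r₀ r₁ s₀ s₁ → pos 2 * (e₀ * e₀ + a₁ * a₁ * c + c * e₁ * e₁) + pos 4 * (- (a₀ * r₀) + e₀ * s₀ - r₀ * r₀ + a₀ * a₁ * c + pos 2 * a₀ * c * r₁ + pos 2 * a₁ * c * r₀ + a₁ * c * r₁ - pos 2 * c * e₀ * e₁ - pos 2 * c * e₀ * s₁ - c * e₁ * e₁ - pos 2 * c * e₁ * s₀ - c * e₁ * s₁ + pos 4 * c * r₀ * r₁ + c * r₁ * r₁) ≡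
        a₀ * a₀ + c * (a₁ * a₁) + (pos 2 * c * ((a₀ + pos 2 * r₀) * (a₁ + pos 2 * r₁) + (a₁ + pos 2 * r₁) * (a₀ + pos 2 * r₀) + (a₁ + pos 2 * r₁) * (a₁ + pos 2 * r₁)) - ((a₀ + pos 2 * r₀) * (a₀ + pos 2 * r₀) + c * ((a₁ + pos 2 * r₁) * (a₁ + pos 2 * r₁)))) - pos 2 * (pos 2 * c * (e₀ * (e₁ + pos 2 * s₁) + e₁ * (e₀ + pos 2 * s₀) + e₁ * (e₁ + pos 2 * s₁)) - (e₀ * (e₀ + pos 2 * s₀) + c * (e₁ * (e₁ + pos 2 * s₁))))
      lem₀ = solve-∀
      q₀ : Even (e₀ * e₀ + a₁ * a₁ * c + c * e₁ * e₁)
      q₀ = quarter {y = - (a₀ * r₀) + e₀ * s₀ - r₀ * r₀ + a₀ * a₁ * c + pos 2 * a₀ * c * r₁ + pos 2 * a₁ * c * r₀ + a₁ * c * r₁ - pos 2 * c * e₀ * e₁ - pos 2 * c * e₀ * s₁ - c * e₁ * e₁ - pos 2 * c * e₁ * s₀ - c * e₁ * s₁ + pos 4 * c * r₀ * r₁ + c * r₁ * r₁} {m = l₀} (trans (lem₀ c a₀ a₁ e₀ e₁ r₀ r₁ s₀ s₁) h₀)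
      lem₁ : ∀ c a₀ a₁ e₀ e₁ r₀ r₁ s₀ s₁ → pos 2 * (a₀ * a₀ + a₁ * a₁ + e₁ * e₁ + a₁ * a₁ * c) + pos 4 * (a₀ * a₁ + pos 2 * a₀ * r₀ + a₀ * r₁ + a₁ * r₀ + a₁ * r₁ - e₀ * e₀ - e₀ * e₁ - pos 2 * e₀ * s₀ - e₀ * s₁ - e₁ * e₁ - e₁ * s₀ - e₁ * s₁ + pos 2 * r₀ * r₀ + pos 2 * r₀ * r₁ + r₁ * r₁ + pos 2 * a₁ * c * r₁ - c * e₁ * e₁ - pos 2 * c * e₁ * s₁ + pos 2 * c * r₁ * r₁) ≡
        a₀ * a₁ + a₁ * a₀ + a₁ * a₁ + (pos 2 * ((a₀ + pos 2 * r₀) * (a₀ + pos 2 * r₀) + c * ((a₁ + pos 2 * r₁) * (a₁ + pos 2 * r₁))) + ((a₀ + pos 2 * r₀) * (a₁ + pos 2 * r₁) + (a₁ + pos 2 * r₁) * (a₀ + pos 2 * r₀) + (a₁ + pos 2 * r₁) * (a₁ + pos 2 * r₁))) - pos 2 * (pos 2 * (e₀ * (e₀ + pos 2 * s₀) + c * (e₁ * (e₁ + pos 2 * s₁))) + (e₀ * (e₁ + pos 2 * s₁) + e₁ * (e₀ + pos 2 * s₀) + e₁ * (e₁ + pos 2 * s₁)))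
      lem₁ = solve-∀
      q₁ : Even (a₀ * a₀ + a₁ * a₁ + e₁ * e₁ + a₁ * a₁ * c)
      q₁ = quarter {y = a₀ * a₁ + pos 2 * a₀ * r₀ + a₀ * r₁ + a₁ * r₀ + a₁ * r₁ - e₀ * e₀ - e₀ * e₁ - pos 2 * e₀ * s₀ - e₀ * s₁ - e₁ * e₁ - e₁ * s₀ - e₁ * s₁ + pos 2 * r₀ * r₀ + pos 2 * r₀ * r₁ + r₁ * r₁ + pos 2 * a₁ * c * r₁ - c * e₁ * e₁ - pos 2 * c * e₁ * s₁ + pos 2 * c * r₁ * r₁} {m = l₁} (trans (lem₁ c a₀ a₁ e₀ e₁ r₀ r₁ s₀ s₁) h₁)
      lem₂ : ∀ c a₀ a₁ e₀ e₁ r₀ r₁ s₀ s₁ → pos 2 * (a₀ * a₀ + a₁ * a₁ * c + c * e₁ * e₁) + pos 4 * (a₀ * r₀ + e₀ * s₀ + s₀ * s₀ + a₁ * c * r₁ - c * e₀ * e₁ - pos 2 * c * e₀ * s₁ - c * e₁ * e₁ - pos 2 * c * e₁ * s₀ - c * e₁ * s₁ - pos 4 * c * s₀ * s₁ - c * s₁ * s₁) ≡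
        pos 2 * (a₀ * (a₀ + pos 2 * r₀) + c * (a₁ * (a₁ + pos 2 * r₁))) - (e₀ * e₀ + c * (e₁ * e₁)) - (pos 2 * c * ((e₀ + pos 2 * s₀) * (e₁ + pos 2 * s₁) + (e₁ + pos 2 * s₁) * (e₀ + pos 2 * s₀) + (e₁ + pos 2 * s₁) * (e₁ + pos 2 * s₁)) - ((e₀ + pos 2 * s₀) * (e₀ + pos 2 * s₀) + c * ((e₁ + pos 2 * s₁) * (e₁ + pos 2 * s₁))))
      lem₂ = solve-∀
      q₂ : Even (a₀ * a₀ + a₁ * a₁ * c + c * e₁ * e₁)
      q₂ = quarter {y = a₀ * r₀ + e₀ * s₀ + s₀ * s₀ + a₁ * c * r₁ - c * e₀ * e₁ - pos 2 * c * e₀ * s₁ - c * e₁ * e₁ - pos 2 * c * e₁ * s₀ - c * e₁ * s₁ - pos 4 * c * s₀ * s₁ - c * s₁ * s₁} {m = l₂} (trans (lem₂ c a₀ a₁ e₀ e₁ r₀ r₁ s₀ s₁) h₂)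
      lem₃ : ∀ c a₀ a₁ e₀ e₁ r₀ r₁ s₀ s₁ → pos 2 * (a₁ * a₁ + e₀ * e₀ + e₁ * e₁ + c * e₁ * e₁) + pos 4 * (a₀ * a₁ + a₀ * r₁ + a₁ * r₀ + a₁ * r₁ - e₀ * e₀ - e₀ * e₁ - pos 2 * e₀ * s₀ - e₀ * s₁ - e₁ * e₁ - e₁ * s₀ - e₁ * s₁ - pos 2 * s₀ * s₀ - pos 2 * s₀ * s₁ - s₁ * s₁ - c * e₁ * e₁ - pos 2 * c * e₁ * s₁ - pos 2 * c * s₁ * s₁) ≡
        pos 2 * (a₀ * (a₁ + pos 2 * r₁) + a₁ * (a₀ + pos 2 * r₀) + a₁ * (a₁ + pos 2 * r₁)) - (e₀ * e₁ + e₁ * e₀ + e₁ * e₁) - (pos 2 * ((e₀ + pos 2 * s₀) * (e₀ + pos 2 * s₀) + c * ((e₁ + pos 2 * s₁) * (e₁ + pos 2 * s₁))) + ((e₀ + pos 2 * s₀) * (e₁ + pos 2 * s₁) + (e₁ + pos 2 * s₁) * (e₀ + pos 2 * s₀) + (e₁ + pos 2 * s₁) * (e₁ + pos 2 * s₁)))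
      lem₃ = solve-∀
      q₃ : Even (a₁ * a₁ + e₀ * e₀ + e₁ * e₁ + c * e₁ * e₁)
      q₃ = quarter {y = a₀ * a₁ + a₀ * r₁ + a₁ * r₀ + a₁ * r₁ - e₀ * e₀ - e₀ * e₁ - pos 2 * e₀ * s₀ - e₀ * s₁ - e₁ * e₁ - e₁ * s₀ - e₁ * s₁ - pos 2 * s₀ * s₀ - pos 2 * s₀ * s₁ - s₁ * s₁ - c * e₁ * e₁ - pos 2 * c * e₁ * s₁ - pos 2 * c * s₁ * s₁} {m = l₃} (trans (lem₃ c a₀ a₁ e₀ e₁ r₀ r₁ s₀ s₁) h₃)
      Ea₀ : Even a₀
      Ea₀ = parity-of (c ∷ a₀ ∷ a₁ ∷ e₀ ∷ e₁ ∷ []) (λ c a₀ a₁ e₀ e₁ →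
          (c :- con 1ℤ ∷ e₀ :* e₀ :+ a₁ :* a₁ :* c :+ c :* e₁ :* e₁ ∷ a₀ :* a₀ :+ a₁ :* a₁ :+ e₁ :* e₁ :+ a₁ :* a₁ :* c ∷ a₀ :* a₀ :+ a₁ :* a₁ :* c :+ c :* e₁ :* e₁ ∷ a₁ :* a₁ :+ e₀ :* e₀ :+ e₁ :* e₁ :+ c :* e₁ :* e₁ ∷ []) , a₀) refl (c-1 ∷ q₀ ∷ q₁ ∷ q₂ ∷ q₃ ∷ [])
      Ea₁ : Even a₁
      Ea₁ = parity-of (c ∷ a₀ ∷ a₁ ∷ e₀ ∷ e₁ ∷ []) (λ c a₀ a₁ e₀ e₁ →
          (c :- con 1ℤ ∷ e₀ :* e₀ :+ a₁ :* a₁ :* c :+ c :* e₁ :* e₁ ∷ a₀ :* a₀ :+ a₁ :* a₁ :+ e₁ :* e₁ :+ a₁ :* a₁ :* c ∷ a₀ :* a₀ :+ a₁ :* a₁ :* c :+ c :* e₁ :* e₁ ∷ a₁ :* a₁ :+ e₀ :* e₀ :+ e₁ :* e₁ :+ c :* e₁ :* e₁ ∷ []) , a₁) refl (c-1 ∷ q₀ ∷ q₁ ∷ q₂ ∷ q₃ ∷ [])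
      Ee₀ : Even e₀
      Ee₀ = parity-of (c ∷ a₀ ∷ a₁ ∷ e₀ ∷ e₁ ∷ []) (λ c a₀ a₁ e₀ e₁ →
          (c :- con 1ℤ ∷ e₀ :* e₀ :+ a₁ :* a₁ :* c :+ c :* e₁ :* e₁ ∷ a₀ :* a₀ :+ a₁ :* a₁ :+ e₁ :* e₁ :+ a₁ :* a₁ :* c ∷ a₀ :* a₀ :+ a₁ :* a₁ :* c :+ c :* e₁ :* e₁ ∷ a₁ :* a₁ :+ e₀ :* e₀ :+ e₁ :* e₁ :+ c :* e₁ :* e₁ ∷ []) , e₀) refl (c-1 ∷ q₀ ∷ q₁ ∷ q₂ ∷ q₃ ∷ [])
      Ee₁ : Even e₁
      Ee₁ = parity-of (c ∷ a₀ ∷ a₁ ∷ e₀ ∷ e₁ ∷ []) (λ c a₀ a₁ e₀ e₁ →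
          (c :- con 1ℤ ∷ e₀ :* e₀ :+ a₁ :* a₁ :* c :+ c :* e₁ :* e₁ ∷ a₀ :* a₀ :+ a₁ :* a₁ :+ e₁ :* e₁ :+ a₁ :* a₁ :* c ∷ a₀ :* a₀ :+ a₁ :* a₁ :* c :+ c :* e₁ :* e₁ ∷ a₁ :* a₁ :+ e₀ :* e₀ :+ e₁ :* e₁ :+ c :* e₁ :* e₁ ∷ []) , e₁) refl (c-1 ∷ q₀ ∷ q₁ ∷ q₂ ∷ q₃ ∷ [])

open OddParities

square-abs : ∀ z → z ℤ.* z ≡ pos (ℤ.∣ z ∣ ℕ.* ℤ.∣ z ∣)
square-abs (pos k)  = sym (ℤₚ.pos-* k k)
square-abs -[1+ k ] = refl

definite-form : ∀ n x y → ℤ.∣ x ℤ.* x ℤ.+ pos n ℤ.* (y ℤ.* y) ∣ ℕ.< n → y ≡ 0ℤ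
definite-form n x y h = go ℤ.∣ y ∣ refl
  where
  go : ∀ j → ℤ.∣ y ∣ ≡ j → y ≡ 0ℤ
  go zero    e = ℤₚ.∣i∣≡0⇒i≡0 e
  go (suc k) e = ⊥-elim (ℕₚ.<⇒≱ h (ℕₚ.≤-trans (ℕₚ.≤-trans (ℕₚ.m≤m*n n (suc k ℕ.* suc k)) (ℕₚ.m≤n+m _ (ℤ.∣ x ∣ ℕ.* ℤ.∣ x ∣))) (ℕₚ.≤-reflexive (sym (cong ℤ.∣_∣ form)))))
    where
    form : x ℤ.* x ℤ.+ pos n ℤ.* (y ℤ.* y) ≡ pos (ℤ.∣ x ∣ ℕ.* ℤ.∣ x ∣ ℕ.+ n ℕ.* (suc k ℕ.* suc k))
    form = cong₂ ℤ._+_ (square-abs x) (trans (cong (pos n ℤ.*_) (trans (square-abs y) (cong (λ j → pos (j ℕ.* j)) e))) (sym (ℤₚ.pos-* n (suc k ℕ.* suc k))))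

norm-forces-zero : ∀ n x y → (x ℤ.* x ℤ.+ pos (2 ℕ.+ n) ℤ.* (y ℤ.* y) ≡ 1ℤ) ⊎ (x ℤ.* x ℤ.+ pos (2 ℕ.+ n) ℤ.* (y ℤ.* y) ≡ ℤ.- 1ℤ) → y ≡ 0ℤ
norm-forces-zero n x y h = definite-form (2 ℕ.+ n) x y (subst (ℕ._< 2 ℕ.+ n) (sym (abs h)) (ℕ.s≤s (ℕ.s≤s ℕ.z≤n)))
  where
  abs : _ → ℤ.∣ x ℤ.* x ℤ.+ pos (2 ℕ.+ n) ℤ.* (y ℤ.* y) ∣ ≡ 1
  abs (inj₁ e) = cong ℤ.∣_∣ e
  abs (inj₂ e) = cong ℤ.∣_∣ e

unit-norm : ∀ {a x y} → y ≡ 0ℤ → (x ℤ.* x ℤ.+ a ℤ.* (y ℤ.* y) ≡ 1ℤ) ⊎ (x ℤ.* x ℤ.+ a ℤ.* (y ℤ.* y) ≡ ℤ.- 1ℤ) → x ≡ 1ℤ ⊎ x ≡ ℤ.- 1ℤ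
unit-norm {a} {x} refl (inj₁ e) = unit⇒±1 {x} {x} (trans (lem a x) e)
  where lem : ∀ a x → x ℤ.* x ≡ x ℤ.* x ℤ.+ a ℤ.* (0ℤ ℤ.* 0ℤ)
        lem = solve-∀
unit-norm {a} {x} refl (inj₂ e) = unit⇒±1 {x} {ℤ.- x} (trans (lem a x) (cong ℤ.-_ e))
  where lem : ∀ a x → x ℤ.* (ℤ.- x) ≡ ℤ.- (x ℤ.* x ℤ.+ a ℤ.* (0ℤ ℤ.* 0ℤ))
        lem = solve-∀

-- Modulo 8 the value 8(p² − 5q²) − ((2P)² − 5g²) is 5 as soon as it is odd and 4pq + Pg = 0.
five-obstruction : ∀ p q P g → pos 16 ℤ.* (p ℤ.* q) ℤ.+ pos 2 ℤ.* (pos 2 ℤ.* P ℤ.* g) ≡ 0ℤ → ∀ {x} → x ≡ 1ℤ ⊎ x ≡ ℤ.- 1ℤ →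
  pos 8 ℤ.* (p ℤ.* p ℤ.- pos 5 ℤ.* (q ℤ.* q)) ℤ.- (pos 2 ℤ.* P ℤ.* (pos 2 ℤ.* P) ℤ.- pos 5 ℤ.* (g ℤ.* g)) ≢ x
five-obstruction p q P g y≡0 {x} x≡ e = build g-odd P-even (proj₂ r²+r)
  where
  x-odd : x ≡ 1ℤ ⊎ x ≡ ℤ.- 1ℤ → Odd x
  x-odd (inj₁ refl) = 0ℤ , refl
  x-odd (inj₂ refl) = ℤ.- 1ℤ , refl
  g-odd : Odd g
  g-odd with parity g
  ... | inj₂ o = o
  ... | inj₁ v = ⊥-elim (even-odd (subst Even e (parity-of (p ∷ q ∷ P ∷ g ∷ []) (λ p q P g → (g ∷ []) , (con (pos 8) :* (p :* p :- con (pos 5) :* (q :* q)) :- (con (pos 2) :* P :* (con (pos 2) :* P) :- con (pos 5) :* (g :* g)))) refl (v ∷ []))) (x-odd x≡))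
  lem₁ : ∀ p q P g → pos 4 ℤ.* (P ℤ.* g) ≡ pos 16 ℤ.* (p ℤ.* q) ℤ.+ pos 2 ℤ.* (pos 2 ℤ.* P ℤ.* g) ℤ.+ pos 4 ℤ.* (pos 2 ℤ.* (ℤ.- pos 2 ℤ.* (p ℤ.* q)))
  lem₁ = solve-∀
  Pg-even : Even (P ℤ.* g)
  Pg-even = ℤ.- pos 2 ℤ.* (p ℤ.* q) , ℤₚ.*-cancelˡ-≡ (pos 4) _ _ (trans (lem₁ p q P g) (trans (cong (ℤ._+ pos 4 ℤ.* (pos 2 ℤ.* (ℤ.- pos 2 ℤ.* (p ℤ.* q)))) y≡0) (ℤₚ.+-identityˡ _)))
  P-even : Even P
  P-even with parity P
  ... | inj₁ v = v
  ... | inj₂ o = ⊥-elim (even-odd Pg-even (odd-* o g-odd))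
  r = proj₁ g-odd
  r²+r : Σ ℤ λ r → Even (r ℤ.* r ℤ.+ r)
  r²+r = r , parity-of (r ∷ []) (λ r → [] , (r :* r :+ r)) refl []
  lem₂ : ∀ p q w r → let P = pos 2 ℤ.* w ; g = pos 2 ℤ.* r ℤ.+ 1ℤ in
    pos 8 ℤ.* (p ℤ.* p ℤ.- pos 5 ℤ.* (q ℤ.* q)) ℤ.- (pos 2 ℤ.* P ℤ.* (pos 2 ℤ.* P) ℤ.- pos 5 ℤ.* (g ℤ.* g)) ≡
    pos 5 ℤ.+ pos 4 ℤ.* (pos 2 ℤ.* (p ℤ.* p ℤ.- pos 5 ℤ.* (q ℤ.* q) ℤ.- pos 2 ℤ.* (w ℤ.* w)) ℤ.+ pos 5 ℤ.* (r ℤ.* r ℤ.+ r))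
  lem₂ = solve-∀
  build : Odd g → Even P → Even (r ℤ.* r ℤ.+ r) → ⊥
  build _ (w , P≡) (k , r≡) = contradiction x≡
    where
    z = p ℤ.* p ℤ.- pos 5 ℤ.* (q ℤ.* q) ℤ.- pos 2 ℤ.* (w ℤ.* w) ℤ.+ pos 5 ℤ.* k
    lem₃ : ∀ m k → pos 5 ℤ.+ pos 4 ℤ.* (pos 2 ℤ.* m ℤ.+ pos 5 ℤ.* (pos 2 ℤ.* k)) ≡ pos 5 ℤ.+ pos 8 ℤ.* (m ℤ.+ pos 5 ℤ.* k)
    lem₃ = solve-∀
    x≡5 : x ≡ pos 5 ℤ.+ pos 8 ℤ.* z
    x≡5 = trans (sym e) (trans (cong₂ (λ P g → pos 8 ℤ.* (p ℤ.* p ℤ.- pos 5 ℤ.* (q ℤ.* q)) ℤ.- (pos 2 ℤ.* P ℤ.* (pos 2 ℤ.* P) ℤ.- pos 5 ℤ.* (g ℤ.* g))) P≡ (proj₂ g-odd))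
      (trans (lem₂ p q w r) (trans (cong (λ t → pos 5 ℤ.+ pos 4 ℤ.* (pos 2 ℤ.* (p ℤ.* p ℤ.- pos 5 ℤ.* (q ℤ.* q) ℤ.- pos 2 ℤ.* (w ℤ.* w)) ℤ.+ pos 5 ℤ.* t)) r≡) (lem₃ (p ℤ.* p ℤ.- pos 5 ℤ.* (q ℤ.* q) ℤ.- pos 2 ℤ.* (w ℤ.* w)) k))))
    lem₄ : ∀ z → pos 5 ℤ.+ pos 8 ℤ.* z ≡ 1ℤ ℤ.+ pos 4 ℤ.* (pos 2 ℤ.* z ℤ.+ 1ℤ)
    lem₄ = solve-∀
    lem₅ : ∀ z → pos 5 ℤ.+ pos 8 ℤ.* z ≡ ℤ.- 1ℤ ℤ.+ pos 2 ℤ.* (pos 2 ℤ.* (pos 2 ℤ.* z ℤ.+ 1ℤ) ℤ.+ 1ℤ)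
    lem₅ = solve-∀
    lem₆ : ∀ x m → m ≡ x ℤ.+ m ℤ.- x
    lem₆ = solve-∀
    contradiction : x ≡ 1ℤ ⊎ x ≡ ℤ.- 1ℤ → ⊥
    contradiction (inj₁ refl) = even-odd (0ℤ , ℤₚ.*-cancelˡ-≡ (pos 4) (pos 2 ℤ.* z ℤ.+ 1ℤ) 0ℤ (trans (lem₆ 1ℤ _) (cong (ℤ._- 1ℤ) (trans (sym (lem₄ z)) (sym x≡5))))) (z , refl)
    contradiction (inj₂ refl) = even-odd (0ℤ , ℤₚ.*-cancelˡ-≡ (pos 2) (pos 2 ℤ.* (pos 2 ℤ.* z ℤ.+ 1ℤ) ℤ.+ 1ℤ) 0ℤ (trans (lem₆ (ℤ.- 1ℤ) _) (cong (λ t → t ℤ.- ℤ.- 1ℤ) (trans (sym (lem₅ z)) (sym x≡5))))) (pos 2 ℤ.* z ℤ.+ 1ℤ , refl)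

-- Parities of the coordinates when c is even.

module ChiParities where
  open Data.Integer using (_+_; _*_; _-_; -_)

  open import Data.List.Relation.Unary.All using (All; []; _∷_)
  open import Relation.Nullary using (¬_; yes; no)

  -- With c = 2d: the coordinates of s² − φ y² = 4 p with respect to 1, ω, φ, ω(1+φ)/2.
  ChiEquations : (d k₀ k₁ k₂ k₃ j₀ j₁ j₂ j₃ l₀ l₁ l₂ l₃ : ℤ) → Set
  ChiEquations d k₀ k₁ k₂ k₃ j₀ j₁ j₂ j₃ l₀ l₁ l₂ l₃ =
    pos 2 * j₀ * j₂ + k₀ * k₀ - k₂ * k₂ - pos 4 * d * j₀ * j₃ - pos 8 * d * j₁ * j₂ - pos 2 * d * j₁ * j₃ - pos 4 * d * j₂ * j₃ - d * j₃ * j₃ + pos 2 * d * k₁ * k₁ + pos 2 * d * k₁ * k₃ + pos 4 * d * k₂ * k₃ + d * k₃ * k₃ ≡ pos 4 * l₀ ×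
    pos 2 * j₀ * j₁ - pos 4 * j₀ * j₂ + j₁ * j₁ - pos 2 * j₁ * j₂ + pos 2 * j₂ * j₂ + pos 2 * k₀ * k₁ + k₁ * k₁ - pos 2 * k₁ * k₂ + pos 2 * k₂ * k₂ - pos 4 * d * j₁ * j₃ - d * j₃ * j₃ + d * k₃ * k₃ ≡ pos 4 * l₁ ×
    - (j₀ * j₀) + j₂ * j₂ + pos 2 * k₀ * k₂ - pos 2 * d * j₁ * j₁ - pos 2 * d * j₁ * j₃ - pos 4 * d * j₂ * j₃ - d * j₃ * j₃ + pos 2 * d * k₁ * k₃ + d * k₃ * k₃ ≡ pos 4 * l₂ ×
    - (pos 4 * j₀ * j₁) - pos 2 * j₀ * j₃ - pos 2 * j₁ * j₁ - pos 2 * j₁ * j₃ - pos 4 * j₂ * j₂ - pos 2 * j₂ * j₃ - j₃ * j₃ + pos 2 * k₀ * k₃ + pos 4 * k₁ * k₂ + pos 2 * k₁ * k₃ + pos 2 * k₂ * k₃ + k₃ * k₃ - pos 2 * d * j₃ * j₃ ≡ pos 4 * l₃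

  chi-equations : ∀ d k₀ k₁ k₂ k₃ j₀ j₁ j₂ j₃ {l₀ l₁ l₂ l₃} →
    NormEquations (pos 8) (pos 2 * d) (pos 2 * k₀) (pos 2 * k₁ + k₃) (pos 2 * k₂) k₃ (pos 2 * j₀) (pos 2 * j₁ + j₃) (pos 2 * j₂) j₃ (pos 2 * l₀) (pos 2 * l₁ + l₃) (pos 2 * l₂) l₃ →
    ChiEquations d k₀ k₁ k₂ k₃ j₀ j₁ j₂ j₃ l₀ l₁ l₂ l₃
  chi-equations d k₀ k₁ k₂ k₃ j₀ j₁ j₂ j₃ {l₀} {l₁} {l₂} {l₃} (h₀ , h₁ , h₂ , h₃) =
    ℤₚ.*-cancelˡ-≡ (pos 4) _ (pos 4 * l₀) (trans (lem₀ d k₀ k₁ k₂ k₃ j₀ j₁ j₂ j₃) (trans h₀ (eight l₀))) ,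
    -- The basis element ω(1 + φ)/2 contributes equally to the coordinates of ω and of ωφ, so the
    -- ω-coordinate in the new basis is seen in the difference of these two equations.
    ℤₚ.*-cancelˡ-≡ (pos 4) _ (pos 4 * l₁) (trans (lem₁ d k₀ k₁ k₂ k₃ j₀ j₁ j₂ j₃) (trans (cong₂ _-_ h₁ h₃) (eight′ l₁ l₃))) ,
    ℤₚ.*-cancelˡ-≡ (pos 4) _ (pos 4 * l₂) (trans (lem₂ d k₀ k₁ k₂ k₃ j₀ j₁ j₂ j₃) (trans h₂ (eight l₂))) ,
    ℤₚ.*-cancelˡ-≡ (pos 2) _ (pos 4 * l₃) (trans (lem₃ d k₀ k₁ k₂ k₃ j₀ j₁ j₂ j₃) (trans h₃ (eight″ l₃)))
    where
    eight : ∀ l → pos 8 * (pos 2 * l) ≡ pos 4 * (pos 4 * l)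
    eight = solve-∀
    eight′ : ∀ l m → pos 8 * (pos 2 * l + m) - pos 8 * m ≡ pos 4 * (pos 4 * l)
    eight′ = solve-∀
    eight″ : ∀ l → pos 8 * l ≡ pos 2 * (pos 4 * l)
    eight″ = solve-∀
    lem₀ : ∀ d k₀ k₁ k₂ k₃ j₀ j₁ j₂ j₃ → pos 4 * (pos 2 * j₀ * j₂ + k₀ * k₀ - k₂ * k₂ - pos 4 * d * j₀ * j₃ - pos 8 * d * j₁ * j₂ - pos 2 * d * j₁ * j₃ - pos 4 * d * j₂ * j₃ - d * j₃ * j₃ + pos 2 * d * k₁ * k₁ + pos 2 * d * k₁ * k₃ + pos 4 * d * k₂ * k₃ + d * k₃ * k₃) ≡
      (pos 2 * k₀) * (pos 2 * k₀) + (pos 2 * d) * ((pos 2 * k₁ + k₃) * (pos 2 * k₁ + k₃)) + (pos 2 * (pos 2 * d) * ((pos 2 * k₂) * k₃ + k₃ * (pos 2 * k₂) + k₃ * k₃) - ((pos 2 * k₂) * (pos 2 * k₂) + (pos 2 * d) * (k₃ * k₃))) - pos 2 * (pos 2 * (pos 2 * d) * ((pos 2 * j₀) * j₃ + (pos 2 * j₁ + j₃) * (pos 2 * j₂) + (pos 2 * j₁ + j₃) * j₃) - ((pos 2 * j₀) * (pos 2 * j₂) + (pos 2 * d) * ((pos 2 * j₁ + j₃) * j₃)))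
    lem₀ = solve-∀
    lem₁ : ∀ d k₀ k₁ k₂ k₃ j₀ j₁ j₂ j₃ → pos 4 * (pos 2 * j₀ * j₁ - pos 4 * j₀ * j₂ + j₁ * j₁ - pos 2 * j₁ * j₂ + pos 2 * j₂ * j₂ + pos 2 * k₀ * k₁ + k₁ * k₁ - pos 2 * k₁ * k₂ + pos 2 * k₂ * k₂ - pos 4 * d * j₁ * j₃ - d * j₃ * j₃ + d * k₃ * k₃) ≡
      ((pos 2 * k₀) * (pos 2 * k₁ + k₃) + (pos 2 * k₁ + k₃) * (pos 2 * k₀) + (pos 2 * k₁ + k₃) * (pos 2 * k₁ + k₃) + (pos 2 * ((pos 2 * k₂) * (pos 2 * k₂) + (pos 2 * d) * (k₃ * k₃)) + ((pos 2 * k₂) * k₃ + k₃ * (pos 2 * k₂) + k₃ * k₃)) - pos 2 * (pos 2 * ((pos 2 * j₀) * (pos 2 * j₂) + (pos 2 * d) * ((pos 2 * j₁ + j₃) * j₃)) + ((pos 2 * j₀) * j₃ + (pos 2 * j₁ + j₃) * (pos 2 * j₂) + (pos 2 * j₁ + j₃) * j₃))) - (pos 2 * ((pos 2 * k₀) * k₃ + (pos 2 * k₁ + k₃) * (pos 2 * k₂) + (pos 2 * k₁ + k₃) * k₃) - ((pos 2 * j₀) * (pos 2 * j₁ + j₃) + (pos 2 * j₁ + j₃) * (pos 2 * j₀) + (pos 2 * j₁ + j₃) * (pos 2 * j₁ + j₃)) - (pos 2 * ((pos 2 * j₂) * (pos 2 * j₂) + (pos 2 * d) * (j₃ * j₃))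 + ((pos 2 * j₂) * j₃ + j₃ * (pos 2 * j₂) + j₃ * j₃)))
    lem₁ = solve-∀
    lem₂ : ∀ d k₀ k₁ k₂ k₃ j₀ j₁ j₂ j₃ → pos 4 * (- (j₀ * j₀) + j₂ * j₂ + pos 2 * k₀ * k₂ - pos 2 * d * j₁ * j₁ - pos 2 * d * j₁ * j₃ - pos 4 * d * j₂ * j₃ - d * j₃ * j₃ + pos 2 * d * k₁ * k₃ + d * k₃ * k₃) ≡
      pos 2 * ((pos 2 * k₀) * (pos 2 * k₂) + (pos 2 * d) * ((pos 2 * k₁ + k₃) * k₃)) - ((pos 2 * j₀) * (pos 2 * j₀) + (pos 2 * d) * ((pos 2 * j₁ + j₃) * (pos 2 * j₁ + j₃))) - (pos 2 * (pos 2 * d) * ((pos 2 * j₂) * j₃ + j₃ * (pos 2 * j₂) + j₃ * j₃) - ((pos 2 * j₂) * (pos 2 * j₂) + (pos 2 * d) * (j₃ * j₃)))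
    lem₂ = solve-∀
    lem₃ : ∀ d k₀ k₁ k₂ k₃ j₀ j₁ j₂ j₃ → pos 2 * (- (pos 4 * j₀ * j₁) - pos 2 * j₀ * j₃ - pos 2 * j₁ * j₁ - pos 2 * j₁ * j₃ - pos 4 * j₂ * j₂ - pos 2 * j₂ * j₃ - j₃ * j₃ + pos 2 * k₀ * k₃ + pos 4 * k₁ * k₂ + pos 2 * k₁ * k₃ + pos 2 * k₂ * k₃ + k₃ * k₃ - pos 2 * d * j₃ * j₃) ≡
      pos 2 * ((pos 2 * k₀) * k₃ + (pos 2 * k₁ + k₃) * (pos 2 * k₂) + (pos 2 * k₁ + k₃) * k₃) - ((pos 2 * j₀) * (pos 2 * j₁ + j₃) + (pos 2 * j₁ + j₃) * (pos 2 * j₀) + (pos 2 * j₁ + j₃) * (pos 2 * j₁ + j₃)) - (pos 2 * ((pos 2 * j₂) * (pos 2 * j₂) + (pos 2 * d) * (j₃ * j₃)) + ((pos 2 * j₂) * j₃ + j₃ * (pos 2 * j₂) + j₃ * j₃))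
    lem₃ = solve-∀

  -- The first four fields are the equations modulo 2. The forms F₀ to F₃ are what is left after
  -- these congruences have been substituted and a factor 2 removed.
  record ChiParity (d k₀ k₁ k₂ k₃ j₀ j₁ j₂ j₃ : ℤ) : Set where
    field
      k₀-k₂ : Even (k₀ - k₂)
      k₁-j₁ : Even (k₁ - j₁)
      j₀-j₂ : Even (j₀ - j₂)
      k₃-j₃ : Even (k₃ - j₃)
      F₀    : Even (j₂ * j₂ + d * (j₁ * j₁))
      F₁    : Even (j₁ * j₁ + j₂ * j₂ + k₂ * k₂)
      F₂    : Even (k₂ * k₂ + d * (j₁ * j₁))
      F₃    : Even (j₁ * j₁ + d * (j₃ * j₃))

  chi-parity : ∀ {d k₀ k₁ k₂ k₃ j₀ j₁ j₂ j₃ l₀ l₁ l₂ l₃} → ChiEquations d k₀ k₁ k₂ k₃ j₀ j₁ j₂ j₃ l₀ l₁ l₂ l₃ → ChiParity d k₀ k₁ k₂ k₃ j₀ j₁ j₂ j₃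
  chi-parity {d} {k₀} {k₁} {k₂} {k₃} {j₀} {j₁} {j₂} {j₃} {l₀} {l₁} {l₂} {l₃} (h₀ , h₁ , h₂ , h₃) =
    build (even-difference k₀ k₂ k₀-k₂) (even-difference k₁ j₁ k₁-j₁) (even-difference j₀ j₂ j₀-j₂) (even-difference k₃ j₃ k₃-j₃)
    where
    k₃-j₃ : Even (k₃ - j₃)
    k₃-j₃ = parity-of (d ∷ k₀ ∷ k₁ ∷ k₂ ∷ k₃ ∷ j₀ ∷ j₁ ∷ j₂ ∷ j₃ ∷ []) (λ d k₀ k₁ k₂ k₃ j₀ j₁ j₂ j₃ →
      (:- (con (pos 4) :* j₀ :* j₁) :- con (pos 2) :* j₀ :* j₃ :- con (pos 2) :* j₁ :* j₁ :- con (pos 2) :* j₁ :* j₃ :- con (pos 4) :* j₂ :* j₂ :- con (pos 2) :* j₂ :* j₃ :- j₃ :* j₃ :+ con (pos 2) :* k₀ :* k₃ :+ con (pos 4) :* k₁ :* k₂ :+ con (pos 2) :* k₁ :* k₃ :+ con (pos 2) :* k₂ :* k₃ :+ k₃ :* k₃ :- con (pos 2) :* d :* j₃ :* j₃ ∷ []) , (k₃ :- j₃)) refl (four⇒even h₃ ∷ [])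
    k₀-k₂ : Even (k₀ - k₂)
    k₀-k₂ = parity-of (d ∷ k₀ ∷ k₁ ∷ k₂ ∷ k₃ ∷ j₀ ∷ j₁ ∷ j₂ ∷ j₃ ∷ []) (λ d k₀ k₁ k₂ k₃ j₀ j₁ j₂ j₃ →
      (k₃ :- j₃ ∷ con (pos 2) :* j₀ :* j₂ :+ k₀ :* k₀ :- k₂ :* k₂ :- con (pos 4) :* d :* j₀ :* j₃ :- con (pos 8) :* d :* j₁ :* j₂ :- con (pos 2) :* d :* j₁ :* j₃ :- con (pos 4) :* d :* j₂ :* j₃ :- d :* j₃ :* j₃ :+ con (pos 2) :* d :* k₁ :* k₁ :+ con (pos 2) :* d :* k₁ :* k₃ :+ con (pos 4) :* d :* k₂ :* k₃ :+ d :* k₃ :* k₃ ∷ []) , (k₀ :- k₂)) refl (k₃-j₃ ∷ four⇒even h₀ ∷ [])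
    k₁-j₁ : Even (k₁ - j₁)
    k₁-j₁ = parity-of (d ∷ k₀ ∷ k₁ ∷ k₂ ∷ k₃ ∷ j₀ ∷ j₁ ∷ j₂ ∷ j₃ ∷ []) (λ d k₀ k₁ k₂ k₃ j₀ j₁ j₂ j₃ →
      (k₃ :- j₃ ∷ con (pos 2) :* j₀ :* j₁ :- con (pos 4) :* j₀ :* j₂ :+ j₁ :* j₁ :- con (pos 2) :* j₁ :* j₂ :+ con (pos 2) :* j₂ :* j₂ :+ con (pos 2) :* k₀ :* k₁ :+ k₁ :* k₁ :- con (pos 2) :* k₁ :* k₂ :+ con (pos 2) :* k₂ :* k₂ :- con (pos 4) :* d :* j₁ :* j₃ :- d :* j₃ :* j₃ :+ d :* k₃ :* k₃ ∷ []) , (k₁ :- j₁)) refl (k₃-j₃ ∷ four⇒even h₁ ∷ [])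
    j₀-j₂ : Even (j₀ - j₂)
    j₀-j₂ = parity-of (d ∷ k₀ ∷ k₁ ∷ k₂ ∷ k₃ ∷ j₀ ∷ j₁ ∷ j₂ ∷ j₃ ∷ []) (λ d k₀ k₁ k₂ k₃ j₀ j₁ j₂ j₃ →
      (k₃ :- j₃ ∷ :- (j₀ :* j₀) :+ j₂ :* j₂ :+ con (pos 2) :* k₀ :* k₂ :- con (pos 2) :* d :* j₁ :* j₁ :- con (pos 2) :* d :* j₁ :* j₃ :- con (pos 4) :* d :* j₂ :* j₃ :- d :* j₃ :* j₃ :+ con (pos 2) :* d :* k₁ :* k₃ :+ d :* k₃ :* k₃ ∷ []) , (j₀ :- j₂)) refl (k₃-j₃ ∷ four⇒even h₂ ∷ [])
    build : (∃ λ r → k₀ ≡ k₂ + pos 2 * r) → (∃ λ r → k₁ ≡ j₁ + pos 2 * r) → (∃ λ r → j₀ ≡ j₂ + pos 2 * r) → (∃ λ r → k₃ ≡ j₃ + pos 2 * r) → ChiParity d k₀ k₁ k₂ k₃ j₀ j₁ j₂ j₃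
    build (r₀ , refl) (r₁ , refl) (r₃ , refl) (r₂ , refl) = record { k₀-k₂ = k₀-k₂ ; k₁-j₁ = k₁-j₁ ; j₀-j₂ = j₀-j₂ ; k₃-j₃ = k₃-j₃ ; F₀ = q₀ ; F₁ = q₁ ; F₂ = q₂ ; F₃ = q₃ }
      where
      lem₀ : ∀ d j₁ j₂ j₃ k₂ r₀ r₁ r₂ r₃ → pos 2 * (j₂ * j₂ + d * (j₁ * j₁)) + pos 4 * (j₂ * r₃ + k₂ * r₀ + r₀ * r₀ - pos 2 * d * j₁ * j₂ + pos 2 * d * j₁ * r₁ + d * j₁ * r₂ - pos 2 * d * j₂ * j₃ + d * j₃ * k₂ + d * j₃ * r₁ + d * j₃ * r₂ - pos 2 * d * j₃ * r₃ + pos 2 * d * k₂ * r₂ + pos 2 * d * r₁ * r₁ + pos 2 * d * r₁ * r₂ + d * r₂ * r₂) ≡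
        pos 2 * (j₂ + pos 2 * r₃) * j₂ + (k₂ + pos 2 * r₀) * (k₂ + pos 2 * r₀) - k₂ * k₂ - pos 4 * d * (j₂ + pos 2 * r₃) * j₃ - pos 8 * d * j₁ * j₂ - pos 2 * d * j₁ * j₃ - pos 4 * d * j₂ * j₃ - d * j₃ * j₃ + pos 2 * d * (j₁ + pos 2 * r₁) * (j₁ + pos 2 * r₁) + pos 2 * d * (j₁ + pos 2 * r₁) * (j₃ + pos 2 * r₂) + pos 4 * d * k₂ * (j₃ + pos 2 * r₂) + d * (j₃ + pos 2 * r₂) * (j₃ + pos 2 * r₂)
      lem₀ = solve-∀
      q₀ : Even (j₂ * j₂ + d * (j₁ * j₁))
      q₀ = quarter {y = j₂ * r₃ + k₂ * r₀ + r₀ * r₀ - pos 2 * d * j₁ * j₂ + pos 2 * d * j₁ * r₁ + d * j₁ * r₂ - pos 2 * d * j₂ * j₃ + d * j₃ * k₂ + d * j₃ * r₁ + d * j₃ * r₂ - pos 2 * d * j₃ * r₃ + pos 2 * d * k₂ * r₂ + pos 2 * d * r₁ * r₁ + pos 2 * d * r₁ * r₂ + d * r₂ * r₂} {m = l₀} (trans (lem₀ d j₁ j₂ j₃ k₂ r₀ r₁ r₂ r₃) h₀)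
      lem₁ : ∀ d j₁ j₂ j₃ k₂ r₀ r₁ r₂ r₃ → pos 2 * (j₁ * j₁ + j₂ * j₂ + k₂ * k₂) + pos 4 * (j₁ * r₀ + j₁ * r₁ + j₁ * r₃ - j₂ * j₂ - pos 2 * j₂ * r₃ + pos 2 * r₀ * r₁ + r₁ * r₁ - d * j₁ * j₃ + d * j₃ * r₂ + d * r₂ * r₂) ≡
        pos 2 * (j₂ + pos 2 * r₃) * j₁ - pos 4 * (j₂ + pos 2 * r₃) * j₂ + j₁ * j₁ - pos 2 * j₁ * j₂ + pos 2 * j₂ * j₂ + pos 2 * (k₂ + pos 2 * r₀) * (j₁ + pos 2 * r₁) + (j₁ + pos 2 * r₁) * (j₁ + pos 2 * r₁) - pos 2 * (j₁ + pos 2 * r₁) * k₂ + pos 2 * k₂ * k₂ - pos 4 * d * j₁ * j₃ - d * j₃ * j₃ + d * (j₃ + pos 2 * r₂) * (j₃ + pos 2 * r₂)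
      lem₁ = solve-∀
      q₁ : Even (j₁ * j₁ + j₂ * j₂ + k₂ * k₂)
      q₁ = quarter {y = j₁ * r₀ + j₁ * r₁ + j₁ * r₃ - j₂ * j₂ - pos 2 * j₂ * r₃ + pos 2 * r₀ * r₁ + r₁ * r₁ - d * j₁ * j₃ + d * j₃ * r₂ + d * r₂ * r₂} {m = l₁} (trans (lem₁ d j₁ j₂ j₃ k₂ r₀ r₁ r₂ r₃) h₁)
      lem₂ : ∀ d j₁ j₂ j₃ k₂ r₀ r₁ r₂ r₃ → pos 2 * (k₂ * k₂ + d * (j₁ * j₁)) + pos 4 * (- (j₂ * r₃) + k₂ * r₀ - r₃ * r₃ - d * j₁ * j₁ + d * j₁ * r₂ - d * j₂ * j₃ + d * j₃ * r₁ + d * j₃ * r₂ + pos 2 * d * r₁ * r₂ + d * r₂ * r₂) ≡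
        - ((j₂ + pos 2 * r₃) * (j₂ + pos 2 * r₃)) + j₂ * j₂ + pos 2 * (k₂ + pos 2 * r₀) * k₂ - pos 2 * d * j₁ * j₁ - pos 2 * d * j₁ * j₃ - pos 4 * d * j₂ * j₃ - d * j₃ * j₃ + pos 2 * d * (j₁ + pos 2 * r₁) * (j₃ + pos 2 * r₂) + d * (j₃ + pos 2 * r₂) * (j₃ + pos 2 * r₂)
      lem₂ = solve-∀
      q₂ : Even (k₂ * k₂ + d * (j₁ * j₁))
      q₂ = quarter {y = - (j₂ * r₃) + k₂ * r₀ - r₃ * r₃ - d * j₁ * j₁ + d * j₁ * r₂ - d * j₂ * j₃ + d * j₃ * r₁ + d * j₃ * r₂ + pos 2 * d * r₁ * r₂ + d * r₂ * r₂} {m = l₂} (trans (lem₂ d j₁ j₂ j₃ k₂ r₀ r₁ r₂ r₃) h₂)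
      lem₃ : ∀ d j₁ j₂ j₃ k₂ r₀ r₁ r₂ r₃ → pos 2 * (j₁ * j₁ + d * (j₃ * j₃)) + pos 4 * (- (j₁ * j₁) - j₁ * j₂ + j₁ * k₂ + j₁ * r₂ - pos 2 * j₁ * r₃ - j₂ * j₂ - j₂ * j₃ + j₃ * k₂ + j₃ * r₀ + j₃ * r₁ + j₃ * r₂ - j₃ * r₃ + pos 2 * k₂ * r₁ + pos 2 * k₂ * r₂ + pos 2 * r₀ * r₂ + pos 2 * r₁ * r₂ + r₂ * r₂ - d * j₃ * j₃) ≡
        - (pos 4 * (j₂ + pos 2 * r₃) * j₁) - pos 2 * (j₂ + pos 2 * r₃) * j₃ - pos 2 * j₁ * j₁ - pos 2 * j₁ * j₃ - pos 4 * j₂ * j₂ - pos 2 * j₂ * j₃ - j₃ * j₃ + pos 2 * (k₂ + pos 2 * r₀) * (j₃ + pos 2 * r₂) + pos 4 * (j₁ + pos 2 * r₁) * k₂ + pos 2 * (j₁ + pos 2 * r₁) * (j₃ + pos 2 * r₂) + pos 2 * k₂ * (j₃ + pos 2 * r₂) + (j₃ + pos 2 * r₂) * (j₃ + pos 2 * r₂) - pos 2 * d * j₃ * j₃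
      lem₃ = solve-∀
      q₃ : Even (j₁ * j₁ + d * (j₃ * j₃))
      q₃ = quarter {y = - (j₁ * j₁) - j₁ * j₂ + j₁ * k₂ + j₁ * r₂ - pos 2 * j₁ * r₃ - j₂ * j₂ - j₂ * j₃ + j₃ * k₂ + j₃ * r₀ + j₃ * r₁ + j₃ * r₂ - j₃ * r₃ + pos 2 * k₂ * r₁ + pos 2 * k₂ * r₂ + pos 2 * r₀ * r₂ + pos 2 * r₁ * r₂ + r₂ * r₂ - d * j₃ * j₃} {m = l₃} (trans (lem₃ d j₁ j₂ j₃ k₂ r₀ r₁ r₂ r₃) h₃)

  module ParityConsequences {d k₀ k₁ k₂ k₃ j₀ j₁ j₂ j₃ : ℤ} (parities : ChiParity d k₀ k₁ k₂ k₃ j₀ j₁ j₂ j₃) where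
    open ChiParity parities

    -- For odd d the four forms read j₂ + j₁, j₁ + j₂ + k₂, k₂ + j₁ and j₁ + j₃ over 𝔽₂, which
    -- leaves only zero.
    all-even : Odd d → Even j₀ × Even j₁ × Even j₂ × Even j₃
    all-even (m , d≡) = E₀ , E₁ , E₂ , E₃
      where
      d-1 : Even (d - 1ℤ)
      d-1 = m , trans (cong (_- 1ℤ) d≡) (lem m)
        where lem : ∀ m → pos 2 * m + 1ℤ - 1ℤ ≡ pos 2 * m
              lem = solve-∀
      E₁ : Even j₁
      E₁ = parity-of (d ∷ j₁ ∷ j₂ ∷ j₃ ∷ k₂ ∷ []) (λ d j₁ j₂ j₃ k₂ →
        (d :- con 1ℤ ∷ j₂ :* j₂ :+ d :* (j₁ :* j₁) ∷ j₁ :* j₁ :+ j₂ :* j₂ :+ k₂ :* k₂ ∷ k₂ :* k₂ :+ d :* (j₁ :* j₁) ∷ j₁ :* j₁ :+ d :* (j₃ :* j₃) ∷ []) , (j₁)) refl (d-1 ∷ F₀ ∷ F₁ ∷ F₂ ∷ F₃ ∷ [])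
      E₂ : Even j₂
      E₂ = parity-of (d ∷ j₁ ∷ j₂ ∷ j₃ ∷ k₂ ∷ []) (λ d j₁ j₂ j₃ k₂ →
        (d :- con 1ℤ ∷ j₂ :* j₂ :+ d :* (j₁ :* j₁) ∷ j₁ :* j₁ :+ j₂ :* j₂ :+ k₂ :* k₂ ∷ k₂ :* k₂ :+ d :* (j₁ :* j₁) ∷ j₁ :* j₁ :+ d :* (j₃ :* j₃) ∷ []) , (j₂)) refl (d-1 ∷ F₀ ∷ F₁ ∷ F₂ ∷ F₃ ∷ [])
      E₃ : Even j₃
      E₃ = parity-of (d ∷ j₁ ∷ j₂ ∷ j₃ ∷ k₂ ∷ []) (λ d j₁ j₂ j₃ k₂ →
        (d :- con 1ℤ ∷ j₂ :* j₂ :+ d :* (j₁ :* j₁) ∷ j₁ :* j₁ :+ j₂ :* j₂ :+ k₂ :* k₂ ∷ k₂ :* k₂ :+ d :* (j₁ :* j₁) ∷ j₁ :* j₁ :+ d :* (j₃ :* j₃) ∷ []) , (j₃)) refl (d-1 ∷ F₀ ∷ F₁ ∷ F₂ ∷ F₃ ∷ [])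
      E₀ : Even j₀
      E₀ = parity-of (j₀ ∷ j₂ ∷ []) (λ j₀ j₂ → (j₀ :- j₂ ∷ j₂ ∷ []) , j₀) refl (j₀-j₂ ∷ E₂ ∷ [])

    -- For even d the forms say nothing about k₃ and j₃. Those two come out odd later, from the
    -- roots of q modulo 2.
    module _ (d-even : Even d) where
      e-j₁ : Even j₁
      e-j₁ = parity-of (d ∷ j₁ ∷ j₃ ∷ []) (λ d j₁ j₃ →
        (d ∷ j₁ :* j₁ :+ d :* (j₃ :* j₃) ∷ []) , (j₁)) refl (d-even ∷ F₃ ∷ [])
      e-j₂ : Even j₂
      e-j₂ = parity-of (d ∷ j₁ ∷ j₂ ∷ []) (λ d j₁ j₂ →
        (d ∷ j₂ :* j₂ :+ d :* (j₁ :* j₁) ∷ []) , (j₂)) refl (d-even ∷ F₀ ∷ [])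
      e-k₂ : Even k₂
      e-k₂ = parity-of (d ∷ j₁ ∷ k₂ ∷ []) (λ d j₁ k₂ →
        (d ∷ k₂ :* k₂ :+ d :* (j₁ :* j₁) ∷ []) , (k₂)) refl (d-even ∷ F₂ ∷ [])
      e-j₀ : Even j₀
      e-j₀ = parity-of (j₀ ∷ j₂ ∷ []) (λ j₀ j₂ → (j₀ :- j₂ ∷ j₂ ∷ []) , j₀) refl (j₀-j₂ ∷ e-j₂ ∷ [])
      e-k₀ : Even k₀
      e-k₀ = parity-of (k₀ ∷ k₂ ∷ []) (λ j₀ j₂ → (j₀ :- j₂ ∷ j₂ ∷ []) , j₀) refl (k₀-k₂ ∷ e-k₂ ∷ [])
      e-k₁ : Even k₁
      e-k₁ = parity-of (k₁ ∷ j₁ ∷ []) (λ j₀ j₂ → (j₀ :- j₂ ∷ j₂ ∷ []) , j₀) refl (k₁-j₁ ∷ e-j₁ ∷ [])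

  -- Modulo 8, with d divisible by 4, the ring homomorphism sending ω, φ and χ to 1 makes 4 p a difference of two odd squares.
  trace-even : ∀ n {k₀ k₁ k₂ k₃ j₀ j₁ j₂ j₃ l₀ l₁ l₂ l₃} → (Even k₀ × Even k₁ × Even k₂ × Odd k₃) × (Even j₀ × Even j₁ × Even j₂ × Odd j₃) →
    ChiEquations (pos 4 * n) k₀ k₁ k₂ k₃ j₀ j₁ j₂ j₃ l₀ l₁ l₂ l₃ → Even (l₀ + l₁ + l₂ + l₃)
  trace-even n {l₀ = l₀} {l₁} {l₂} {l₃} (((κ₀ , refl) , (κ₁ , refl) , (κ₂ , refl) , (κ₃ , refl)) , ((μ₀ , refl) , (μ₁ , refl) , (μ₂ , refl) , (μ₃ , refl))) (h₀ , h₁ , h₂ , h₃) =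
    subst Even value (parity-of (κ₀ ∷ κ₁ ∷ κ₂ ∷ κ₃ ∷ μ₀ ∷ μ₁ ∷ μ₂ ∷ μ₃ ∷ G ∷ []) (λ κ₀ κ₁ κ₂ κ₃ μ₀ μ₁ μ₂ μ₃ G → [] , ((κ₀ :* κ₀ :+ κ₀) :+ (κ₁ :* κ₁ :+ κ₁) :+ (κ₂ :* κ₂ :+ κ₂) :+ (κ₃ :* κ₃ :+ κ₃) :+ (μ₀ :* μ₀ :+ μ₀) :+ (μ₁ :* μ₁ :+ μ₁) :+ (μ₂ :* μ₂ :+ μ₂) :+ (μ₃ :* μ₃ :+ μ₃) :+ con (pos 2) :* G)) refl [])
    where
    G : ℤ
    G = - (n) - μ₀ - μ₁ - μ₂ - μ₃ + pos 4 * n * κ₁ + pos 4 * n * κ₂ + pos 6 * n * κ₃ - pos 4 * n * μ₀ - pos 8 * n * μ₁ - pos 8 * n * μ₂ - pos 10 * n * μ₃ + κ₀ * κ₁ + κ₀ * κ₂ + κ₀ * κ₃ + κ₁ * κ₂ + κ₁ * κ₃ + κ₂ * κ₃ - μ₀ * μ₀ - μ₀ * μ₁ - μ₀ * μ₂ - μ₀ * μ₃ - μ₁ * μ₁ - μ₁ * μ₂ - μ₁ * μ₃ - μ₂ * μ₂ - μ₂ * μ₃ - μ₃ * μ₃ + pos 4 * n * κ₁ * κ₁ + pos 8 * n * κ₁ * κ₃ + pos 8 * n * κ₂ * κ₃ + pos 6 * n * κ₃ * κ₃ - pos 8 * n * μ₀ * μ₃ - pos 4 * n * μ₁ * μ₁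 - pos 16 * n * μ₁ * μ₂ - pos 16 * n * μ₁ * μ₃ - pos 16 * n * μ₂ * μ₃ - pos 10 * n * μ₃ * μ₃
    lem : ∀ n κ₀ κ₁ κ₂ κ₃ μ₀ μ₁ μ₂ μ₃ → pos 4 * ((κ₀ * κ₀ + κ₀) + (κ₁ * κ₁ + κ₁) + (κ₂ * κ₂ + κ₂) + (κ₃ * κ₃ + κ₃) + (μ₀ * μ₀ + μ₀) + (μ₁ * μ₁ + μ₁) + (μ₂ * μ₂ + μ₂) + (μ₃ * μ₃ + μ₃) + pos 2 * (- (n) - μ₀ - μ₁ - μ₂ - μ₃ + pos 4 * n * κ₁ + pos 4 * n * κ₂ + pos 6 * n * κ₃ - pos 4 * n * μ₀ - pos 8 * n * μ₁ - pos 8 * n * μ₂ - pos 10 * n * μ₃ + κ₀ * κ₁ + κ₀ * κ₂ + κ₀ * κ₃ + κ₁ * κ₂ + κ₁ * κ₃ + κ₂ * κ₃ - μ₀ * μ₀ - μ₀ * μ₁ - μ₀ * μ₂ - μ₀ * μ₃ - μ₁ * μ₁ - μ₁ * μ₂ - μ₁ * μ₃ - μ₂ * μ₂ - μ₂ * μ₃ - μ₃ * μ₃ + pos 4 * n * κ₁ * κ₁ + pos 8 * n * κ₁ * κ₃ + pos 8 * n * κ₂ * κ₃ + pos 6 * n * κ₃ * κ₃ - pos 8 * n * μ₀ * μ₃ - pos 4 * n * μ₁ * μ₁ - pos 16 * n * μ₁ * μ₂ - pos 16 * n * μ₁ * μ₃ - pos 16 * n * μ₂ * μ₃ - pos 10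 * n * μ₃ * μ₃)) ≡
      (pos 2 * (pos 2 * μ₀) * (pos 2 * μ₂) + (pos 2 * κ₀) * (pos 2 * κ₀) - (pos 2 * κ₂) * (pos 2 * κ₂) - pos 4 * (pos 4 * n) * (pos 2 * μ₀) * (pos 2 * μ₃ + 1ℤ) - pos 8 * (pos 4 * n) * (pos 2 * μ₁) * (pos 2 * μ₂) - pos 2 * (pos 4 * n) * (pos 2 * μ₁) * (pos 2 * μ₃ + 1ℤ) - pos 4 * (pos 4 * n) * (pos 2 * μ₂) * (pos 2 * μ₃ + 1ℤ) - (pos 4 * n) * (pos 2 * μ₃ + 1ℤ) * (pos 2 * μ₃ + 1ℤ) + pos 2 * (pos 4 * n) * (pos 2 * κ₁) * (pos 2 * κ₁) + pos 2 * (pos 4 * n) * (pos 2 * κ₁) * (pos 2 * κ₃ + 1ℤ) + pos 4 * (pos 4 * n) * (pos 2 * κ₂) * (pos 2 * κ₃ + 1ℤ) + (pos 4 * n) * (pos 2 * κ₃ + 1ℤ) * (pos 2 * κ₃ + 1ℤ)) + (pos 2 * (pos 2 * μ₀) * (pos 2 * μ₁) - pos 4 * (pos 2 * μ₀) * (pos 2 * μ₂) + (pos 2 * μ₁) * (pos 2 * μ₁) - pos 2 * (pos 2 * μ₁) * (pos 2 * μ₂) + pos 2 * (pos 2 * μ₂) * (pos 2 * μ₂) + pos 2 * (pos 2 * κ₀) * (pos 2 * κ₁) + (pos 2 * κ₁) * (pos 2 * κ₁) - pos 2 * (pos 2 * κ₁) * (pos 2 * κ₂) + pos 2 * (pos 2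 * κ₂) * (pos 2 * κ₂) - pos 4 * (pos 4 * n) * (pos 2 * μ₁) * (pos 2 * μ₃ + 1ℤ) - (pos 4 * n) * (pos 2 * μ₃ + 1ℤ) * (pos 2 * μ₃ + 1ℤ) + (pos 4 * n) * (pos 2 * κ₃ + 1ℤ) * (pos 2 * κ₃ + 1ℤ)) + (- ((pos 2 * μ₀) * (pos 2 * μ₀)) + (pos 2 * μ₂) * (pos 2 * μ₂) + pos 2 * (pos 2 * κ₀) * (pos 2 * κ₂) - pos 2 * (pos 4 * n) * (pos 2 * μ₁) * (pos 2 * μ₁) - pos 2 * (pos 4 * n) * (pos 2 * μ₁) * (pos 2 * μ₃ + 1ℤ) - pos 4 * (pos 4 * n) * (pos 2 * μ₂) * (pos 2 * μ₃ + 1ℤ) - (pos 4 * n) * (pos 2 * μ₃ + 1ℤ) * (pos 2 * μ₃ + 1ℤ) + pos 2 * (pos 4 * n) * (pos 2 * κ₁) * (pos 2 * κ₃ + 1ℤ) + (pos 4 * n) * (pos 2 * κ₃ + 1ℤ) * (pos 2 * κ₃ + 1ℤ)) + (- (pos 4 * (pos 2 * μ₀) * (pos 2 * μ₁)) - pos 2 * (pos 2 * μ₀) * (pos 2 * μ₃ + 1ℤ) - pos 2 * (pos 2 * μ₁) * (pos 2 * μ₁) - pos 2 * (pos 2 * μ₁) * (pos 2 * μ₃ + 1ℤ) - pos 4 * (pos 2 * μ₂) * (pos 2 * μ₂) - pos 2 * (pos 2 * μ₂) * (pos 2 * μ₃ + 1ℤ) - (pos 2 * μ₃ + 1ℤ)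 * (pos 2 * μ₃ + 1ℤ) + pos 2 * (pos 2 * κ₀) * (pos 2 * κ₃ + 1ℤ) + pos 4 * (pos 2 * κ₁) * (pos 2 * κ₂) + pos 2 * (pos 2 * κ₁) * (pos 2 * κ₃ + 1ℤ) + pos 2 * (pos 2 * κ₂) * (pos 2 * κ₃ + 1ℤ) + (pos 2 * κ₃ + 1ℤ) * (pos 2 * κ₃ + 1ℤ) - pos 2 * (pos 4 * n) * (pos 2 * μ₃ + 1ℤ) * (pos 2 * μ₃ + 1ℤ))
    lem = solve-∀
    lem₂ : ∀ l₀ l₁ l₂ l₃ → pos 4 * l₀ + pos 4 * l₁ + pos 4 * l₂ + pos 4 * l₃ ≡ pos 4 * (l₀ + l₁ + l₂ + l₃)
    lem₂ = solve-∀
    value : (κ₀ * κ₀ + κ₀) + (κ₁ * κ₁ + κ₁) + (κ₂ * κ₂ + κ₂) + (κ₃ * κ₃ + κ₃) + (μ₀ * μ₀ + μ₀) + (μ₁ * μ₁ + μ₁) + (μ₂ * μ₂ + μ₂) + (μ₃ * μ₃ + μ₃) + pos 2 * G ≡ l₀ + l₁ + l₂ + l₃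
    value = ℤₚ.*-cancelˡ-≡ (pos 4) _ (l₀ + l₁ + l₂ + l₃) (trans (lem n κ₀ κ₁ κ₂ κ₃ μ₀ μ₁ μ₂ μ₃) (trans (cong₂ _+_ (cong₂ _+_ (cong₂ _+_ h₀ h₁) h₂) h₃) (lem₂ l₀ l₁ l₂ l₃)))

  -- In the φ-equation every term is divisible by 4 under these parities, and modulo 2 the quotient
  -- is μ₀² + μ₂². The lemma links the parity of l₂ to the coordinates of 2B.
  l₂-parity : ∀ n {k₀ k₁ k₂ k₃ j₀ j₁ j₂ j₃ l₀ l₁ l₂ l₃} → (Even k₀ × Even k₁ × Even k₂ × Odd k₃) × (Even j₀ × Even j₁ × Even j₂ × Odd j₃) → ∀ {μ₀ μ₂} → j₀ ≡ pos 2 * μ₀ → j₂ ≡ pos 2 * μ₂ →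
    ChiEquations (pos 4 * n + pos 2) k₀ k₁ k₂ k₃ j₀ j₁ j₂ j₃ l₀ l₁ l₂ l₃ → Even l₂ → Even (μ₀ + μ₂)
  l₂-parity n {l₀ = l₀} {l₁} {l₂} {l₃} (((κ₀ , refl) , (κ₁ , refl) , (κ₂ , refl) , (κ₃ , refl)) , (_ , (μ₁ , refl) , _ , (μ₃ , refl))) {μ₀} {μ₂} refl refl (h₀ , h₁ , h₂ , h₃) e =
    parity-of (μ₀ ∷ μ₂ ∷ G ∷ []) (λ μ₀ μ₂ G → (μ₀ :* μ₀ :+ μ₂ :* μ₂ :+ con (pos 2) :* G ∷ []) , (μ₀ :+ μ₂)) refl (subst Even (sym value) e ∷ [])
    where
    G : ℤ
    G = κ₁ + κ₃ - μ₁ - pos 2 * μ₂ - μ₃ + pos 2 * n * κ₁ + pos 2 * n * κ₃ - pos 2 * n * μ₁ - pos 4 * n * μ₂ - pos 2 * n * μ₃ + κ₀ * κ₂ + pos 2 * κ₁ * κ₃ + κ₃ * κ₃ - μ₀ * μ₀ - pos 2 * μ₁ * μ₁ - pos 2 * μ₁ * μ₃ - pos 4 * μ₂ * μ₃ - μ₃ * μ₃ + pos 4 * n * κ₁ * κ₃ + pos 2 * n * κ₃ * κ₃ - pos 4 * n * μ₁ * μ₁ - pos 4 * n * μ₁ * μ₃ - pos 8 * n * μ₂ * μ₃ - pos 2 * n * μ₃ * μ₃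
    lem : ∀ n κ₀ κ₁ κ₂ κ₃ μ₀ μ₁ μ₂ μ₃ → pos 4 * (μ₀ * μ₀ + μ₂ * μ₂ + pos 2 * (κ₁ + κ₃ - μ₁ - pos 2 * μ₂ - μ₃ + pos 2 * n * κ₁ + pos 2 * n * κ₃ - pos 2 * n * μ₁ - pos 4 * n * μ₂ - pos 2 * n * μ₃ + κ₀ * κ₂ + pos 2 * κ₁ * κ₃ + κ₃ * κ₃ - μ₀ * μ₀ - pos 2 * μ₁ * μ₁ - pos 2 * μ₁ * μ₃ - pos 4 * μ₂ * μ₃ - μ₃ * μ₃ + pos 4 * n * κ₁ * κ₃ + pos 2 * n * κ₃ * κ₃ - pos 4 * n * μ₁ * μ₁ - pos 4 * n * μ₁ * μ₃ - pos 8 * n * μ₂ * μ₃ - pos 2 * n * μ₃ * μ₃)) ≡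
      - ((pos 2 * μ₀) * (pos 2 * μ₀)) + (pos 2 * μ₂) * (pos 2 * μ₂) + pos 2 * (pos 2 * κ₀) * (pos 2 * κ₂) - pos 2 * (pos 4 * n + pos 2) * (pos 2 * μ₁) * (pos 2 * μ₁) - pos 2 * (pos 4 * n + pos 2) * (pos 2 * μ₁) * (pos 2 * μ₃ + 1ℤ) - pos 4 * (pos 4 * n + pos 2) * (pos 2 * μ₂) * (pos 2 * μ₃ + 1ℤ) - (pos 4 * n + pos 2) * (pos 2 * μ₃ + 1ℤ) * (pos 2 * μ₃ + 1ℤ) + pos 2 * (pos 4 * n + pos 2) * (pos 2 * κ₁) * (pos 2 * κ₃ + 1ℤ) + (pos 4 * n + pos 2) * (pos 2 * κ₃ + 1ℤ) * (pos 2 * κ₃ + 1ℤ)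
    lem = solve-∀
    value : μ₀ * μ₀ + μ₂ * μ₂ + pos 2 * G ≡ l₂
    value = ℤₚ.*-cancelˡ-≡ (pos 4) _ l₂ (trans (lem n κ₀ κ₁ κ₂ κ₃ μ₀ μ₁ μ₂ μ₃) h₂)

open ChiParities

odd-pred : ∀ {z} → Odd z → Even (z ℤ.- 1ℤ)
odd-pred {z} (m , e) = m , trans (cong (ℤ._- 1ℤ) e) (lem m)
  where lem : ∀ m → pos 2 ℤ.* m ℤ.+ 1ℤ ℤ.- 1ℤ ≡ pos 2 ℤ.* m
        lem = solve-∀

odd-succ : ∀ {z} → Even (z ℤ.- 1ℤ) → Odd z
odd-succ {z} (m , e) = m , trans (lem z) (cong (ℤ._+ 1ℤ) e)
  where lem : ∀ z → z ≡ z ℤ.- 1ℤ ℤ.+ 1ℤ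
        lem = solve-∀

¬even⇒odd : ∀ {z} → ¬ Even z → Odd z
¬even⇒odd {z} h with parity z
... | inj₁ e = ⊥-elim (h e)
... | inj₂ o = o

value : List ℤ → ℤ → ℤ
value []      r = 0ℤ
value (k ∷ P) r = k ℤ.+ r ℤ.* value P r

-- Coordinates of a product in the basis 1, ω, φ, χ = ω(1 + φ)/2 with c = 2d, from ω² = ω + 2d, φ² =
-- 2ω - 1, ωφ = 2χ - ω, χω = χ + d(1 + φ), χφ = χ + 2d and χ² = χ + d(1 + φ + ω).
mul₀ mul₁ mul₂ mul₃ : (d k₀ k₁ k₂ k₃ j₀ j₁ j₂ j₃ : ℤ) → ℤ
mul₀ d k₀ k₁ k₂ k₃ j₀ j₁ j₂ j₃ = k₀ ℤ.* j₀ ℤ.- k₂ ℤ.* j₂ ℤ.+ d ℤ.* (pos 2 ℤ.* (k₁ ℤ.* j₁ ℤ.+ k₂ ℤ.* j₃ ℤ.+ k₃ ℤ.* j₂) ℤ.+ k₁ ℤ.* j₃ ℤ.+ k₃ ℤ.* j₁ ℤ.+ k₃ ℤ.* j₃)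
mul₁ d k₀ k₁ k₂ k₃ j₀ j₁ j₂ j₃ = k₀ ℤ.* j₁ ℤ.+ k₁ ℤ.* j₀ ℤ.+ k₁ ℤ.* j₁ ℤ.- (k₁ ℤ.* j₂ ℤ.+ k₂ ℤ.* j₁) ℤ.+ pos 2 ℤ.* (k₂ ℤ.* j₂) ℤ.+ d ℤ.* (k₃ ℤ.* j₃)
mul₂ d k₀ k₁ k₂ k₃ j₀ j₁ j₂ j₃ = k₀ ℤ.* j₂ ℤ.+ k₂ ℤ.* j₀ ℤ.+ d ℤ.* (k₁ ℤ.* j₃ ℤ.+ k₃ ℤ.* j₁ ℤ.+ k₃ ℤ.* j₃)
mul₃ d k₀ k₁ k₂ k₃ j₀ j₁ j₂ j₃ = k₀ ℤ.* j₃ ℤ.+ k₃ ℤ.* j₀ ℤ.+ pos 2 ℤ.* (k₁ ℤ.* j₂ ℤ.+ k₂ ℤ.* j₁) ℤ.+ k₁ ℤ.* j₃ ℤ.+ k₃ ℤ.* j₁ ℤ.+ k₂ ℤ.* j₃ ℤ.+ k₃ ℤ.* j₂ ℤ.+ k₃ ℤ.* j₃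

-- For w₃(w₁ − 1) even (and d even) this is modulo 2 the ring homomorphism with ω ↦ w₁, φ ↦ 1, ω(1+φ)/2 ↦ w₃.
λ⟨_,_⟩ : (w₁ w₃ k₀ k₁ k₂ k₃ : ℤ) → ℤ
λ⟨ w₁ , w₃ ⟩ k₀ k₁ k₂ k₃ = k₀ ℤ.+ w₁ ℤ.* k₁ ℤ.+ k₂ ℤ.+ w₃ ℤ.* k₃

-- For even d the multiplication table modulo 2 has ω² = ω, χφ = χ² = χ and χω = χ; the last
-- relation is what the condition on w₁ and w₃ expresses. Over 𝔽₂ it admits (1,1), (1,0) and (0,0).
λ-mul : ∀ {d w₁ w₃} k₀ k₁ k₂ k₃ j₀ j₁ j₂ j₃ → Even d → Even (w₃ ℤ.* (w₁ ℤ.- 1ℤ)) →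
  Even (λ⟨ w₁ , w₃ ⟩ (mul₀ d k₀ k₁ k₂ k₃ j₀ j₁ j₂ j₃) (mul₁ d k₀ k₁ k₂ k₃ j₀ j₁ j₂ j₃) (mul₂ d k₀ k₁ k₂ k₃ j₀ j₁ j₂ j₃) (mul₃ d k₀ k₁ k₂ k₃ j₀ j₁ j₂ j₃)
        ℤ.- λ⟨ w₁ , w₃ ⟩ k₀ k₁ k₂ k₃ ℤ.* λ⟨ w₁ , w₃ ⟩ j₀ j₁ j₂ j₃)
λ-mul {d} {w₁} {w₃} k₀ k₁ k₂ k₃ j₀ j₁ j₂ j₃ d-even w-even = parity-of (d ∷ w₁ ∷ w₃ ∷ k₀ ∷ k₁ ∷ k₂ ∷ k₃ ∷ j₀ ∷ j₁ ∷ j₂ ∷ j₃ ∷ []) (λ d w₁ w₃ k₀ k₁ k₂ k₃ j₀ j₁ j₂ j₃ →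
  (d ∷ w₃ :* (w₁ :- con 1ℤ) ∷ []) ,
  ((k₀ :* j₀ :- k₂ :* j₂ :+ d :* (con (pos 2) :* (k₁ :* j₁ :+ k₂ :* j₃ :+ k₃ :* j₂) :+ k₁ :* j₃ :+ k₃ :* j₁ :+ k₃ :* j₃)) :+
   w₁ :* (k₀ :* j₁ :+ k₁ :* j₀ :+ k₁ :* j₁ :- (k₁ :* j₂ :+ k₂ :* j₁) :+ con (pos 2) :* (k₂ :* j₂) :+ d :* (k₃ :* j₃)) :+
   (k₀ :* j₂ :+ k₂ :* j₀ :+ d :* (k₁ :* j₃ :+ k₃ :* j₁ :+ k₃ :* j₃)) :+
   w₃ :* (k₀ :* j₃ :+ k₃ :* j₀ :+ con (pos 2) :* (k₁ :* j₂ :+ k₂ :* j₁) :+ k₁ :* j₃ :+ k₃ :* j₁ :+ k₂ :* j₃ :+ k₃ :* j₂ :+ k₃ :* j₃) :-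
   (k₀ :+ w₁ :* k₁ :+ k₂ :+ w₃ :* k₃) :* (j₀ :+ w₁ :* j₁ :+ j₂ :+ w₃ :* j₃))) refl (d-even ∷ w-even ∷ [])

-- The image of r² - rs + p under the homomorphism, as a solver term, for s and p with coordinates k
-- and l.
λE : ∀ {k} (w₁ w₃ r k₀ k₁ k₂ k₃ l₀ l₁ l₂ l₃ : ZExpr k) → ZExpr k
λE w₁ w₃ r k₀ k₁ k₂ k₃ l₀ l₁ l₂ l₃ = (r :* r :- r :* k₀ :+ l₀) :+ w₁ :* (l₁ :- r :* k₁) :+ (l₂ :- r :* k₂) :+ w₃ :* (l₃ :- r :* k₃)

-- Conjugation and traces in the tower, and the embedding of K.

module Part₁ {a : ℤ} (sf : SquareFree a) (S : OcticTower a) (u : ℕ) (odd : (ℤ.- 1ℤ) ℤ.^ u ≡ ℤ.- 1ℤ) where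
  open import Data.Vec.Relation.Unary.All using (All; []; _∷_)

  open ≡-Reasoning

  a≢0 : a ≢ 0ℤ
  a≢0 = squareFree⇒≢0 a sf

  open OcticTower S public
  open Solver algebra public
  open Integrality.Integral {algebra} public

  Integral = Integrality.Integral algebra
  eval  = Integrality.eval algebra
  ^-+   = Integrality.^-+ algebra
  ^-*   = Integrality.^-* algebra
  I-ι   = Integrality.I-ι algebra
  I-q   = λ {r} → Integrality.I-q algebra {r}
  I-monic = Integrality.I-monic algebra

  I-+ : ∀ {x y} → Integral x → Integral y → Integral (x + y)
  I-+ = Integrality.I-+ algebra
  I-* : ∀ {x y} → Integral x → Integral y → Integral (x * y)
  I-* = Integrality.I-* algebra
  I-- : ∀ {x y} → Integral x → Integral y → Integral (x - y)
  I-- = Integrality.I-- algebra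
  I-neg : ∀ {x} → Integral x → Integral (- x)
  I-neg = Integrality.I-neg algebra

  -- The way to use a relation with the solver: to get x = y from u = v it suffices to add a
  -- multiple of the relation, with sides exchanged, so that the result is a polynomial identity.
  -- The factor `c` is the cofactor of the relation.
  lc₁ : ∀ {x y} c {u v} → u ≡ v → x + c * v ≡ y + c * u → x ≡ y
  lc₁ {x} {y} c {u} refl e = trans (ring [] (x ∷ c ∷ u ∷ []) (λ x c u → x ⊜ x :+ c :* u :- c :* u) refl)
    (trans (cong (_- c * u) e) (ring [] (y ∷ c ∷ u ∷ []) (λ x c u → x :+ c :* u :- c :* u ⊜ x) refl))

  lc₂ : ∀ {x y} c {u v} → u ≡ v → ∀ d {s t} → s ≡ t → x + (c * v + d * t) ≡ y + (c * u + d * s) → x ≡ y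
  lc₂ {x} {y} c {u} refl d {s} refl e = lc₁ 1# {c * u + d * s} refl (trans (cong (x +_) (*-identityˡ _)) (trans e (cong (y +_) (sym (*-identityˡ _)))))

  σ-⟪⟫ : ∀ z → σ ⟪ z ⟫ ≡ ⟪ z ⟫
  σ-⟪⟫ z = trans (cong σ (⟪⟫-q z)) (trans (σ-q (ι z)) (sym (⟪⟫-q z)))

  σ-0 : σ 0# ≡ 0#
  σ-0 = trans (cong σ (sym ⟪0⟫)) (trans (σ-⟪⟫ 0ℤ) ⟪0⟫)

  σ-1 : σ 1# ≡ 1#
  σ-1 = trans (cong σ (sym ⟪1⟫)) (trans (σ-⟪⟫ 1ℤ) ⟪1⟫)

  σ-neg : ∀ x → σ (- x) ≡ - σ x
  σ-neg x = begin
    σ (- x)                    ≡⟨ cong σ (ring [] (x ∷ []) (λ x → :- x ⊜ emb (con (ℤ.- 1ℤ)) :* x) refl) ⟩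
    σ (⟪ ℤ.- 1ℤ ⟫ * x)         ≡⟨ trans (σ-* ⟪ ℤ.- 1ℤ ⟫ x) (cong (_* σ x) (σ-⟪⟫ (ℤ.- 1ℤ))) ⟩
    ⟪ ℤ.- 1ℤ ⟫ * σ x           ≡⟨ ring [] (σ x ∷ []) (λ x → emb (con (ℤ.- 1ℤ)) :* x ⊜ :- x) refl ⟩
    - σ x                      ∎

  σ-- : ∀ x y → σ (x - y) ≡ σ x - σ y
  σ-- x y = trans (σ-+ x (- y)) (cong (σ x +_) (σ-neg y))

  σ-^ : ∀ x k → σ (x ^ k) ≡ σ x ^ k
  σ-^ x zero    = σ-1
  σ-^ x (suc k) = trans (σ-* x (x ^ k)) (cong (σ x *_) (σ-^ x k))

  ⟪⟫-^ : ∀ z k → ⟪ z ⟫ ^ k ≡ ⟪ z ℤ.^ k ⟫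
  ⟪⟫-^ z zero    = sym ⟪1⟫
  ⟪⟫-^ z (suc k) = trans (cong (⟪ z ⟫ *_) (⟪⟫-^ z k)) (sym (⟪⟫-* z (z ℤ.^ k)))

  I-σ : ∀ {x} → Integral x → Integral (σ x)
  I-σ {x} h = Integrality.integral (d h) (d≢0 h) λ k →
    subst Λ (trans (σ-* ⟪ d h ⟫ (x ^ k)) (cong₂ _*_ (σ-⟪⟫ (d h)) (σ-^ x k))) (σ-Λ (Λ-^ h k))

  Λ⇒I : ∀ {x} → Λ x → Integral x
  Λ⇒I {x} h = Integrality.integral 1ℤ (λ ()) λ k → Λ-* (Λ-ι 1ℤ) (pow k)
    where
    pow : ∀ k → Λ (x ^ k)
    pow zero    = subst Λ ⟪1⟫ (Λ-ι 1ℤ)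
    pow (suc k) = Λ-* h (pow k)

  I-θ : Integral θ
  I-θ = Λ⇒I Λ-θ

  I-ζ : Integral ζ
  I-ζ = Λ⇒I Λ-ζ

  I-1 : Integral 1#
  I-1 = subst Integral ⟪1⟫ (I-ι 1ℤ)

  I-0 : Integral 0#
  I-0 = subst Integral ⟪0⟫ (I-ι 0ℤ)

  I-^ : ∀ {x} → Integral x → ∀ k → Integral (x ^ k)
  I-^ h zero    = I-1
  I-^ h (suc k) = I-* h (I-^ h k)

  ⟪⟫-inj : ∀ {x y} → ⟪ x ⟫ ≡ ⟪ y ⟫ → x ≡ y
  ⟪⟫-inj {x} {y} e = ι-inj (q-inj (trans (sym (⟪⟫-q x)) (trans e (⟪⟫-q y))))

  inverse : ∀ {n} → n ≢ 0ℤ → ∃ λ r → q r * ⟪ n ⟫ ≡ 1#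
  inverse {n} n≢0 with ι-inverse n≢0
  ... | r , e = r , trans (cong (q r *_) (⟪⟫-q n)) (trans (sym (q-* r (ι n))) (trans (cong q e) q-1))

  -- Nonzero integers are invertible in a ℚ-algebra. As there may be zero divisors, every
  -- cancellation is reduced to this one.
  cancel : ∀ {n x y} → n ≢ 0ℤ → ⟪ n ⟫ * x ≡ ⟪ n ⟫ * y → x ≡ y
  cancel {n} {x} {y} n≢0 e with inverse n≢0
  ... | r , i = begin
    x                   ≡⟨ trans (sym (*-identityˡ x)) (cong (_* x) (sym i)) ⟩
    q r * ⟪ n ⟫ * x     ≡⟨ trans (*-assoc (q r) ⟪ n ⟫ x) (trans (cong (q r *_) e) (sym (*-assoc (q r) ⟪ n ⟫ y))) ⟩
    q r * ⟪ n ⟫ * y     ≡⟨ trans (cong (_* y) i) (*-identityˡ y) ⟩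
    y                   ∎

  -- The hypothesis makes w equal to the rational number k/n, and a rational integral element is an
  -- integer. Divisibility in ℤ is obtained from integrality in this way.
  rational : ∀ {n k w} → n ≢ 0ℤ → Integral w → ⟪ n ⟫ * w ≡ ⟪ k ⟫ → ∃ λ z → w ≡ ⟪ z ⟫ × n ℤ.* z ≡ k
  rational {n} {k} {w} n≢0 h e with inverse n≢0
  ... | r , i with I-q (subst Integral w≡q h)
    where
    w≡q : w ≡ q (r ℚ.* ι k)
    w≡q = begin
      w                    ≡⟨ trans (sym (*-identityˡ w)) (cong (_* w) (sym i)) ⟩
      q r * ⟪ n ⟫ * w      ≡⟨ trans (*-assoc (q r) ⟪ n ⟫ w) (cong (q r *_) (trans e (⟪⟫-q k))) ⟩
      q r * q (ι k)        ≡⟨ q-* r (ι k) ⟨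
      q (r ℚ.* ι k)        ∎
  ... | z , s = z , w≡z , ⟪⟫-inj (trans (⟪⟫-* n z) (trans (cong (⟪ n ⟫ *_) (sym w≡z)) e))
    where
    w≡z : w ≡ ⟪ z ⟫
    w≡z = cancel n≢0 (begin
      ⟪ n ⟫ * w                    ≡⟨ e ⟩
      ⟪ k ⟫                        ≡⟨ trans (sym (*-identityˡ ⟪ k ⟫)) (cong (_* ⟪ k ⟫) (sym i)) ⟩
      q r * ⟪ n ⟫ * ⟪ k ⟫          ≡⟨ ring (n ∷ k ∷ []) (q r ∷ []) (λ n k r → r :* emb n :* emb k ⊜ emb n :* (r :* emb k)) refl ⟩
      ⟪ n ⟫ * (q r * ⟪ k ⟫)        ≡⟨ cong (⟪ n ⟫ *_) (trans (cong (q r *_) (⟪⟫-q k)) (trans (sym (q-* r (ι k))) (trans (cong q s) (sym (⟪⟫-q z))))) ⟩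
      ⟪ n ⟫ * ⟪ z ⟫                ∎)

  -- The sum of the eight conjugates, factored as (1 + σ)(1 + σ²)(1 + σ⁴) so that each factor halves
  -- the number of surviving powers.
  trace : Carrier → Carrier
  trace x = half (x + σ (σ (σ (σ x))))
    where
    half : Carrier → Carrier
    half y = (y + σ (σ y)) + σ (y + σ (σ y))

  I-trace : ∀ {x} → Integral x → Integral (trace x)
  I-trace h = I-+ h₂ (I-σ h₂)
    where
    h₁ = I-+ h (I-σ (I-σ (I-σ (I-σ h))))
    h₂ = I-+ h₁ (I-σ (I-σ h₁))

  lin : ∀ {n} → Vec ℚ n → Carrier → Carrier
  lin []       x = 0#
  lin (c ∷ cs) x = q c + x * lin cs x

  σ-lin : ∀ {n} (v : Vec ℚ n) x → σ (lin v x) ≡ lin v (σ x)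
  σ-lin []      x = σ-0
  σ-lin (c ∷ v) x = trans (σ-+ (q c) (x * lin v x)) (cong₂ _+_ (σ-q c) (trans (σ-* x (lin v x)) (cong (σ x *_) (σ-lin v x))))

  σ-lin′ : ∀ {n} (v : Vec ℚ n) {x y} → σ x ≡ y → σ (lin v x) ≡ lin v y
  σ-lin′ v {x} e = trans (σ-lin v x) (cong (lin v) e)

  -- The trace kills x, x², …, x⁷: x ↦ -x, x² ↦ -x² and x⁴ ↦ -x⁴ under σ⁴, σ² and σ.
  trace-lin : ∀ x z (v : Vec ℚ 8) → σ x ≡ z * x → σ z ≡ z → z ^ 4 ≡ ⟪ ℤ.- 1ℤ ⟫ → trace (lin v x) ≡ ⟪ pos 8 ⟫ * q (Vec.head v)
  trace-lin x z v@(c₀ ∷ c₁ ∷ c₂ ∷ c₃ ∷ c₄ ∷ c₅ ∷ c₆ ∷ c₇ ∷ []) sx sz z⁴ = begin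
    trace (lin v x)
      ≡⟨ cong (λ y → (y + σ (σ y)) + σ (y + σ (σ y))) (trans (cong (lin v x +_) (σ⁴ v))
         (ring [] (x ∷ q c₀ ∷ q c₁ ∷ q c₂ ∷ q c₃ ∷ q c₄ ∷ q c₅ ∷ q c₆ ∷ q c₇ ∷ []) (λ x c₀ c₁ c₂ c₃ c₄ c₅ c₆ c₇ →
           let f = λ x → c₀ :+ x :* (c₁ :+ x :* (c₂ :+ x :* (c₃ :+ x :* (c₄ :+ x :* (c₅ :+ x :* (c₆ :+ x :* (c₇ :+ x :* :0))))))) ; X = x :* x in
           f x :+ f (:- x) ⊜ lit 2 :* (c₀ :+ X :* (c₂ :+ X :* (c₄ :+ X :* (c₆ :+ X :* :0))))) refl)) ⟩
    (⟪ pos 2 ⟫ * lin v₄ (x * x) + σ (σ (⟪ pos 2 ⟫ * lin v₄ (x * x)))) + σ (⟪ pos 2 ⟫ * lin v₄ (x * x) + σ (σ (⟪ pos 2 ⟫ * lin v₄ (x * x))))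
      ≡⟨ cong (λ w → w + σ w) (trans (cong (⟪ pos 2 ⟫ * lin v₄ (x * x) +_) σ²)
         (ring [] (x * x ∷ q c₀ ∷ q c₂ ∷ q c₄ ∷ q c₆ ∷ []) (λ x c₀ c₂ c₄ c₆ →
           let f = λ x → c₀ :+ x :* (c₂ :+ x :* (c₄ :+ x :* (c₆ :+ x :* :0))) ; X = x :* x in
           lit 2 :* f x :+ lit 2 :* f (:- x) ⊜ lit 4 :* (c₀ :+ X :* (c₄ :+ X :* :0))) refl)) ⟩
    ⟪ pos 4 ⟫ * lin v₂ (x * x * (x * x)) + σ (⟪ pos 4 ⟫ * lin v₂ (x * x * (x * x)))
      ≡⟨ trans (cong (⟪ pos 4 ⟫ * lin v₂ (x * x * (x * x)) +_) (trans (σ-* ⟪ pos 4 ⟫ _) (cong₂ _*_ (σ-⟪⟫ (pos 4)) (σ-lin′ v₂ σx⁴))))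
         (ring [] (x * x * (x * x) ∷ q c₀ ∷ q c₄ ∷ []) (λ x c₀ c₄ →
           let f = λ x → c₀ :+ x :* (c₄ :+ x :* :0) in
           lit 4 :* f x :+ lit 4 :* f (:- x) ⊜ lit 8 :* c₀) refl) ⟩
    ⟪ pos 8 ⟫ * q c₀ ∎
    where
    v₄ = c₀ ∷ c₂ ∷ c₄ ∷ c₆ ∷ []
    v₂ = c₀ ∷ c₄ ∷ []

    σz* : ∀ w {u} → σ w ≡ u → σ (z * w) ≡ z * u
    σz* w e = trans (σ-* z w) (cong₂ _*_ sz e)

    σ⁴x : σ (σ (σ (σ x))) ≡ - x
    σ⁴x = trans (cong (λ w → σ (σ (σ w))) sx) (trans (cong (λ w → σ (σ w)) (σz* x sx)) (trans (cong σ (σz* (z * x) (σz* x sx))) (trans (σz* _ (σz* (z * x) (σz* x sx)))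
      (lc₁ x z⁴ (ring [] (x ∷ z ∷ []) (λ x z → z :* (z :* (z :* (z :* x))) :+ x :* emb (con (ℤ.- 1ℤ)) ⊜ :- x :+ x :* z :^ 4) refl)))))

    σ⁴ : ∀ (v : Vec ℚ 8) → σ (σ (σ (σ (lin v x)))) ≡ lin v (- x)
    σ⁴ v = trans (cong (λ w → σ (σ (σ w))) (σ-lin v x)) (trans (cong (λ w → σ (σ w)) (σ-lin v _)) (trans (cong σ (σ-lin v _)) (trans (σ-lin v _) (cong (lin v) σ⁴x))))

    σx² : σ (x * x) ≡ z * x * (z * x)
    σx² = trans (σ-* x x) (cong₂ _*_ sx sx)

    σ²x² : σ (σ (x * x)) ≡ - (x * x)
    σ²x² = trans (cong σ σx²) (trans (σ-* (z * x) (z * x)) (trans (cong (λ w → w * w) (σz* x sx))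
      (lc₁ (x * x) z⁴ (ring [] (x ∷ z ∷ []) (λ x z → z :* (z :* x) :* (z :* (z :* x)) :+ x :* x :* emb (con (ℤ.- 1ℤ)) ⊜ :- (x :* x) :+ x :* x :* z :^ 4) refl))))

    σ² : σ (σ (⟪ pos 2 ⟫ * lin v₄ (x * x))) ≡ ⟪ pos 2 ⟫ * lin v₄ (- (x * x))
    σ² = trans (cong σ (trans (σ-* ⟪ pos 2 ⟫ _) (cong₂ _*_ (σ-⟪⟫ (pos 2)) (σ-lin v₄ (x * x))))) (trans (σ-* ⟪ pos 2 ⟫ _) (cong₂ _*_ (σ-⟪⟫ (pos 2)) (σ-lin′ v₄ σ²x²)))

    σx⁴ : σ (x * x * (x * x)) ≡ - (x * x * (x * x))
    σx⁴ = trans (σ-* (x * x) (x * x)) (trans (cong (λ w → w * w) σx²)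
      (lc₁ (x ^ 4) z⁴ (ring [] (x ∷ z ∷ []) (λ x z → z :* x :* (z :* x) :* (z :* x :* (z :* x)) :+ x :^ 4 :* emb (con (ℤ.- 1ℤ)) ⊜ :- (x :* x :* (x :* x)) :+ x :^ 4 :* z :^ 4) refl)))

  m : ℤ
  m = a ℤ.^ u

  m≢0 : m ≢ 0ℤ
  m≢0 = ^-≢0 a≢0 u

  α : Carrier
  α = θ ^ u

  ^-∘ : ∀ x j k → (x ^ j) ^ k ≡ (x ^ k) ^ j
  ^-∘ x zero    zero    = refl
  ^-∘ x zero    (suc k) = trans (*-identityˡ _) (^-∘ x zero k)
  ^-∘ x (suc j) k       = trans (^-* x (x ^ j) k) (cong (x ^ k *_) (^-∘ x j k))

  ^-∘-* : ∀ x j k → (x ^ j) ^ k ≡ x ^ (j ℕ.* k)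
  ^-∘-* x zero    zero    = refl
  ^-∘-* x zero    (suc k) = trans (*-identityˡ _) (^-∘-* x zero k)
  ^-∘-* x (suc j) k = trans (^-* x (x ^ j) k) (trans (cong (x ^ k *_) (^-∘-* x j k)) (sym (^-+ x k (j ℕ.* k))))

  α⁸ : α ^ 8 ≡ ⟪ m ⟫
  α⁸ = trans (^-∘ θ u 8) (trans (cong (_^ u) θ⁸) (⟪⟫-^ a u))

  σ-α : σ α ≡ ζ ^ u * α
  σ-α = trans (σ-^ θ u) (trans (cong (_^ u) σ-θ) (^-* ζ θ u))

  σ-ζᵘ : σ (ζ ^ u) ≡ ζ ^ u
  σ-ζᵘ = trans (σ-^ ζ u) (cong (_^ u) σ-ζ)

  -- Here u must be odd: then ζᵘ again has fourth power -1, and the trace formula holds for α with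
  -- ζᵘ in place of ζ.
  ζᵘ⁴ : (ζ ^ u) ^ 4 ≡ ⟪ ℤ.- 1ℤ ⟫
  ζᵘ⁴ = trans (^-∘ ζ u 4) (trans (cong (_^ u) ζ⁴) (trans (⟪⟫-^ (ℤ.- 1ℤ) u) (cong ⟪_⟫ odd)))

  e : K → Carrier
  e v = lin v α

  q-0 : q 0ℚ ≡ 0#
  q-0 = trans (sym (⟪⟫-q 0ℤ)) ⟪0⟫

  lin-⊕ : ∀ {n} (v w : Vec ℚ n) x → lin (Vec.zipWith ℚ._+_ v w) x ≡ lin v x + lin w x
  lin-⊕ []      []      x = sym (+-identityˡ 0#)
  lin-⊕ (c ∷ v) (d ∷ w) x = trans (cong₂ (λ s t → s + x * t) (q-+ c d) (lin-⊕ v w x))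
    (ring [] (q c ∷ q d ∷ x ∷ lin v x ∷ lin w x ∷ []) (λ c d x v w → c :+ d :+ x :* (v :+ w) ⊜ c :+ x :* v :+ (d :+ x :* w)) refl)

  lin-scale : ∀ {n} r (v : Vec ℚ n) x → lin (Vec.map (r ℚ.*_) v) x ≡ q r * lin v x
  lin-scale r []      x = sym (zeroʳ (q r))
  lin-scale r (c ∷ v) x = trans (cong₂ (λ s t → s + x * t) (q-* r c) (lin-scale r v x))
    (ring [] (q r ∷ q c ∷ x ∷ lin v x ∷ []) (λ r c x v → r :* c :+ x :* (r :* v) ⊜ r :* (c :+ x :* v)) refl)

  lin-replicate-0 : ∀ n x → lin (Vec.replicate n 0ℚ) x ≡ 0#
  lin-replicate-0 zero    x = refl
  lin-replicate-0 (suc n) x = trans (cong₂ (λ s t → s + x * t) q-0 (lin-replicate-0 n x)) (ring [] (x ∷ []) (λ x → :0 :+ x :* :0 ⊜ :0) refl)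

  lin-rotate : ∀ {x k} → x ^ 8 ≡ ⟪ k ⟫ → ∀ v → lin (mulα k v) x ≡ x * lin v x
  lin-rotate {x} {k} x⁸ v@(c₀ ∷ c₁ ∷ c₂ ∷ c₃ ∷ c₄ ∷ c₅ ∷ c₆ ∷ c₇ ∷ []) =
    trans (cong (λ s → s + x * lin (c₀ ∷ c₁ ∷ c₂ ∷ c₃ ∷ c₄ ∷ c₅ ∷ c₆ ∷ []) x) (trans (q-* (ι k) c₇) (cong (_* q c₇) (trans (sym (⟪⟫-q k)) (sym x⁸)))))
    (ring [] (x ∷ q c₀ ∷ q c₁ ∷ q c₂ ∷ q c₃ ∷ q c₄ ∷ q c₅ ∷ q c₆ ∷ q c₇ ∷ []) (λ x c₀ c₁ c₂ c₃ c₄ c₅ c₆ c₇ →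
      x :^ 8 :* c₇ :+ x :* (c₀ :+ x :* (c₁ :+ x :* (c₂ :+ x :* (c₃ :+ x :* (c₄ :+ x :* (c₅ :+ x :* (c₆ :+ x :* :0)))))))
      ⊜ x :* (c₀ :+ x :* (c₁ :+ x :* (c₂ :+ x :* (c₃ :+ x :* (c₄ :+ x :* (c₅ :+ x :* (c₆ :+ x :* (c₇ :+ x :* :0))))))))) refl)

  e-𝟘 : e 𝟘 ≡ 0#
  e-𝟘 = lin-replicate-0 8 α

  e-𝟙 : e 𝟙 ≡ 1#
  e-𝟙 = trans (cong₂ (λ s t → s + α * t) q-1 (lin-replicate-0 7 α)) (ring [] (α ∷ []) (λ x → :1 :+ x :* :0 ⊜ :1) refl)

  e-α : e αK ≡ α
  e-α = trans (cong₂ (λ s t → s + α * t) q-0 (cong₂ (λ s t → s + α * t) q-1 (lin-replicate-0 6 α))) (ring [] (α ∷ []) (λ x → :0 :+ x :* (:1 :+ x :* :0) ⊜ x) refl)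

  e-⊕ : ∀ v w → e (v ⊕ w) ≡ e v + e w
  e-⊕ v w = lin-⊕ v w α

  e-scale : ∀ r v → e (scale r v) ≡ q r * e v
  e-scale r v = lin-scale r v α

  e-mulα : ∀ v → e (mulα m v) ≡ α * e v
  e-mulα = lin-rotate α⁸

  e-* : ∀ v w → e (mulK m v w) ≡ e v * e w
  e-* v@(c₀ ∷ c₁ ∷ c₂ ∷ c₃ ∷ c₄ ∷ c₅ ∷ c₆ ∷ c₇ ∷ []) w = go v w
    where
    toList : ∀ {n} → Vec ℚ n → List ℚ
    toList []      = []
    toList (x ∷ v) = x ∷ toList v
    go : ∀ {n} (v : Vec ℚ n) w → e (mulAux m (toList v) w) ≡ lin v α * e w
    go []      w = trans e-𝟘 (sym (zeroˡ (e w)))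
    go (c ∷ v) w = begin
      e (scale c w ⊕ mulAux m (toList v) (mulα m w))        ≡⟨ e-⊕ (scale c w) (mulAux m (toList v) (mulα m w)) ⟩
      e (scale c w) + e (mulAux m (toList v) (mulα m w))    ≡⟨ cong₂ _+_ (e-scale c w) (trans (go v (mulα m w)) (cong (lin v α *_) (e-mulα w))) ⟩
      q c * e w + lin v α * (α * e w)                       ≡⟨ ring [] (q c ∷ e w ∷ lin v α ∷ α ∷ []) (λ c w l x → c :* w :+ l :* (x :* w) ⊜ (c :+ x :* l) :* w) refl ⟩
      (q c + α * lin v α) * e w                             ∎

  e-^ : ∀ v k → e (powK m v k) ≡ e v ^ k
  e-^ v zero    = e-𝟙
  e-^ v (suc k) = trans (e-* v (powK m v k)) (cong (e v *_) (e-^ v k))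

  e-eval : ∀ cs v → e (evalℤ m cs v) ≡ eval cs (e v)
  e-eval []       v = e-𝟘
  e-eval (c ∷ cs) v = trans (e-⊕ (scale (ι c) 𝟙) (mulK m v (evalℤ m cs v)))
    (cong₂ _+_ (trans (e-scale (ι c) 𝟙) (trans (cong₂ _*_ (sym (⟪⟫-q c)) e-𝟙) (*-identityʳ ⟪ c ⟫))) (trans (e-* v (evalℤ m cs v)) (cong (e v *_) (e-eval cs v))))

  q≡0⇒ : ∀ {r} → q r ≡ 0# → r ≡ 0ℚ
  q≡0⇒ h = q-inj (trans h (sym q-0))

  head≡0 : ∀ (v : K) → e v ≡ 0# → Vec.head v ≡ 0ℚ
  head≡0 v h = q≡0⇒ (cancel {pos 8} (λ ()) (begin
    ⟪ pos 8 ⟫ * q (Vec.head v)  ≡⟨ trace-lin α (ζ ^ u) v σ-α σ-ζᵘ ζᵘ⁴ ⟨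
    trace (e v)                 ≡⟨ cong trace h ⟩
    trace 0#                    ≡⟨ cong trace e-𝟘 ⟨
    trace (e 𝟘)                 ≡⟨ trace-lin α (ζ ^ u) 𝟘 σ-α σ-ζᵘ ζᵘ⁴ ⟩
    ⟪ pos 8 ⟫ * q 0ℚ            ≡⟨ cong (⟪ pos 8 ⟫ *_) q-0 ⟩
    ⟪ pos 8 ⟫ * 0#              ∎))

  cancelℚ : ∀ {r} → ι m ℚ.* r ≡ 0ℚ → r ≡ 0ℚ
  cancelℚ {r} h = q≡0⇒ (cancel m≢0 (trans (trans (cong (_* q r) (⟪⟫-q m)) (trans (sym (q-* (ι m) r)) (trans (cong q h) q-0))) (sym (zeroʳ ⟪ m ⟫))))

  -- The trace reads off the constant coordinate. Repeated multiplication by α brings each of the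
  -- others, multiplied by m, into that place.
  e-kernel : ∀ v → e v ≡ 0# → v ≡ 𝟘
  e-kernel v₀@(c₀ ∷ c₁ ∷ c₂ ∷ c₃ ∷ c₄ ∷ c₅ ∷ c₆ ∷ c₇ ∷ []) h₀ =
    cong₂ _∷_ (head≡0 v₀ h₀) (cong₂ _∷_ (z v₇ h₇) (cong₂ _∷_ (z v₆ h₆) (cong₂ _∷_ (z v₅ h₅) (cong₂ _∷_ (z v₄ h₄)
      (cong₂ _∷_ (z v₃ h₃) (cong₂ _∷_ (z v₂ h₂) (cong₂ _∷_ (z v₁ h₁) refl)))))))
    where
    rot : ∀ v → e v ≡ 0# → e (mulα m v) ≡ 0#
    rot v h = trans (e-mulα v) (trans (cong (α *_) h) (zeroʳ α))
    z : ∀ (v : K) {r} {w : Vec ℚ 7} {{_ : v ≡ ι m ℚ.* r ∷ w}} → e v ≡ 0# → r ≡ 0ℚ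
    z v {{refl}} h = cancelℚ (head≡0 v h)
    v₁ = mulα m v₀ ; h₁ = rot v₀ h₀
    v₂ = mulα m v₁ ; h₂ = rot v₁ h₁
    v₃ = mulα m v₂ ; h₃ = rot v₂ h₂
    v₄ = mulα m v₃ ; h₄ = rot v₃ h₃
    v₅ = mulα m v₄ ; h₅ = rot v₄ h₄
    v₆ = mulα m v₅ ; h₆ = rot v₅ h₅
    v₇ = mulα m v₆ ; h₇ = rot v₆ h₆

  private
    difference≡0 : ∀ {n} (v w : Vec ℚ n) → Vec.zipWith ℚ._+_ v (Vec.map (ι (ℤ.- 1ℤ) ℚ.*_) w) ≡ Vec.replicate n 0ℚ → v ≡ w
    difference≡0 []      []      _ = refl
    difference≡0 (c ∷ v) (d ∷ w) h = cong₂ _∷_ (q-inj (lc₁ 1# head (begin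
        q c + 1# * q 0ℚ                        ≡⟨ cong (λ z → q c + 1# * z) q-0 ⟩
        q c + 1# * 0#                          ≡⟨ ring [] (q c ∷ q d ∷ []) (λ c d → c :+ :1 :* :0 ⊜ d :+ :1 :* (c :+ emb (con (ℤ.- 1ℤ)) :* d)) refl ⟩
        q d + 1# * (q c + ⟪ ℤ.- 1ℤ ⟫ * q d)    ∎))) (difference≡0 v w (cong Vec.tail h))
      where
      head : q c + ⟪ ℤ.- 1ℤ ⟫ * q d ≡ q 0ℚ
      head = begin
        q c + ⟪ ℤ.- 1ℤ ⟫ * q d           ≡⟨ cong (λ z → q c + z * q d) (⟪⟫-q (ℤ.- 1ℤ)) ⟩
        q c + q (ι (ℤ.- 1ℤ)) * q d       ≡⟨ cong (q c +_) (q-* (ι (ℤ.- 1ℤ)) d) ⟨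
        q c + q (ι (ℤ.- 1ℤ) ℚ.* d)       ≡⟨ q-+ c (ι (ℤ.- 1ℤ) ℚ.* d) ⟨
        q (c ℚ.+ ι (ℤ.- 1ℤ) ℚ.* d)       ≡⟨ cong q (cong Vec.head h) ⟩
        q 0ℚ                             ∎

  e-inj : ∀ {v w} → e v ≡ e w → v ≡ w
  e-inj {v} {w} h = difference≡0 v w (e-kernel (v ⊕ scale (ι (ℤ.- 1ℤ)) w) (begin
    e (v ⊕ scale (ι (ℤ.- 1ℤ)) w)       ≡⟨ trans (e-⊕ v (scale (ι (ℤ.- 1ℤ)) w)) (cong (e v +_) (trans (e-scale (ι (ℤ.- 1ℤ)) w) (cong (_* e w) (sym (⟪⟫-q (ℤ.- 1ℤ)))))) ⟩
    e v + ⟪ ℤ.- 1ℤ ⟫ * e w             ≡⟨ cong (λ x → x + ⟪ ℤ.- 1ℤ ⟫ * e w) h ⟩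
    e w + ⟪ ℤ.- 1ℤ ⟫ * e w             ≡⟨ ring [] (e w ∷ []) (λ w → w :+ emb (con (ℤ.- 1ℤ)) :* w ⊜ :0) refl ⟩
    0#                                 ∎))

  e-monic : ∀ β cs → e (powK m β (length cs) ⊕ evalℤ m cs β) ≡ e β ^ length cs + eval cs (e β)
  e-monic β cs = trans (e-⊕ (powK m β (length cs)) (evalℤ m cs β)) (cong₂ _+_ (e-^ β (length cs)) (e-eval cs β))

  integral⇒ : ∀ {β} → IsIntegral m β → Integral (e β)
  integral⇒ {β} (cs , h) = I-monic (e β) cs (trans (sym (e-monic β cs)) (trans (cong e h) e-𝟘))

  integral⇐ : ∀ {β} cs → e β ^ length cs + eval cs (e β) ≡ 0# → IsIntegral m β
  integral⇐ {β} cs h = cs , e-inj (trans (e-monic β cs) (trans h (sym e-𝟘)))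

  -- The image of K described by the powers of θ instead of those of α. Its integral elements have
  -- small denominators in these coordinates.
  InK : Carrier → Set
  InK x = ∃ λ (b : K) → x ≡ lin b θ

  InK-+ : ∀ {x y} → InK x → InK y → InK (x + y)
  InK-+ (b , refl) (c , refl) = b ⊕ c , sym (lin-⊕ b c θ)

  InK-θ : ∀ {x} → InK x → InK (θ * x)
  InK-θ (b , refl) = mulα a b , sym (lin-rotate θ⁸ b)

  InK-q : ∀ r → InK (q r)
  InK-q r = scale r 𝟙 , sym (trans (lin-scale r 𝟙 θ) (trans (cong (q r *_) (trans (cong₂ (λ s t → s + θ * t) q-1 (lin-replicate-0 7 θ))
    (ring [] (θ ∷ []) (λ x → :1 :+ x :* :0 ⊜ :1) refl))) (*-identityʳ (q r))))

  InK-e : ∀ v → InK (e v)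
  InK-e v = go v
    where
    powers : ∀ k {x} → InK x → InK (θ ^ k * x)
    powers zero    {x} h = subst InK (sym (*-identityˡ x)) h
    powers (suc k) {x} h = subst InK (sym (*-assoc θ (θ ^ k) x)) (InK-θ (powers k h))
    go : ∀ {n} (v : Vec ℚ n) → InK (lin v α)
    go []      = subst InK q-0 (InK-q 0ℚ)
    go (c ∷ v) = InK-+ (InK-q c) (powers u (go v))

  I-eval : ∀ cs {x} → Integral x → Integral (eval cs x)
  I-eval []       h = I-0
  I-eval (c ∷ cs) h = I-+ (I-ι c) (I-* h (I-eval cs h))

  -- Part (1): removing the denominators of integral elements.

  8b₀ : ∀ (b : K) → Integral (lin b θ) → IsInt (ι (pos 8) ℚ.* Vec.head b)
  8b₀ b h = I-q (subst Integral (trans (trace-lin θ ζ b σ-θ σ-ζ ζ⁴) (trans (cong (_* q (Vec.head b)) (⟪⟫-q (pos 8))) (sym (q-* (ι (pos 8)) (Vec.head b))))) (I-trace h))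

  -- Eight times the constant coordinate is an integer, being a trace. Multiplication by θ rotates
  -- the coordinates and puts a factor a on the one that wraps round, so each of the others needs at
  -- most 8a.
  clear-8a : ∀ (b : K) → Integral (lin b θ) → ∃ λ gs → length gs ≡ 8 × ⟪ pos 8 ℤ.* a ⟫ * lin b θ ≡ eval gs θ
  clear-8a b₀@(c₀ ∷ c₁ ∷ c₂ ∷ c₃ ∷ c₄ ∷ c₅ ∷ c₆ ∷ c₇ ∷ []) h₀ = assemble b₀
    ((a ℤ.* g₀ , lift c₀ (pos 8) p₀′ a) ∷ f (z b₇ h₇) ∷ f (z b₆ h₆) ∷ f (z b₅ h₅) ∷ f (z b₄ h₄) ∷ f (z b₃ h₃) ∷ f (z b₂ h₂) ∷ f (z b₁ h₁) ∷ [])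
    where
    g₀ = proj₁ (8b₀ b₀ h₀)
    p₀ = proj₂ (8b₀ b₀ h₀)
    rot : ∀ (b : K) → Integral (lin b θ) → Integral (lin (mulα a b) θ)
    rot b h = subst Integral (sym (lin-rotate θ⁸ b)) (I-* I-θ h)
    b₁ = mulα a b₀ ; h₁ = rot b₀ h₀
    b₂ = mulα a b₁ ; h₂ = rot b₁ h₁
    b₃ = mulα a b₂ ; h₃ = rot b₂ h₂
    b₄ = mulα a b₃ ; h₄ = rot b₃ h₃
    b₅ = mulα a b₄ ; h₅ = rot b₄ h₄
    b₆ = mulα a b₅ ; h₆ = rot b₅ h₅
    b₇ = mulα a b₆ ; h₇ = rot b₆ h₆

    p₀′ : ⟪ pos 8 ⟫ * q c₀ ≡ ⟪ g₀ ⟫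
    p₀′ = trans (cong (_* q c₀) (⟪⟫-q (pos 8))) (trans (sym (q-* (ι (pos 8)) c₀)) (trans (cong q p₀) (sym (⟪⟫-q g₀))))

    lift : ∀ c k {g} → ⟪ k ⟫ * q c ≡ ⟪ g ⟫ → ∀ n → ⟪ k ℤ.* n ⟫ * q c ≡ ⟪ n ℤ.* g ⟫
    lift c k {g} e n = trans (ring (k ∷ n ∷ []) (q c ∷ []) (λ k n c → emb (k :* n) :* c ⊜ emb n :* (emb k :* c)) refl) (trans (cong (⟪ n ⟫ *_) e) (sym (⟪⟫-* n g)))

    z : ∀ (b : K) → Integral (lin b θ) → ∃ λ g → q (ι (pos 8)) * q (Vec.head b) ≡ ⟪ g ⟫
    z b h = proj₁ (8b₀ b h) , trans (sym (q-* (ι (pos 8)) (Vec.head b))) (trans (cong q (proj₂ (8b₀ b h))) (sym (⟪⟫-q (proj₁ (8b₀ b h)))))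

    f : ∀ {c} (w : ∃ λ g → q (ι (pos 8)) * q (ι a ℚ.* c) ≡ ⟪ g ⟫) → ∃ λ g → ⟪ pos 8 ℤ.* a ⟫ * q c ≡ ⟪ g ⟫
    f {c} (g , e) = g , (begin
      ⟪ pos 8 ℤ.* a ⟫ * q c             ≡⟨ ring (a ∷ []) (q c ∷ []) (λ a c → emb (con (pos 8) :* a) :* c ⊜ lit 8 :* (emb a :* c)) refl ⟩
      ⟪ pos 8 ⟫ * (⟪ a ⟫ * q c)         ≡⟨ cong₂ _*_ (⟪⟫-q (pos 8)) (trans (cong (_* q c) (⟪⟫-q a)) (sym (q-* (ι a) c))) ⟩
      q (ι (pos 8)) * q (ι a ℚ.* c)     ≡⟨ e ⟩
      ⟪ g ⟫                             ∎)

    assemble : ∀ {n} (v : Vec ℚ n) → All (λ c → ∃ λ g → ⟪ pos 8 ℤ.* a ⟫ * q c ≡ ⟪ g ⟫) v → ∃ λ gs → length gs ≡ n × ⟪ pos 8 ℤ.* a ⟫ * lin v θ ≡ eval gs θ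
    assemble []      []            = [] , refl , zeroʳ _
    assemble (c ∷ v) ((g , e) ∷ h) = let gs , len , e′ = assemble v h in
      g ∷ gs , cong suc len , trans (ring (pos 8 ℤ.* a ∷ []) (q c ∷ θ ∷ lin v θ ∷ []) (λ n c t v → emb n :* (c :+ t :* v) ⊜ emb n :* c :+ t :* (emb n :* v)) refl)
        (cong₂ (λ x y → x + θ * y) e e′)

  -- At the first coefficient g not divisible by p, multiplying by a power of η turns t into gη⁷/p modulo integral elements.
  Uniformizer : Carrier → ℤ → Set
  Uniformizer η p = ∀ g z → Integral z → ⟪ p ⟫ * z ≡ ⟪ g ⟫ * η ^ 7 → p ∣ᶻ g

  divide-out : ∀ {η p μ} → p ≢ 0ℤ → Integral η → Integral μ → η ^ 8 ≡ ⟪ p ⟫ * μ → Uniformizer η p →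
    ∀ gs k {t} → k ℕ.+ length gs ≡ 8 → Integral t → ⟪ p ⟫ * t ≡ η ^ k * eval gs η → ∃ λ hs → length hs ≡ length gs × t ≡ η ^ k * eval hs η
  divide-out {η} {p} {μ} p≢0 I-η I-μ η⁸ unif [] k {t} _ I-t e = [] , refl , cancel p≢0 (trans e (ring (p ∷ []) (η ^ k ∷ []) (λ p e → e :* :0 ⊜ emb p :* (e :* :0)) refl))
  divide-out {η} {p} {μ} p≢0 I-η I-μ η⁸ unif (g ∷ gs) k {t} k+n≡8 I-t e =
    -- Multiplying pt = ηᵏ(g + ηG) by ηⁿ with n + k = 7 gives gη⁷ + η⁸G. Since η⁸ = pμ, subtracting
    -- μG from ηⁿt leaves an integral z with pz = gη⁷, to which the uniformiser property applies.
    let divides h g≡ph = unif g (η ^ n * t - μ * G) (I-- (I-* (I-^ I-η n) I-t) (I-* I-μ (I-eval gs I-η))) pz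
        hs , len , t≡ = divide-out p≢0 I-η I-μ η⁸ unif gs (suc k) {t - η ^ k * ⟪ h ⟫} (trans (sym (ℕₚ.+-suc k (length gs))) k+n≡8) (I-- I-t (I-* (I-^ I-η k) (I-ι h))) (rest h g≡ph)
    in h ∷ hs , cong suc len , restore h hs t≡
    where
    n = length gs
    G = eval gs η
    ηⁿηᵏ : η ^ n * η ^ k ≡ η ^ 7
    ηⁿηᵏ = trans (sym (^-+ η n k)) (cong (η ^_) (ℕₚ.suc-injective (trans (cong suc (ℕₚ.+-comm n k)) (trans (sym (ℕₚ.+-suc k n)) k+n≡8))))
    pz : ⟪ p ⟫ * (η ^ n * t - μ * G) ≡ ⟪ g ⟫ * η ^ 7
    pz = begin
      ⟪ p ⟫ * (η ^ n * t - μ * G)                 ≡⟨ ring (p ∷ []) (η ^ n ∷ t ∷ μ ∷ G ∷ []) (λ p u t m G → emb p :* (u :* t :- m :* G) ⊜ u :* (emb p :* t) :- (emb p :* m) :* G) refl ⟩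
      η ^ n * (⟪ p ⟫ * t) - ⟪ p ⟫ * μ * G         ≡⟨ cong₂ (λ x y → η ^ n * x - y * G) e (sym η⁸) ⟩
      η ^ n * (η ^ k * (⟪ g ⟫ + η * G)) - η ^ 8 * G ≡⟨ cong (_- η ^ 8 * G) (trans (sym (*-assoc (η ^ n) (η ^ k) (⟪ g ⟫ + η * G))) (cong (_* (⟪ g ⟫ + η * G)) ηⁿηᵏ)) ⟩
      η ^ 7 * (⟪ g ⟫ + η * G) - η ^ 8 * G         ≡⟨ ring (g ∷ []) (η ∷ G ∷ []) (λ g e G → e :^ 7 :* (emb g :+ e :* G) :- e :^ 8 :* G ⊜ emb g :* e :^ 7) refl ⟩
      ⟪ g ⟫ * η ^ 7                               ∎
    rest : ∀ h → g ≡ p ℤ.* h → ⟪ p ⟫ * (t - η ^ k * ⟪ h ⟫) ≡ η * η ^ k * eval gs η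
    rest h g≡ph = begin
      ⟪ p ⟫ * (t - η ^ k * ⟪ h ⟫)                                 ≡⟨ ring (p ∷ h ∷ []) (t ∷ η ^ k ∷ []) (λ p h t v → emb p :* (t :- v :* emb h) ⊜ emb p :* t :- v :* emb (p :* h)) refl ⟩
      ⟪ p ⟫ * t - η ^ k * ⟪ p ℤ.* h ⟫                             ≡⟨ cong₂ (λ x y → x - η ^ k * ⟪ y ⟫) e (sym g≡ph) ⟩
      η ^ k * (⟪ g ⟫ + η * eval gs η) - η ^ k * ⟪ g ⟫             ≡⟨ ring (g ∷ []) (η ∷ η ^ k ∷ eval gs η ∷ []) (λ g e v G → v :* (emb g :+ e :* G) :- v :* emb g ⊜ e :* v :* G) refl ⟩
      η * η ^ k * eval gs η                                       ∎
    restore : ∀ h hs → t - η ^ k * ⟪ h ⟫ ≡ η * η ^ k * eval hs η → t ≡ η ^ k * (⟪ h ⟫ + η * eval hs η)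
    restore h hs t≡ = begin
      t                                                ≡⟨ ring (h ∷ []) (t ∷ η ^ k ∷ []) (λ h t v → t ⊜ (t :- v :* emb h) :+ v :* emb h) refl ⟩
      (t - η ^ k * ⟪ h ⟫) + η ^ k * ⟪ h ⟫              ≡⟨ cong (_+ η ^ k * ⟪ h ⟫) t≡ ⟩
      η * η ^ k * eval hs η + η ^ k * ⟪ h ⟫            ≡⟨ ring (h ∷ []) (η ∷ η ^ k ∷ eval hs η ∷ []) (λ h e v H → e :* v :* H :+ v :* emb h ⊜ v :* (emb h :+ e :* H)) refl ⟩
      η ^ k * (⟪ h ⟫ + η * eval hs η)                  ∎

  divide-out₀ : ∀ {η p μ} → p ≢ 0ℤ → Integral η → Integral μ → η ^ 8 ≡ ⟪ p ⟫ * μ → Uniformizer η p →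
    ∀ gs {t} → length gs ≡ 8 → Integral t → ⟪ p ⟫ * t ≡ eval gs η → ∃ λ hs → length hs ≡ 8 × t ≡ eval hs η
  divide-out₀ p≢0 I-η I-μ η⁸ unif gs len I-t e =
    let hs , len′ , t≡ = divide-out p≢0 I-η I-μ η⁸ unif gs 0 len I-t (trans e (sym (*-identityˡ _)))
    in hs , trans len′ len , trans t≡ (*-identityˡ _)

  -- The eighth power of pz = gθ⁷ is p⁸z⁸ = g⁸a⁷ = g⁸p⁷a′⁷, so pz⁸ = g⁸a′⁷ with z⁸ rational and
  -- integral.
  θ-uniformizer : ∀ {p a′} → p ≢ 0ℤ → a ≡ p ℤ.* a′ → (∀ g → p ∣ᶻ g ℤ.^ 8 ℤ.* a′ ℤ.^ 7 → p ∣ᶻ g) → Uniformizer θ p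
  θ-uniformizer {p} {a′} p≢0 a≡ root g z I-z e =
    let k , _ , pk = rational {p} {g ℤ.^ 8 ℤ.* a′ ℤ.^ 7} p≢0 (I-^ I-z 8) pz⁸ in root g (divides k (sym pk))
    where
    pz⁸ : ⟪ p ⟫ * z ^ 8 ≡ ⟪ g ℤ.^ 8 ℤ.* a′ ℤ.^ 7 ⟫
    pz⁸ = cancel (^-≢0 p≢0 7) (begin
      ⟪ p ℤ.^ 7 ⟫ * (⟪ p ⟫ * z ^ 8)                ≡⟨ ring (p ∷ []) (z ∷ []) (λ p z → emb (p :^ 7) :* (emb p :* z :^ 8) ⊜ (emb p :* z) :^ 8) refl ⟩
      (⟪ p ⟫ * z) ^ 8                              ≡⟨ cong (_^ 8) e ⟩
      (⟪ g ⟫ * θ ^ 7) ^ 8                          ≡⟨ ring (g ∷ []) (θ ∷ []) (λ g t → (emb g :* t :^ 7) :^ 8 ⊜ emb (g :^ 8) :* (t :^ 8) :^ 7) refl ⟩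
      ⟪ g ℤ.^ 8 ⟫ * (θ ^ 8) ^ 7                    ≡⟨ cong (λ x → ⟪ g ℤ.^ 8 ⟫ * x ^ 7) (trans θ⁸ (cong ⟪_⟫ a≡)) ⟩
      ⟪ g ℤ.^ 8 ⟫ * ⟪ p ℤ.* a′ ⟫ ^ 7               ≡⟨ ring (p ∷ a′ ∷ g ∷ []) [] (λ p a g → emb (g :^ 8) :* emb (p :* a) :^ 7 ⊜ emb (p :^ 7) :* emb (g :^ 8 :* a :^ 7)) refl ⟩
      ⟪ p ℤ.^ 7 ⟫ * ⟪ g ℤ.^ 8 ℤ.* a′ ℤ.^ 7 ⟫       ∎)

  -- All prime factors of a are removed at once, with p = a and cofactor 1: since a is square-free,
  -- a divides g as soon as it divides g⁸. The factor 8 stays inside the integral element 8t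
  -- meanwhile.
  clear-8 : ∀ {t} → InK t → Integral t → ∃ λ gs → length gs ≡ 8 × ⟪ pos 8 ⟫ * t ≡ eval gs θ
  clear-8 {t} (b , refl) I-t = let gs , len , e = clear-8a b I-t in divide-out₀ {θ} {a} {1#} a≢0 I-θ I-1 (trans θ⁸ (sym (*-identityʳ ⟪ a ⟫)))
      (θ-uniformizer {a} {1ℤ} a≢0 (sym (ℤₚ.*-identityʳ a)) λ { g (divides k p) → squareFree-root⁸ a sf (divides k (trans (sym (ℤₚ.*-identityʳ (g ℤ.^ 8))) p)) })
      gs len (I-* (I-ι (pos 8)) I-t)
      (trans (ring (a ∷ []) (lin b θ ∷ []) (λ a t → emb a :* (lit 8 :* t) ⊜ emb (con (pos 8) :* a) :* t) refl) e)

  relative-norm : (Carrier → Carrier) → Carrier → Carrier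
  relative-norm τ x = x * τ x

  σ² σ⁴ : Carrier → Carrier
  σ² x = σ (σ x)
  σ⁴ x = σ² (σ² x)

  -- The product of the eight conjugates, grouped like the trace.
  norm : Carrier → Carrier
  norm x = relative-norm σ (relative-norm σ² (relative-norm σ⁴ x))

  σ²-* : ∀ x y → σ² (x * y) ≡ σ² x * σ² y
  σ²-* x y = trans (cong σ (σ-* x y)) (σ-* (σ x) (σ y))

  σ⁴-* : ∀ x y → σ⁴ (x * y) ≡ σ⁴ x * σ⁴ y
  σ⁴-* x y = trans (cong σ² (σ²-* x y)) (σ²-* (σ² x) (σ² y))

  relative-norm-* : ∀ τ → (∀ x y → τ (x * y) ≡ τ x * τ y) → ∀ x y → relative-norm τ (x * y) ≡ relative-norm τ x * relative-norm τ y
  relative-norm-* τ τ-* x y = trans (cong (x * y *_) (τ-* x y)) (ring [] (x ∷ y ∷ τ x ∷ τ y ∷ []) (λ x y u v → x :* y :* (u :* v) ⊜ x :* u :* (y :* v)) refl)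

  norm-* : ∀ x y → norm (x * y) ≡ norm x * norm y
  norm-* x y = trans (cong (λ z → relative-norm σ (relative-norm σ² z)) (relative-norm-* σ⁴ σ⁴-* x y))
    (trans (cong (relative-norm σ) (relative-norm-* σ² σ²-* (relative-norm σ⁴ x) (relative-norm σ⁴ y)))
      (relative-norm-* σ σ-* (relative-norm σ² (relative-norm σ⁴ x)) (relative-norm σ² (relative-norm σ⁴ y))))

  I-norm : ∀ {x} → Integral x → Integral (norm x)
  I-norm h = I-* h₂ (I-σ h₂)
    where
    h₁ = I-* h (I-σ (I-σ (I-σ (I-σ h))))
    h₂ = I-* h₁ (I-σ (I-σ h₁))

  norm-fixed : ∀ {x} → σ x ≡ x → norm x ≡ x ^ 8
  norm-fixed {x} e = trans (cong (relative-norm σ) (trans (cong (relative-norm σ²) (cong (x *_) e⁴)) (cong (x * x *_) (trans (cong σ (trans (σ-* x x) (cong₂ _*_ e e))) (trans (σ-* x x) (cong₂ _*_ e e))))))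
    (trans (cong (x * x * (x * x) *_) (trans (σ-* (x * x) (x * x)) (cong (λ y → y * y) (trans (σ-* x x) (cong₂ _*_ e e)))))
      (ring [] (x ∷ []) (λ x → x :* x :* (x :* x) :* (x :* x :* (x :* x)) ⊜ x :^ 8) refl))
    where
    e⁴ : σ⁴ x ≡ x
    e⁴ = trans (cong (λ y → σ (σ (σ y))) e) (trans (cong (λ y → σ (σ y)) e) (trans (cong σ e) e))

  norm-⟪⟫ : ∀ k → norm ⟪ k ⟫ ≡ ⟪ k ℤ.^ 8 ⟫
  norm-⟪⟫ k = trans (norm-fixed (σ-⟪⟫ k)) (⟪⟫-^ k 8)

  norm-^ : ∀ x k → norm (x ^ k) ≡ norm x ^ k
  norm-^ x zero    = trans (norm-fixed σ-1) (ring [] [] (:1 :^ 8 ⊜ :1) refl)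
  norm-^ x (suc k) = trans (norm-* x (x ^ k)) (cong (norm x *_) (norm-^ x k))

  σ²-θ : σ² θ ≡ ζ ^ 2 * θ
  σ²-θ = trans (cong σ σ-θ) (trans (σ-* ζ θ) (trans (cong₂ _*_ σ-ζ σ-θ) (ring [] (ζ ∷ θ ∷ []) (λ z t → z :* (z :* t) ⊜ z :^ 2 :* t) refl)))

  σ²-ζ : σ² ζ ≡ ζ
  σ²-ζ = trans (cong σ σ-ζ) σ-ζ

  σ⁴-θ : σ⁴ θ ≡ - θ
  σ⁴-θ = trans (cong σ² σ²-θ) (trans (σ²-* (ζ ^ 2) θ) (trans (cong₂ _*_ (trans (cong σ (σ-^ ζ 2)) (trans (σ-^ (σ ζ) 2) (cong (_^ 2) σ²-ζ))) σ²-θ)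
    (lc₁ θ ζ⁴ (ring [] (ζ ∷ θ ∷ []) (λ z t → z :^ 2 :* (z :^ 2 :* t) :+ t :* emb (con (ℤ.- 1ℤ)) ⊜ :- t :+ t :* z :^ 4) refl))))

  η : Carrier
  η = θ - 1#

  -- The product telescopes: (θ - 1)(-θ - 1) = 1 - θ², then 1 - θ⁴, then 1 - a.
  norm-η : norm η ≡ ⟪ 1ℤ ℤ.- a ⟫
  norm-η = begin
    norm η                                                    ≡⟨ cong (λ y → relative-norm σ (relative-norm σ² (η * y))) σ⁴-η ⟩
    relative-norm σ (relative-norm σ² ((θ - 1#) * (- θ - 1#)))   ≡⟨ cong (λ y → relative-norm σ (relative-norm σ² y)) (ring [] (θ ∷ []) (λ t → (t :- :1) :* (:- t :- :1) ⊜ :1 :- t :* t) refl) ⟩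
    relative-norm σ (relative-norm σ² (1# - θ * θ))             ≡⟨ cong (relative-norm σ) (trans (cong ((1# - θ * θ) *_) σ²-1-φ) (ring [] (θ ∷ []) (λ t → (:1 :- t :* t) :* (:1 :+ t :* t) ⊜ :1 :- t :^ 4) refl)) ⟩
    relative-norm σ (1# - θ ^ 4)                              ≡⟨ cong ((1# - θ ^ 4) *_) σ-1-ρ ⟩
    (1# - θ ^ 4) * (1# + θ ^ 4)                               ≡⟨ lc₁ (- 1#) θ⁸ (ring (a ∷ []) (θ ∷ []) (λ a t → (:1 :- t :^ 4) :* (:1 :+ t :^ 4) :+ :- :1 :* emb a ⊜ emb (con 1ℤ :- a) :+ :- :1 :* t :^ 8) refl) ⟩
    ⟪ 1ℤ ℤ.- a ⟫                                              ∎
    where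
    σ⁴-η : σ⁴ η ≡ - θ - 1#
    σ⁴-η = trans (cong (λ y → σ (σ (σ y))) (σ-- θ 1#)) (trans (cong (λ y → σ (σ y)) (σ-- (σ θ) (σ 1#))) (trans (cong σ (σ-- (σ² θ) (σ² 1#))) (trans (σ-- _ _)
      (cong₂ _-_ σ⁴-θ (trans (cong (λ y → σ (σ (σ y))) σ-1) (trans (cong (λ y → σ (σ y)) σ-1) (trans (cong σ σ-1) σ-1)))))))
    σ²-1-φ : σ² (1# - θ * θ) ≡ 1# + θ * θ
    σ²-1-φ = trans (cong σ (σ-- 1# (θ * θ))) (trans (σ-- (σ 1#) (σ (θ * θ))) (trans (cong₂ _-_ (trans (cong σ σ-1) σ-1) (trans (σ²-* θ θ) (cong (λ y → y * y) σ²-θ)))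
      (lc₁ (- (θ * θ)) ζ⁴ (ring [] (ζ ∷ θ ∷ []) (λ z t → :1 :- z :^ 2 :* t :* (z :^ 2 :* t) :+ :- (t :* t) :* emb (con (ℤ.- 1ℤ)) ⊜ :1 :+ t :* t :+ :- (t :* t) :* z :^ 4) refl))))
    σ-1-ρ : σ (1# - θ ^ 4) ≡ 1# + θ ^ 4
    σ-1-ρ = trans (σ-- 1# (θ ^ 4)) (trans (cong₂ _-_ σ-1 (trans (σ-^ θ 4) (cong (_^ 4) σ-θ)))
      (lc₁ (- (θ ^ 4)) ζ⁴ (ring [] (ζ ∷ θ ∷ []) (λ z t → :1 :- (z :* t) :^ 4 :+ :- (t :^ 4) :* emb (con (ℤ.- 1ℤ)) ⊜ :1 :+ t :^ 4 :+ :- (t :^ 4) :* z :^ 4) refl)))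

  -- Taking norms of 2z = gη⁷ gives 2⁸N(z) = g⁸(2o)⁷, so 2N(z) = g⁸o⁷ with an integer N(z), and g is
  -- even. Norms are needed because no power of θ - 1 is rational as θ⁸ is.
  η-uniformizer : ∀ {o} → Odd o → 1ℤ ℤ.- a ≡ pos 2 ℤ.* o → Uniformizer η (pos 2)
  η-uniformizer {o} o-odd a≡ g z I-z e =
    let k , _ , e′ = rational {pos 2} {g ℤ.^ 8 ℤ.* o ℤ.^ 7} (λ ()) (I-norm I-z) 2norm
        h , g≡ = even-root {g} {o ℤ.^ 7} {8} {k} (odd-^ o-odd 7) e′
    in divides h g≡
    where
    2norm : ⟪ pos 2 ⟫ * norm z ≡ ⟪ g ℤ.^ 8 ℤ.* o ℤ.^ 7 ⟫
    2norm = cancel {pos 2 ℤ.^ 7} (λ ()) (begin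
      ⟪ pos 2 ℤ.^ 7 ⟫ * (⟪ pos 2 ⟫ * norm z)             ≡⟨ ring [] (norm z ∷ []) (λ n → emb (con (pos 2) :^ 7) :* (lit 2 :* n) ⊜ emb (con (pos 2 ℤ.^ 8)) :* n) refl ⟩
      ⟪ pos 2 ℤ.^ 8 ⟫ * norm z                           ≡⟨ trans (norm-* ⟪ pos 2 ⟫ z) (cong (_* norm z) (norm-⟪⟫ (pos 2))) ⟨
      norm (⟪ pos 2 ⟫ * z)                               ≡⟨ cong norm e ⟩
      norm (⟪ g ⟫ * η ^ 7)                               ≡⟨ trans (norm-* ⟪ g ⟫ (η ^ 7)) (cong₂ _*_ (norm-⟪⟫ g) (trans (norm-^ η 7) (cong (_^ 7) (trans norm-η (cong ⟪_⟫ a≡))))) ⟩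
      ⟪ g ℤ.^ 8 ⟫ * ⟪ pos 2 ℤ.* o ⟫ ^ 7                  ≡⟨ ring (g ∷ o ∷ []) [] (λ g o → emb (g :^ 8) :* emb (con (pos 2) :* o) :^ 7 ⊜ emb (con (pos 2) :^ 7) :* emb (g :^ 8 :* o :^ 7)) refl ⟩
      ⟪ pos 2 ℤ.^ 7 ⟫ * ⟪ g ℤ.^ 8 ℤ.* o ℤ.^ 7 ⟫          ∎)

  halve³ : ∀ {x μ} → Integral x → Integral μ → x ^ 8 ≡ ⟪ pos 2 ⟫ * μ → Uniformizer x (pos 2) →
    ∀ gs {t} → length gs ≡ 8 → Integral t → ⟪ pos 8 ⟫ * t ≡ eval gs x → ∃ λ hs → length hs ≡ 8 × t ≡ eval hs x
  halve³ {x} I-x I-μ x⁸ unif gs {t} len I-t e =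
    let gs₁ , len₁ , e₁ = half gs len (I-* (I-ι (pos 4)) I-t) (trans (ring [] (t ∷ []) (λ t → lit 2 :* (lit 4 :* t) ⊜ lit 8 :* t) refl) e)
        gs₂ , len₂ , e₂ = half gs₁ len₁ (I-* (I-ι (pos 2)) I-t) (trans (ring [] (t ∷ []) (λ t → lit 2 :* (lit 2 :* t) ⊜ lit 4 :* t) refl) e₁)
    in half gs₂ len₂ I-t e₂
    where
    half : ∀ gs {t} → length gs ≡ 8 → Integral t → ⟪ pos 2 ⟫ * t ≡ eval gs x → ∃ λ hs → length hs ≡ 8 × t ≡ eval hs x
    half gs = divide-out₀ (λ ()) I-x I-μ x⁸ unif gs

  prepend : ℤ → ℤ → List ℤ → List ℤ
  prepend g c []       = g ∷ []
  prepend g c (l ∷ ls) = (g ℤ.+ c ℤ.* l) ∷ prepend l c ls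

  eval-prepend : ∀ g c ls x → eval (prepend g c ls) x ≡ ⟪ g ⟫ + (x + ⟪ c ⟫) * eval ls x
  eval-prepend g c []       x = ring (g ∷ c ∷ []) (x ∷ []) (λ g c x → emb g :+ x :* :0 ⊜ emb g :+ (x :+ emb c) :* :0) refl
  eval-prepend g c (l ∷ ls) x = trans (cong (λ y → ⟪ g ℤ.+ c ℤ.* l ⟫ + x * y) (eval-prepend l c ls x))
    (ring (g ∷ c ∷ l ∷ []) (x ∷ eval ls x ∷ []) (λ g c l x y → emb (g :+ c :* l) :+ x :* (emb l :+ (x :+ emb c) :* y) ⊜ emb g :+ (x :+ emb c) :* (emb l :+ x :* y)) refl)

  length-prepend : ∀ g c ls → length (prepend g c ls) ≡ suc (length ls)
  length-prepend g c []       = refl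
  length-prepend g c (l ∷ ls) = cong suc (length-prepend l c ls)

  -- Coefficients of the polynomial shifted by c, to pass between powers of θ and powers of θ - 1.
  -- `prepend` is one Horner step, g + (x + c) times the rest.
  taylor : ℤ → List ℤ → List ℤ
  taylor c []       = []
  taylor c (g ∷ gs) = prepend g c (taylor c gs)

  eval-taylor : ∀ c gs x → eval (taylor c gs) x ≡ eval gs (x + ⟪ c ⟫)
  eval-taylor c []       x = refl
  eval-taylor c (g ∷ gs) x = trans (eval-prepend g c (taylor c gs) x) (cong (λ y → ⟪ g ⟫ + (x + ⟪ c ⟫) * y) (eval-taylor c gs x))

  length-taylor : ∀ c gs → length (taylor c gs) ≡ length gs
  length-taylor c []       = refl
  length-taylor c (g ∷ gs) = trans (length-prepend g c (taylor c gs)) (cong suc (length-taylor c gs))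

  maximal-even : ∀ {a′} → Odd a′ → a ≡ pos 2 ℤ.* a′ → ∀ {t} → InK t → Integral t → ∃ λ gs → t ≡ eval gs θ
  maximal-even {a′} a′-odd a≡ t∈K I-t =
    let gs , len , e = clear-8 t∈K I-t
        hs , _ , t≡ = halve³ {θ} {⟪ a′ ⟫} I-θ (I-ι a′) (trans θ⁸ (trans (cong ⟪_⟫ a≡) (⟪⟫-* (pos 2) a′))) (θ-uniformizer {pos 2} {a′} (λ ()) a≡ root) gs len I-t e
    in hs , t≡
    where
    root : ∀ g → pos 2 ∣ᶻ g ℤ.^ 8 ℤ.* a′ ℤ.^ 7 → pos 2 ∣ᶻ g
    root g (divides k p) = let h , q = even-root {g} {a′ ℤ.^ 7} {8} {k} (odd-^ a′-odd 7) (sym p) in divides h q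

  maximal-3-mod-4 : ∀ {c} → a ≡ pos 4 ℤ.* c ℤ.+ pos 3 → ∀ {t} → InK t → Integral t → ∃ λ gs → t ≡ eval gs θ
  maximal-3-mod-4 {c} a≡ t∈K I-t =
    let gs , len , e = clear-8 t∈K I-t
        hs , _ , t≡ = halve³ {η} {eval μ θ} (I-- I-θ I-1) (I-eval μ I-θ) η⁸ (η-uniformizer {ℤ.- (pos 2 ℤ.* c ℤ.+ 1ℤ)} (ℤ.- c ℤ.- 1ℤ , o-odd c) (trans (cong (λ x → 1ℤ ℤ.- x) a≡) (o≡ c)))
          (taylor 1ℤ gs) (trans (length-taylor 1ℤ gs) len) I-t (trans e (trans (cong (eval gs) (ring [] (θ ∷ []) (λ t → t ⊜ t :- :1 :+ emb (con 1ℤ)) refl)) (sym (eval-taylor 1ℤ gs η))))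
    in taylor (ℤ.- 1ℤ) hs , trans t≡ (trans (cong (eval hs) (ring [] (θ ∷ []) (λ t → t :- :1 ⊜ t :+ emb (con (ℤ.- 1ℤ))) refl)) (sym (eval-taylor (ℤ.- 1ℤ) hs θ)))
    where
    -- Half of the expansion of (θ - 1)⁸: the coefficients are the signed binomials of 8 divided by
    -- 2, and θ⁸ = 4c + 3 joins the constant term 1 to make (4c + 4)/2.
    μ = (pos 2 ℤ.* c ℤ.+ pos 2) ∷ ℤ.- pos 4 ∷ pos 14 ∷ ℤ.- pos 28 ∷ pos 35 ∷ ℤ.- pos 28 ∷ pos 14 ∷ ℤ.- pos 4 ∷ []
    o-odd : ∀ c → ℤ.- (pos 2 ℤ.* c ℤ.+ 1ℤ) ≡ pos 2 ℤ.* (ℤ.- c ℤ.- 1ℤ) ℤ.+ 1ℤ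
    o-odd = solve-∀
    o≡ : ∀ c → 1ℤ ℤ.- (pos 4 ℤ.* c ℤ.+ pos 3) ≡ pos 2 ℤ.* (ℤ.- (pos 2 ℤ.* c ℤ.+ 1ℤ))
    o≡ = solve-∀
    η⁸ : η ^ 8 ≡ ⟪ pos 2 ⟫ * eval μ θ
    η⁸ = lc₁ 1# (trans θ⁸ (cong ⟪_⟫ a≡)) (ring (c ∷ []) (θ ∷ []) (λ c t →
      (t :- :1) :^ 8 :+ :1 :* emb (con (pos 4) :* c :+ con (pos 3)) ⊜
      lit 2 :* (emb (con (pos 2) :* c :+ con (pos 2)) :+ t :* (emb (con (ℤ.- pos 4)) :+ t :* (lit 14 :+ t :* (emb (con (ℤ.- pos 28)) :+ t :* (lit 35 :+ t :* (emb (con (ℤ.- pos 28)) :+ t :* (lit 14 :+ t :* (emb (con (ℤ.- pos 4)) :+ t :* :0))))))))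
      :+ :1 :* t :^ 8) refl)

  -- Monic integer equations for the elements of ℤ[θ].

  record IsSubring (P : Carrier → Set) : Set where
    field
      P-⟪⟫ : ∀ z → P ⟪ z ⟫
      P-+  : ∀ {x y} → P x → P y → P (x + y)
      P-*  : ∀ {x y} → P x → P y → P (x * y)
    P-0 : P 0#
    P-0 = subst P ⟪0⟫ (P-⟪⟫ 0ℤ)
    P-1 : P 1#
    P-1 = subst P ⟪1⟫ (P-⟪⟫ 1ℤ)
  open IsSubring

  data InAdjoin (P : Carrier → Set) (r : Carrier) : Carrier → Set where
    adj : ∀ {x} y z → P y → P z → x ≡ y + z * r → InAdjoin P r x

  adjoin-isSubring : ∀ {P r} → IsSubring P → P (r * r) → IsSubring (InAdjoin P r)
  adjoin-isSubring {P} {r} s r² = record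
    { P-⟪⟫ = λ z → adj ⟪ z ⟫ 0# (P-⟪⟫ s z) (P-0 s) (ring (z ∷ []) (r ∷ []) (λ z r → emb z ⊜ emb z :+ :0 :* r) refl)
    ; P-+ = λ { (adj y z p q refl) (adj y′ z′ p′ q′ refl) → adj (y + y′) (z + z′) (P-+ s p p′) (P-+ s q q′)
        (ring [] (r ∷ y ∷ z ∷ y′ ∷ z′ ∷ []) (λ r y z u v → y :+ z :* r :+ (u :+ v :* r) ⊜ y :+ u :+ (z :+ v) :* r) refl) }
    ; P-* = λ { (adj y z p q refl) (adj y′ z′ p′ q′ refl) → adj (y * y′ + r * r * (z * z′)) (y * z′ + z * y′)
        (P-+ s (P-* s p p′) (P-* s r² (P-* s q q′))) (P-+ s (P-* s p q′) (P-* s q p′))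
        (ring [] (r ∷ y ∷ z ∷ y′ ∷ z′ ∷ []) (λ r y z u v → (y :+ z :* r) :* (u :+ v :* r) ⊜ y :* u :+ r :* r :* (z :* v) :+ (y :* v :+ z :* u) :* r) refl) }
    }

  adjoin-base : ∀ {P r x} → IsSubring P → P x → InAdjoin P r x
  adjoin-base {r = r} {x} s p = adj x 0# p (P-0 s) (ring [] (r ∷ x ∷ []) (λ r x → x ⊜ x :+ :0 :* r) refl)

  adjoin-root : ∀ {P r} → IsSubring P → InAdjoin P r r
  adjoin-root {r = r} s = adj 0# 1# (P-0 s) (P-1 s) (ring [] (r ∷ []) (λ r → r ⊜ :0 :+ :1 :* r) refl)

  -- Polynomials in t of degree below n with coefficients in P, in Horner form. That tⁿ lies in
  -- `Span P t n` is a monic equation of degree n over P.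
  data Span (P : Carrier → Set) (t : Carrier) : ℕ → Carrier → Set where
    nil  : Span P t 0 0#
    cons : ∀ {n c x} → P c → Span P t n x → Span P t (suc n) (c + t * x)

  module _ {P : Carrier → Set} (s : IsSubring P) {t : Carrier} where

    span-0 : ∀ n → Span P t n 0#
    span-0 zero    = nil
    span-0 (suc n) = subst (Span P t (suc n)) (ring [] (t ∷ []) (λ t → :0 :+ t :* :0 ⊜ :0) refl) (cons (P-0 s) (span-0 n))

    span-scale : ∀ {n c x} → P c → Span P t n x → Span P t n (c * x)
    span-scale {c = c} p nil = subst (Span P t 0) (sym (zeroʳ c)) nil
    span-scale {c = c} p (cons {n} {d} {x} q h) = subst (Span P t (suc n)) (ring [] (t ∷ c ∷ d ∷ x ∷ []) (λ t c d x → c :* d :+ t :* (c :* x) ⊜ c :* (d :+ t :* x)) refl)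
      (cons (P-* s p q) (span-scale p h))

    span-+ : ∀ {n x y} → Span P t n x → Span P t n y → Span P t n (x + y)
    span-+ nil nil = subst (Span P t 0) (sym (+-identityˡ 0#)) nil
    span-+ (cons {n} {c} {x} p h) (cons {c = d} {y} q k) = subst (Span P t (suc n)) (ring [] (t ∷ c ∷ d ∷ x ∷ y ∷ []) (λ t c d x y → c :+ d :+ t :* (x :+ y) ⊜ c :+ t :* x :+ (d :+ t :* y)) refl)
      (cons (P-+ s p q) (span-+ h k))

    span-weaken : ∀ {n x} m → Span P t n x → Span P t (n ℕ.+ m) x
    span-weaken m nil        = span-0 m
    span-weaken m (cons p h) = cons p (span-weaken m h)

    span-shift : ∀ {n x} → Span P t n x → Span P t (suc n) (t * x)
    span-shift {n} {x} h = subst (Span P t (suc n)) (+-identityˡ (t * x)) (cons (P-0 s) h)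

    span-^ : ∀ {n x} m → Span P t n x → Span P t (m ℕ.+ n) (t ^ m * x)
    span-^ {n} {x} zero    h = subst (Span P t n) (sym (*-identityˡ x)) h
    span-^ {n} {x} (suc m) h = subst (Span P t (suc m ℕ.+ n)) (sym (*-assoc t (t ^ m) x)) (span-shift (span-^ m h))

    span-* : ∀ {m n x y} → Span P t m x → Span P t n y → Span P t (m ℕ.+ n) (x * y)
    span-* {n = n} {y = y} nil k = subst (Span P t n) (sym (zeroˡ y)) (span-0 n)
    span-* {n = n} {y = y} (cons {m} {c} {x} p h) k = subst (Span P t (suc m ℕ.+ n)) (ring [] (t ∷ c ∷ x ∷ y ∷ []) (λ t c x y → c :* y :+ t :* (x :* y) ⊜ (c :+ t :* x) :* y) refl)
      (span-+ (subst (λ j → Span P t j (c * y)) (ℕₚ.+-comm n (suc m)) (span-weaken (suc m) (span-scale p k))) (span-shift (span-* h k)))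

    span-split : ∀ {r n x} → Span (InAdjoin P r) t n x → Σ Carrier λ y → Σ Carrier λ z → Span P t n y × Span P t n z × x ≡ y + z * r
    span-split {r} nil = 0# , 0# , nil , nil , ring [] (r ∷ []) (λ r → :0 ⊜ :0 :+ :0 :* r) refl
    span-split {r} (cons (adj y z p q refl) h) with span-split h
    ... | y′ , z′ , k , l , refl = y + t * y′ , z + t * z′ , cons p k , cons q l ,
      ring [] (r ∷ t ∷ y ∷ z ∷ y′ ∷ z′ ∷ []) (λ r t y z u v → y :+ z :* r :+ t :* (u :+ v :* r) ⊜ y :+ t :* u :+ (z :+ t :* v) :* r) refl

    -- tⁿ = y + z r with y, z of lower degree gives (tⁿ - y)² = r² z².
    span-descend : ∀ {r} n → P (r * r) → Span (InAdjoin P r) t n (t ^ n) → Span P t (n ℕ.+ n) (t ^ (n ℕ.+ n))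
    span-descend {r} n r² h =
      let y , z , k , l , e = span-split h
      in subst (Span P t (n ℕ.+ n)) (trans (cancel-square y z e) (sym (^-+ t n n)))
           (span-+ (span-+ (span-scale (P-⟪⟫ s (pos 2)) (span-^ n k)) (span-scale (P-⟪⟫ s (ℤ.- 1ℤ)) (span-* k k))) (span-scale r² (span-* l l)))
      where
      cancel-square : ∀ y z → t ^ n ≡ y + z * r → ⟪ pos 2 ⟫ * (t ^ n * y) + ⟪ ℤ.- 1ℤ ⟫ * (y * y) + r * r * (z * z) ≡ t ^ n * t ^ n
      cancel-square y z e = trans (cong (λ w → ⟪ pos 2 ⟫ * (w * y) + ⟪ ℤ.- 1ℤ ⟫ * (y * y) + r * r * (z * z)) e) (trans
        (ring [] (y ∷ z ∷ r ∷ []) (λ y z r → lit 2 :* ((y :+ z :* r) :* y) :+ emb (con (ℤ.- 1ℤ)) :* (y :* y) :+ r :* r :* (z :* z) ⊜ (y :+ z :* r) :* (y :+ z :* r)) refl)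
        (sym (cong (λ w → w * w) e)))

  data InZ : Carrier → Set where
    int : ∀ {x} z → x ≡ ⟪ z ⟫ → InZ x

  Z-isSubring : IsSubring InZ
  Z-isSubring = record
    { P-⟪⟫ = λ z → int z refl
    ; P-+ = λ { (int x refl) (int y refl) → int (x ℤ.+ y) (sym (⟪⟫-+ x y)) }
    ; P-* = λ { (int x refl) (int y refl) → int (x ℤ.* y) (sym (⟪⟫-* x y)) } }

  InZρ InZφ InZθ : Carrier → Set
  InZρ = InAdjoin InZ (θ ^ 4)
  InZφ = InAdjoin InZρ (θ ^ 2)
  InZθ = InAdjoin InZφ θ

  ρ²∈ : InZ (θ ^ 4 * θ ^ 4)
  ρ²∈ = int a (trans (sym (^-+ θ 4 4)) θ⁸)

  Zρ-isSubring : IsSubring InZρ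
  Zρ-isSubring = adjoin-isSubring Z-isSubring ρ²∈

  φ²∈ : InZρ (θ ^ 2 * θ ^ 2)
  φ²∈ = subst InZρ (^-+ θ 2 2) (adjoin-root Z-isSubring)

  Zφ-isSubring : IsSubring InZφ
  Zφ-isSubring = adjoin-isSubring Zρ-isSubring φ²∈

  θ²∈ : InZφ (θ * θ)
  θ²∈ = subst InZφ (cong (θ *_) (*-identityʳ θ)) (adjoin-root Zρ-isSubring)

  Zθ-isSubring : IsSubring InZθ
  Zθ-isSubring = adjoin-isSubring Zφ-isSubring θ²∈

  eval-∈ : ∀ {P x} → IsSubring P → P x → ∀ cs → P (eval cs x)
  eval-∈ s p []       = P-0 s
  eval-∈ s p (c ∷ cs) = P-+ s (P-⟪⟫ s c) (P-* s p (eval-∈ s p cs))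

  span-eval : ∀ {t n x} → Span InZ t n x → ∃ λ cs → length cs ≡ n × - x ≡ eval cs t
  span-eval nil = [] , refl , ring [] [] (:- :0 ⊜ :0) refl
  span-eval {t} (cons {x = x} (int c refl) h) = let cs , len , e = span-eval h in
    ℤ.- c ∷ cs , cong suc len , trans (ring (c ∷ []) (t ∷ x ∷ []) (λ c t x → :- (emb c :+ t :* x) ⊜ emb (:- c) :+ t :* (:- x)) refl) (cong (λ y → ⟪ ℤ.- c ⟫ + t * y) e)

  -- `IsIntegral` demands an actual monic polynomial, which common denominators do not supply. The
  -- trivial equation of t over ℤ[θ] is squared down through ℤ[θ²] and ℤ[θ⁴] to ℤ, its degree
  -- growing from 1 to 8.
  Zθ-integral : ∀ {t} → InZθ t → ∃ λ cs → t ^ length cs + eval cs t ≡ 0#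
  Zθ-integral {t} h = finish (span-eval t⁸)
    where
    t¹ : Span InZθ t 1 (t ^ 1)
    t¹ = subst (Span InZθ t 1) (ring [] (t ∷ []) (λ t → t :+ t :* :0 ⊜ t :^ 1) refl) (cons h nil)
    t² : Span InZφ t 2 (t ^ 2)
    t² = span-descend Zφ-isSubring {r = θ} 1 θ²∈ t¹
    t⁴ : Span InZρ t 4 (t ^ 4)
    t⁴ = span-descend Zρ-isSubring {r = θ ^ 2} 2 φ²∈ t²
    t⁸ : Span InZ t 8 (t ^ 8)
    t⁸ = span-descend Z-isSubring {r = θ ^ 4} 4 ρ²∈ t⁴
    finish : (∃ λ cs → length cs ≡ 8 × - (t ^ 8) ≡ eval cs t) → ∃ λ cs → t ^ length cs + eval cs t ≡ 0#
    finish (cs , len , e) = cs , trans (cong₂ (λ n y → t ^ n + y) len (sym e)) (-‿inverseʳ (t ^ 8))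

  -- The image of α^x is θ^(ux) = θ^(8y+1) = a^y θ, so α^x / a^y is the element of K that lies over
  -- θ.
  e-θ : ∀ {x y} → u ℕ.* x ≡ 8 ℕ.* y ℕ.+ 1 → ∀ θᴷ → scale (ι (a ℤ.^ y)) θᴷ ≡ powK m αK x → e θᴷ ≡ θ
  e-θ {x} {y} ux θᴷ h = cancel (^-≢0 a≢0 y) (begin
    ⟪ a ℤ.^ y ⟫ * e θᴷ            ≡⟨ trans (e-scale (ι (a ℤ.^ y)) θᴷ) (cong (_* e θᴷ) (sym (⟪⟫-q (a ℤ.^ y)))) ⟨
    e (scale (ι (a ℤ.^ y)) θᴷ)    ≡⟨ cong e h ⟩
    e (powK m αK x)               ≡⟨ trans (e-^ αK x) (cong (_^ x) e-α) ⟩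
    α ^ x                         ≡⟨ trans (^-∘-* θ u x) (cong (θ ^_) ux) ⟩
    θ ^ (8 ℕ.* y ℕ.+ 1)           ≡⟨ ^-+ θ (8 ℕ.* y) 1 ⟩
    θ ^ (8 ℕ.* y) * θ ^ 1         ≡⟨ cong₂ _*_ (trans (sym (^-∘-* θ 8 y)) (trans (cong (_^ y) θ⁸) (⟪⟫-^ a y))) (*-identityʳ θ) ⟩
    ⟪ a ℤ.^ y ⟫ * θ               ∎)

  ring-of-integers : (∀ {t} → InK t → Integral t → ∃ λ gs → t ≡ eval gs θ) → ∀ θᴷ → e θᴷ ≡ θ → RingOfIntegersIs m θᴷ
  ring-of-integers maximal θᴷ eθ = (λ β h → coordinates β (maximal (InK-e β) (integral⇒ h))) , (λ { β (gs , refl) → relation gs (Zθ-integral (Zθ∋ gs)) })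
    where
    coordinates : ∀ β → (∃ λ gs → e β ≡ eval gs θ) → InZ[ m ] θᴷ β
    coordinates β (gs , t≡) = gs , e-inj (trans (e-eval gs θᴷ) (trans (cong (eval gs) eθ) (sym t≡)))
    Zθ∋ : ∀ gs → InZθ (e (evalℤ m gs θᴷ))
    Zθ∋ gs = subst InZθ (sym (trans (e-eval gs θᴷ) (cong (eval gs) eθ))) (eval-∈ Zθ-isSubring (adjoin-root Zφ-isSubring) gs)
    relation : ∀ gs → (∃ λ cs → e (evalℤ m gs θᴷ) ^ length cs + eval cs (e (evalℤ m gs θᴷ)) ≡ 0#) → IsIntegral m (evalℤ m gs θᴷ)
    relation gs (cs , h) = integral⇐ cs h

  -- α^x / a^y
  root-of-a : ∀ {x y} → u ℕ.* x ≡ 8 ℕ.* y ℕ.+ 1 → Σ K λ θᴷ → e θᴷ ≡ θ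
  root-of-a {x} {y} ux = build (inverse (^-≢0 a≢0 y))
    where
    build : (∃ λ r → q r * ⟪ a ℤ.^ y ⟫ ≡ 1#) → Σ K λ θᴷ → e θᴷ ≡ θ
    build (r , inv) = scale r (powK m αK x) , e-θ {x} {y} ux (scale r (powK m αK x)) (e-inj {scale (ι (a ℤ.^ y)) (scale r (powK m αK x))} {powK m αK x} (begin
      e (scale (ι (a ℤ.^ y)) (scale r (powK m αK x)))  ≡⟨ trans (e-scale (ι (a ℤ.^ y)) (scale r (powK m αK x))) (cong₂ _*_ (sym (⟪⟫-q (a ℤ.^ y))) (e-scale r (powK m αK x))) ⟩
      ⟪ a ℤ.^ y ⟫ * (q r * e (powK m αK x))     ≡⟨ trans (sym (*-assoc ⟪ a ℤ.^ y ⟫ (q r) (e (powK m αK x)))) (cong (_* e (powK m αK x)) (trans (*-comm ⟪ a ℤ.^ y ⟫ (q r)) inv)) ⟩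
      1# * e (powK m αK x)                      ≡⟨ *-identityˡ _ ⟩
      e (powK m αK x)                           ∎))

  -- Part (2), a = 4c + 1: the subfields ℚ(√a) and ℚ(⁴√a) and their integers.

  module Generators (c : ℤ) (a≡ : a ≡ pos 4 ℤ.* c ℤ.+ 1ℤ) where

    open IsSubring

    abstract
      -- These are ⁴√a, √a, √-1 and √-a. They are abstract so that the solver treats them as
      -- independent variables, and each relation between them is invoked explicitly.
      φ ρ i ι√ : Carrier
      φ = θ * θ
      ρ = φ * φ
      i = ζ * ζ
      ι√ = i * ρ

      φ-def : φ ≡ θ * θ
      φ-def = refl
      ρ-def : ρ ≡ φ * φ
      ρ-def = refl
      i-def : i ≡ ζ * ζ
      i-def = refl
      ι-def : ι√ ≡ i * ρ
      ι-def = refl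

      ½ : Carrier
      ½ = q (proj₁ (inverse {pos 2} (λ ())))

      2½ : ⟪ pos 2 ⟫ * ½ ≡ 1#
      2½ = trans (*-comm ⟪ pos 2 ⟫ ½) (proj₂ (inverse {pos 2} (λ ())))

    abstract
      ρρ : ρ * ρ ≡ ⟪ a ⟫
      ρρ = trans (cong (λ x → x * x) (trans ρ-def (cong (λ x → x * x) φ-def))) (trans (ring [] (θ ∷ []) (λ t → t :* t :* (t :* t) :* (t :* t :* (t :* t)) ⊜ t :^ 8) refl) θ⁸)

      ii : i * i ≡ ⟪ ℤ.- 1ℤ ⟫
      ii = trans (cong (λ x → x * x) i-def) (trans (ring [] (ζ ∷ []) (λ t → t :* t :* (t :* t) ⊜ t :^ 4) refl) ζ⁴)

      σ-i : σ i ≡ i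
      σ-i = trans (cong σ i-def) (trans (σ-* ζ ζ) (trans (cong (λ x → x * x) σ-ζ) (sym i-def)))

      σ-φ : σ φ ≡ i * φ
      σ-φ = trans (cong σ φ-def) (trans (σ-* θ θ) (trans (cong (λ x → x * x) σ-θ)
        (trans (ring [] (ζ ∷ θ ∷ []) (λ z t → z :* t :* (z :* t) ⊜ z :* z :* (t :* t)) refl) (cong₂ _*_ (sym i-def) (sym φ-def)))))

      σ-ρ : σ ρ ≡ - ρ
      σ-ρ = trans (cong σ ρ-def) (trans (σ-* φ φ) (trans (cong (λ x → x * x) σ-φ)
        (lc₂ (φ * φ) ii 1# ρ-def (ring [] (i ∷ φ ∷ ρ ∷ []) (λ i f r → i :* f :* (i :* f) :+ (f :* f :* emb (con (ℤ.- 1ℤ)) :+ :1 :* (f :* f)) ⊜ :- r :+ (f :* f :* (i :* i) :+ :1 :* r)) refl))))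

      σ²-i : σ² i ≡ i
      σ²-i = trans (cong σ σ-i) σ-i

      σ²-φ : σ² φ ≡ - φ
      σ²-φ = trans (cong σ σ-φ) (trans (σ-* i φ) (trans (cong₂ _*_ σ-i σ-φ) (lc₁ φ ii (ring [] (i ∷ φ ∷ []) (λ i f → i :* (i :* f) :+ f :* emb (con (ℤ.- 1ℤ)) ⊜ :- f :+ f :* (i :* i)) refl))))

      σ²-ρ : σ² ρ ≡ ρ
      σ²-ρ = trans (cong σ σ-ρ) (trans (σ-neg ρ) (trans (cong -_ σ-ρ) (ring [] (ρ ∷ []) (λ r → :- (:- r) ⊜ r) refl)))

      ιι : ι√ * ι√ ≡ ⟪ ℤ.- a ⟫
      ιι = trans (cong (λ x → x * x) ι-def) (lc₂ (ρ * ρ) ii (- 1#) ρρ (ring (a ∷ []) (i ∷ ρ ∷ []) (λ a i r →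
        i :* r :* (i :* r) :+ (r :* r :* emb (con (ℤ.- 1ℤ)) :+ :- :1 :* emb a) ⊜ emb (:- a) :+ (r :* r :* (i :* i) :+ :- :1 :* (r :* r))) refl))

      σ-ι : σ ι√ ≡ - ι√
      σ-ι = trans (cong σ ι-def) (trans (σ-* i ρ) (trans (cong₂ _*_ σ-i σ-ρ) (trans (ring [] (i ∷ ρ ∷ []) (λ i r → i :* (:- r) ⊜ :- (i :* r)) refl) (cong -_ (sym ι-def)))))

      I-φ : Integral φ
      I-φ = subst Integral (sym φ-def) (I-* I-θ I-θ)
      I-ρ : Integral ρ
      I-ρ = subst Integral (sym ρ-def) (I-* I-φ I-φ)
      I-i : Integral i
      I-i = subst Integral (sym i-def) (I-* I-ζ I-ζ)
      I-ι√ : Integral ι√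
      I-ι√ = subst Integral (sym ι-def) (I-* I-i I-ρ)

      a-odd : Odd a
      a-odd = pos 2 ℤ.* c , trans a≡ (lem c)
        where lem : ∀ c → pos 4 ℤ.* c ℤ.+ 1ℤ ≡ pos 2 ℤ.* (pos 2 ℤ.* c) ℤ.+ 1ℤ
              lem = solve-∀

    2^_ : ℕ → ℤ
    2^ k = pos 2 ℤ.^ k

    2^≢0 : ∀ k → 2^ k ≢ 0ℤ
    2^≢0 k = ^-≢0 (λ ()) k

    -- The elements of ℤ[1/2]. Once the denominators of t are known to divide 8, all rational
    -- coordinates lie here, and an odd factor such as a can be cancelled from their integrality.
    data Dyadic : Carrier → Set where
      dyadic : ∀ {x} k n → ⟪ 2^ k ⟫ * x ≡ ⟪ n ⟫ → Dyadic x

    2^-+ : ∀ j k → ⟪ 2^ (j ℕ.+ k) ⟫ ≡ ⟪ 2^ j ⟫ * ⟪ 2^ k ⟫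
    2^-+ j k = trans (sym (⟪⟫-^ (pos 2) (j ℕ.+ k))) (trans (^-+ ⟪ pos 2 ⟫ j k) (cong₂ _*_ (⟪⟫-^ (pos 2) j) (⟪⟫-^ (pos 2) k)))

    Dyadic-isSubring : IsSubring Dyadic
    Dyadic-isSubring = record
      { P-⟪⟫ = λ z → dyadic 0 z (trans (cong (_* ⟪ z ⟫) ⟪1⟫) (*-identityˡ ⟪ z ⟫))
      ; P-+ = λ { {x} {y} (dyadic j m p) (dyadic k n r) → dyadic (j ℕ.+ k) (2^ k ℤ.* m ℤ.+ 2^ j ℤ.* n) (begin
          ⟪ 2^ (j ℕ.+ k) ⟫ * (x + y)                                     ≡⟨ cong (_* (x + y)) (2^-+ j k) ⟩
          ⟪ 2^ j ⟫ * ⟪ 2^ k ⟫ * (x + y)                                  ≡⟨ ring (2^ j ∷ 2^ k ∷ []) (x ∷ y ∷ []) (λ j k x y → emb j :* emb k :* (x :+ y) ⊜ emb k :* (emb j :* x) :+ emb j :* (emb k :* y)) refl ⟩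
          ⟪ 2^ k ⟫ * (⟪ 2^ j ⟫ * x) + ⟪ 2^ j ⟫ * (⟪ 2^ k ⟫ * y)          ≡⟨ cong₂ (λ s t → ⟪ 2^ k ⟫ * s + ⟪ 2^ j ⟫ * t) p r ⟩
          ⟪ 2^ k ⟫ * ⟪ m ⟫ + ⟪ 2^ j ⟫ * ⟪ n ⟫                            ≡⟨ ring (2^ j ∷ 2^ k ∷ m ∷ n ∷ []) [] (λ j k m n → emb k :* emb m :+ emb j :* emb n ⊜ emb (k :* m :+ j :* n)) refl ⟩
          ⟪ 2^ k ℤ.* m ℤ.+ 2^ j ℤ.* n ⟫                                  ∎) }
      ; P-* = λ { {x} {y} (dyadic j m p) (dyadic k n r) → dyadic (j ℕ.+ k) (m ℤ.* n) (begin
          ⟪ 2^ (j ℕ.+ k) ⟫ * (x * y)                                     ≡⟨ cong (_* (x * y)) (2^-+ j k) ⟩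
          ⟪ 2^ j ⟫ * ⟪ 2^ k ⟫ * (x * y)                                  ≡⟨ ring (2^ j ∷ 2^ k ∷ []) (x ∷ y ∷ []) (λ j k x y → emb j :* emb k :* (x :* y) ⊜ (emb j :* x) :* (emb k :* y)) refl ⟩
          ⟪ 2^ j ⟫ * x * (⟪ 2^ k ⟫ * y)                                  ≡⟨ trans (cong₂ _*_ p r) (sym (⟪⟫-* m n)) ⟩
          ⟪ m ℤ.* n ⟫                                                    ∎) }
      }

    D-½ : Dyadic ½
    D-½ = dyadic 1 1ℤ (trans 2½ (sym ⟪1⟫))

    σ-dyadic : ∀ {x} → Dyadic x → σ x ≡ x
    σ-dyadic {x} (dyadic k n p) = cancel (2^≢0 k) (trans (cong (_* σ x) (sym (σ-⟪⟫ (2^ k)))) (trans (sym (σ-* ⟪ 2^ k ⟫ x)) (trans (cong σ p) (trans (σ-⟪⟫ n) (sym p)))))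

    dyadic-integral : ∀ {x} → Dyadic x → Integral x → ∃ λ z → x ≡ ⟪ z ⟫
    dyadic-integral {x} (dyadic k n p) h = finish (rational (2^≢0 k) h p)
      where
      finish : (∃ λ z → x ≡ ⟪ z ⟫ × 2^ k ℤ.* z ≡ n) → ∃ λ z → x ≡ ⟪ z ⟫
      finish (z , e , _) = z , e

    -- An odd denominator is coprime to a power of two.
    odd-cancel : ∀ {b x} k → Odd b → Integral (⟪ b ⟫ * x) → Integral (⟪ 2^ k ⟫ * x) → Integral x
    odd-cancel {b} {x} k o h h′ = finish (bezout-2^ o k)
      where
      finish : (∃ λ y → ∃ λ z → b ℤ.* y ℤ.+ 2^ k ℤ.* z ≡ 1ℤ) → Integral x
      finish (y , z , e) = subst Integral (begin
        ⟪ y ⟫ * (⟪ b ⟫ * x) + ⟪ z ⟫ * (⟪ 2^ k ⟫ * x)  ≡⟨ ring (y ∷ z ∷ b ∷ 2^ k ∷ []) (x ∷ []) (λ y z b p x → emb y :* (emb b :* x) :+ emb z :* (emb p :* x) ⊜ emb (b :* y :+ p :* z) :* x) refl ⟩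
        ⟪ b ℤ.* y ℤ.+ 2^ k ℤ.* z ⟫ * x                ≡⟨ cong (λ w → ⟪ w ⟫ * x) e ⟩
        ⟪ 1ℤ ⟫ * x                                    ≡⟨ trans (cong (_* x) ⟪1⟫) (*-identityˡ x) ⟩
        x                                             ∎) (I-+ (I-* (I-ι y) h) (I-* (I-ι z) h′))

    dyadic-cancel : ∀ {b x} → Odd b → Dyadic x → Integral (⟪ b ⟫ * x) → ∃ λ z → x ≡ ⟪ z ⟫
    dyadic-cancel o d@(dyadic k n p) h = dyadic-integral d (odd-cancel k o h (subst Integral (sym p) (I-ι n)))

    -- Trace and norm conditions for an integer of ℚ(√b) with r = √b. It is applied to √a and to
    -- √-a.
    record QuadraticInteger (r : Carrier) (b : ℤ) (z : Carrier) : Set where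
      constructor quadratic
      field
        P Q M : ℤ
        2z    : ⟪ pos 2 ⟫ * z ≡ ⟪ P ⟫ + ⟪ Q ⟫ * r
        zσz   : z * σ z ≡ ⟪ M ⟫
        norm≡ : P ℤ.* P ℤ.- b ℤ.* (Q ℤ.* Q) ≡ pos 4 ℤ.* M

    -- For z = x + yr the integral elements z + zσ and r(z - σz), with zσ standing for σz, are 2x
    -- and 2by. The factor b is odd while y is dyadic, so 2y is an integer as well.
    quadratic-integer : ∀ {r b z} → Odd b → r * r ≡ ⟪ b ⟫ → σ r ≡ - r → Integral r → InAdjoin Dyadic r z → Integral z → QuadraticInteger r b z
    quadratic-integer {r} {b} {z} o rr σr I-r (adj x y dx dy z≡) h = build
        (dyadic-integral (P-* Dyadic-isSubring (P-⟪⟫ Dyadic-isSubring (pos 2)) dx) (subst Integral 2x (I-+ h (I-σ h))))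
        (dyadic-cancel o (P-* Dyadic-isSubring (P-⟪⟫ Dyadic-isSubring (pos 2)) dy) (subst Integral 2by (I-* I-r (I-- h (I-σ h)))))
        (dyadic-integral (subst Dyadic (sym zσz′) (P-+ Dyadic-isSubring (P-* Dyadic-isSubring dx dx) (P-* Dyadic-isSubring (P-⟪⟫ Dyadic-isSubring (ℤ.- b)) (P-* Dyadic-isSubring dy dy)))) (I-* h (I-σ h)))
      where
      σz : σ z ≡ x - y * r
      σz = trans (cong σ z≡) (trans (σ-+ x (y * r)) (trans (cong₂ _+_ (σ-dyadic dx) (trans (σ-* y r) (cong₂ _*_ (σ-dyadic dy) σr))) (ring [] (x ∷ y ∷ r ∷ []) (λ x y r → x :+ y :* (:- r) ⊜ x :- y :* r) refl)))
      2x : z + σ z ≡ ⟪ pos 2 ⟫ * x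
      2x = trans (cong₂ _+_ z≡ σz) (ring [] (x ∷ y ∷ r ∷ []) (λ x y r → x :+ y :* r :+ (x :- y :* r) ⊜ lit 2 :* x) refl)
      2by : r * (z - σ z) ≡ ⟪ b ⟫ * (⟪ pos 2 ⟫ * y)
      2by = trans (cong₂ (λ s t → r * (s - t)) z≡ σz) (trans (ring [] (x ∷ y ∷ r ∷ []) (λ x y r → r :* (x :+ y :* r :- (x :- y :* r)) ⊜ r :* r :* (lit 2 :* y)) refl) (cong (_* (⟪ pos 2 ⟫ * y)) rr))
      zσz′ : z * σ z ≡ x * x + ⟪ ℤ.- b ⟫ * (y * y)
      zσz′ = trans (cong₂ _*_ z≡ σz) (lc₁ (- (y * y)) rr (ring (b ∷ []) (x ∷ y ∷ r ∷ []) (λ b x y r → (x :+ y :* r) :* (x :- y :* r) :+ :- (y :* y) :* emb b ⊜ x :* x :+ emb (:- b) :* (y :* y) :+ :- (y :* y) :* (r :* r)) refl))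
      build : (∃ λ P → ⟪ pos 2 ⟫ * x ≡ ⟪ P ⟫) → (∃ λ Q → ⟪ pos 2 ⟫ * y ≡ ⟪ Q ⟫) → (∃ λ M → z * σ z ≡ ⟪ M ⟫) → QuadraticInteger r b z
      build (P , p) (Q , e) (M , m) = quadratic P Q M
        (trans (cong (⟪ pos 2 ⟫ *_) z≡) (trans (ring [] (x ∷ y ∷ r ∷ []) (λ x y r → lit 2 :* (x :+ y :* r) ⊜ lit 2 :* x :+ lit 2 :* y :* r) refl) (cong₂ (λ s t → s + t * r) p e)))
        m
        (⟪⟫-inj (begin
          ⟪ P ℤ.* P ℤ.- b ℤ.* (Q ℤ.* Q) ⟫                                                ≡⟨ ring (P ∷ Q ∷ b ∷ []) [] (λ P Q b → emb (P :* P :- b :* (Q :* Q)) ⊜ emb P :* emb P :- emb b :* (emb Q :* emb Q)) refl ⟩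
          ⟪ P ⟫ * ⟪ P ⟫ - ⟪ b ⟫ * (⟪ Q ⟫ * ⟪ Q ⟫)                                        ≡⟨ cong₂ (λ s t → s * s - ⟪ b ⟫ * (t * t)) p e ⟨
          ⟪ pos 2 ⟫ * x * (⟪ pos 2 ⟫ * x) - ⟪ b ⟫ * (⟪ pos 2 ⟫ * y * (⟪ pos 2 ⟫ * y))    ≡⟨ ring (b ∷ []) (x ∷ y ∷ []) (λ b x y → let 2x = lit 2 :* x ; 2y = lit 2 :* y in 2x :* 2x :- emb b :* (2y :* 2y) ⊜ lit 4 :* (x :* x :+ emb (:- b) :* (y :* y))) refl ⟩
          ⟪ pos 4 ⟫ * (x * x + ⟪ ℤ.- b ⟫ * (y * y))                                      ≡⟨ cong (⟪ pos 4 ⟫ *_) (trans (sym zσz′) m) ⟩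
          ⟪ pos 4 ⟫ * ⟪ M ⟫                                                              ≡⟨ sym (⟪⟫-* (pos 4) M) ⟩
          ⟪ pos 4 ℤ.* M ⟫                                                                ∎))

    open IsSubring

    -- ℤ[1/2][√a], ℤ[1/2][⁴√a] and ℤ[1/2][θ]. They stand in for the fields F = ℚ(√a), L = ℚ(⁴√a) and
    -- K, and membership keeps the coordinates at hand.
    DF DL DK : Carrier → Set
    DF = InAdjoin Dyadic ρ
    DL = InAdjoin DF φ
    DK = InAdjoin DL θ

    abstract
      DF-isSubring : IsSubring DF
      DF-isSubring = adjoin-isSubring Dyadic-isSubring (subst Dyadic (sym ρρ) (P-⟪⟫ Dyadic-isSubring a))
      DL-isSubring : IsSubring DL
      DL-isSubring = adjoin-isSubring DF-isSubring (subst DF ρ-def (adjoin-root Dyadic-isSubring))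
      DK-isSubring : IsSubring DK
      DK-isSubring = adjoin-isSubring DL-isSubring (subst DL φ-def (adjoin-root DF-isSubring))

      ω : Carrier
      ω = ½ * (1# + ρ)

      2ω : ⟪ pos 2 ⟫ * ω ≡ 1# + ρ
      2ω = trans (sym (*-assoc ⟪ pos 2 ⟫ ½ (1# + ρ))) (trans (cong (_* (1# + ρ)) 2½) (*-identityˡ (1# + ρ)))

      DF-ω : DF ω
      DF-ω = P-* DF-isSubring (adjoin-base Dyadic-isSubring D-½) (P-+ DF-isSubring (P-1 DF-isSubring) (adjoin-root Dyadic-isSubring))

      ρ≡2ω-1 : ρ ≡ ⟪ pos 2 ⟫ * ω - 1#
      ρ≡2ω-1 = trans (ring [] (ρ ∷ []) (λ r → r ⊜ (:1 :+ r) :- :1) refl) (cong (_- 1#) (sym 2ω))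

      ωω : ω * ω ≡ ω + ⟪ c ⟫
      ωω = cancel {pos 4} (λ ()) (begin
        ⟪ pos 4 ⟫ * (ω * ω)                          ≡⟨ ring [] (ω ∷ []) (λ w → lit 4 :* (w :* w) ⊜ (lit 2 :* w) :* (lit 2 :* w)) refl ⟩
        (⟪ pos 2 ⟫ * ω) * (⟪ pos 2 ⟫ * ω)            ≡⟨ cong (λ x → x * x) 2ω ⟩
        (1# + ρ) * (1# + ρ)                          ≡⟨ lc₁ 1# (trans ρρ (cong ⟪_⟫ a≡)) (ring (c ∷ []) (ρ ∷ []) (λ c r → (:1 :+ r) :* (:1 :+ r) :+ :1 :* emb (con (pos 4) :* c :+ con 1ℤ) ⊜ lit 2 :* (:1 :+ r) :+ lit 4 :* emb c :+ :1 :* (r :* r)) refl) ⟩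
        ⟪ pos 2 ⟫ * (1# + ρ) + ⟪ pos 4 ⟫ * ⟪ c ⟫     ≡⟨ cong (λ x → ⟪ pos 2 ⟫ * x + ⟪ pos 4 ⟫ * ⟪ c ⟫) (sym 2ω) ⟩
        ⟪ pos 2 ⟫ * (⟪ pos 2 ⟫ * ω) + ⟪ pos 4 ⟫ * ⟪ c ⟫ ≡⟨ ring (c ∷ []) (ω ∷ []) (λ c w → lit 2 :* (lit 2 :* w) :+ lit 4 :* emb c ⊜ lit 4 :* (w :+ emb c)) refl ⟩
        ⟪ pos 4 ⟫ * (ω + ⟪ c ⟫)                      ∎)

      σ-ω : σ ω ≡ 1# - ω
      σ-ω = cancel {pos 2} (λ ()) (begin
        ⟪ pos 2 ⟫ * σ ω           ≡⟨ trans (cong (_* σ ω) (sym (σ-⟪⟫ (pos 2)))) (sym (σ-* ⟪ pos 2 ⟫ ω)) ⟩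
        σ (⟪ pos 2 ⟫ * ω)         ≡⟨ trans (cong σ 2ω) (trans (σ-+ 1# ρ) (cong₂ _+_ σ-1 σ-ρ)) ⟩
        1# + - ρ                  ≡⟨ cong (λ x → 1# + - x) ρ≡2ω-1 ⟩
        1# + - (⟪ pos 2 ⟫ * ω - 1#) ≡⟨ ring [] (ω ∷ []) (λ w → :1 :+ :- (lit 2 :* w :- :1) ⊜ lit 2 :* (:1 :- w)) refl ⟩
        ⟪ pos 2 ⟫ * (1# - ω)      ∎)

      I-ω : Integral ω
      I-ω = I-monic ω (ℤ.- c ∷ ℤ.- 1ℤ ∷ []) (lc₁ 1# ωω (ring (c ∷ []) (ω ∷ []) (λ c w → w :^ 2 :+ (emb (:- c) :+ w :* (emb (con (ℤ.- 1ℤ)) :+ w :* :0)) :+ :1 :* (w :+ emb c) ⊜ :0 :+ :1 :* (w :* w)) refl))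

      σ²-DF : ∀ {x} → DF x → σ² x ≡ x
      σ²-DF {x} (adj y z dy dz refl) = trans (cong σ (σ-+ y (z * ρ))) (trans (σ-+ (σ y) (σ (z * ρ))) (cong₂ _+_ (trans (cong σ (σ-dyadic dy)) (σ-dyadic dy))
        (trans (σ²-* z ρ) (cong₂ _*_ (trans (cong σ (σ-dyadic dz)) (σ-dyadic dz)) σ²-ρ))))

      DF-bounded : ∀ {x} → DF x → ∃ λ k → Integral (⟪ 2^ k ⟫ * x)
      DF-bounded {x} (adj y z (dyadic j m p) (dyadic k n r) refl) = j ℕ.+ k , subst Integral (sym (begin
        ⟪ 2^ (j ℕ.+ k) ⟫ * (y + z * ρ)               ≡⟨ cong (_* (y + z * ρ)) (2^-+ j k) ⟩
        ⟪ 2^ j ⟫ * ⟪ 2^ k ⟫ * (y + z * ρ)            ≡⟨ ring (2^ j ∷ 2^ k ∷ []) (y ∷ z ∷ ρ ∷ []) (λ j k y z r → emb j :* emb k :* (y :+ z :* r) ⊜ emb k :* (emb j :* y) :+ emb j :* (emb k :* z) :* r) refl ⟩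
        ⟪ 2^ k ⟫ * (⟪ 2^ j ⟫ * y) + ⟪ 2^ j ⟫ * (⟪ 2^ k ⟫ * z) * ρ ≡⟨ cong₂ (λ s t → ⟪ 2^ k ⟫ * s + ⟪ 2^ j ⟫ * t * ρ) p r ⟩
        ⟪ 2^ k ⟫ * ⟪ m ⟫ + ⟪ 2^ j ⟫ * ⟪ n ⟫ * ρ      ∎)) (I-+ (I-* (I-ι _) (I-ι m)) (I-* (I-* (I-ι _) (I-ι n)) I-ρ))

    record IntegerOfF (z : Carrier) : Set where
      constructor intF
      field
        p q : ℤ
        z≡  : z ≡ ⟪ p ⟫ + ⟪ q ⟫ * ω

    abstract
      integerOfF : ∀ {z} → DF z → Integral z → IntegerOfF z
      integerOfF {z} d h = build (quadratic-integer a-odd ρρ σ-ρ I-ρ d h)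
        where
        build : QuadraticInteger ρ a z → IntegerOfF z
        build (quadratic P Q M 2z _ e) = half (even-difference P Q (parity-of (P ∷ Q ∷ []) (λ P Q → (P :* P :- Q :* Q ∷ []) , (P :- Q)) refl (four⇒even {m = M ℤ.+ c ℤ.* (Q ℤ.* Q)} PQ ∷ [])))
          where
          lem₁ : ∀ P Q c → P ℤ.* P ℤ.- Q ℤ.* Q ≡ P ℤ.* P ℤ.- (pos 4 ℤ.* c ℤ.+ 1ℤ) ℤ.* (Q ℤ.* Q) ℤ.+ pos 4 ℤ.* (c ℤ.* (Q ℤ.* Q))
          lem₁ = solve-∀
          lem₂ : ∀ M x → pos 4 ℤ.* M ℤ.+ pos 4 ℤ.* x ≡ pos 4 ℤ.* (M ℤ.+ x)
          lem₂ = solve-∀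
          PQ : P ℤ.* P ℤ.- Q ℤ.* Q ≡ pos 4 ℤ.* (M ℤ.+ c ℤ.* (Q ℤ.* Q))
          PQ = trans (lem₁ P Q c) (trans (cong (λ x → P ℤ.* P ℤ.- x ℤ.* (Q ℤ.* Q) ℤ.+ pos 4 ℤ.* (c ℤ.* (Q ℤ.* Q))) (sym a≡)) (trans (cong (ℤ._+ pos 4 ℤ.* (c ℤ.* (Q ℤ.* Q))) e) (lem₂ M (c ℤ.* (Q ℤ.* Q)))))
          half : (∃ λ p → P ≡ Q ℤ.+ pos 2 ℤ.* p) → IntegerOfF z
          half (p , P≡) = intF p Q (cancel {pos 2} (λ ()) (begin
            ⟪ pos 2 ⟫ * z                                   ≡⟨ trans 2z (cong₂ (λ s t → ⟪ s ⟫ + ⟪ Q ⟫ * t) P≡ ρ≡2ω-1) ⟩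
            ⟪ Q ℤ.+ pos 2 ℤ.* p ⟫ + ⟪ Q ⟫ * (⟪ pos 2 ⟫ * ω - 1#)   ≡⟨ ring (p ∷ Q ∷ []) (ω ∷ []) (λ p Q w → emb (Q :+ con (pos 2) :* p) :+ emb Q :* (lit 2 :* w :- :1) ⊜ lit 2 :* (emb p :+ emb Q :* w)) refl ⟩
            ⟪ pos 2 ⟫ * (⟪ p ⟫ + ⟪ Q ⟫ * ω)                 ∎))

      independentF : ∀ {p q p′ q′} → ⟪ p ⟫ + ⟪ q ⟫ * ω ≡ ⟪ p′ ⟫ + ⟪ q′ ⟫ * ω → p ≡ p′ × q ≡ q′
      independentF {p} {q} {p′} {q′} e = ⟪⟫-inj (lc₂ 1# e (- ω) (cong ⟪_⟫ q≡) (ring (p ∷ q ∷ p′ ∷ q′ ∷ []) (ω ∷ []) (λ p q p′ q′ w →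
          emb p :+ (:1 :* (emb p′ :+ emb q′ :* w) :+ :- w :* emb q′) ⊜ emb p′ :+ (:1 :* (emb p :+ emb q :* w) :+ :- w :* emb q)) refl)) , q≡
        where
        conj : ∀ p q → σ (⟪ p ⟫ + ⟪ q ⟫ * ω) ≡ ⟪ p ⟫ + ⟪ q ⟫ * (1# - ω)
        conj p q = trans (σ-+ ⟪ p ⟫ (⟪ q ⟫ * ω)) (cong₂ _+_ (σ-⟪⟫ p) (trans (σ-* ⟪ q ⟫ ω) (cong₂ _*_ (σ-⟪⟫ q) σ-ω)))
        diff : ⟪ q ⟫ * ρ ≡ ⟪ q′ ⟫ * ρ
        diff = trans (cong (⟪ q ⟫ *_) ρ≡2ω-1) (trans (lc₂ 1# e (- 1#) (trans (sym (conj p q)) (trans (cong σ e) (conj p′ q′))) (ring (p ∷ q ∷ p′ ∷ q′ ∷ []) (ω ∷ []) (λ p q p′ q′ w →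
          emb q :* (lit 2 :* w :- :1) :+ (:1 :* (emb p′ :+ emb q′ :* w) :+ :- :1 :* (emb p′ :+ emb q′ :* (:1 :- w))) ⊜
          emb q′ :* (lit 2 :* w :- :1) :+ (:1 :* (emb p :+ emb q :* w) :+ :- :1 :* (emb p :+ emb q :* (:1 :- w)))) refl)) (cong (⟪ q′ ⟫ *_) (sym ρ≡2ω-1)))
        q≡ : q ≡ q′
        q≡ = ⟪⟫-inj (cancel a≢0 (begin
          ⟪ a ⟫ * ⟪ q ⟫        ≡⟨ trans (cong (_* ⟪ q ⟫) (sym ρρ)) (ring (q ∷ []) (ρ ∷ []) (λ q r → r :* r :* emb q ⊜ r :* (emb q :* r)) refl) ⟩
          ρ * (⟪ q ⟫ * ρ)      ≡⟨ cong (ρ *_) diff ⟩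
          ρ * (⟪ q′ ⟫ * ρ)     ≡⟨ trans (ring (q′ ∷ []) (ρ ∷ []) (λ q r → r :* (emb q :* r) ⊜ r :* r :* emb q) refl) (cong (_* ⟪ q′ ⟫) ρρ) ⟩
          ⟪ a ⟫ * ⟪ q′ ⟫       ∎))

      -- σ² fixes ℤ[1/2][√a] and negates φ, so adding the conjugate equation isolates x; then y is
      -- recovered from yφ because φ⁴ = a is a nonzero integer.
      DF-split : ∀ {x y x′ y′} → DF x → DF y → DF x′ → DF y′ → x + y * φ ≡ x′ + y′ * φ → x ≡ x′ × y ≡ y′
      DF-split {x} {y} {x′} {y′} dx dy dx′ dy′ e = x≡ , y≡
        where
        conj : ∀ {x y} → DF x → DF y → σ² (x + y * φ) ≡ x - y * φ
        conj {x} {y} dx dy = trans (cong σ (σ-+ x (y * φ))) (trans (σ-+ (σ x) (σ (y * φ))) (trans (cong₂ _+_ (σ²-DF dx) (trans (σ²-* y φ) (cong₂ _*_ (σ²-DF dy) σ²-φ))) (ring [] (x ∷ y ∷ φ ∷ []) (λ x y f → x :+ y :* (:- f) ⊜ x :- y :* f) refl)))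
        e′ : x - y * φ ≡ x′ - y′ * φ
        e′ = trans (sym (conj dx dy)) (trans (cong σ² e) (conj dx′ dy′))
        x≡ : x ≡ x′
        x≡ = cancel {pos 2} (λ ()) (lc₂ 1# e 1# e′ (ring [] (x ∷ y ∷ x′ ∷ y′ ∷ φ ∷ []) (λ x y x′ y′ f →
          lit 2 :* x :+ (:1 :* (x′ :+ y′ :* f) :+ :1 :* (x′ :- y′ :* f)) ⊜ lit 2 :* x′ :+ (:1 :* (x :+ y :* f) :+ :1 :* (x :- y :* f))) refl))
        yφ : y * φ ≡ y′ * φ
        yφ = lc₂ 1# e (- 1#) x≡ (ring [] (x ∷ y ∷ x′ ∷ y′ ∷ φ ∷ []) (λ x y x′ y′ f → y :* f :+ (:1 :* (x′ :+ y′ :* f) :+ :- :1 :* x′) ⊜ y′ :* f :+ (:1 :* (x :+ y :* f) :+ :- :1 :* x)) refl)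
        φ⁴ : φ * φ * φ * φ ≡ ⟪ a ⟫
        φ⁴ = trans (ring [] (φ ∷ []) (λ f → f :* f :* f :* f ⊜ f :* f :* (f :* f)) refl) (trans (cong (λ r → r * r) (sym ρ-def)) ρρ)
        y≡ : y ≡ y′
        y≡ = cancel a≢0 (begin
          ⟪ a ⟫ * y               ≡⟨ trans (cong (_* y) (sym φ⁴)) (ring [] (φ ∷ y ∷ []) (λ f y → f :* f :* f :* f :* y ⊜ f :* f :* f :* (y :* f)) refl) ⟩
          φ * φ * φ * (y * φ)     ≡⟨ cong (φ * φ * φ *_) yφ ⟩
          φ * φ * φ * (y′ * φ)    ≡⟨ trans (ring [] (φ ∷ y′ ∷ []) (λ f y → f :* f :* f :* (y :* f) ⊜ f :* f :* f :* f :* y) refl) (cong (_* y′) φ⁴) ⟩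
          ⟪ a ⟫ * y′              ∎)

    record IntegerOfL (z : Carrier) : Set where
      constructor intL
      field
        p₀ p₁ q₀ q₁ : ℤ
        2z   : ⟪ pos 2 ⟫ * z ≡ (⟪ p₀ ⟫ + ⟪ p₁ ⟫ * ω) + (⟪ q₀ ⟫ + ⟪ q₁ ⟫ * ω) * φ
        even : Even p₀ × Even q₀ × Even (p₁ ℤ.- q₁) × Even (c ℤ.* q₁)

    abstract
      -- For z = x + yφ the relative trace 2x, the element 2y (its factor a cancelled) and the
      -- relative norm x² - y²ρ are integers of F. Four times the norm is then a condition modulo 4
      -- on the coordinates of 2x and 2y.
      integerOfL : ∀ {z} → DL z → Integral z → IntegerOfL z
      integerOfL {z} (adj x y dx dy z≡) h = build (integerOfF 2x∈ I-2x) (integerOfF 2y∈ I-2y) (integerOfF zz̃∈ (I-* h (I-σ (I-σ h))))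
        where
        z̃ : σ² z ≡ x - y * φ
        z̃ = trans (cong σ² z≡) (trans (cong σ (σ-+ x (y * φ))) (trans (σ-+ (σ x) (σ (y * φ))) (trans (cong₂ _+_ (σ²-DF dx) (trans (σ²-* y φ) (cong₂ _*_ (σ²-DF dy) σ²-φ))) (ring [] (x ∷ y ∷ φ ∷ []) (λ x y f → x :+ y :* (:- f) ⊜ x :- y :* f) refl))))
        2x∈ : DF (⟪ pos 2 ⟫ * x)
        2x∈ = P-* DF-isSubring (P-⟪⟫ DF-isSubring (pos 2)) dx
        2y∈ : DF (⟪ pos 2 ⟫ * y)
        2y∈ = P-* DF-isSubring (P-⟪⟫ DF-isSubring (pos 2)) dy
        I-2x : Integral (⟪ pos 2 ⟫ * x)
        I-2x = subst Integral (trans (cong₂ _+_ z≡ z̃) (ring [] (x ∷ y ∷ φ ∷ []) (λ x y f → x :+ y :* f :+ (x :- y :* f) ⊜ lit 2 :* x) refl)) (I-+ h (I-σ (I-σ h)))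
        φ⁴ : φ * φ * φ * φ ≡ ⟪ a ⟫
        φ⁴ = trans (ring [] (φ ∷ []) (λ f → f :* f :* f :* f ⊜ f :* f :* (f :* f)) refl) (trans (cong (λ r → r * r) (sym ρ-def)) ρρ)
        I-2ay : Integral (⟪ a ⟫ * (⟪ pos 2 ⟫ * y))
        I-2ay = subst Integral (trans (cong₂ (λ s t → φ * φ * φ * (s - t)) z≡ z̃) (trans (ring [] (x ∷ y ∷ φ ∷ []) (λ x y f → f :* f :* f :* (x :+ y :* f :- (x :- y :* f)) ⊜ f :* f :* f :* f :* (lit 2 :* y)) refl) (cong (_* (⟪ pos 2 ⟫ * y)) φ⁴)))
          (I-* (I-* (I-* I-φ I-φ) I-φ) (I-- h (I-σ (I-σ h))))
        I-2y : Integral (⟪ pos 2 ⟫ * y)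
        I-2y = odd-cancel (proj₁ (DF-bounded 2y∈)) a-odd I-2ay (proj₂ (DF-bounded 2y∈))
        zz̃ : z * σ² z ≡ x * x - y * y * ρ
        zz̃ = trans (cong₂ _*_ z≡ z̃) (lc₁ (y * y) ρ-def (ring [] (x ∷ y ∷ φ ∷ ρ ∷ []) (λ x y f r → (x :+ y :* f) :* (x :- y :* f) :+ y :* y :* (f :* f) ⊜ x :* x :- y :* y :* r :+ y :* y :* r) refl))
        zz̃∈ : DF (z * σ² z)
        zz̃∈ = subst DF (sym (trans zz̃ (ring [] (x ∷ y ∷ ρ ∷ []) (λ x y r → x :* x :- y :* y :* r ⊜ x :* x :+ emb (con (ℤ.- 1ℤ)) :* (y :* y :* r)) refl)))
          (P-+ DF-isSubring (P-* DF-isSubring dx dx) (P-* DF-isSubring (P-⟪⟫ DF-isSubring (ℤ.- 1ℤ)) (P-* DF-isSubring (P-* DF-isSubring dy dy) (adjoin-root Dyadic-isSubring))))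
        build : IntegerOfF (⟪ pos 2 ⟫ * x) → IntegerOfF (⟪ pos 2 ⟫ * y) → IntegerOfF (z * σ² z) → IntegerOfL z
        build (intF p₀ p₁ ex) (intF q₀ q₁ ey) (intF m₀ m₁ em) = intL p₀ p₁ q₀ q₁
          (trans (cong (⟪ pos 2 ⟫ *_) z≡) (trans (ring [] (x ∷ y ∷ φ ∷ []) (λ x y f → lit 2 :* (x :+ y :* f) ⊜ lit 2 :* x :+ lit 2 :* y :* f) refl) (cong₂ (λ s t → s + t * φ) ex ey)))
          (uncurry (relative-integer c p₀ p₁ q₀ q₁ m₀ m₁) (independentF (trans (sym (lc₁ (⟪ p₁ ⟫ * ⟪ p₁ ⟫ - ⟪ q₁ ⟫ * ⟪ q₁ ⟫ * (⟪ pos 2 ⟫ * ω - 1#) - ⟪ pos 4 ⟫ * ⟪ q₀ ⟫ * ⟪ q₁ ⟫ - ⟪ pos 2 ⟫ * ⟪ q₁ ⟫ * ⟪ q₁ ⟫) ωω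
              (ring (c ∷ p₀ ∷ p₁ ∷ q₀ ∷ q₁ ∷ []) (ω ∷ []) (λ c p₀ p₁ q₀ q₁ w →
                let co = emb p₁ :* emb p₁ :- emb q₁ :* emb q₁ :* (lit 2 :* w :- :1) :- lit 4 :* emb q₀ :* emb q₁ :- lit 2 :* emb q₁ :* emb q₁ in
                (emb p₀ :+ emb p₁ :* w) :* (emb p₀ :+ emb p₁ :* w) :- (emb q₀ :+ emb q₁ :* w) :* (emb q₀ :+ emb q₁ :* w) :* (lit 2 :* w :- :1) :+ co :* (w :+ emb c) ⊜
                emb (p₀ :* p₀ :+ c :* (p₁ :* p₁) :+ (q₀ :* q₀ :+ c :* (q₁ :* q₁)) :- con (pos 2) :* c :* (con (pos 2) :* q₀ :* q₁ :+ q₁ :* q₁)) :+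
                emb (con (pos 2) :* p₀ :* p₁ :+ p₁ :* p₁ :- (con (pos 2) :* (q₀ :* q₀ :+ c :* (q₁ :* q₁)) :+ (con (pos 2) :* q₀ :* q₁ :+ q₁ :* q₁))) :* w :+ co :* (w :* w)) refl)))
            (trans norm-eq (ring (m₀ ∷ m₁ ∷ []) (ω ∷ []) (λ m₀ m₁ w → lit 4 :* (emb m₀ :+ emb m₁ :* w) ⊜ emb (con (pos 4) :* m₀) :+ emb (con (pos 4) :* m₁) :* w) refl)))))
          where
          norm-eq : (⟪ p₀ ⟫ + ⟪ p₁ ⟫ * ω) * (⟪ p₀ ⟫ + ⟪ p₁ ⟫ * ω) - (⟪ q₀ ⟫ + ⟪ q₁ ⟫ * ω) * (⟪ q₀ ⟫ + ⟪ q₁ ⟫ * ω) * (⟪ pos 2 ⟫ * ω - 1#) ≡ ⟪ pos 4 ⟫ * (⟪ m₀ ⟫ + ⟪ m₁ ⟫ * ω)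
          norm-eq = begin
            (⟪ p₀ ⟫ + ⟪ p₁ ⟫ * ω) * (⟪ p₀ ⟫ + ⟪ p₁ ⟫ * ω) - (⟪ q₀ ⟫ + ⟪ q₁ ⟫ * ω) * (⟪ q₀ ⟫ + ⟪ q₁ ⟫ * ω) * (⟪ pos 2 ⟫ * ω - 1#)
              ≡⟨ trans (cong₂ (λ s t → s * s - t * t * (⟪ pos 2 ⟫ * ω - 1#)) (sym ex) (sym ey)) (cong (λ r → ⟪ pos 2 ⟫ * x * (⟪ pos 2 ⟫ * x) - ⟪ pos 2 ⟫ * y * (⟪ pos 2 ⟫ * y) * r) (sym ρ≡2ω-1)) ⟩
            ⟪ pos 2 ⟫ * x * (⟪ pos 2 ⟫ * x) - ⟪ pos 2 ⟫ * y * (⟪ pos 2 ⟫ * y) * ρ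
              ≡⟨ ring [] (x ∷ y ∷ ρ ∷ []) (λ x y r → let 2x = lit 2 :* x ; 2y = lit 2 :* y in 2x :* 2x :- 2y :* 2y :* r ⊜ lit 4 :* (x :* x :- y :* y :* r)) refl ⟩
            ⟪ pos 4 ⟫ * (x * x - y * y * ρ)  ≡⟨ cong (⟪ pos 4 ⟫ *_) (trans (sym zz̃) em) ⟩
            ⟪ pos 4 ⟫ * (⟪ m₀ ⟫ + ⟪ m₁ ⟫ * ω) ∎

    open IsSubring

    -- What is used of ℤ_K = ℤ[t]: t is integral with dyadic coordinates, and ω and θ are integer
    -- polynomials in t. With cⱼ = uⱼ + vⱼρ, t is c₀ + c₁θ + c₂θ² + c₃θ³.
    record Generator : Set where
      field
        t u₀ v₀ u₁ v₁ u₂ v₂ u₃ v₃ : Carrier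
        Du₀ : Dyadic u₀
        Dv₀ : Dyadic v₀
        Du₁ : Dyadic u₁
        Dv₁ : Dyadic v₁
        Du₂ : Dyadic u₂
        Dv₂ : Dyadic v₂
        Du₃ : Dyadic u₃
        Dv₃ : Dyadic v₃
        t≡  : t ≡ ((u₀ + v₀ * ρ) + (u₂ + v₂ * ρ) * φ) + ((u₁ + v₁ * ρ) + (u₃ + v₃ * ρ) * φ) * θ
        I-t : Integral t
        Pω Pθ : List ℤ
        Pω≡ : eval Pω t ≡ ω
        Pθ≡ : eval Pθ t ≡ θ

    abstract
      eval-difference : ∀ P {x y} → Integral x → Integral y → ∃ λ h → Integral h × eval P x - eval P y ≡ (x - y) * h
      eval-difference []      {x} {y} I-x I-y = 0# , I-0 , ring [] (x ∷ y ∷ []) (λ x y → :0 :- :0 ⊜ (x :- y) :* :0) refl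
      eval-difference (k ∷ P) {x} {y} I-x I-y = step (eval-difference P I-x I-y)
        where
        step : (∃ λ h → Integral h × eval P x - eval P y ≡ (x - y) * h) → ∃ λ h → Integral h × (⟪ k ⟫ + x * eval P x) - (⟪ k ⟫ + y * eval P y) ≡ (x - y) * h
        step (h , I-h , e) = eval P x + y * h , I-+ (I-eval P I-x) (I-* I-y I-h) ,
          lc₁ y e (ring (k ∷ []) (x ∷ y ∷ h ∷ eval P x ∷ eval P y ∷ []) (λ k x y h p q →
            (emb k :+ x :* p) :- (emb k :+ y :* q) :+ y :* ((x :- y) :* h) ⊜ (x :- y) :* (p :+ y :* h) :+ y :* (p :- q)) refl)

      σ-eval : ∀ P x → σ (eval P x) ≡ eval P (σ x)
      σ-eval []      x = σ-0
      σ-eval (k ∷ P) x = trans (σ-+ ⟪ k ⟫ (x * eval P x)) (cong₂ _+_ (σ-⟪⟫ k) (trans (σ-* x (eval P x)) (cong (σ x *_) (σ-eval P x))))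

      σ⁴-eval : ∀ P x → σ⁴ (eval P x) ≡ eval P (σ⁴ x)
      σ⁴-eval P x = trans (cong (λ y → σ (σ (σ y))) (σ-eval P x)) (trans (cong σ² (σ-eval P (σ x))) (trans (cong σ (σ-eval P (σ² x))) (σ-eval P _)))

      σ²-+ : ∀ x y → σ² (x + y) ≡ σ² x + σ² y
      σ²-+ x y = trans (cong σ (σ-+ x y)) (σ-+ (σ x) (σ y))

      σ²-- : ∀ x y → σ² (x - y) ≡ σ² x - σ² y
      σ²-- x y = trans (cong σ (σ-- x y)) (σ-- (σ x) (σ y))

      σ⁴-DL : ∀ {x} → DL x → σ⁴ x ≡ x
      σ⁴-DL (adj y z dy dz refl) = trans (cong σ² (σ²-+ y (z * φ))) (trans (σ²-+ (σ² y) (σ² (z * φ))) (cong₂ _+_ (trans (cong σ² (σ²-DF dy)) (σ²-DF dy))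
        (trans (cong σ² (σ²-* z φ)) (trans (σ²-* (σ² z) (σ² φ)) (cong₂ _*_ (trans (cong σ² (σ²-DF dz)) (σ²-DF dz)) σ⁴-φ)))))
        where
        σ⁴-φ : σ² (σ² φ) ≡ φ
        σ⁴-φ = trans (cong σ² σ²-φ) (trans (cong σ (σ-neg φ)) (trans (σ-neg (σ φ)) (trans (cong -_ σ²-φ) (ring [] (φ ∷ []) (λ f → :- (:- f) ⊜ f) refl))))

      θ-cancel : ∀ {x y} → θ * x ≡ θ * y → x ≡ y
      θ-cancel {x} {y} e = cancel a≢0 (trans (expand x) (trans (cong (θ ^ 7 *_) e) (sym (expand y))))
        where
        expand : ∀ x → ⟪ a ⟫ * x ≡ θ ^ 7 * (θ * x)
        expand x = trans (cong (_* x) (sym θ⁸)) (ring [] (θ ∷ x ∷ []) (λ t x → t :^ 8 :* x ⊜ t :^ 7 :* (t :* x)) refl)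

      DL-bounded : ∀ {x} → DL x → ∃ λ k → Integral (⟪ 2^ k ⟫ * x)
      DL-bounded {x} (adj y z dy dz x≡) = build (DF-bounded dy) (DF-bounded dz)
        where
        build : (∃ λ j → Integral (⟪ 2^ j ⟫ * y)) → (∃ λ k → Integral (⟪ 2^ k ⟫ * z)) → ∃ λ k → Integral (⟪ 2^ k ⟫ * x)
        build (j , p) (k , r) = j ℕ.+ k , subst Integral (sym (trans (cong₂ _*_ (2^-+ j k) x≡)
          (ring (2^ j ∷ 2^ k ∷ []) (y ∷ z ∷ φ ∷ []) (λ j k y z f → emb j :* emb k :* (y :+ z :* f) ⊜ emb k :* (emb j :* y) :+ emb j :* (emb k :* z) :* f) refl)))
          (I-+ (I-* (I-ι (2^ k)) p) (I-* (I-* (I-ι (2^ j)) r) I-φ))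

      -- β_i - β_j divides both √a and 2θ, hence θ.
      divides-θ : ∀ {d h h′ k} → Integral h → Integral h′ → Integral k → d * h ≡ ρ → d * h′ * k ≡ ⟪ pos 2 ⟫ * θ → ∃ λ w → Integral w × d * w ≡ θ
      -- The combination uses a - 4c = 1: ρ times √a·θ gives aθ, and 2c times 2θ gives 4cθ.
      divides-θ {d} {h} {h′} {k} I-h I-h′ I-k e e′ = h * ρ * θ - ⟪ pos 2 ℤ.* c ⟫ * (h′ * k) , I-- (I-* (I-* I-h I-ρ) I-θ) (I-* (I-ι _) (I-* I-h′ I-k)) ,
        (begin
          d * (h * ρ * θ - ⟪ pos 2 ℤ.* c ⟫ * (h′ * k))          ≡⟨ ring (c ∷ []) (d ∷ h ∷ ρ ∷ θ ∷ h′ ∷ k ∷ []) (λ c d h r t h′ k → d :* (h :* r :* t :- emb (con (pos 2) :* c) :* (h′ :* k)) ⊜ d :* h :* r :* t :- emb (con (pos 2) :* c) :* (d :* h′ :* k)) refl ⟩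
          d * h * ρ * θ - ⟪ pos 2 ℤ.* c ⟫ * (d * h′ * k)        ≡⟨ cong₂ (λ x y → x * ρ * θ - ⟪ pos 2 ℤ.* c ⟫ * y) e e′ ⟩
          ρ * ρ * θ - ⟪ pos 2 ℤ.* c ⟫ * (⟪ pos 2 ⟫ * θ)         ≡⟨ cong (λ x → x * θ - ⟪ pos 2 ℤ.* c ⟫ * (⟪ pos 2 ⟫ * θ)) (trans ρρ (cong ⟪_⟫ a≡)) ⟩
          ⟪ pos 4 ℤ.* c ℤ.+ 1ℤ ⟫ * θ - ⟪ pos 2 ℤ.* c ⟫ * (⟪ pos 2 ⟫ * θ) ≡⟨ ring (c ∷ []) (θ ∷ []) (λ c t → emb (con (pos 4) :* c :+ con 1ℤ) :* t :- emb (con (pos 2) :* c) :* (lit 2 :* t) ⊜ t) refl ⟩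
          θ                                                     ∎)

    module FromGenerator (gen : Generator) where
      open Generator gen public

      A B A′ B′ : Carrier
      A  = (u₀ + v₀ * ρ) + (u₂ + v₂ * ρ) * φ
      B  = (u₁ + v₁ * ρ) + (u₃ + v₃ * ρ) * φ
      A′ = (u₀ - v₀ * ρ) + (u₂ - v₂ * ρ) * (i * φ)
      B′ = (u₁ - v₁ * ρ) + (u₃ - v₃ * ρ) * (i * φ)

      abstract
        DL-A : DL A
        DL-A = adj _ _ (adj u₀ v₀ Du₀ Dv₀ refl) (adj u₂ v₂ Du₂ Dv₂ refl) refl
        DL-B : DL B
        DL-B = adj _ _ (adj u₁ v₁ Du₁ Dv₁ refl) (adj u₃ v₃ Du₃ Dv₃ refl) refl

        σ-L : ∀ {x y z w} → Dyadic x → Dyadic y → Dyadic z → Dyadic w → σ ((x + y * ρ) + (z + w * ρ) * φ) ≡ (x - y * ρ) + (z - w * ρ) * (i * φ)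
        σ-L {x} {y} {z} {w} dx dy dz dw = trans (σ-+ _ _) (cong₂ _+_ (f dx dy) (trans (σ-* _ _) (cong₂ _*_ (f dz dw) σ-φ)))
          where
          f : ∀ {x y} → Dyadic x → Dyadic y → σ (x + y * ρ) ≡ x - y * ρ
          f {x} {y} dx dy = trans (σ-+ _ _) (trans (cong₂ _+_ (σ-dyadic dx) (trans (σ-* y ρ) (cong₂ _*_ (σ-dyadic dy) σ-ρ))) (ring [] (x ∷ y ∷ ρ ∷ []) (λ x y r → x :+ y :* (:- r) ⊜ x :- y :* r) refl))

        σA : σ A ≡ A′
        σA = σ-L Du₀ Dv₀ Du₂ Dv₂
        σB : σ B ≡ B′
        σB = σ-L Du₁ Dv₁ Du₃ Dv₃

        β₁≡ : σ t ≡ A′ + B′ * (ζ * θ)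
        β₁≡ = trans (cong σ t≡) (trans (σ-+ _ _) (cong₂ _+_ σA (trans (σ-* _ _) (cong₂ _*_ σB σ-θ))))

        β₄≡ : σ⁴ t ≡ A - B * θ
        β₄≡ = trans (cong σ⁴ t≡) (trans (trans (cong σ² (σ²-+ A (B * θ))) (σ²-+ (σ² A) (σ² (B * θ)))) (trans (cong₂ _+_ (σ⁴-DL DL-A) (trans (σ⁴-* B θ) (cong₂ _*_ (σ⁴-DL DL-B) σ⁴-θ)))
          (ring [] (A ∷ B ∷ θ ∷ []) (λ x y t → x :+ y :* (:- t) ⊜ x :- y :* t) refl)))

        β₅≡ : σ (σ⁴ t) ≡ A′ - B′ * (ζ * θ)
        β₅≡ = trans (cong σ β₄≡) (trans (σ-- _ _) (cong₂ _-_ σA (trans (σ-* _ _) (cong₂ _*_ σB σ-θ))))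

      I-β₁ : Integral (σ t)
      I-β₁ = I-σ I-t
      I-β₄ : Integral (σ⁴ t)
      I-β₄ = I-σ (I-σ (I-σ (I-σ I-t)))
      I-β₅ : Integral (σ (σ⁴ t))
      I-β₅ = I-σ I-β₄

      abstract
        σ⁴-ω : σ⁴ ω ≡ ω
        σ⁴-ω = trans (cong σ² (σ²-DF DF-ω)) (σ²-DF DF-ω)

        ω-ω̄ : ω - (1# - ω) ≡ ρ
        ω-ω̄ = trans (ring [] (ω ∷ []) (λ w → w :- (:1 :- w) ⊜ lit 2 :* w :- :1) refl) (sym ρ≡2ω-1)

        -- x - y divides P(x) - P(y) for every integer polynomial P. For conjugates of t on which ω
        -- differs, the polynomial for ω gives √a, and the one for θ gives a difference of
        -- conjugates of θ. The latter divides 2θ, since (1 - ζ)(1 + ζ)(1 + ζ²) = 1 - ζ⁴ = 2.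
        odd-difference : ∀ {x y θₓ θᵧ} → Integral x → Integral y → eval Pω x ≡ ω → eval Pω y ≡ 1# - ω → eval Pθ x ≡ θₓ → eval Pθ y ≡ θᵧ →
          ∀ {k} → Integral k → (θₓ - θᵧ) * k ≡ ⟪ pos 2 ⟫ * θ → ∃ λ w → Integral w × (x - y) * w ≡ θ
        odd-difference {x} {y} {θₓ} {θᵧ} I-x I-y ωₓ ωᵧ tx ty {k} I-k e = build (eval-difference Pω I-x I-y) (eval-difference Pθ I-x I-y)
          where
          build : (∃ λ h → Integral h × eval Pω x - eval Pω y ≡ (x - y) * h) → (∃ λ h → Integral h × eval Pθ x - eval Pθ y ≡ (x - y) * h) → ∃ λ w → Integral w × (x - y) * w ≡ θ
          build (h , I-h , p) (h′ , I-h′ , p′) = divides-θ I-h I-h′ I-k (trans (sym p) (trans (cong₂ _-_ ωₓ ωᵧ) ω-ω̄)) (trans (cong (_* k) (trans (sym p′) (cong₂ _-_ tx ty))) e)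

        Pω₁ : eval Pω (σ t) ≡ 1# - ω
        Pω₁ = trans (sym (σ-eval Pω t)) (trans (cong σ Pω≡) σ-ω)
        Pω₄ : eval Pω (σ⁴ t) ≡ ω
        Pω₄ = trans (sym (σ⁴-eval Pω t)) (trans (cong σ⁴ Pω≡) σ⁴-ω)
        Pω₅ : eval Pω (σ (σ⁴ t)) ≡ 1# - ω
        Pω₅ = trans (sym (σ-eval Pω (σ⁴ t))) (trans (cong σ Pω₄) σ-ω)
        Pθ₁ : eval Pθ (σ t) ≡ ζ * θ
        Pθ₁ = trans (sym (σ-eval Pθ t)) (trans (cong σ Pθ≡) σ-θ)
        Pθ₄ : eval Pθ (σ⁴ t) ≡ - θ
        Pθ₄ = trans (sym (σ⁴-eval Pθ t)) (trans (cong σ⁴ Pθ≡) σ⁴-θ)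
        Pθ₅ : eval Pθ (σ (σ⁴ t)) ≡ - (ζ * θ)
        Pθ₅ = trans (sym (σ-eval Pθ (σ⁴ t))) (trans (cong σ Pθ₄) (trans (σ-neg θ) (cong -_ σ-θ)))

        I-1±ζ : Integral ((1# + ζ) * (1# + ζ * ζ))
        I-1±ζ = I-* (I-+ I-1 I-ζ) (I-+ I-1 (I-* I-ζ I-ζ))
        I-1∓ζ : Integral ((1# - ζ) * (1# + ζ * ζ))
        I-1∓ζ = I-* (I-- I-1 I-ζ) (I-+ I-1 (I-* I-ζ I-ζ))

        d₀₁ : ∃ λ w → Integral w × (t - σ t) * w ≡ θ
        d₀₁ = odd-difference I-t I-β₁ Pω≡ Pω₁ Pθ≡ Pθ₁ I-1±ζ (lc₁ (- θ) ζ⁴ (ring [] (ζ ∷ θ ∷ []) (λ z t →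
          (t :- z :* t) :* ((:1 :+ z) :* (:1 :+ z :* z)) :+ :- t :* emb (con (ℤ.- 1ℤ)) ⊜ lit 2 :* t :+ :- t :* z :^ 4) refl))
        d₀₅ : ∃ λ w → Integral w × (t - σ (σ⁴ t)) * w ≡ θ
        d₀₅ = odd-difference I-t I-β₅ Pω≡ Pω₅ Pθ≡ Pθ₅ I-1∓ζ (lc₁ (- θ) ζ⁴ (ring [] (ζ ∷ θ ∷ []) (λ z t →
          (t :- :- (z :* t)) :* ((:1 :- z) :* (:1 :+ z :* z)) :+ :- t :* emb (con (ℤ.- 1ℤ)) ⊜ lit 2 :* t :+ :- t :* z :^ 4) refl))
        d₄₁ : ∃ λ w → Integral w × (σ⁴ t - σ t) * w ≡ θ
        d₄₁ = odd-difference I-β₄ I-β₁ Pω₄ Pω₁ Pθ₄ Pθ₁ (I-neg I-1∓ζ) (lc₁ (- θ) ζ⁴ (ring [] (ζ ∷ θ ∷ []) (λ z t →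
          (:- t :- z :* t) :* (:- ((:1 :- z) :* (:1 :+ z :* z))) :+ :- t :* emb (con (ℤ.- 1ℤ)) ⊜ lit 2 :* t :+ :- t :* z :^ 4) refl))
        d₄₅ : ∃ λ w → Integral w × (σ⁴ t - σ (σ⁴ t)) * w ≡ θ
        d₄₅ = odd-difference I-β₄ I-β₅ Pω₄ Pω₅ Pθ₄ Pθ₅ (I-neg I-1±ζ) (lc₁ (- θ) ζ⁴ (ring [] (ζ ∷ θ ∷ []) (λ z t →
          (:- t :- :- (z :* t)) :* (:- ((:1 :+ z) :* (:1 :+ z :* z))) :+ :- t :* emb (con (ℤ.- 1ℤ)) ⊜ lit 2 :* t :+ :- t :* z :^ 4) refl))

      r₀ : Carrier
      r₀ = (t - σ t) * (t - σ (σ⁴ t)) * ((σ⁴ t - σ t) * (σ⁴ t - σ (σ⁴ t)))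

      abstract
        I-r₀ : Integral r₀
        I-r₀ = I-* (I-* (I-- I-t I-β₁) (I-- I-t I-β₅)) (I-* (I-- I-β₄ I-β₁) (I-- I-β₄ I-β₅))

        -- Each of the four differences divides θ, and θ⁴ = ρ.
        r₀∣ρ : ∃ λ w → Integral w × r₀ * w ≡ ρ
        r₀∣ρ = build d₀₁ d₀₅ d₄₁ d₄₅
          where
          build : (∃ λ w → Integral w × (t - σ t) * w ≡ θ) → (∃ λ w → Integral w × (t - σ (σ⁴ t)) * w ≡ θ) →
                  (∃ λ w → Integral w × (σ⁴ t - σ t) * w ≡ θ) → (∃ λ w → Integral w × (σ⁴ t - σ (σ⁴ t)) * w ≡ θ) → ∃ λ w → Integral w × r₀ * w ≡ ρ
          build (w₁ , i₁ , e₁) (w₂ , i₂ , e₂) (w₃ , i₃ , e₃) (w₄ , i₄ , e₄) = w₁ * w₂ * (w₃ * w₄) , I-* (I-* i₁ i₂) (I-* i₃ i₄) ,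
            trans (ring [] ((t - σ t) ∷ (t - σ (σ⁴ t)) ∷ (σ⁴ t - σ t) ∷ (σ⁴ t - σ (σ⁴ t)) ∷ w₁ ∷ w₂ ∷ w₃ ∷ w₄ ∷ []) (λ a b c d x y z w →
              a :* b :* (c :* d) :* (x :* y :* (z :* w)) ⊜ a :* x :* (b :* y) :* (c :* z :* (d :* w))) refl)
            (trans (cong₂ _*_ (cong₂ _*_ e₁ e₂) (cong₂ _*_ e₃ e₄)) (trans (cong (λ f → f * f) (sym φ-def)) (sym ρ-def)))

    -- The unit ε of ℚ(√-a) in the coordinates of t.

    module RelativeNorm (gen : Generator) where
      open FromGenerator gen public

      open IsSubring

      φ⁴ : φ * φ * (φ * φ) ≡ ⟪ a ⟫
      φ⁴ = trans (cong (λ r → r * r) (sym ρ-def)) ρρ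

      -- With cⱼ = uⱼ + vⱼρ: Nⱼ is the norm of cⱼ from F to ℚ, er + es ρ = 4v₀ρc₂ - c₁² - ρc₃², and
      -- gᵣ - gₛρ = c₁ times the conjugate of c₃. The quantities g and h + 4W are the rational
      -- coordinates of `Hᴵ` below.
      N₁ N₂ N₃ er es T₀ gᵣ gₛ W g h : Carrier
      N₁ = u₁ * u₁ - ⟪ a ⟫ * (v₁ * v₁)
      N₂ = u₂ * u₂ - ⟪ a ⟫ * (v₂ * v₂)
      N₃ = u₃ * u₃ - ⟪ a ⟫ * (v₃ * v₃)
      er = ⟪ pos 4 ⟫ * ⟪ a ⟫ * (v₀ * v₂) - (u₁ * u₁ + ⟪ a ⟫ * (v₁ * v₁) + ⟪ pos 2 ⟫ * ⟪ a ⟫ * (u₃ * v₃))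
      es = ⟪ pos 4 ⟫ * (v₀ * u₂) - (⟪ pos 2 ⟫ * (u₁ * v₁) + u₃ * u₃ + ⟪ a ⟫ * (v₃ * v₃))
      T₀ = ⟪ pos 4 ⟫ * (v₀ * v₀ + u₂ * v₂ - (u₁ * v₃ + u₃ * v₁))
      gᵣ = u₁ * u₃ - ⟪ a ⟫ * (v₁ * v₃)
      gₛ = u₁ * v₃ - v₁ * u₃
      W  = N₁ * N₁ - ⟪ a ⟫ * (N₃ * N₃) - ⟪ pos 4 ⟫ * ⟪ a ⟫ * (gᵣ * gₛ)
      g  = ⟪ pos 4 ⟫ * (er * es) - ⟪ a ⟫ * (T₀ * T₀) + ⟪ pos 4 ⟫ * (N₂ * N₂)
      h  = ⟪ pos 2 ⟫ * (er * er) - ⟪ pos 2 ⟫ * ⟪ a ⟫ * (es * es) + ⟪ pos 4 ⟫ * ⟪ a ⟫ * (T₀ * N₂)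

      -- Chosen so that `Hᴵ` = ρg + ip₀ and (i - 1)`S′` = p′ + q′√-a. Then X + Y√-a is the expansion
      -- of (ρg + ip₀)² + 8(p′ + q′√-a)².
      p₀ p′ q′ X Y : Carrier
      p₀ = h + ⟪ pos 4 ⟫ * W
      p′ = ⟪ pos 2 ⟫ * ⟪ a ⟫ * (gᵣ * T₀) - ⟪ pos 4 ⟫ * ⟪ a ⟫ * (N₂ * gₛ) - ⟪ pos 2 ⟫ * (er * N₁) - ⟪ pos 2 ⟫ * ⟪ a ⟫ * (es * N₃)
      q′ = ⟪ pos 2 ⟫ * (es * N₁) - ⟪ pos 2 ⟫ * (er * N₃) - ⟪ pos 4 ⟫ * (gᵣ * N₂) - ⟪ pos 2 ⟫ * ⟪ a ⟫ * (T₀ * gₛ)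
      X  = ⟪ pos 8 ⟫ * (p′ * p′ - ⟪ a ⟫ * (q′ * q′)) - (p₀ * p₀ - ⟪ a ⟫ * (g * g))
      Y  = ⟪ pos 16 ⟫ * (p′ * q′) + ⟪ pos 2 ⟫ * (p₀ * g)

      ε : Carrier
      ε = X + Y * ι√

      private
        -- A - A′ = φδ gives r₀ = φ²(E² - 4i(BB′)²). Here E = E₀ + φE₁ and V = BB′ = M₀ + φf with
        -- parts fixed by σ². Writing Ẽ and Ṽ for the images under σ², (E² - 4iV²)(Ẽ² - 4iṼ²) = (EẼ
        -- + 4iVṼ)² - 4i(EṼ + ẼV)², where the first bracket is H and the second is 2S.
        δᴵ E E₀ᴵ E₁ᴵ M₀ fᴵ Hᴵ S′ : Carrier
        δᴵ  = ⟪ pos 2 ⟫ * v₀ * φ + (u₂ + v₂ * ρ) - i * (u₂ - v₂ * ρ)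
        E  = φ * (δᴵ * δᴵ) - B * B - i * (B′ * B′)
        E₀ᴵ = (1# + i) * er + (1# - i) * es * ρ
        E₁ᴵ = ρ * T₀ - ⟪ pos 2 ⟫ * i * N₂
        M₀ = N₁ + N₃ * ι√
        fᴵ  = (1# + i) * gᵣ + (1# - i) * gₛ * ρ
        Hᴵ  = (E₀ᴵ * E₀ᴵ - ρ * (E₁ᴵ * E₁ᴵ)) + ⟪ pos 4 ⟫ * i * (M₀ * M₀ - ρ * (fᴵ * fᴵ))
        S′ = M₀ * E₀ᴵ - ρ * (fᴵ * E₁ᴵ)

        abstract
          r₀≡ : r₀ ≡ φ * φ * (E * E - ⟪ pos 4 ⟫ * i * ((B * B′) * (B * B′)))
          r₀≡ = begin
            r₀  ≡⟨ cong₂ (λ x y → x * y) (cong₂ _*_ (cong₂ _-_ t≡ β₁≡) (cong₂ _-_ t≡ β₅≡)) (cong₂ _*_ (cong₂ _-_ β₄≡ β₁≡) (cong₂ _-_ β₄≡ β₅≡)) ⟩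
            _   ≡⟨ ring [] (A ∷ B ∷ A′ ∷ B′ ∷ θ ∷ ζ ∷ []) (λ A B A′ B′ t z →
                     let Δ = A :- A′ ; D = t :* t :* (B :* B) ; D′ = z :* z :* (t :* t) :* (B′ :* B′) in
                     (A :+ B :* t :- (A′ :+ B′ :* (z :* t))) :* (A :+ B :* t :- (A′ :- B′ :* (z :* t))) :* ((A :- B :* t :- (A′ :+ B′ :* (z :* t))) :* (A :- B :* t :- (A′ :- B′ :* (z :* t)))) ⊜
                     (Δ :* Δ :- D :- D′) :* (Δ :* Δ :- D :- D′) :- lit 4 :* (D :* D′)) refl ⟩
            _   ≡⟨ cong₂ (λ fᴵ i → ((A - A′) * (A - A′) - fᴵ * (B * B) - i * fᴵ * (B′ * B′)) * ((A - A′) * (A - A′) - fᴵ * (B * B) - i * fᴵ * (B′ * B′)) - ⟪ pos 4 ⟫ * ((fᴵ * (B * B)) * (i * fᴵ * (B′ * B′)))) (sym φ-def) (sym i-def) ⟩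
            _   ≡⟨ cong (λ x → (x * x - φ * (B * B) - i * φ * (B′ * B′)) * (x * x - φ * (B * B) - i * φ * (B′ * B′)) - ⟪ pos 4 ⟫ * ((φ * (B * B)) * (i * φ * (B′ * B′)))) Δ≡ ⟩
            _   ≡⟨ ring [] (φ ∷ i ∷ δᴵ ∷ B ∷ B′ ∷ []) (λ fᴵ i d B B′ →
                     let y = fᴵ :* d :* (fᴵ :* d) :- fᴵ :* (B :* B) :- i :* fᴵ :* (B′ :* B′) ; E = fᴵ :* (d :* d) :- B :* B :- i :* (B′ :* B′) in
                     y :* y :- lit 4 :* (fᴵ :* (B :* B) :* (i :* fᴵ :* (B′ :* B′))) ⊜ fᴵ :* fᴵ :* (E :* E :- lit 4 :* i :* (B :* B′ :* (B :* B′)))) refl ⟩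
            φ * φ * (E * E - ⟪ pos 4 ⟫ * i * ((B * B′) * (B * B′))) ∎
            where
            Δ≡ : A - A′ ≡ φ * δᴵ
            Δ≡ = lc₁ (⟪ pos 2 ⟫ * v₀) ρ-def (ring [] (u₀ ∷ v₀ ∷ u₂ ∷ v₂ ∷ ρ ∷ φ ∷ i ∷ []) (λ u₀ v₀ u₂ v₂ r fᴵ i →
              (u₀ :+ v₀ :* r) :+ (u₂ :+ v₂ :* r) :* fᴵ :- ((u₀ :- v₀ :* r) :+ (u₂ :- v₂ :* r) :* (i :* fᴵ)) :+ lit 2 :* v₀ :* (fᴵ :* fᴵ) ⊜
              fᴵ :* (lit 2 :* v₀ :* fᴵ :+ (u₂ :+ v₂ :* r) :- i :* (u₂ :- v₂ :* r)) :+ lit 2 :* v₀ :* r) refl)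

          E≡ : E ≡ E₀ᴵ + φ * E₁ᴵ
          -- Writing ρ as φ² and a as φ⁴ leaves i² = -1 as the only relation for the solver to be
          -- told; afterwards the powers of φ are folded back.
          E≡ = trans (cong (λ r → ex r) ρ-def) (trans
            (lc₁ (φ * (c̄ u₂ v₂ * c̄ u₂ v₂) - ⟪ pos 2 ⟫ * (c̄ u₁ v₁ * c̄ u₃ v₃ * φ) - i * (c̄ u₃ v₃ * c̄ u₃ v₃ * (φ * φ))) ii
              (ring [] (v₀ ∷ u₁ ∷ v₁ ∷ u₂ ∷ v₂ ∷ u₃ ∷ v₃ ∷ φ ∷ i ∷ []) (λ v₀ u₁ v₁ u₂ v₂ u₃ v₃ fᴵ i →
                let r = fᴵ :* fᴵ ; a = r :* r ; two = lit 2 ; four = lit 4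
                    δᴵ = two :* v₀ :* fᴵ :+ (u₂ :+ v₂ :* r) :- i :* (u₂ :- v₂ :* r)
                    B = (u₁ :+ v₁ :* r) :+ (u₃ :+ v₃ :* r) :* fᴵ ; B′ = (u₁ :- v₁ :* r) :+ (u₃ :- v₃ :* r) :* (i :* fᴵ)
                    er = four :* a :* (v₀ :* v₂) :- (u₁ :* u₁ :+ a :* (v₁ :* v₁) :+ two :* a :* (u₃ :* v₃))
                    es = four :* (v₀ :* u₂) :- (two :* (u₁ :* v₁) :+ u₃ :* u₃ :+ a :* (v₃ :* v₃))
                    T₀ = four :* (v₀ :* v₀ :+ u₂ :* v₂ :- (u₁ :* v₃ :+ u₃ :* v₁))
                    N₂ = u₂ :* u₂ :- a :* (v₂ :* v₂)
                    c̄ = λ u v → u :- v :* r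
                    co = fᴵ :* (c̄ u₂ v₂ :* c̄ u₂ v₂) :- two :* (c̄ u₁ v₁ :* c̄ u₃ v₃ :* fᴵ) :- i :* (c̄ u₃ v₃ :* c̄ u₃ v₃ :* (fᴵ :* fᴵ)) in
                fᴵ :* (δᴵ :* δᴵ) :- B :* B :- i :* (B′ :* B′) :+ co :* emb (con (ℤ.- 1ℤ)) ⊜
                (:1 :+ i) :* er :+ (:1 :- i) :* es :* r :+ fᴵ :* (r :* T₀ :- two :* i :* N₂) :+ co :* (i :* i)) refl))
            (trans (cong (λ α → e₀₁ (φ * φ) α) φ⁴) (cong (λ r → e₀₁ r ⟪ a ⟫) (sym ρ-def))))
            where
            c̄ : Carrier → Carrier → Carrier
            c̄ u v = u - v * (φ * φ)
            ex : Carrier → Carrier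
            ex ρ = let δᴵ = ⟪ pos 2 ⟫ * v₀ * φ + (u₂ + v₂ * ρ) - i * (u₂ - v₂ * ρ)
                       B = (u₁ + v₁ * ρ) + (u₃ + v₃ * ρ) * φ ; B′ = (u₁ - v₁ * ρ) + (u₃ - v₃ * ρ) * (i * φ)
                   in φ * (δᴵ * δᴵ) - B * B - i * (B′ * B′)
            e₀₁ : Carrier → Carrier → Carrier
            e₀₁ ρ a = let er = ⟪ pos 4 ⟫ * a * (v₀ * v₂) - (u₁ * u₁ + a * (v₁ * v₁) + ⟪ pos 2 ⟫ * a * (u₃ * v₃))
                          es = ⟪ pos 4 ⟫ * (v₀ * u₂) - (⟪ pos 2 ⟫ * (u₁ * v₁) + u₃ * u₃ + a * (v₃ * v₃))
                          N₂ = u₂ * u₂ - a * (v₂ * v₂)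
                      in (1# + i) * er + (1# - i) * es * ρ + φ * (ρ * T₀ - ⟪ pos 2 ⟫ * i * N₂)

          BB′≡ : B * B′ ≡ M₀ + φ * fᴵ
          BB′≡ = trans (cong (λ r → ((u₁ + v₁ * r) + (u₃ + v₃ * r) * φ) * ((u₁ - v₁ * r) + (u₃ - v₃ * r) * (i * φ))) ρ-def) (trans
            (ring [] (u₁ ∷ v₁ ∷ u₃ ∷ v₃ ∷ φ ∷ i ∷ []) (λ u₁ v₁ u₃ v₃ fᴵ i →
              let r = fᴵ :* fᴵ ; a = r :* r in
              ((u₁ :+ v₁ :* r) :+ (u₃ :+ v₃ :* r) :* fᴵ) :* ((u₁ :- v₁ :* r) :+ (u₃ :- v₃ :* r) :* (i :* fᴵ)) ⊜
              (u₁ :* u₁ :- a :* (v₁ :* v₁)) :+ (u₃ :* u₃ :- a :* (v₃ :* v₃)) :* (i :* r) :+ fᴵ :* ((:1 :+ i) :* (u₁ :* u₃ :- a :* (v₁ :* v₃)) :+ (:1 :- i) :* (u₁ :* v₃ :- v₁ :* u₃) :* r)) refl)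
            (trans (cong (λ α → m₀₁ (φ * φ) α (i * (φ * φ))) φ⁴) (trans (cong (λ r → m₀₁ r ⟪ a ⟫ (i * r)) (sym ρ-def)) (cong (m₀₁ ρ ⟪ a ⟫) (sym ι-def)))))
            where
            m₀₁ : Carrier → Carrier → Carrier → Carrier
            m₀₁ ρ a ι = (u₁ * u₁ - a * (v₁ * v₁)) + (u₃ * u₃ - a * (v₃ * v₃)) * ι + φ * ((1# + i) * (u₁ * u₃ - a * (v₁ * v₃)) + (1# - i) * (u₁ * v₃ - v₁ * u₃) * ρ)

          H≡ : Hᴵ ≡ ρ * g + i * p₀
          H≡ = trans (cong (λ ι → hᵢ ⟪ a ⟫ ι) ι-def) (trans (cong (λ α → hᵢ α (i * ρ)) (sym ρρ)) (trans
            (lc₁ (co (ρ * ρ)) ii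
              (ring [] (er ∷ es ∷ T₀ ∷ N₂ ∷ u₁ ∷ v₁ ∷ u₃ ∷ v₃ ∷ ρ ∷ i ∷ []) (λ er es T₀ N₂ u₁ v₁ u₃ v₃ r i →
                let a = r :* r ; two = lit 2 ; four = lit 4
                    N₁ = u₁ :* u₁ :- a :* (v₁ :* v₁) ; N₃ = u₃ :* u₃ :- a :* (v₃ :* v₃)
                    gᵣ = u₁ :* u₃ :- a :* (v₁ :* v₃) ; gₛ = u₁ :* v₃ :- v₁ :* u₃
                    E₀ᴵ = (:1 :+ i) :* er :+ (:1 :- i) :* es :* r ; E₁ᴵ = r :* T₀ :- two :* i :* N₂
                    M₀ = N₁ :+ N₃ :* (i :* r) ; fᴵ = (:1 :+ i) :* gᵣ :+ (:1 :- i) :* gₛ :* r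
                    W = N₁ :* N₁ :- a :* (N₃ :* N₃) :- four :* a :* (gᵣ :* gₛ)
                    g = four :* (er :* es) :- a :* (T₀ :* T₀) :+ four :* (N₂ :* N₂)
                    h = two :* (er :* er) :- two :* a :* (es :* es) :+ four :* a :* (T₀ :* N₂)
                    co = (er :- es :* r) :* (er :- es :* r) :- four :* r :* (N₂ :* N₂) :+ four :* i :* (N₃ :* N₃ :* (r :* r) :- r :* ((gᵣ :- gₛ :* r) :* (gᵣ :- gₛ :* r)))
                in (E₀ᴵ :* E₀ᴵ :- r :* (E₁ᴵ :* E₁ᴵ)) :+ four :* i :* (M₀ :* M₀ :- r :* (fᴵ :* fᴵ)) :+ co :* emb (con (ℤ.- 1ℤ)) ⊜ r :* g :+ i :* (h :+ four :* W) :+ co :* (i :* i)) refl))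
            (cong (λ α → rhs α) ρρ)))
            where
            n₁ n₃ gr gs co rhs : Carrier → Carrier
            n₁ a = u₁ * u₁ - a * (v₁ * v₁)
            n₃ a = u₃ * u₃ - a * (v₃ * v₃)
            gr a = u₁ * u₃ - a * (v₁ * v₃)
            gs a = u₁ * v₃ - v₁ * u₃
            hᵢ : Carrier → Carrier → Carrier
            hᵢ a ι = (E₀ᴵ * E₀ᴵ - ρ * (E₁ᴵ * E₁ᴵ)) + ⟪ pos 4 ⟫ * i * ((n₁ a + n₃ a * ι) * (n₁ a + n₃ a * ι) - ρ * (((1# + i) * gr a + (1# - i) * gs a * ρ) * ((1# + i) * gr a + (1# - i) * gs a * ρ)))
            co a = (er - es * ρ) * (er - es * ρ) - ⟪ pos 4 ⟫ * ρ * (N₂ * N₂) + ⟪ pos 4 ⟫ * i * (n₃ a * n₃ a * (ρ * ρ) - ρ * ((gr a - gs a * ρ) * (gr a - gs a * ρ)))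
            rhs a = ρ * (⟪ pos 4 ⟫ * (er * es) - a * (T₀ * T₀) + ⟪ pos 4 ⟫ * (N₂ * N₂)) +
                    i * (⟪ pos 2 ⟫ * (er * er) - ⟪ pos 2 ⟫ * a * (es * es) + ⟪ pos 4 ⟫ * a * (T₀ * N₂) + ⟪ pos 4 ⟫ * (n₁ a * n₁ a - a * (n₃ a * n₃ a) - ⟪ pos 4 ⟫ * a * (gr a * gs a)))

          S′≡ : (i - 1#) * S′ ≡ p′ + q′ * ι√
          S′≡ = trans (cong (λ ι → (i - 1#) * ((N₁ + N₃ * ι) * E₀ᴵ - ρ * (fᴵ * E₁ᴵ))) ι-def) (trans
            (lc₁ ((N₁ + N₃ * (i * ρ)) * (er - ρ * es) + ⟪ pos 2 ⟫ * (N₃ * es * (ρ * ρ)) - ρ * E₁ᴵ * (gᵣ - ρ * gₛ) + ⟪ pos 4 ⟫ * (ρ * ρ * (gₛ * N₂))) ii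
              (ring [] (er ∷ es ∷ T₀ ∷ N₂ ∷ N₁ ∷ N₃ ∷ gᵣ ∷ gₛ ∷ ρ ∷ i ∷ []) (λ er es T₀ N₂ N₁ N₃ gᵣ gₛ r i →
                let a = r :* r ; two = lit 2 ; four = lit 4
                    E₀ᴵ = (:1 :+ i) :* er :+ (:1 :- i) :* es :* r ; E₁ᴵ = r :* T₀ :- two :* i :* N₂
                    M₀ = N₁ :+ N₃ :* (i :* r) ; fᴵ = (:1 :+ i) :* gᵣ :+ (:1 :- i) :* gₛ :* r
                    co = M₀ :* (er :- r :* es) :+ two :* (N₃ :* es :* (r :* r)) :- r :* E₁ᴵ :* (gᵣ :- r :* gₛ) :+ four :* (r :* r :* (gₛ :* N₂))
                in (i :- :1) :* (M₀ :* E₀ᴵ :- r :* (fᴵ :* E₁ᴵ)) :+ co :* emb (con (ℤ.- 1ℤ)) ⊜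
                   (two :* a :* (gᵣ :* T₀) :- four :* a :* (N₂ :* gₛ) :- two :* (er :* N₁) :- two :* a :* (es :* N₃)) :+
                   (two :* (es :* N₁) :- two :* (er :* N₃) :- four :* (gᵣ :* N₂) :- two :* a :* (T₀ :* gₛ)) :* (i :* r) :+ co :* (i :* i)) refl))
            (cong₂ (λ α ι → (⟪ pos 2 ⟫ * α * (gᵣ * T₀) - ⟪ pos 4 ⟫ * α * (N₂ * gₛ) - ⟪ pos 2 ⟫ * (er * N₁) - ⟪ pos 2 ⟫ * α * (es * N₃)) +
                            (⟪ pos 2 ⟫ * (es * N₁) - ⟪ pos 2 ⟫ * (er * N₃) - ⟪ pos 4 ⟫ * (gᵣ * N₂) - ⟪ pos 2 ⟫ * α * (T₀ * gₛ)) * ι) ρρ (sym ι-def)))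

          -- Since (i - 1)² = -2i, the term -16iS² equals 8((i - 1)S)². Both squares then lie in
          -- ℚ(√-a), because ρg + ip₀ = i(p₀ - g√-a).
          ε≡ : Hᴵ * Hᴵ - ⟪ pos 16 ⟫ * i * (S′ * S′) ≡ ε
          ε≡ = begin
            Hᴵ * Hᴵ - ⟪ pos 16 ⟫ * i * (S′ * S′)
              ≡⟨ lc₁ (- ⟪ pos 8 ⟫ * (S′ * S′)) ii (ring [] (Hᴵ ∷ S′ ∷ i ∷ []) (λ Hᴵ S i → Hᴵ :* Hᴵ :- lit 16 :* i :* (S :* S) :+ :- lit 8 :* (S :* S) :* emb (con (ℤ.- 1ℤ)) ⊜
                   Hᴵ :* Hᴵ :+ lit 8 :* ((i :- :1) :* S :* ((i :- :1) :* S)) :+ :- lit 8 :* (S :* S) :* (i :* i)) refl) ⟩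
            Hᴵ * Hᴵ + ⟪ pos 8 ⟫ * ((i - 1#) * S′ * ((i - 1#) * S′))
              ≡⟨ cong₂ (λ x y → x * x + ⟪ pos 8 ⟫ * (y * y)) H≡ S′≡ ⟩
            (ρ * g + i * p₀) * (ρ * g + i * p₀) + ⟪ pos 8 ⟫ * ((p′ + q′ * ι√) * (p′ + q′ * ι√))
              ≡⟨ lc₂ (p₀ * p₀) ii (⟪ pos 8 ⟫ * (q′ * q′)) ιι (ring (a ∷ []) (ρ ∷ i ∷ ι√ ∷ g ∷ p₀ ∷ p′ ∷ q′ ∷ []) (λ a r i ι g p₀ p q →
                   (r :* g :+ i :* p₀) :* (r :* g :+ i :* p₀) :+ lit 8 :* ((p :+ q :* ι) :* (p :+ q :* ι)) :+ (p₀ :* p₀ :* emb (con (ℤ.- 1ℤ)) :+ lit 8 :* (q :* q) :* emb (:- a)) ⊜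
                   r :* r :* (g :* g) :+ lit 2 :* (p₀ :* g) :* (i :* r) :- p₀ :* p₀ :+ lit 8 :* (p :* p :- emb a :* (q :* q)) :+ lit 16 :* (p :* q) :* ι :+ (p₀ :* p₀ :* (i :* i) :+ lit 8 :* (q :* q) :* (ι :* ι))) refl) ⟩
            ρ * ρ * (g * g) + ⟪ pos 2 ⟫ * (p₀ * g) * (i * ρ) - p₀ * p₀ + ⟪ pos 8 ⟫ * (p′ * p′ - ⟪ a ⟫ * (q′ * q′)) + ⟪ pos 16 ⟫ * (p′ * q′) * ι√
              ≡⟨ cong₂ (λ α ι → α * (g * g) + ⟪ pos 2 ⟫ * (p₀ * g) * ι - p₀ * p₀ + ⟪ pos 8 ⟫ * (p′ * p′ - ⟪ a ⟫ * (q′ * q′)) + ⟪ pos 16 ⟫ * (p′ * q′) * ι√) ρρ (sym ι-def) ⟩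
            ⟪ a ⟫ * (g * g) + ⟪ pos 2 ⟫ * (p₀ * g) * ι√ - p₀ * p₀ + ⟪ pos 8 ⟫ * (p′ * p′ - ⟪ a ⟫ * (q′ * q′)) + ⟪ pos 16 ⟫ * (p′ * q′) * ι√
              ≡⟨ ring (a ∷ []) (ι√ ∷ g ∷ p₀ ∷ p′ ∷ q′ ∷ []) (λ a ι g p₀ p q →
                   emb a :* (g :* g) :+ lit 2 :* (p₀ :* g) :* ι :- p₀ :* p₀ :+ lit 8 :* (p :* p :- emb a :* (q :* q)) :+ lit 16 :* (p :* q) :* ι ⊜
                   lit 8 :* (p :* p :- emb a :* (q :* q)) :- (p₀ :* p₀ :- emb a :* (g :* g)) :+ (lit 16 :* (p :* q) :+ lit 2 :* (p₀ :* g)) :* ι) refl ⟩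
            ε ∎

      Fixed : Carrier → Set
      Fixed x = σ² x ≡ x

      abstract
        Fixed-isSubring : IsSubring Fixed
        Fixed-isSubring = record
          { P-⟪⟫ = λ z → trans (cong σ (σ-⟪⟫ z)) (σ-⟪⟫ z)
          ; P-+ = λ {x} {y} p q → trans (σ²-+ x y) (cong₂ _+_ p q)
          ; P-* = λ {x} {y} p q → trans (σ²-* x y) (cong₂ _*_ p q) }

        subring-- : ∀ {P} → IsSubring P → ∀ {x y} → P x → P y → P (x - y)
        subring-- {P} s {x} {y} px py = subst P (ring [] (x ∷ y ∷ []) (λ x y → x :+ emb (con (ℤ.- 1ℤ)) :* y ⊜ x :- y) refl) (P-+ s px (P-* s (P-⟪⟫ s (ℤ.- 1ℤ)) py))

        fixed : ∀ {x} → Dyadic x → Fixed x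
        fixed d = trans (cong σ (σ-dyadic d)) (σ-dyadic d)

      -- These polynomials lie in every subring containing ℤ[1/2]. This is used for ℤ[1/2] itself
      -- and for the elements fixed by σ².
      module Closure {P : Carrier → Set} (s : IsSubring P) (∈-dyadic : ∀ {x} → Dyadic x → P x) where
        private
          infixl 6 _⊞_ _⊟_
          infixl 7 _⊠_
          _⊞_ : ∀ {x y} → P x → P y → P (x + y)
          _⊞_ = P-+ s
          _⊟_ : ∀ {x y} → P x → P y → P (x - y)
          _⊟_ = subring-- s
          _⊠_ : ∀ {x y} → P x → P y → P (x * y)
          _⊠_ = P-* s
          k : ∀ z → P ⟪ z ⟫
          k = P-⟪⟫ s
          dy : ∀ {x} → Dyadic x → P x
          dy = ∈-dyadic
        abstract
          P-N₁ : P N₁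
          P-N₁ = (dy Du₁) ⊠ (dy Du₁) ⊟ k a ⊠ ((dy Dv₁) ⊠ (dy Dv₁))
          P-N₂ : P N₂
          P-N₂ = (dy Du₂) ⊠ (dy Du₂) ⊟ k a ⊠ ((dy Dv₂) ⊠ (dy Dv₂))
          P-N₃ : P N₃
          P-N₃ = (dy Du₃) ⊠ (dy Du₃) ⊟ k a ⊠ ((dy Dv₃) ⊠ (dy Dv₃))
          P-er : P er
          P-er = k _ ⊠ k _ ⊠ ((dy Dv₀) ⊠ (dy Dv₂)) ⊟ ((dy Du₁) ⊠ (dy Du₁) ⊞ k _ ⊠ ((dy Dv₁) ⊠ (dy Dv₁)) ⊞ k _ ⊠ k _ ⊠ ((dy Du₃) ⊠ (dy Dv₃)))
          P-es : P es
          P-es = k _ ⊠ ((dy Dv₀) ⊠ (dy Du₂)) ⊟ (k _ ⊠ ((dy Du₁) ⊠ (dy Dv₁)) ⊞ (dy Du₃) ⊠ (dy Du₃) ⊞ k _ ⊠ ((dy Dv₃) ⊠ (dy Dv₃)))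
          P-T₀ : P T₀
          P-T₀ = k _ ⊠ ((dy Dv₀) ⊠ (dy Dv₀) ⊞ (dy Du₂) ⊠ (dy Dv₂) ⊟ ((dy Du₁) ⊠ (dy Dv₃) ⊞ (dy Du₃) ⊠ (dy Dv₁)))
          P-gᵣ : P gᵣ
          P-gᵣ = (dy Du₁) ⊠ (dy Du₃) ⊟ k _ ⊠ ((dy Dv₁) ⊠ (dy Dv₃))
          P-gₛ : P gₛ
          P-gₛ = (dy Du₁) ⊠ (dy Dv₃) ⊟ (dy Dv₁) ⊠ (dy Du₃)
          P-W : P W
          P-W = P-N₁ ⊠ P-N₁ ⊟ k _ ⊠ (P-N₃ ⊠ P-N₃) ⊟ k _ ⊠ k _ ⊠ (P-gᵣ ⊠ P-gₛ)
          P-g : P g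
          P-g = k _ ⊠ (P-er ⊠ P-es) ⊟ k _ ⊠ (P-T₀ ⊠ P-T₀) ⊞ k _ ⊠ (P-N₂ ⊠ P-N₂)
          P-p₀ : P p₀
          P-p₀ = k _ ⊠ (P-er ⊠ P-er) ⊟ k _ ⊠ k _ ⊠ (P-es ⊠ P-es) ⊞ k _ ⊠ k _ ⊠ (P-T₀ ⊠ P-N₂) ⊞ k _ ⊠ P-W
          P-p′ : P p′
          P-p′ = k _ ⊠ k _ ⊠ (P-gᵣ ⊠ P-T₀) ⊟ k _ ⊠ k _ ⊠ (P-N₂ ⊠ P-gₛ) ⊟ k _ ⊠ (P-er ⊠ P-N₁) ⊟ k _ ⊠ k _ ⊠ (P-es ⊠ P-N₃)
          P-q′ : P q′
          P-q′ = k _ ⊠ (P-es ⊠ P-N₁) ⊟ k _ ⊠ (P-er ⊠ P-N₃) ⊟ k _ ⊠ (P-gᵣ ⊠ P-N₂) ⊟ k _ ⊠ k _ ⊠ (P-T₀ ⊠ P-gₛ)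
          P-X : P X
          P-X = k _ ⊠ (P-p′ ⊠ P-p′ ⊟ k _ ⊠ (P-q′ ⊠ P-q′)) ⊟ (P-p₀ ⊠ P-p₀ ⊟ k _ ⊠ (P-g ⊠ P-g))
          P-Y : P Y
          P-Y = k _ ⊠ (P-p′ ⊠ P-q′) ⊞ k _ ⊠ (P-p₀ ⊠ P-g)

      module Fix = Closure Fixed-isSubring fixed

      abstract
        -- σ² negates φ and fixes the parts E₀, E₁, M₀ and f, so the product is a relative norm. Its
        -- outer factor φ²·φ² is ρ² = a.
        r₀σ²r₀ : r₀ * σ² r₀ ≡ ⟪ a ⟫ * ε
        r₀σ²r₀ = begin
          r₀ * σ² r₀
            ≡⟨ cong₂ _*_ r₀≡′ (trans (cong σ² r₀≡′) σ²r₀) ⟩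
          φ * φ * quad (E₀ᴵ + φ * E₁ᴵ) (M₀ + φ * fᴵ) * (φ * φ * quad (E₀ᴵ + - φ * E₁ᴵ) (M₀ + - φ * fᴵ))
            ≡⟨ ring [] (φ ∷ i ∷ E₀ᴵ ∷ E₁ᴵ ∷ M₀ ∷ fᴵ ∷ []) (λ p i E₀ᴵ E₁ᴵ M₀ fᴵ →
                 let quad : Expr 0 6 → Expr 0 6 → Expr 0 6
                     quad E V = E :* E :- lit 4 :* i :* (V :* V)
                     r = p :* p
                     Hᴵ = (E₀ᴵ :* E₀ᴵ :- r :* (E₁ᴵ :* E₁ᴵ)) :+ lit 4 :* i :* (M₀ :* M₀ :- r :* (fᴵ :* fᴵ)) ; S = M₀ :* E₀ᴵ :- r :* (fᴵ :* E₁ᴵ)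
                 in p :* p :* quad (E₀ᴵ :+ p :* E₁ᴵ) (M₀ :+ p :* fᴵ) :* (p :* p :* quad (E₀ᴵ :+ :- p :* E₁ᴵ) (M₀ :+ :- p :* fᴵ)) ⊜ p :* p :* (p :* p) :* (Hᴵ :* Hᴵ :- lit 16 :* i :* (S :* S))) refl ⟩
          φ * φ * (φ * φ) * hs (φ * φ)    ≡⟨ cong₂ (λ α r → α * hs r) φ⁴ (sym ρ-def) ⟩
          ⟪ a ⟫ * hs ρ                    ≡⟨ cong (⟪ a ⟫ *_) ε≡ ⟩
          ⟪ a ⟫ * ε                       ∎
          where
          quad : Carrier → Carrier → Carrier
          quad E V = E * E - ⟪ pos 4 ⟫ * i * (V * V)
          hs : Carrier → Carrier
          hs r = ((E₀ᴵ * E₀ᴵ - r * (E₁ᴵ * E₁ᴵ)) + ⟪ pos 4 ⟫ * i * (M₀ * M₀ - r * (fᴵ * fᴵ))) * ((E₀ᴵ * E₀ᴵ - r * (E₁ᴵ * E₁ᴵ)) + ⟪ pos 4 ⟫ * i * (M₀ * M₀ - r * (fᴵ * fᴵ))) -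
                 ⟪ pos 16 ⟫ * i * ((M₀ * E₀ᴵ - r * (fᴵ * E₁ᴵ)) * (M₀ * E₀ᴵ - r * (fᴵ * E₁ᴵ)))
          r₀≡′ : r₀ ≡ φ * φ * quad (E₀ᴵ + φ * E₁ᴵ) (M₀ + φ * fᴵ)
          r₀≡′ = trans r₀≡ (cong₂ (λ E V → φ * φ * quad E V) E≡ BB′≡)
          fx : IsSubring Fixed
          fx = Fixed-isSubring
          F-ρ : Fixed ρ
          F-ρ = σ²-ρ
          F-i : Fixed i
          F-i = σ²-i
          F-ι : Fixed ι√
          F-ι = subst Fixed (sym ι-def) (P-* fx {i} {ρ} F-i F-ρ)
          F-E₀ : Fixed E₀ᴵ
          F-E₀ = P-+ fx (P-* fx (P-+ fx (P-1 fx) F-i) Fix.P-er) (P-* fx (P-* fx (subring-- fx (P-1 fx) F-i) Fix.P-es) F-ρ)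
          F-E₁ : Fixed E₁ᴵ
          F-E₁ = subring-- fx (P-* fx F-ρ Fix.P-T₀) (P-* fx (P-* fx (P-⟪⟫ fx (pos 2)) F-i) Fix.P-N₂)
          F-M₀ : Fixed M₀
          F-M₀ = P-+ fx Fix.P-N₁ (P-* fx Fix.P-N₃ F-ι)
          F-f : Fixed fᴵ
          F-f = P-+ fx (P-* fx (P-+ fx (P-1 fx) F-i) Fix.P-gᵣ) (P-* fx (P-* fx (subring-- fx (P-1 fx) F-i) Fix.P-gₛ) F-ρ)
          conj : ∀ {x y} → Fixed x → Fixed y → σ² (x + φ * y) ≡ x + - φ * y
          conj {x} {y} fx fy = trans (σ²-+ x (φ * y)) (cong₂ _+_ fx (trans (σ²-* φ y) (cong₂ _*_ σ²-φ fy)))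
          σ²-quad : ∀ E V → σ² (quad E V) ≡ quad (σ² E) (σ² V)
          σ²-quad E V = trans (σ²-- (E * E) (⟪ pos 4 ⟫ * i * (V * V))) (cong₂ _-_ (σ²-* E E) (trans (σ²-* (⟪ pos 4 ⟫ * i) (V * V)) (cong₂ _*_ (trans (σ²-* ⟪ pos 4 ⟫ i) (cong₂ _*_ (P-⟪⟫ fx (pos 4)) F-i)) (σ²-* V V))))
          σ²r₀ : σ² (φ * φ * quad (E₀ᴵ + φ * E₁ᴵ) (M₀ + φ * fᴵ)) ≡ φ * φ * quad (E₀ᴵ + - φ * E₁ᴵ) (M₀ + - φ * fᴵ)
          σ²r₀ = trans (σ²-* (φ * φ) (quad (E₀ᴵ + φ * E₁ᴵ) (M₀ + φ * fᴵ))) (cong₂ _*_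
            (trans (σ²-* φ φ) (trans (cong (λ x → x * x) σ²-φ) (ring [] (φ ∷ []) (λ fᴵ → :- fᴵ :* (:- fᴵ) ⊜ fᴵ :* fᴵ) refl)))
            (trans (σ²-quad (E₀ᴵ + φ * E₁ᴵ) (M₀ + φ * fᴵ)) (cong₂ quad (conj F-E₀ F-E₁) (conj F-M₀ F-f))))

      open IsSubring

      module Dy = Closure Dyadic-isSubring (λ d → d)

      abstract
        rational-unit : ∀ {m w} → Integral w → ⟪ m ⟫ * w ≡ 1# → ∃ λ z → m ℤ.* z ≡ 1ℤ
        rational-unit {m} {w} h e = finish (rational {m} {1ℤ} k≢0 h (trans e (sym ⟪1⟫)))
          where
          k≢0 : m ≢ 0ℤ
          k≢0 refl = 1≢0 (⟪⟫-inj (trans ⟪1⟫ (trans (sym e) (trans (cong (_* w) ⟪0⟫) (trans (zeroˡ w) (sym ⟪0⟫))))))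
            where 1≢0 : 1ℤ ≢ 0ℤ
                  1≢0 ()
          finish : (∃ λ z → w ≡ ⟪ z ⟫ × m ℤ.* z ≡ 1ℤ) → ∃ λ z → m ℤ.* z ≡ 1ℤ
          finish (z , _ , p) = z , p

        I-ε : Integral ε
        I-ε = bounded Dy.P-X Dy.P-Y
          where
          bounded : Dyadic X → Dyadic Y → Integral ε
          bounded (dyadic j m p) (dyadic k n r) = odd-cancel (j ℕ.+ k) a-odd (subst Integral r₀σ²r₀ (I-* I-r₀ (I-σ (I-σ I-r₀))))
            (subst Integral (sym (trans (cong (_* ε) (2^-+ j k)) (trans (ring (2^ j ∷ 2^ k ∷ []) (X ∷ Y ∷ ι√ ∷ []) (λ j k x y w → emb j :* emb k :* (x :+ y :* w) ⊜ emb k :* (emb j :* x) :+ emb j :* (emb k :* y) :* w) refl)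
              (cong₂ (λ s t → ⟪ 2^ k ⟫ * s + ⟪ 2^ j ⟫ * t * ι√) p r)))) (I-+ (I-* (I-ι _) (I-ι m)) (I-* (I-* (I-ι _) (I-ι n)) I-ι√)))

        -- If r₀w = ρ, then conjugating by σ² and multiplying gives aε·wσ²(w) = ρ² = a, and a
        -- cancels.
        ε-unit : ∃ λ w → Integral w × ε * w ≡ 1#
        ε-unit = build r₀∣ρ
          where
          build : (∃ λ w → Integral w × r₀ * w ≡ ρ) → ∃ λ w → Integral w × ε * w ≡ 1#
          build (w , I-w , e) = w * σ² w , I-* I-w (I-σ (I-σ I-w)) , cancel a≢0 (begin
            ⟪ a ⟫ * (ε * (w * σ² w))           ≡⟨ trans (sym (*-assoc ⟪ a ⟫ ε (w * σ² w))) (cong (_* (w * σ² w)) (sym r₀σ²r₀)) ⟩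
            r₀ * σ² r₀ * (w * σ² w)            ≡⟨ ring [] (r₀ ∷ σ² r₀ ∷ w ∷ σ² w ∷ []) (λ r s w v → r :* s :* (w :* v) ⊜ r :* w :* (s :* v)) refl ⟩
            r₀ * w * (σ² r₀ * σ² w)            ≡⟨ cong₂ _*_ e (trans (sym (σ²-* r₀ w)) (trans (cong σ² e) σ²-ρ)) ⟩
            ρ * ρ                              ≡⟨ ρρ ⟩
            ⟪ a ⟫                              ≡⟨ *-identityʳ ⟪ a ⟫ ⟨
            ⟪ a ⟫ * 1#                         ∎)

      record UnitCoordinates : Set where
        constructor coordinates
        field
          x y   : ℤ
          X≡    : X ≡ ⟪ x ⟫
          Y≡    : Y ≡ ⟪ y ⟫
          norm≡ : (x ℤ.* x ℤ.+ a ℤ.* (y ℤ.* y) ≡ 1ℤ) ⊎ (x ℤ.* x ℤ.+ a ℤ.* (y ℤ.* y) ≡ ℤ.- 1ℤ)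

      abstract
        -- Since -a ≡ 3 (mod 4), the integers of ℚ(√-a) are ℤ[√-a]: P² + aQ² divisible by 4 forces P
        -- and Q to be even. The norm of the unit ε is an integer dividing 1.
        unit-coordinates : UnitCoordinates
        unit-coordinates = build (quadratic-integer (neg-odd a-odd) ιι σ-ι I-ι√ (adj X Y Dy.P-X Dy.P-Y refl) I-ε) ε-unit
          where
          neg-odd : ∀ {z} → Odd z → Odd (ℤ.- z)
          neg-odd = bit-neg true
          build : QuadraticInteger ι√ (ℤ.- a) ε → (∃ λ w → Integral w × ε * w ≡ 1#) → UnitCoordinates
          build (quadratic P Q M 2z zσz n≡) (w , I-w , e) = finish (proj₁ evens) (proj₂ evens) (rational-unit (I-* I-w (I-σ I-w)) Mw)
            where
            Mw : ⟪ M ⟫ * (w * σ w) ≡ 1#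
            Mw = trans (cong (_* (w * σ w)) (sym zσz)) (trans (ring [] (ε ∷ σ ε ∷ w ∷ σ w ∷ []) (λ r s w v → r :* s :* (w :* v) ⊜ r :* w :* (s :* v)) refl)
              (trans (cong₂ _*_ e (trans (sym (σ-* ε w)) (trans (cong σ e) σ-1))) (*-identityˡ 1#)))
            conj : ∀ {x y} → Dyadic x → Dyadic y → σ (x + y * ι√) ≡ x - y * ι√
            conj {x} {y} dx dy = trans (σ-+ x (y * ι√)) (trans (cong₂ _+_ (σ-dyadic dx) (trans (σ-* y ι√) (cong₂ _*_ (σ-dyadic dy) σ-ι))) (ring [] (x ∷ y ∷ ι√ ∷ []) (λ x y r → x :+ y :* (:- r) ⊜ x :- y :* r) refl))
            2z̄ : ⟪ pos 2 ⟫ * (X - Y * ι√) ≡ ⟪ P ⟫ - ⟪ Q ⟫ * ι√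
            2z̄ = trans (cong₂ _*_ (sym (σ-⟪⟫ (pos 2))) (sym (conj Dy.P-X Dy.P-Y))) (trans (sym (σ-* ⟪ pos 2 ⟫ ε)) (trans (cong σ 2z) (conj (P-⟪⟫ Dyadic-isSubring P) (P-⟪⟫ Dyadic-isSubring Q))))
            2X : ⟪ pos 2 ⟫ * X ≡ ⟪ P ⟫
            2X = cancel {pos 2} (λ ()) (lc₂ 1# 2z 1# 2z̄ (ring (P ∷ Q ∷ []) (X ∷ Y ∷ ι√ ∷ []) (λ P Q X Y r → let two = lit 2 in
              two :* (two :* X) :+ (:1 :* (emb P :+ emb Q :* r) :+ :1 :* (emb P :- emb Q :* r)) ⊜ two :* emb P :+ (:1 :* (two :* (X :+ Y :* r)) :+ :1 :* (two :* (X :- Y :* r)))) refl))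
            2Yι : ⟪ pos 2 ⟫ * Y * ι√ ≡ ⟪ Q ⟫ * ι√
            2Yι = lc₂ 1# 2z (- 1#) 2X (ring (P ∷ Q ∷ []) (X ∷ Y ∷ ι√ ∷ []) (λ P Q X Y r → let two = lit 2 in
              two :* Y :* r :+ (:1 :* (emb P :+ emb Q :* r) :+ :- :1 :* emb P) ⊜ emb Q :* r :+ (:1 :* (two :* (X :+ Y :* r)) :+ :- :1 :* (two :* X))) refl)
            2Y : ⟪ pos 2 ⟫ * Y ≡ ⟪ Q ⟫
            2Y = cancel {ℤ.- a} (λ h → a≢0 (trans (sym (ℤₚ.neg-involutive a)) (cong ℤ.-_ h))) (trans (trans (cong (_* (⟪ pos 2 ⟫ * Y)) (sym ιι)) (ring [] (ι√ ∷ Y ∷ []) (λ r Y → r :* r :* (lit 2 :* Y) ⊜ r :* (lit 2 :* Y :* r)) refl))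
              (trans (cong (ι√ *_) 2Yι) (trans (ring (Q ∷ []) (ι√ ∷ []) (λ Q r → r :* (emb Q :* r) ⊜ r :* r :* emb Q) refl) (cong (_* ⟪ Q ⟫) ιι))))
            evens : Even P × Even Q
            evens = parity-of (P ∷ Q ∷ []) (λ P Q → (P :- Q ∷ Q ∷ []) , P) refl (E-P-Q ∷ E-Q ∷ []) , E-Q
              where
              lem₁ : ∀ P Q c → P ℤ.* P ℤ.+ Q ℤ.* Q ≡ P ℤ.* P ℤ.- (ℤ.- (pos 4 ℤ.* c ℤ.+ 1ℤ)) ℤ.* (Q ℤ.* Q) ℤ.- pos 4 ℤ.* (c ℤ.* (Q ℤ.* Q))
              lem₁ = solve-∀
              lem₂ : ∀ M x → pos 4 ℤ.* M ℤ.- pos 4 ℤ.* x ≡ pos 4 ℤ.* (M ℤ.- x)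
              lem₂ = solve-∀
              PQ : P ℤ.* P ℤ.+ Q ℤ.* Q ≡ pos 4 ℤ.* (M ℤ.- c ℤ.* (Q ℤ.* Q))
              PQ = trans (lem₁ P Q c) (trans (cong (λ x → P ℤ.* P ℤ.- (ℤ.- x) ℤ.* (Q ℤ.* Q) ℤ.- pos 4 ℤ.* (c ℤ.* (Q ℤ.* Q))) (sym a≡)) (trans (cong (ℤ._- pos 4 ℤ.* (c ℤ.* (Q ℤ.* Q))) n≡) (lem₂ M (c ℤ.* (Q ℤ.* Q)))))
              E-P-Q : Even (P ℤ.- Q)
              E-P-Q = parity-of (P ∷ Q ∷ []) (λ P Q → (P :* P :+ Q :* Q ∷ []) , (P :- Q)) refl (four⇒even {m = M ℤ.- c ℤ.* (Q ℤ.* Q)} PQ ∷ [])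
              v : ℤ
              v = proj₁ (even-difference P Q E-P-Q)
              lem₃ : ∀ Q v → pos 2 ℤ.* (Q ℤ.* Q) ℤ.+ pos 4 ℤ.* (Q ℤ.* v ℤ.+ v ℤ.* v) ≡ (Q ℤ.+ pos 2 ℤ.* v) ℤ.* (Q ℤ.+ pos 2 ℤ.* v) ℤ.+ Q ℤ.* Q
              lem₃ = solve-∀
              E-Q : Even Q
              E-Q = parity-of (Q ∷ []) (λ Q → (Q :* Q ∷ []) , Q) refl (quarter {Q ℤ.* Q} {Q ℤ.* v ℤ.+ v ℤ.* v} {M ℤ.- c ℤ.* (Q ℤ.* Q)}
                (trans (lem₃ Q v) (trans (cong (λ P → P ℤ.* P ℤ.+ Q ℤ.* Q) (sym (proj₂ (even-difference P Q E-P-Q)))) PQ)) ∷ [])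
            finish : Even P → Even Q → (∃ λ z → M ℤ.* z ≡ 1ℤ) → UnitCoordinates
            finish (x , P≡) (y , Q≡) (z , Mz) = coordinates x y
              (cancel {pos 2} (λ ()) (trans 2X (trans (cong ⟪_⟫ P≡) (⟪⟫-* (pos 2) x))))
              (cancel {pos 2} (λ ()) (trans 2Y (trans (cong ⟪_⟫ Q≡) (⟪⟫-* (pos 2) y))))
              (sign (unit⇒±1 {M} {z} Mz))
              where
              lem : ∀ a x y → pos 4 ℤ.* (x ℤ.* x ℤ.+ a ℤ.* (y ℤ.* y)) ≡ pos 2 ℤ.* x ℤ.* (pos 2 ℤ.* x) ℤ.- (ℤ.- a) ℤ.* (pos 2 ℤ.* y ℤ.* (pos 2 ℤ.* y))
              lem = solve-∀
              n : x ℤ.* x ℤ.+ a ℤ.* (y ℤ.* y) ≡ M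
              n = ℤₚ.*-cancelˡ-≡ (pos 4) _ _ (trans (lem a x y) (trans (cong₂ (λ P Q → P ℤ.* P ℤ.- (ℤ.- a) ℤ.* (Q ℤ.* Q)) (sym P≡) (sym Q≡)) n≡))
              sign : M ≡ 1ℤ ⊎ M ≡ ℤ.- 1ℤ → (x ℤ.* x ℤ.+ a ℤ.* (y ℤ.* y) ≡ 1ℤ) ⊎ (x ℤ.* x ℤ.+ a ℤ.* (y ℤ.* y) ≡ ℤ.- 1ℤ)
              sign (inj₁ p) = inj₁ (trans n p)
              sign (inj₂ p) = inj₂ (trans n p)

      2B : Carrier
      2B = ⟪ pos 2 ⟫ * B

      abstract
        -- θ⁷(t - σ⁴t) = 2aB is integral, and the odd factor a cancels because the coordinates of B
        -- are dyadic.
        I-2B : Integral 2B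
        I-2B = odd-cancel (proj₁ bounded) a-odd (subst Integral θ⁷d (I-* (I-^ I-θ 7) (I-- I-t I-β₄))) (proj₂ bounded)
          where
          bounded : ∃ λ k → Integral (⟪ 2^ k ⟫ * 2B)
          bounded = DL-bounded (P-* DL-isSubring (P-⟪⟫ DL-isSubring (pos 2)) DL-B)
          θ⁷d : θ ^ 7 * (t - σ⁴ t) ≡ ⟪ a ⟫ * 2B
          θ⁷d = trans (cong (θ ^ 7 *_) (cong₂ _-_ t≡ β₄≡)) (trans (ring [] (A ∷ B ∷ θ ∷ []) (λ A B t → t :^ 7 :* (A :+ B :* t :- (A :- B :* t)) ⊜ t :^ 8 :* (lit 2 :* B)) refl) (cong (_* 2B) θ⁸))

        -- The polynomial that expresses θ through t shows that t - σ⁴t = 2Bθ divides θ - σ⁴θ = 2θ;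
        -- θ cancels.
        2B∣2 : ∃ λ w → Integral w × 2B * w ≡ ⟪ pos 2 ⟫
        2B∣2 = build (eval-difference Pθ I-t I-β₄)
          where
          build : (∃ λ h → Integral h × eval Pθ t - eval Pθ (σ⁴ t) ≡ (t - σ⁴ t) * h) → ∃ λ w → Integral w × 2B * w ≡ ⟪ pos 2 ⟫
          build (h , I-h , e) = h , I-h , θ-cancel (begin
            θ * (⟪ pos 2 ⟫ * B * h)           ≡⟨ ring [] (A ∷ B ∷ θ ∷ h ∷ []) (λ A B t h → t :* (lit 2 :* B :* h) ⊜ (A :+ B :* t :- (A :- B :* t)) :* h) refl ⟩
            ((A + B * θ) - (A - B * θ)) * h   ≡⟨ cong (_* h) (sym (cong₂ _-_ t≡ β₄≡)) ⟩
            (t - σ⁴ t) * h                    ≡⟨ trans (sym e) (cong₂ _-_ Pθ≡ Pθ₄) ⟩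
            θ - - θ                           ≡⟨ ring [] (θ ∷ []) (λ t → t :- (:- t) ⊜ t :* lit 2) refl ⟩
            θ * ⟪ pos 2 ⟫                     ∎)

      private
        module Dᴶ = IsSubring Dyadic-isSubring

      infix 4 _≈_
      -- Congruence modulo a over ℤ[1/2]. As a is odd, a congruence between integers is an honest
      -- one.
      data _≈_ (x y : Carrier) : Set where
        mod-a : ∀ d → Dyadic d → x ≡ y + ⟪ a ⟫ * d → x ≈ y

      abstract
        ≈-trans : ∀ {x y z} → x ≈ y → y ≈ z → x ≈ z
        ≈-trans {z = z} (mod-a d dd p) (mod-a f df r) = mod-a (f + d) (P-+ Dyadic-isSubring df dd) (trans p (trans (cong (_+ ⟪ a ⟫ * d) r) (ring (a ∷ []) (z ∷ d ∷ f ∷ []) (λ a z d f → z :+ emb a :* f :+ emb a :* d ⊜ z :+ emb a :* (f :+ d)) refl)))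

        ≈-* : ∀ {x y x′ y′} → Dyadic y → Dyadic y′ → x ≈ y → x′ ≈ y′ → x * x′ ≈ y * y′
        ≈-* {y = y} {y′ = y′} dy dy′ (mod-a d dd p) (mod-a f df r) = mod-a (y * f + d * y′ + ⟪ a ⟫ * (d * f))
          (Dᴶ.P-+ (Dᴶ.P-+ (Dᴶ.P-* dy df) (Dᴶ.P-* dd dy′)) (Dᴶ.P-* (Dᴶ.P-⟪⟫ a) (Dᴶ.P-* dd df)))
          (trans (cong₂ _*_ p r) (ring (a ∷ []) (y ∷ d ∷ y′ ∷ f ∷ []) (λ a y d y′ f → (y :+ emb a :* d) :* (y′ :+ emb a :* f) ⊜ y :* y′ :+ emb a :* (y :* f :+ d :* y′ :+ emb a :* (d :* f))) refl))

        ≈-scale : ∀ k {x y} → x ≈ y → ⟪ k ⟫ * x ≈ ⟪ k ⟫ * y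
        ≈-scale k {y = y} (mod-a d dd p) = mod-a (⟪ k ⟫ * d) (P-* Dyadic-isSubring (P-⟪⟫ Dyadic-isSubring k) dd) (trans (cong (⟪ k ⟫ *_) p) (ring (a ∷ k ∷ []) (y ∷ d ∷ []) (λ a k y d → emb k :* (y :+ emb a :* d) ⊜ emb k :* y :+ emb a :* (emb k :* d)) refl))

        ≈-+ : ∀ {x y x′ y′} → x ≈ y → x′ ≈ y′ → x + x′ ≈ y + y′
        ≈-+ {y = y} {y′ = y′} (mod-a d dd p) (mod-a f df r) = mod-a (d + f) (P-+ Dyadic-isSubring dd df) (trans (cong₂ _+_ p r) (ring (a ∷ []) (y ∷ d ∷ y′ ∷ f ∷ []) (λ a y d z f → y :+ emb a :* d :+ (z :+ emb a :* f) ⊜ y :+ z :+ emb a :* (d :+ f)) refl))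

        ≈-reflexive : ∀ {x y} → x ≡ y → x ≈ y
        ≈-reflexive {x} refl = mod-a 0# (P-0 Dyadic-isSubring) (ring (a ∷ []) (x ∷ []) (λ a x → x ⊜ x :+ emb a :* :0) refl)

      private
        D-- : ∀ {x y} → Dyadic x → Dyadic y → Dyadic (x - y)
        D-- = subring-- Dyadic-isSubring

        abstract
          er-mod-a : ∀ {v₀ u₁ v₁ v₂ u₃ v₃} → Dyadic v₀ → Dyadic v₁ → Dyadic v₂ → Dyadic u₃ → Dyadic v₃ →
            ⟪ pos 4 ⟫ * ⟪ a ⟫ * (v₀ * v₂) - (u₁ * u₁ + ⟪ a ⟫ * (v₁ * v₁) + ⟪ pos 2 ⟫ * ⟪ a ⟫ * (u₃ * v₃)) ≈ ⟪ ℤ.- 1ℤ ⟫ * (u₁ * u₁)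
          er-mod-a {v₀} {u₁} {v₁} {v₂} {u₃} {v₃} Dv₀ Dv₁ Dv₂ Du₃ Dv₃ = mod-a (⟪ pos 4 ⟫ * (v₀ * v₂) - (v₁ * v₁ + ⟪ pos 2 ⟫ * (u₃ * v₃)))
            (D-- (Dᴶ.P-* (Dᴶ.P-⟪⟫ (pos 4)) (Dᴶ.P-* Dv₀ Dv₂)) (Dᴶ.P-+ (Dᴶ.P-* Dv₁ Dv₁) (Dᴶ.P-* (Dᴶ.P-⟪⟫ (pos 2)) (Dᴶ.P-* Du₃ Dv₃))))
            (ring (a ∷ []) (v₀ ∷ u₁ ∷ v₁ ∷ v₂ ∷ u₃ ∷ v₃ ∷ []) (λ a v₀ u₁ v₁ v₂ u₃ v₃ →
              lit 4 :* emb a :* (v₀ :* v₂) :- (u₁ :* u₁ :+ emb a :* (v₁ :* v₁) :+ lit 2 :* emb a :* (u₃ :* v₃)) ⊜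
              emb (con (ℤ.- 1ℤ)) :* (u₁ :* u₁) :+ emb a :* (lit 4 :* (v₀ :* v₂) :- (v₁ :* v₁ :+ lit 2 :* (u₃ :* v₃)))) refl)

          norm-mod-a : ∀ {u₁ v₁} → Dyadic v₁ → u₁ * u₁ - ⟪ a ⟫ * (v₁ * v₁) ≈ u₁ * u₁
          norm-mod-a {u₁} {v₁} Dv₁ = mod-a (⟪ ℤ.- 1ℤ ⟫ * (v₁ * v₁)) (Dᴶ.P-* (Dᴶ.P-⟪⟫ (ℤ.- 1ℤ)) (Dᴶ.P-* Dv₁ Dv₁))
            (ring (a ∷ []) (u₁ ∷ v₁ ∷ []) (λ a u v → u :* u :- emb a :* (v :* v) ⊜ u :* u :+ emb a :* (emb (con (ℤ.- 1ℤ)) :* (v :* v))) refl)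

          p₀-mod-a : ∀ {u² er es T₀ N₁ N₂ N₃ gᵣ gₛ} → Dyadic u² → Dyadic es → Dyadic T₀ → Dyadic N₂ → Dyadic N₃ → Dyadic gᵣ → Dyadic gₛ → er ≈ ⟪ ℤ.- 1ℤ ⟫ * u² → N₁ ≈ u² →
            ⟪ pos 2 ⟫ * (er * er) - ⟪ pos 2 ⟫ * ⟪ a ⟫ * (es * es) + ⟪ pos 4 ⟫ * ⟪ a ⟫ * (T₀ * N₂) + ⟪ pos 4 ⟫ * (N₁ * N₁ - ⟪ a ⟫ * (N₃ * N₃) - ⟪ pos 4 ⟫ * ⟪ a ⟫ * (gᵣ * gₛ)) ≈ ⟪ pos 6 ⟫ * (u² * u²)
          p₀-mod-a {u²} {er} {es} {T₀} {N₁} {N₂} {N₃} {gᵣ} {gₛ} Du Des DT DN₂ DN₃ Dgᵣ Dgₛ er≈ N₁≈ =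
            ≈-trans {y = ⟪ pos 2 ⟫ * (er * er) + ⟪ pos 4 ⟫ * (N₁ * N₁)} (mod-a (⟪ pos 4 ⟫ * (T₀ * N₂) - ⟪ pos 2 ⟫ * (es * es) - ⟪ pos 4 ⟫ * (N₃ * N₃ + ⟪ pos 4 ⟫ * (gᵣ * gₛ)))
              (D-- (D-- (Dᴶ.P-* (Dᴶ.P-⟪⟫ (pos 4)) (Dᴶ.P-* DT DN₂)) (Dᴶ.P-* (Dᴶ.P-⟪⟫ (pos 2)) (Dᴶ.P-* Des Des))) (Dᴶ.P-* (Dᴶ.P-⟪⟫ (pos 4)) (Dᴶ.P-+ (Dᴶ.P-* DN₃ DN₃) (Dᴶ.P-* (Dᴶ.P-⟪⟫ (pos 4)) (Dᴶ.P-* Dgᵣ Dgₛ)))))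
              (ring (a ∷ []) (er ∷ es ∷ T₀ ∷ N₁ ∷ N₂ ∷ N₃ ∷ gᵣ ∷ gₛ ∷ []) (λ a er es T₀ N₁ N₂ N₃ gᵣ gₛ → let two = lit 2 ; four = lit 4 in
                two :* (er :* er) :- two :* emb a :* (es :* es) :+ four :* emb a :* (T₀ :* N₂) :+ four :* (N₁ :* N₁ :- emb a :* (N₃ :* N₃) :- four :* emb a :* (gᵣ :* gₛ)) ⊜
                two :* (er :* er) :+ four :* (N₁ :* N₁) :+ emb a :* (four :* (T₀ :* N₂) :- two :* (es :* es) :- four :* (N₃ :* N₃ :+ four :* (gᵣ :* gₛ)))) refl))
            (≈-trans {y = ⟪ pos 2 ⟫ * (⟪ ℤ.- 1ℤ ⟫ * u² * (⟪ ℤ.- 1ℤ ⟫ * u²)) + ⟪ pos 4 ⟫ * (u² * u²)}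
              (≈-+ (≈-scale (pos 2) (≈-* (Dᴶ.P-* (Dᴶ.P-⟪⟫ (ℤ.- 1ℤ)) Du) (Dᴶ.P-* (Dᴶ.P-⟪⟫ (ℤ.- 1ℤ)) Du) er≈ er≈)) (≈-scale (pos 4) (≈-* Du Du N₁≈ N₁≈)))
              (≈-reflexive (ring [] (u² ∷ []) (λ u → let m = emb (con (ℤ.- 1ℤ)) in lit 2 :* (m :* u :* (m :* u)) :+ lit 4 :* (u :* u) ⊜ lit 6 :* (u :* u)) refl)))

          p′-mod-a : ∀ {u² er es T₀ N₁ N₂ N₃ gᵣ gₛ} → Dyadic u² → Dyadic es → Dyadic T₀ → Dyadic N₂ → Dyadic N₃ → Dyadic gᵣ → Dyadic gₛ → er ≈ ⟪ ℤ.- 1ℤ ⟫ * u² → N₁ ≈ u² →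
            ⟪ pos 2 ⟫ * ⟪ a ⟫ * (gᵣ * T₀) - ⟪ pos 4 ⟫ * ⟪ a ⟫ * (N₂ * gₛ) - ⟪ pos 2 ⟫ * (er * N₁) - ⟪ pos 2 ⟫ * ⟪ a ⟫ * (es * N₃) ≈ ⟪ pos 2 ⟫ * (u² * u²)
          p′-mod-a {u²} {er} {es} {T₀} {N₁} {N₂} {N₃} {gᵣ} {gₛ} Du Des DT DN₂ DN₃ Dgᵣ Dgₛ er≈ N₁≈ =
            ≈-trans {y = ⟪ ℤ.- pos 2 ⟫ * (er * N₁)} (mod-a (⟪ pos 2 ⟫ * (gᵣ * T₀) - ⟪ pos 4 ⟫ * (N₂ * gₛ) - ⟪ pos 2 ⟫ * (es * N₃))
              (D-- (D-- (Dᴶ.P-* (Dᴶ.P-⟪⟫ (pos 2)) (Dᴶ.P-* Dgᵣ DT)) (Dᴶ.P-* (Dᴶ.P-⟪⟫ (pos 4)) (Dᴶ.P-* DN₂ Dgₛ))) (Dᴶ.P-* (Dᴶ.P-⟪⟫ (pos 2)) (Dᴶ.P-* Des DN₃)))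
              (ring (a ∷ []) (er ∷ es ∷ T₀ ∷ N₁ ∷ N₂ ∷ N₃ ∷ gᵣ ∷ gₛ ∷ []) (λ a er es T₀ N₁ N₂ N₃ gᵣ gₛ → let two = lit 2 ; four = lit 4 in
                two :* emb a :* (gᵣ :* T₀) :- four :* emb a :* (N₂ :* gₛ) :- two :* (er :* N₁) :- two :* emb a :* (es :* N₃) ⊜
                emb (con (ℤ.- pos 2)) :* (er :* N₁) :+ emb a :* (two :* (gᵣ :* T₀) :- four :* (N₂ :* gₛ) :- two :* (es :* N₃))) refl))
            (≈-trans {y = ⟪ ℤ.- pos 2 ⟫ * (⟪ ℤ.- 1ℤ ⟫ * u² * u²)} (≈-scale (ℤ.- pos 2) (≈-* (Dᴶ.P-* (Dᴶ.P-⟪⟫ (ℤ.- 1ℤ)) Du) Du er≈ N₁≈))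
              (≈-reflexive (ring [] (u² ∷ []) (λ u → emb (con (ℤ.- pos 2)) :* (emb (con (ℤ.- 1ℤ)) :* u :* u) ⊜ lit 2 :* (u :* u)) refl)))

          X-mod-a : ∀ {v p₀ p′ q′ g} → Dyadic v → Dyadic q′ → Dyadic g → p₀ ≈ ⟪ pos 6 ⟫ * v → p′ ≈ ⟪ pos 2 ⟫ * v →
            ⟪ pos 8 ⟫ * (p′ * p′ - ⟪ a ⟫ * (q′ * q′)) - (p₀ * p₀ - ⟪ a ⟫ * (g * g)) ≈ ⟪ ℤ.- pos 4 ⟫ * (v * v)
          X-mod-a {v} {p₀} {p′} {q′} {g} Dv Dq Dg p₀≈ p′≈ =
            ≈-trans {y = ⟪ pos 8 ⟫ * (p′ * p′) + ⟪ ℤ.- 1ℤ ⟫ * (p₀ * p₀)} (mod-a (g * g - ⟪ pos 8 ⟫ * (q′ * q′)) (D-- (Dᴶ.P-* Dg Dg) (Dᴶ.P-* (Dᴶ.P-⟪⟫ (pos 8)) (Dᴶ.P-* Dq Dq)))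
              (ring (a ∷ []) (p₀ ∷ p′ ∷ q′ ∷ g ∷ []) (λ a p₀ p q g → lit 8 :* (p :* p :- emb a :* (q :* q)) :- (p₀ :* p₀ :- emb a :* (g :* g)) ⊜
                lit 8 :* (p :* p) :+ emb (con (ℤ.- 1ℤ)) :* (p₀ :* p₀) :+ emb a :* (g :* g :- lit 8 :* (q :* q))) refl))
            (≈-trans {y = ⟪ pos 8 ⟫ * (⟪ pos 2 ⟫ * v * (⟪ pos 2 ⟫ * v)) + ⟪ ℤ.- 1ℤ ⟫ * (⟪ pos 6 ⟫ * v * (⟪ pos 6 ⟫ * v))}
              (≈-+ (≈-scale (pos 8) (≈-* (Dᴶ.P-* (Dᴶ.P-⟪⟫ (pos 2)) Dv) (Dᴶ.P-* (Dᴶ.P-⟪⟫ (pos 2)) Dv) p′≈ p′≈)) (≈-scale (ℤ.- 1ℤ) (≈-* (Dᴶ.P-* (Dᴶ.P-⟪⟫ (pos 6)) Dv) (Dᴶ.P-* (Dᴶ.P-⟪⟫ (pos 6)) Dv) p₀≈ p₀≈)))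
              (≈-reflexive (ring [] (v ∷ []) (λ v → let 2v = lit 2 :* v ; 6v = lit 6 :* v in
                lit 8 :* (2v :* 2v) :+ emb (con (ℤ.- 1ℤ)) :* (6v :* 6v) ⊜ emb (con (ℤ.- pos 4)) :* (v :* v)) refl)))

      u₁⁴ : Carrier
      u₁⁴ = u₁ * u₁ * (u₁ * u₁)

      abstract
        -- Modulo a one has er ≡ -u₁² and N₁ ≡ u₁², so p₀ ≡ 6u₁⁴ and p′ ≡ 2u₁⁴, and X ≡ 8·4u₁⁸ -
        -- 36u₁⁸.
        X≈ : X ≈ ⟪ ℤ.- pos 4 ⟫ * (u₁⁴ * u₁⁴)
        X≈ = X-mod-a (Dᴶ.P-* D-u² D-u²) Dy.P-q′ Dy.P-g
          (p₀-mod-a D-u² Dy.P-es Dy.P-T₀ Dy.P-N₂ Dy.P-N₃ Dy.P-gᵣ Dy.P-gₛ er≈ N₁≈)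
          (p′-mod-a D-u² Dy.P-es Dy.P-T₀ Dy.P-N₂ Dy.P-N₃ Dy.P-gᵣ Dy.P-gₛ er≈ N₁≈)
          where
          D-u² : Dyadic (u₁ * u₁)
          D-u² = Dᴶ.P-* Du₁ Du₁
          er≈ : er ≈ ⟪ ℤ.- 1ℤ ⟫ * (u₁ * u₁)
          er≈ = er-mod-a Dv₀ Dv₁ Dv₂ Du₃ Dv₃
          N₁≈ : N₁ ≈ u₁ * u₁
          N₁≈ = norm-mod-a Dv₁

      private
        module Lᴷ = IsSubring DL-isSubring
        module Fᴷ = IsSubring DF-isSubring

      infix 20 _⊹_ω
      _⊹_ω : ℤ → ℤ → Carrier
      m ⊹ n ω = ⟪ m ⟫ + ⟪ n ⟫ * ω

      abstract
        DF-+ω : ∀ {m n} → DF (m ⊹ n ω)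
        DF-+ω = Fᴷ.P-+ (Fᴷ.P-⟪⟫ _) (Fᴷ.P-* (Fᴷ.P-⟪⟫ _) DF-ω)

        mul-ω : ∀ m n k l → (m ⊹ n ω) * (k ⊹ l ω) ≡ (m ℤ.* k ℤ.+ c ℤ.* (n ℤ.* l)) ⊹ (m ℤ.* l ℤ.+ n ℤ.* k ℤ.+ n ℤ.* l) ω
        mul-ω m n k l = lc₁ (⟪ n ⟫ * ⟪ l ⟫) ωω (ring (c ∷ m ∷ n ∷ k ∷ l ∷ []) (ω ∷ []) (λ c m n k l w →
          (emb m :+ emb n :* w) :* (emb k :+ emb l :* w) :+ emb n :* emb l :* (w :+ emb c) ⊜
          emb (m :* k :+ c :* (n :* l)) :+ emb (m :* l :+ n :* k :+ n :* l) :* w :+ emb n :* emb l :* (w :* w)) refl)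

        ρ-ω : ∀ m n → ρ * (m ⊹ n ω) ≡ (pos 2 ℤ.* c ℤ.* n ℤ.- m) ⊹ (pos 2 ℤ.* m ℤ.+ n) ω
        ρ-ω m n = trans (cong (_* (m ⊹ n ω)) ρ≡2ω-1) (lc₁ (⟪ pos 2 ⟫ * ⟪ n ⟫) ωω (ring (c ∷ m ∷ n ∷ []) (ω ∷ []) (λ c m n w → let k = lit 2 :* emb n in
          (lit 2 :* w :- :1) :* (emb m :+ emb n :* w) :+ k :* (w :+ emb c) ⊜
          emb (con (pos 2) :* c :* n :- m) :+ emb (con (pos 2) :* m :+ n) :* w :+ k :* (w :* w)) refl))

        norm-over-φ : ∀ s₀ s₁ y₀ y₁ → (s₀ + s₁ * φ) * (s₀ + s₁ * φ) - φ * ((y₀ + y₁ * φ) * (y₀ + y₁ * φ)) ≡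
          (s₀ * s₀ + ρ * (s₁ * s₁) - ⟪ pos 2 ⟫ * (ρ * (y₀ * y₁))) + (⟪ pos 2 ⟫ * (s₀ * s₁) - y₀ * y₀ - ρ * (y₁ * y₁)) * φ
        norm-over-φ s₀ s₁ y₀ y₁ = lc₁ (⟪ pos 2 ⟫ * (y₀ * y₁) + y₁ * y₁ * φ - s₁ * s₁) ρ-def
          (ring [] (s₀ ∷ s₁ ∷ y₀ ∷ y₁ ∷ φ ∷ ρ ∷ []) (λ s₀ s₁ y₀ y₁ f r → let two = lit 2 ; k = two :* (y₀ :* y₁) :+ y₁ :* y₁ :* f :- s₁ :* s₁ in
            (s₀ :+ s₁ :* f) :* (s₀ :+ s₁ :* f) :- f :* ((y₀ :+ y₁ :* f) :* (y₀ :+ y₁ :* f)) :+ k :* (f :* f) ⊜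
            (s₀ :* s₀ :+ r :* (s₁ :* s₁) :- two :* (r :* (y₀ :* y₁))) :+ (two :* (s₀ :* s₁) :- y₀ :* y₀ :- r :* (y₁ :* y₁)) :* f :+ k :* r) refl)

        -- With s = t + σ⁴t, p = tσ⁴t and y = 2B the identity 4p = s² - φy² holds. The coordinates
        -- of the doubled quantities are integers, and 4·4p = 8·2p explains the factor 8.
        norm-equations : ∀ {s y p a₀ a₁ b₀ b₁ e₀ e₁ f₀ f₁ l₀ l₁ l₂ l₃} →
          ⟪ pos 2 ⟫ * s ≡ (a₀ ⊹ a₁ ω) + (b₀ ⊹ b₁ ω) * φ → ⟪ pos 2 ⟫ * y ≡ (e₀ ⊹ e₁ ω) + (f₀ ⊹ f₁ ω) * φ → ⟪ pos 2 ⟫ * p ≡ (l₀ ⊹ l₁ ω) + (l₂ ⊹ l₃ ω) * φ →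
          ⟪ pos 4 ⟫ * p ≡ s * s - φ * (y * y) → NormEquations (pos 8) c a₀ a₁ b₀ b₁ e₀ e₁ f₀ f₁ l₀ l₁ l₂ l₃
        norm-equations {s} {y} {p} {a₀} {a₁} {b₀} {b₁} {e₀} {e₁} {f₀} {f₁} {l₀} {l₁} {l₂} {l₃} s≡ y≡ p≡ e = result (DF-split DF-+ω DF-+ω DF-+ω DF-+ω split)
          where
          scale8 : ∀ m n → ⟪ pos 8 ⟫ * (m ⊹ n ω) ≡ (pos 8 ℤ.* m) ⊹ (pos 8 ℤ.* n) ω
          scale8 m n = ring (m ∷ n ∷ []) (ω ∷ []) (λ m n w → lit 8 :* (emb m :+ emb n :* w) ⊜ emb (con (pos 8) :* m) :+ emb (con (pos 8) :* n) :* w) refl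
          B₀ B₁ D₀ D₁ I₀ I₁ F₀ F₁ F₂ F₃ : ℤ
          B₀ = b₀ ℤ.* b₀ ℤ.+ c ℤ.* (b₁ ℤ.* b₁)
          B₁ = b₀ ℤ.* b₁ ℤ.+ b₁ ℤ.* b₀ ℤ.+ b₁ ℤ.* b₁
          D₀ = e₀ ℤ.* f₀ ℤ.+ c ℤ.* (e₁ ℤ.* f₁)
          D₁ = e₀ ℤ.* f₁ ℤ.+ e₁ ℤ.* f₀ ℤ.+ e₁ ℤ.* f₁
          I₀ = f₀ ℤ.* f₀ ℤ.+ c ℤ.* (f₁ ℤ.* f₁)
          I₁ = f₀ ℤ.* f₁ ℤ.+ f₁ ℤ.* f₀ ℤ.+ f₁ ℤ.* f₁
          F₀ = a₀ ℤ.* a₀ ℤ.+ c ℤ.* (a₁ ℤ.* a₁) ℤ.+ (pos 2 ℤ.* c ℤ.* B₁ ℤ.- B₀) ℤ.- pos 2 ℤ.* (pos 2 ℤ.* c ℤ.* D₁ ℤ.- D₀)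
          F₁ = a₀ ℤ.* a₁ ℤ.+ a₁ ℤ.* a₀ ℤ.+ a₁ ℤ.* a₁ ℤ.+ (pos 2 ℤ.* B₀ ℤ.+ B₁) ℤ.- pos 2 ℤ.* (pos 2 ℤ.* D₀ ℤ.+ D₁)
          F₂ = pos 2 ℤ.* (a₀ ℤ.* b₀ ℤ.+ c ℤ.* (a₁ ℤ.* b₁)) ℤ.- (e₀ ℤ.* e₀ ℤ.+ c ℤ.* (e₁ ℤ.* e₁)) ℤ.- (pos 2 ℤ.* c ℤ.* I₁ ℤ.- I₀)
          F₃ = pos 2 ℤ.* (a₀ ℤ.* b₁ ℤ.+ a₁ ℤ.* b₀ ℤ.+ a₁ ℤ.* b₁) ℤ.- (e₀ ℤ.* e₁ ℤ.+ e₁ ℤ.* e₀ ℤ.+ e₁ ℤ.* e₁) ℤ.- (pos 2 ℤ.* I₀ ℤ.+ I₁)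
          combine₀ : ∀ m n k l j h → (m ⊹ n ω) + (k ⊹ l ω) - ⟪ pos 2 ⟫ * (j ⊹ h ω) ≡ (m ℤ.+ k ℤ.- pos 2 ℤ.* j) ⊹ (n ℤ.+ l ℤ.- pos 2 ℤ.* h) ω
          combine₀ m n k l j h = ring (m ∷ n ∷ k ∷ l ∷ j ∷ h ∷ []) (ω ∷ []) (λ m n k l j h w → (emb m :+ emb n :* w) :+ (emb k :+ emb l :* w) :- lit 2 :* (emb j :+ emb h :* w) ⊜
            emb (m :+ k :- con (pos 2) :* j) :+ emb (n :+ l :- con (pos 2) :* h) :* w) refl
          combine₁ : ∀ m n k l j h → ⟪ pos 2 ⟫ * (m ⊹ n ω) - (k ⊹ l ω) - (j ⊹ h ω) ≡ (pos 2 ℤ.* m ℤ.- k ℤ.- j) ⊹ (pos 2 ℤ.* n ℤ.- l ℤ.- h) ω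
          combine₁ m n k l j h = ring (m ∷ n ∷ k ∷ l ∷ j ∷ h ∷ []) (ω ∷ []) (λ m n k l j h w → lit 2 :* (emb m :+ emb n :* w) :- (emb k :+ emb l :* w) :- (emb j :+ emb h :* w) ⊜
            emb (con (pos 2) :* m :- k :- j) :+ emb (con (pos 2) :* n :- l :- h) :* w) refl
          ρ-mul : ∀ m n k l → ρ * ((m ⊹ n ω) * (k ⊹ l ω)) ≡ (pos 2 ℤ.* c ℤ.* (m ℤ.* l ℤ.+ n ℤ.* k ℤ.+ n ℤ.* l) ℤ.- (m ℤ.* k ℤ.+ c ℤ.* (n ℤ.* l))) ⊹ (pos 2 ℤ.* (m ℤ.* k ℤ.+ c ℤ.* (n ℤ.* l)) ℤ.+ (m ℤ.* l ℤ.+ n ℤ.* k ℤ.+ n ℤ.* l)) ω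
          ρ-mul m n k l = trans (cong (ρ *_) (mul-ω m n k l)) (ρ-ω _ _)
          const≡ : (a₀ ⊹ a₁ ω) * (a₀ ⊹ a₁ ω) + ρ * ((b₀ ⊹ b₁ ω) * (b₀ ⊹ b₁ ω)) - ⟪ pos 2 ⟫ * (ρ * ((e₀ ⊹ e₁ ω) * (f₀ ⊹ f₁ ω))) ≡
            F₀ ⊹ F₁ ω
          const≡ = trans (cong₂ _-_ (cong₂ _+_ (mul-ω a₀ a₁ a₀ a₁) (ρ-mul b₀ b₁ b₀ b₁)) (cong (⟪ pos 2 ⟫ *_) (ρ-mul e₀ e₁ f₀ f₁))) (combine₀ _ _ _ _ _ _)
          linear≡ : ⟪ pos 2 ⟫ * ((a₀ ⊹ a₁ ω) * (b₀ ⊹ b₁ ω)) - (e₀ ⊹ e₁ ω) * (e₀ ⊹ e₁ ω) - ρ * ((f₀ ⊹ f₁ ω) * (f₀ ⊹ f₁ ω)) ≡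
            F₂ ⊹ F₃ ω
          linear≡ = trans (cong₂ _-_ (cong₂ _-_ (cong (⟪ pos 2 ⟫ *_) (mul-ω a₀ a₁ b₀ b₁)) (mul-ω e₀ e₁ e₀ e₁)) (ρ-mul f₀ f₁ f₀ f₁)) (combine₁ _ _ _ _ _ _)
          split : (F₀ ⊹ F₁ ω) + (F₂ ⊹ F₃ ω) * φ ≡ ((pos 8 ℤ.* l₀) ⊹ (pos 8 ℤ.* l₁) ω) + ((pos 8 ℤ.* l₂) ⊹ (pos 8 ℤ.* l₃) ω) * φ
          split = begin
            (F₀ ⊹ F₁ ω) + (F₂ ⊹ F₃ ω) * φ                                              ≡⟨ cong₂ (λ x y → x + y * φ) const≡ linear≡ ⟨
            _                                                                          ≡⟨ norm-over-φ (a₀ ⊹ a₁ ω) (b₀ ⊹ b₁ ω) (e₀ ⊹ e₁ ω) (f₀ ⊹ f₁ ω) ⟨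
            _                                                                          ≡⟨ cong₂ (λ s y → s * s - φ * (y * y)) s≡ y≡ ⟨
            ⟪ pos 2 ⟫ * s * (⟪ pos 2 ⟫ * s) - φ * (⟪ pos 2 ⟫ * y * (⟪ pos 2 ⟫ * y))    ≡⟨ ring [] (s ∷ y ∷ φ ∷ []) (λ s y f → let two = lit 2 in two :* s :* (two :* s) :- f :* (two :* y :* (two :* y)) ⊜ lit 4 :* (s :* s :- f :* (y :* y))) refl ⟩
            ⟪ pos 4 ⟫ * (s * s - φ * (y * y))                                          ≡⟨ cong (⟪ pos 4 ⟫ *_) e ⟨
            ⟪ pos 4 ⟫ * (⟪ pos 4 ⟫ * p)                                                ≡⟨ ring [] (p ∷ []) (λ p → lit 4 :* (lit 4 :* p) ⊜ lit 8 :* (lit 2 :* p)) refl ⟩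
            ⟪ pos 8 ⟫ * (⟪ pos 2 ⟫ * p)                                                ≡⟨ cong (⟪ pos 8 ⟫ *_) p≡ ⟩
            ⟪ pos 8 ⟫ * ((l₀ ⊹ l₁ ω) + (l₂ ⊹ l₃ ω) * φ)                                ≡⟨ ring [] (l₀ ⊹ l₁ ω ∷ l₂ ⊹ l₃ ω ∷ φ ∷ []) (λ x y f → lit 8 :* (x :+ y :* f) ⊜ lit 8 :* x :+ lit 8 :* y :* f) refl ⟩
            ⟪ pos 8 ⟫ * (l₀ ⊹ l₁ ω) + ⟪ pos 8 ⟫ * (l₂ ⊹ l₃ ω) * φ                      ≡⟨ cong₂ (λ x y → x + y * φ) (scale8 l₀ l₁) (scale8 l₂ l₃) ⟩
            _                                                                          ∎
          result : (F₀ ⊹ F₁ ω) ≡ ((pos 8 ℤ.* l₀) ⊹ (pos 8 ℤ.* l₁) ω) × (F₂ ⊹ F₃ ω) ≡ ((pos 8 ℤ.* l₂) ⊹ (pos 8 ℤ.* l₃) ω) → NormEquations (pos 8) c a₀ a₁ b₀ b₁ e₀ e₁ f₀ f₁ l₀ l₁ l₂ l₃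
          result (x≡ , y≡) = proj₁ (independentF x≡) , proj₂ (independentF x≡) , proj₁ (independentF y≡) , proj₂ (independentF y≡)

      s p : Carrier
      s = ⟪ pos 2 ⟫ * A
      p = A * A - φ * (B * B)

      abstract
        I-s : Integral s
        I-s = subst Integral (trans (cong₂ _+_ t≡ β₄≡) (ring [] (A ∷ B ∷ θ ∷ []) (λ A B t → A :+ B :* t :+ (A :- B :* t) ⊜ lit 2 :* A) refl)) (I-+ I-t I-β₄)

        p≡ : t * σ⁴ t ≡ p
        p≡ = trans (cong₂ _*_ t≡ β₄≡) (lc₁ (B * B) φ-def (ring [] (A ∷ B ∷ θ ∷ φ ∷ []) (λ A B t f → (A :+ B :* t) :* (A :- B :* t) :+ B :* B :* (t :* t) ⊜ A :* A :- f :* (B :* B) :+ B :* B :* f) refl)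
          )

        I-p : Integral p
        I-p = subst Integral p≡ (I-* I-t I-β₄)

        DL-φ : DL φ
        DL-φ = adjoin-root DF-isSubring
        DL-s : DL s
        DL-s = Lᴷ.P-* (Lᴷ.P-⟪⟫ (pos 2)) DL-A
        DL-2B : DL 2B
        DL-2B = Lᴷ.P-* (Lᴷ.P-⟪⟫ (pos 2)) DL-B
        DL-p : DL p
        DL-p = subring-- DL-isSubring (Lᴷ.P-* DL-A DL-A) (Lᴷ.P-* DL-φ (Lᴷ.P-* DL-B DL-B))

        4p : ⟪ pos 4 ⟫ * p ≡ s * s - φ * (2B * 2B)
        4p = ring [] (A ∷ B ∷ φ ∷ []) (λ A B f → let two = lit 2 in lit 4 :* (A :* A :- f :* (B :* B)) ⊜ two :* A :* (two :* A) :- f :* (two :* B :* (two :* B))) refl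

      -- If B itself is integral, then 2B dividing 2 makes it a unit, and its norm `Nᴸ` from L to ℚ
      -- is ±1.
      module UnitB (I-B : Integral B) where

        private
          module Dᴸ = IsSubring Dyadic-isSubring

          Uᵣ Uₛ Nᴸ : Carrier
          Uᵣ = u₁ * u₁ + ⟪ a ⟫ * (v₁ * v₁ - ⟪ pos 2 ⟫ * (u₃ * v₃))
          Uₛ = ⟪ pos 2 ⟫ * (u₁ * v₁) - (u₃ * u₃ + ⟪ a ⟫ * (v₃ * v₃))
          Nᴸ  = Uᵣ * Uᵣ - ⟪ a ⟫ * (Uₛ * Uₛ)

          abstract
            D-Uᵣ : Dyadic Uᵣ
            D-Uᵣ = Dᴸ.P-+ (Dᴸ.P-* Du₁ Du₁) (Dᴸ.P-* (Dᴸ.P-⟪⟫ a) (subring-- Dyadic-isSubring (Dᴸ.P-* Dv₁ Dv₁) (Dᴸ.P-* (Dᴸ.P-⟪⟫ (pos 2)) (Dᴸ.P-* Du₃ Dv₃))))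
            D-Uₛ : Dyadic Uₛ
            D-Uₛ = subring-- Dyadic-isSubring (Dᴸ.P-* (Dᴸ.P-⟪⟫ (pos 2)) (Dᴸ.P-* Du₁ Dv₁)) (Dᴸ.P-+ (Dᴸ.P-* Du₃ Du₃) (Dᴸ.P-* (Dᴸ.P-⟪⟫ a) (Dᴸ.P-* Dv₃ Dv₃)))
            D-N : Dyadic Nᴸ
            D-N = subring-- Dyadic-isSubring (Dᴸ.P-* D-Uᵣ D-Uᵣ) (Dᴸ.P-* (Dᴸ.P-⟪⟫ a) (Dᴸ.P-* D-Uₛ D-Uₛ))

            BB̃ : B * σ² B ≡ Uᵣ + Uₛ * ρ
            BB̃ = trans (cong (B *_) (trans (σ²-+ (u₁ + v₁ * ρ) ((u₃ + v₃ * ρ) * φ)) (cong₂ _+_ (σ²-DF (adj u₁ v₁ Du₁ Dv₁ refl)) (trans (σ²-* (u₃ + v₃ * ρ) φ) (cong₂ _*_ (σ²-DF (adj u₃ v₃ Du₃ Dv₃ refl)) σ²-φ)))))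
              (lc₂ ((u₃ + v₃ * ρ) * (u₃ + v₃ * ρ)) ρ-def (v₁ * v₁ - ⟪ pos 2 ⟫ * (u₃ * v₃) - v₃ * v₃ * ρ) ρρ
                (ring (a ∷ []) (u₁ ∷ v₁ ∷ u₃ ∷ v₃ ∷ ρ ∷ φ ∷ []) (λ a u₁ v₁ u₃ v₃ r f → let two = lit 2 ; k = v₁ :* v₁ :- two :* (u₃ :* v₃) :- v₃ :* v₃ :* r ; j = (u₃ :+ v₃ :* r) :* (u₃ :+ v₃ :* r) in
                  ((u₁ :+ v₁ :* r) :+ (u₃ :+ v₃ :* r) :* f) :* ((u₁ :+ v₁ :* r) :+ (u₃ :+ v₃ :* r) :* (:- f)) :+ (j :* (f :* f) :+ k :* emb a) ⊜
                  u₁ :* u₁ :+ emb a :* (v₁ :* v₁ :- two :* (u₃ :* v₃)) :+ (two :* (u₁ :* v₁) :- (u₃ :* u₃ :+ emb a :* (v₃ :* v₃))) :* r :+ (j :* r :+ k :* (r :* r))) refl))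

            norm-B : (B * σ² B) * σ (B * σ² B) ≡ Nᴸ
            norm-B = trans (cong (λ x → x * σ x) BB̃) (trans (cong ((Uᵣ + Uₛ * ρ) *_) (trans (σ-+ Uᵣ (Uₛ * ρ)) (cong₂ _+_ (σ-dyadic D-Uᵣ) (trans (σ-* Uₛ ρ) (cong₂ _*_ (σ-dyadic D-Uₛ) σ-ρ)))))
              (lc₁ (- (Uₛ * Uₛ)) ρρ (ring (a ∷ []) (Uᵣ ∷ Uₛ ∷ ρ ∷ []) (λ a x y r → (x :+ y :* r) :* (x :+ y :* (:- r)) :+ :- (y :* y) :* emb a ⊜ x :* x :- emb a :* (y :* y) :+ :- (y :* y) :* (r :* r)) refl)))

            I-N : Integral Nᴸ
            I-N = subst Integral norm-B (I-* I-BB̃ (I-σ I-BB̃))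
              where I-BB̃ : Integral (B * σ² B)
                    I-BB̃ = I-* I-B (I-σ (I-σ I-B))

            B∣1 : ∃ λ w → Integral w × B * w ≡ 1#
            B∣1 = build 2B∣2
              where
              build : (∃ λ w → Integral w × 2B * w ≡ ⟪ pos 2 ⟫) → ∃ λ w → Integral w × B * w ≡ 1#
              build (w , I-w , e) = w , I-w , cancel {pos 2} (λ ()) (trans (sym (*-assoc ⟪ pos 2 ⟫ B w)) (trans e (sym (*-identityʳ ⟪ pos 2 ⟫))))

            N≡±1 : ∃ λ n → Nᴸ ≡ ⟪ n ⟫ × n ℤ.* n ≡ 1ℤ
            N≡±1 = build (dyadic-integral D-N I-N) B∣1
              where
              build : (∃ λ n → Nᴸ ≡ ⟪ n ⟫) → (∃ λ w → Integral w × B * w ≡ 1#) → ∃ λ n → Nᴸ ≡ ⟪ n ⟫ × n ℤ.* n ≡ 1ℤ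
              build (n , N≡) (w , I-w , e) = n , N≡ , square (rational-unit (I-* I-w′ (I-σ I-w′)) unit)
                where
                I-w′ : Integral (w * σ² w)
                I-w′ = I-* I-w (I-σ (I-σ I-w))
                e₂ : (B * σ² B) * (w * σ² w) ≡ 1#
                e₂ = trans (ring [] (B ∷ σ² B ∷ w ∷ σ² w ∷ []) (λ r s w v → r :* s :* (w :* v) ⊜ r :* w :* (s :* v)) refl)
                  (trans (cong₂ _*_ e (trans (sym (σ²-* B w)) (trans (cong σ² e) (trans (cong σ σ-1) σ-1)))) (*-identityˡ 1#))
                unit : ⟪ n ⟫ * (w * σ² w * σ (w * σ² w)) ≡ 1#
                unit = trans (cong (_* (w * σ² w * σ (w * σ² w))) (trans (sym N≡) (sym norm-B)))
                  (trans (ring [] (B * σ² B ∷ σ (B * σ² B) ∷ w * σ² w ∷ σ (w * σ² w) ∷ []) (λ r s w v → r :* s :* (w :* v) ⊜ r :* w :* (s :* v)) refl)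
                  (trans (cong₂ _*_ e₂ (trans (sym (σ-* (B * σ² B) (w * σ² w))) (trans (cong σ e₂) σ-1))) (*-identityˡ 1#)))
                square : (∃ λ z → n ℤ.* z ≡ 1ℤ) → n ℤ.* n ≡ 1ℤ
                square (z , p) with unit⇒±1 {n} {z} p
                ... | inj₁ refl = refl
                ... | inj₂ refl = refl

            N≈ : Nᴸ ≈ u₁⁴
            N≈ = ≈-trans {y = Uᵣ * Uᵣ} (mod-a (⟪ ℤ.- 1ℤ ⟫ * (Uₛ * Uₛ)) (Dᴸ.P-* (Dᴸ.P-⟪⟫ (ℤ.- 1ℤ)) (Dᴸ.P-* D-Uₛ D-Uₛ))
                (ring (a ∷ []) (Uᵣ ∷ Uₛ ∷ []) (λ a x y → x :* x :- emb a :* (y :* y) ⊜ x :* x :+ emb a :* (emb (con (ℤ.- 1ℤ)) :* (y :* y))) refl))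
              (≈-* (Dᴸ.P-* Du₁ Du₁) (Dᴸ.P-* Du₁ Du₁) Uᵣ≈ Uᵣ≈)
              where
              Uᵣ≈ : Uᵣ ≈ u₁ * u₁
              Uᵣ≈ = mod-a (v₁ * v₁ - ⟪ pos 2 ⟫ * (u₃ * v₃)) (subring-- Dyadic-isSubring (Dᴸ.P-* Dv₁ Dv₁) (Dᴸ.P-* (Dᴸ.P-⟪⟫ (pos 2)) (Dᴸ.P-* Du₃ Dv₃))) refl

            ≈-sym : ∀ {x y} → x ≈ y → y ≈ x
            ≈-sym {x} {y} (mod-a d dd p) = mod-a (⟪ ℤ.- 1ℤ ⟫ * d) (Dᴸ.P-* (Dᴸ.P-⟪⟫ (ℤ.- 1ℤ)) dd) (trans (ring (a ∷ []) (y ∷ d ∷ []) (λ a y d → y ⊜ y :+ emb a :* d :+ emb a :* (emb (con (ℤ.- 1ℤ)) :* d)) refl) (cong (_+ ⟪ a ⟫ * (⟪ ℤ.- 1ℤ ⟫ * d)) (sym p)))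

        abstract
          -- The norm of B is ±1 and congruent to u₁⁴ modulo a, so u₁⁸ ≡ 1 and the congruence for X
          -- becomes x ≡ -4.
          x≡-4 : ∀ {x} → X ≡ ⟪ x ⟫ → ∃ λ z → x ℤ.+ pos 4 ≡ a ℤ.* z
          x≡-4 {x} X≡ = build N≡±1
            where
            D-u⁴ : Dyadic u₁⁴
            D-u⁴ = Dᴸ.P-* (Dᴸ.P-* Du₁ Du₁) (Dᴸ.P-* Du₁ Du₁)
            build : (∃ λ n → Nᴸ ≡ ⟪ n ⟫ × n ℤ.* n ≡ 1ℤ) → ∃ λ z → x ℤ.+ pos 4 ≡ a ℤ.* z
            build (n , N≡ , nn) = extract (≈-trans {y = X} (≈-reflexive (sym X≡)) (≈-trans X≈ (≈-scale (ℤ.- pos 4) u⁸≈)))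
              where
              u⁸≈ : u₁⁴ * u₁⁴ ≈ 1#
              u⁸≈ = ≈-trans (≈-* (Dᴸ.P-⟪⟫ n) (Dᴸ.P-⟪⟫ n) u⁴≈ u⁴≈) (≈-reflexive (trans (sym (⟪⟫-* n n)) (trans (cong ⟪_⟫ nn) ⟪1⟫)))
                where u⁴≈ : u₁⁴ ≈ ⟪ n ⟫
                      u⁴≈ = ≈-trans (≈-sym N≈) (≈-reflexive N≡)
              extract : ⟪ x ⟫ ≈ ⟪ ℤ.- pos 4 ⟫ * 1# → ∃ λ z → x ℤ.+ pos 4 ≡ a ℤ.* z
              extract (mod-a d dd e) = finish (dyadic-cancel a-odd dd (subst Integral (sym ad) (I-ι (x ℤ.+ pos 4))))
                where
                ad : ⟪ a ⟫ * d ≡ ⟪ x ℤ.+ pos 4 ⟫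
                ad = trans (ring (a ∷ []) (d ∷ []) (λ a d → emb a :* d ⊜ (emb (con (ℤ.- pos 4)) :* :1 :+ emb a :* d) :+ lit 4) refl) (trans (cong (_+ ⟪ pos 4 ⟫) (sym e)) (sym (⟪⟫-+ x (pos 4))))
                finish : (∃ λ z → d ≡ ⟪ z ⟫) → ∃ λ z → x ℤ.+ pos 4 ≡ a ℤ.* z
                finish (z , d≡) = z , ⟪⟫-inj (trans (sym ad) (trans (cong (⟪ a ⟫ *_) d≡) (sym (⟪⟫-* a z))))

          -- From x² + ay² = ±1 and x ≡ -4 follows that a divides 16 - 1 or 16 + 1.
          exceptional : Exceptional c
          exceptional = build unit-coordinates
            where
            build : UnitCoordinates → Exceptional c
            build (coordinates x y X≡ Y≡ n) = step (x≡-4 X≡) n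
              where
              lem₁ : ∀ a z y → let x = a ℤ.* z ℤ.- pos 4 in pos 15 ≡ a ℤ.* (pos 8 ℤ.* z ℤ.- a ℤ.* (z ℤ.* z) ℤ.- y ℤ.* y) ℤ.+ (x ℤ.* x ℤ.+ a ℤ.* (y ℤ.* y)) ℤ.- 1ℤ
              lem₁ = solve-∀
              lem₂ : ∀ a z y → let x = a ℤ.* z ℤ.- pos 4 in pos 17 ≡ a ℤ.* (pos 8 ℤ.* z ℤ.- a ℤ.* (z ℤ.* z) ℤ.- y ℤ.* y) ℤ.+ (x ℤ.* x ℤ.+ a ℤ.* (y ℤ.* y)) ℤ.+ 1ℤ
              lem₂ = solve-∀
              lem₃ : ∀ x → x ≡ (x ℤ.+ pos 4) ℤ.- pos 4
              lem₃ = solve-∀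
              lem₄ : ∀ x → x ℤ.+ 1ℤ ℤ.- 1ℤ ≡ x
              lem₄ = solve-∀
              lem₅ : ∀ x → x ℤ.+ ℤ.- 1ℤ ℤ.+ 1ℤ ≡ x
              lem₅ = solve-∀
              step : (∃ λ z → x ℤ.+ pos 4 ≡ a ℤ.* z) → (x ℤ.* x ℤ.+ a ℤ.* (y ℤ.* y) ≡ 1ℤ) ⊎ (x ℤ.* x ℤ.+ a ℤ.* (y ℤ.* y) ≡ ℤ.- 1ℤ) → Exceptional c
              step (z , e) (inj₁ p) = small-divisors c (inj₁ refl) (subst (_∣ᶻ pos 15) a≡ (divides (pos 8 ℤ.* z ℤ.- a ℤ.* (z ℤ.* z) ℤ.- y ℤ.* y)
                (trans (lem₁ a z y) (trans (cong (λ w → a ℤ.* (pos 8 ℤ.* z ℤ.- a ℤ.* (z ℤ.* z) ℤ.- y ℤ.* y) ℤ.+ w ℤ.- 1ℤ) (trans (cong (λ x → x ℤ.* x ℤ.+ a ℤ.* (y ℤ.* y)) (sym (trans (lem₃ x) (cong (ℤ._- pos 4) e)))) p)) (lem₄ _)))))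
              step (z , e) (inj₂ p) = small-divisors c (inj₂ refl) (subst (_∣ᶻ pos 17) a≡ (divides (pos 8 ℤ.* z ℤ.- a ℤ.* (z ℤ.* z) ℤ.- y ℤ.* y)
                (trans (lem₂ a z y) (trans (cong (λ w → a ℤ.* (pos 8 ℤ.* z ℤ.- a ℤ.* (z ℤ.* z) ℤ.- y ℤ.* y) ℤ.+ w ℤ.+ 1ℤ) (trans (cong (λ x → x ℤ.* x ℤ.+ a ℤ.* (y ℤ.* y)) (sym (trans (lem₃ x) (cong (ℤ._- pos 4) e)))) p)) (lem₅ _)))))

      -- a ≡ 5 (mod 8): only a = -3 survives.

      module OddCase (c-odd : Odd c) where

        record IntegralL (z : Carrier) : Set where
          constructor integralL
          field
            x₀ x₁ y₀ y₁ : ℤ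
            z≡ : z ≡ (x₀ ⊹ x₁ ω) + (y₀ ⊹ y₁ ω) * φ

        2* : ℤ → ℤ
        2* x = pos 2 ℤ.* x

        abstract
          double-ω : ∀ {z x₀ x₁ y₀ y₁} → z ≡ (x₀ ⊹ x₁ ω) + (y₀ ⊹ y₁ ω) * φ → ⟪ pos 2 ⟫ * z ≡ (2* x₀ ⊹ 2* x₁ ω) + (2* y₀ ⊹ 2* y₁ ω) * φ
          double-ω {z} {x₀} {x₁} {y₀} {y₁} e = trans (cong (⟪ pos 2 ⟫ *_) e) (ring (x₀ ∷ x₁ ∷ y₀ ∷ y₁ ∷ []) (ω ∷ φ ∷ []) (λ x₀ x₁ y₀ y₁ w f → let two = con (pos 2) in
            emb two :* ((emb x₀ :+ emb x₁ :* w) :+ (emb y₀ :+ emb y₁ :* w) :* f) ⊜ (emb (two :* x₀) :+ emb (two :* x₁) :* w) :+ (emb (two :* y₀) :+ emb (two :* y₁) :* w) :* f) refl)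

          halve-ω : ∀ {z p₀ p₁ q₀ q₁} → ⟪ pos 2 ⟫ * z ≡ (p₀ ⊹ p₁ ω) + (q₀ ⊹ q₁ ω) * φ → Even p₀ → Even p₁ → Even q₀ → Even q₁ → IntegralL z
          halve-ω {z} e (x₀ , refl) (x₁ , refl) (y₀ , refl) (y₁ , refl) = integralL x₀ x₁ y₀ y₁ (cancel {pos 2} (λ ()) (trans e (sym (double-ω {_} {x₀} {x₁} {y₀} {y₁} refl))))

          -- For odd c the condition that cq₁ is even forces q₁, and with it every coordinate of 2z,
          -- to be even: 1, ω, φ, ωφ is an integral basis of L.
          integralL-of : ∀ {z} → DL z → Integral z → IntegralL z
          integralL-of {z} d h = build (integerOfL d h)
            where
            build : IntegerOfL z → IntegralL z
            build (intL p₀ p₁ q₀ q₁ e (Ep₀ , Eq₀ , Ep₁-q₁ , Ecq₁)) = halve-ω e Ep₀ Ep₁ Eq₀ Eq₁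
              where
              Eq₁ : Even q₁
              Eq₁ with parity q₁
              ... | inj₁ v = v
              ... | inj₂ o = ⊥-elim (even-odd Ecq₁ (odd-* c-odd o))
              Ep₁ : Even p₁
              Ep₁ = parity-of (p₁ ∷ q₁ ∷ []) (λ p q → (p :- q ∷ q ∷ []) , p) refl (Ep₁-q₁ ∷ Eq₁ ∷ [])

          -- s² - φ(2B)² = 4p is divisible by 4, which for odd c forces s = 2A and 2B to be
          -- divisible by 2 among the integers of L.
          integral-halves : IntegralL A × IntegralL B
          integral-halves = build (integralL-of DL-s I-s) (integralL-of DL-2B I-2B) (integralL-of DL-p I-p)
            where
            build : IntegralL s → IntegralL 2B → IntegralL p → IntegralL A × IntegralL B
            build (integralL a₀ a₁ b₀ b₁ s≡) (integralL e₀ e₁ f₀ f₁ y≡) (integralL l₀ l₁ l₂ l₃ p≡′) =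
              finish (even-coordinates {c} {a₀} {a₁} {b₀} {b₁} {e₀} {e₁} {f₀} {f₁} {l₀} {l₁} {l₂} {l₃} c-odd (halve-equations c a₀ a₁ b₀ b₁ e₀ e₁ f₀ f₁ {l₀} {l₁} {l₂} {l₃}
                (norm-equations {s} {2B} {p} (double-ω s≡) (double-ω y≡) (double-ω p≡′) 4p)))
              where
              finish : (Even a₀ × Even a₁ × Even b₀ × Even b₁) × (Even e₀ × Even e₁ × Even f₀ × Even f₁) → IntegralL A × IntegralL B
              finish ((A₀ , A₁ , B₀ , B₁) , (E₀ , E₁ , F₀ , F₁)) = halve-ω s≡ A₀ A₁ B₀ B₁ , halve-ω y≡ E₀ E₁ F₀ F₁

          I-⊹ω : ∀ {m n} → Integral (m ⊹ n ω)
          I-⊹ω {m} {n} = I-+ (I-ι m) (I-* (I-ι n) I-ω)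

          components : ∀ {x y} → DF x → DF y → IntegralL (x + y * φ) → Integral x × Integral y
          components {x} {y} dx dy (integralL x₀ x₁ y₀ y₁ e) = finish (DF-split dx dy DF-+ω DF-+ω e)
            where
            finish : x ≡ (x₀ ⊹ x₁ ω) × y ≡ (y₀ ⊹ y₁ ω) → Integral x × Integral y
            finish (p , q) = subst Integral (sym p) I-⊹ω , subst Integral (sym q) I-⊹ω

          I-B : Integral B
          I-B = build (proj₂ integral-halves)
            where
            build : IntegralL B → Integral B
            build (integralL _ _ _ _ e) = subst Integral (sym e) (I-+ I-⊹ω (I-* I-⊹ω I-φ))

          c≡±1 : Exceptional c → c ≡ 1ℤ ⊎ c ≡ ℤ.- 1ℤ
          c≡±1 (inj₁ refl) = ⊥-elim (even-odd (0ℤ , refl) c-odd)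
          c≡±1 (inj₂ (inj₁ e)) = inj₁ e
          c≡±1 (inj₂ (inj₂ (inj₁ e))) = inj₂ e
          c≡±1 (inj₂ (inj₂ (inj₂ (inj₁ refl)))) = ⊥-elim (even-odd (ℤ.- pos 2 , refl) c-odd)
          c≡±1 (inj₂ (inj₂ (inj₂ (inj₂ refl)))) = ⊥-elim (even-odd (pos 2 , refl) c-odd)

          c-value : c ≡ 1ℤ ⊎ c ≡ ℤ.- 1ℤ
          c-value = c≡±1 (UnitB.exceptional I-B)

        Int : Carrier → Set
        Int x = ∃ λ z → x ≡ ⟪ z ⟫

        Int-isSubring : IsSubring Int
        Int-isSubring = record
          { P-⟪⟫ = λ z → z , refl
          ; P-+ = λ { (y , p) (z , q) → y ℤ.+ z , trans (cong₂ _+_ p q) (sym (⟪⟫-+ y z)) }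
          ; P-* = λ { (y , p) (z , q) → y ℤ.* z , trans (cong₂ _*_ p q) (sym (⟪⟫-* y z)) } }

        private
          module Dᴹ = IsSubring Dyadic-isSubring
          module Z = IsSubring Int-isSubring
          2·_ : Carrier → Carrier
          2· x = ⟪ pos 2 ⟫ * x

          abstract
            conj-F : ∀ {u v} → Dyadic u → Dyadic v → σ (u + v * ρ) ≡ u - v * ρ
            conj-F {u} {v} du dv = trans (σ-+ u (v * ρ)) (trans (cong₂ _+_ (σ-dyadic du) (trans (σ-* v ρ) (cong₂ _*_ (σ-dyadic dv) σ-ρ))) (ring [] (u ∷ v ∷ ρ ∷ []) (λ x y r → x :+ y :* (:- r) ⊜ x :- y :* r) refl))

            half-integers : ∀ {u v} → Dyadic u → Dyadic v → Integral (u + v * ρ) → Int (2· u) × Int (2· v)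
            half-integers {u} {v} du dv h =
              dyadic-integral (Dᴹ.P-* (Dᴹ.P-⟪⟫ (pos 2)) du) (subst Integral (trans (cong (u + v * ρ +_) (conj-F du dv)) (ring [] (u ∷ v ∷ ρ ∷ []) (λ u v r → u :+ v :* r :+ (u :- v :* r) ⊜ lit 2 :* u) refl)) (I-+ h (I-σ h))) ,
              dyadic-cancel a-odd (Dᴹ.P-* (Dᴹ.P-⟪⟫ (pos 2)) dv) (subst Integral (trans (cong (λ x → ρ * (u + v * ρ - x)) (conj-F du dv))
                (trans (ring [] (u ∷ v ∷ ρ ∷ []) (λ u v r → r :* (u :+ v :* r :- (u :- v :* r)) ⊜ r :* r :* (lit 2 :* v)) refl) (cong (_* (2· v)) ρρ))) (I-* I-ρ (I-- h (I-σ h))))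

            norm-integer : ∀ {u v} → Dyadic u → Dyadic v → Integral (u + v * ρ) → Int (u * u - ⟪ a ⟫ * (v * v))
            norm-integer {u} {v} du dv h = dyadic-integral (subring-- Dyadic-isSubring (Dᴹ.P-* du du) (Dᴹ.P-* (Dᴹ.P-⟪⟫ a) (Dᴹ.P-* dv dv)))
              (subst Integral (trans (cong ((u + v * ρ) *_) (conj-F du dv)) (lc₁ (- (v * v)) ρρ (ring (a ∷ []) (u ∷ v ∷ ρ ∷ []) (λ a x y r →
                (x :+ y :* r) :* (x :- y :* r) :+ :- (y :* y) :* emb a ⊜ x :* x :- emb a :* (y :* y) :+ :- (y :* y) :* (r :* r)) refl))) (I-* h (I-σ h)))

            I-c : (Integral (u₀ + v₀ * ρ) × Integral (u₂ + v₂ * ρ)) × (Integral (u₁ + v₁ * ρ) × Integral (u₃ + v₃ * ρ))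
            I-c = components (adj u₀ v₀ Du₀ Dv₀ refl) (adj u₂ v₂ Du₂ Dv₂ refl) (proj₁ integral-halves) , components (adj u₁ v₁ Du₁ Dv₁ refl) (adj u₃ v₃ Du₃ Dv₃ refl) (proj₂ integral-halves)
            I-c₀ : Integral (u₀ + v₀ * ρ)
            I-c₀ = proj₁ (proj₁ I-c)
            I-c₂ : Integral (u₂ + v₂ * ρ)
            I-c₂ = proj₂ (proj₁ I-c)
            I-c₁ : Integral (u₁ + v₁ * ρ)
            I-c₁ = proj₁ (proj₂ I-c)
            I-c₃ : Integral (u₃ + v₃ * ρ)
            I-c₃ = proj₂ (proj₂ I-c)

            Z-2v₀ : Int (2· v₀)
            Z-2v₀ = proj₂ (half-integers Du₀ Dv₀ I-c₀)
            Z-2u₁ : Int (2· u₁)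
            Z-2u₁ = proj₁ (half-integers Du₁ Dv₁ I-c₁)
            Z-2v₁ : Int (2· v₁)
            Z-2v₁ = proj₂ (half-integers Du₁ Dv₁ I-c₁)
            Z-2u₂ : Int (2· u₂)
            Z-2u₂ = proj₁ (half-integers Du₂ Dv₂ I-c₂)
            Z-2v₂ : Int (2· v₂)
            Z-2v₂ = proj₂ (half-integers Du₂ Dv₂ I-c₂)
            Z-2u₃ : Int (2· u₃)
            Z-2u₃ = proj₁ (half-integers Du₃ Dv₃ I-c₃)
            Z-2v₃ : Int (2· v₃)
            Z-2v₃ = proj₂ (half-integers Du₃ Dv₃ I-c₃)

            Z-N₁ : Int N₁
            Z-N₁ = norm-integer Du₁ Dv₁ I-c₁
            Z-N₂ : Int N₂
            Z-N₂ = norm-integer Du₂ Dv₂ I-c₂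
            Z-N₃ : Int N₃
            Z-N₃ = norm-integer Du₃ Dv₃ I-c₃

            Z-T₀ : Int T₀
            Z-T₀ = subst Int (ring [] (v₀ ∷ u₁ ∷ v₁ ∷ u₂ ∷ v₂ ∷ u₃ ∷ v₃ ∷ []) (λ v₀ u₁ v₁ u₂ v₂ u₃ v₃ → let two = lit 2 in
                (two :* v₀) :* (two :* v₀) :+ (two :* u₂) :* (two :* v₂) :- ((two :* u₁) :* (two :* v₃) :+ (two :* u₃) :* (two :* v₁)) ⊜
                lit 4 :* (v₀ :* v₀ :+ u₂ :* v₂ :- (u₁ :* v₃ :+ u₃ :* v₁))) refl)
              (subring-- Int-isSubring (Z.P-+ (Z.P-* Z-2v₀ Z-2v₀) (Z.P-* Z-2u₂ Z-2v₂)) (Z.P-+ (Z.P-* Z-2u₁ Z-2v₃) (Z.P-* Z-2u₃ Z-2v₁)))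

            e≡ : ⟪ pos 2 ⟫ * (2· v₀) * ρ * (u₂ + v₂ * ρ) - (u₁ + v₁ * ρ) * (u₁ + v₁ * ρ) - ρ * ((u₃ + v₃ * ρ) * (u₃ + v₃ * ρ)) ≡ er + es * ρ
            e≡ = lc₁ (v₁ * v₁ + ⟪ pos 2 ⟫ * (u₃ * v₃) + v₃ * v₃ * ρ - ⟪ pos 4 ⟫ * (v₀ * v₂)) (sym ρρ) (ring (a ∷ []) (v₀ ∷ u₁ ∷ v₁ ∷ u₂ ∷ v₂ ∷ u₃ ∷ v₃ ∷ ρ ∷ []) (λ a v₀ u₁ v₁ u₂ v₂ u₃ v₃ r →
              let two = lit 2 ; four = lit 4 ; a = emb a ; k = v₁ :* v₁ :+ two :* (u₃ :* v₃) :+ v₃ :* v₃ :* r :- four :* (v₀ :* v₂) in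
              two :* (two :* v₀) :* r :* (u₂ :+ v₂ :* r) :- (u₁ :+ v₁ :* r) :* (u₁ :+ v₁ :* r) :- r :* ((u₃ :+ v₃ :* r) :* (u₃ :+ v₃ :* r)) :+ k :* (r :* r) ⊜
              (four :* a :* (v₀ :* v₂) :- (u₁ :* u₁ :+ a :* (v₁ :* v₁) :+ two :* a :* (u₃ :* v₃))) :+ (four :* (v₀ :* u₂) :- (two :* (u₁ :* v₁) :+ u₃ :* u₃ :+ a :* (v₃ :* v₃))) :* r :+ k :* a) refl)

            I-Int : ∀ {x} → Int x → Integral x
            I-Int (z , e) = subst Integral (sym e) (I-ι z)

            I-e : Integral (er + es * ρ)
            I-e = subst Integral e≡ (I-- (I-- (I-* (I-* (I-* (I-ι _) (I-Int Z-2v₀)) I-ρ) I-c₂) (I-* I-c₁ I-c₁)) (I-* I-ρ (I-* I-c₃ I-c₃)))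

            Z-2er : Int (2· er)
            Z-2er = proj₁ (half-integers Dy.P-er Dy.P-es I-e)
            Z-2es : Int (2· es)
            Z-2es = proj₂ (half-integers Dy.P-er Dy.P-es I-e)
            Z-Ne : Int (er * er - ⟪ a ⟫ * (es * es))
            Z-Ne = norm-integer Dy.P-er Dy.P-es I-e

            f≡ : (u₁ + v₁ * ρ) * σ (u₃ + v₃ * ρ) ≡ gᵣ + (- gₛ) * ρ
            f≡ = trans (cong ((u₁ + v₁ * ρ) *_) (conj-F Du₃ Dv₃)) (lc₁ (- (v₁ * v₃)) ρρ (ring (a ∷ []) (u₁ ∷ v₁ ∷ u₃ ∷ v₃ ∷ ρ ∷ []) (λ a u₁ v₁ u₃ v₃ r →
              (u₁ :+ v₁ :* r) :* (u₃ :- v₃ :* r) :+ :- (v₁ :* v₃) :* emb a ⊜ u₁ :* u₃ :- emb a :* (v₁ :* v₃) :+ :- (u₁ :* v₃ :- v₁ :* u₃) :* r :+ :- (v₁ :* v₃) :* (r :* r)) refl))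

            D-neg : ∀ {x} → Dyadic x → Dyadic (- x)
            D-neg {x} d = subst Dyadic (ring [] (x ∷ []) (λ x → emb (con (ℤ.- 1ℤ)) :* x ⊜ :- x) refl) (Dᴹ.P-* (Dᴹ.P-⟪⟫ (ℤ.- 1ℤ)) d)

            I-f : Integral (gᵣ + (- gₛ) * ρ)
            I-f = subst Integral f≡ (I-* I-c₁ (I-σ I-c₃))
            Z-2gᵣ : Int (2· gᵣ)
            Z-2gᵣ = proj₁ (half-integers Dy.P-gᵣ (D-neg Dy.P-gₛ) I-f)
            Z-2gₛ : Int (2· gₛ)
            Z-2gₛ = subst Int (ring [] (gₛ ∷ []) (λ x → emb (con (ℤ.- 1ℤ)) :* (lit 2 :* (:- x)) ⊜ lit 2 :* x) refl) (Z.P-* (Z.P-⟪⟫ (ℤ.- 1ℤ)) (proj₂ (half-integers Dy.P-gᵣ (D-neg Dy.P-gₛ) I-f)))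

            -- uⱼ and vⱼ are only half-integers. Grouping p₀/2 into norms of integers of F and
            -- products of doubled coordinates shows that it is an integer, as the argument modulo 8
            -- for a = 5 needs.
            Z-p₀/2 : Int (er * er - ⟪ a ⟫ * (es * es) + ⟪ pos 2 ⟫ * ⟪ a ⟫ * (T₀ * N₂) + ⟪ pos 2 ⟫ * (N₁ * N₁ - ⟪ a ⟫ * (N₃ * N₃) - ⟪ a ⟫ * ((2· gᵣ) * (2· gₛ))))
            Z-p₀/2 = Z.P-+ (Z.P-+ Z-Ne (Z.P-* (Z.P-* (Z.P-⟪⟫ (pos 2)) (Z.P-⟪⟫ a)) (Z.P-* Z-T₀ Z-N₂)))
              (Z.P-* (Z.P-⟪⟫ (pos 2)) (subring-- Int-isSubring (subring-- Int-isSubring (Z.P-* Z-N₁ Z-N₁) (Z.P-* (Z.P-⟪⟫ a) (Z.P-* Z-N₃ Z-N₃))) (Z.P-* (Z.P-⟪⟫ a) (Z.P-* Z-2gᵣ Z-2gₛ))))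
            p₀≡ : p₀ ≡ ⟪ pos 2 ⟫ * (er * er - ⟪ a ⟫ * (es * es) + ⟪ pos 2 ⟫ * ⟪ a ⟫ * (T₀ * N₂) + ⟪ pos 2 ⟫ * (N₁ * N₁ - ⟪ a ⟫ * (N₃ * N₃) - ⟪ a ⟫ * ((2· gᵣ) * (2· gₛ))))
            p₀≡ = ring (a ∷ []) (er ∷ es ∷ T₀ ∷ N₁ ∷ N₂ ∷ N₃ ∷ gᵣ ∷ gₛ ∷ []) (λ a er es T₀ N₁ N₂ N₃ gᵣ gₛ → let two = lit 2 ; four = lit 4 in
                  two :* (er :* er) :- two :* emb a :* (es :* es) :+ four :* emb a :* (T₀ :* N₂) :+ four :* (N₁ :* N₁ :- emb a :* (N₃ :* N₃) :- four :* emb a :* (gᵣ :* gₛ)) ⊜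
                  two :* (er :* er :- emb a :* (es :* es) :+ two :* emb a :* (T₀ :* N₂) :+ two :* (N₁ :* N₁ :- emb a :* (N₃ :* N₃) :- emb a :* ((two :* gᵣ) :* (two :* gₛ))))) refl

            Z-g : Int g
            Z-g = subst Int (ring (a ∷ []) (er ∷ es ∷ T₀ ∷ N₂ ∷ []) (λ a er es T₀ N₂ → let two = lit 2 ; four = lit 4 in
                (two :* er) :* (two :* es) :- emb a :* (T₀ :* T₀) :+ four :* (N₂ :* N₂) ⊜ four :* (er :* es) :- emb a :* (T₀ :* T₀) :+ four :* (N₂ :* N₂)) refl)
              (Z.P-+ (subring-- Int-isSubring (Z.P-* Z-2er Z-2es) (Z.P-* (Z.P-⟪⟫ a) (Z.P-* Z-T₀ Z-T₀))) (Z.P-* (Z.P-⟪⟫ (pos 4)) (Z.P-* Z-N₂ Z-N₂)))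

            Z-p′ : Int p′
            Z-p′ = subst Int (ring (a ∷ []) (er ∷ es ∷ T₀ ∷ N₁ ∷ N₂ ∷ N₃ ∷ gᵣ ∷ gₛ ∷ []) (λ a er es T₀ N₁ N₂ N₃ gᵣ gₛ → let two = lit 2 ; four = lit 4 in
                emb a :* ((two :* gᵣ) :* T₀) :- two :* emb a :* (N₂ :* (two :* gₛ)) :- (two :* er) :* N₁ :- emb a :* ((two :* es) :* N₃) ⊜
                two :* emb a :* (gᵣ :* T₀) :- four :* emb a :* (N₂ :* gₛ) :- two :* (er :* N₁) :- two :* emb a :* (es :* N₃)) refl)
              (subring-- Int-isSubring (subring-- Int-isSubring (subring-- Int-isSubring (Z.P-* (Z.P-⟪⟫ a) (Z.P-* Z-2gᵣ Z-T₀)) (Z.P-* (Z.P-* (Z.P-⟪⟫ (pos 2)) (Z.P-⟪⟫ a)) (Z.P-* Z-N₂ Z-2gₛ))) (Z.P-* Z-2er Z-N₁)) (Z.P-* (Z.P-⟪⟫ a) (Z.P-* Z-2es Z-N₃)))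

            Z-q′ : Int q′
            Z-q′ = subst Int (ring (a ∷ []) (er ∷ es ∷ T₀ ∷ N₁ ∷ N₂ ∷ N₃ ∷ gᵣ ∷ gₛ ∷ []) (λ a er es T₀ N₁ N₂ N₃ gᵣ gₛ → let two = lit 2 ; four = lit 4 in
                (two :* es) :* N₁ :- (two :* er) :* N₃ :- two :* ((two :* gᵣ) :* N₂) :- emb a :* (T₀ :* (two :* gₛ)) ⊜
                two :* (es :* N₁) :- two :* (er :* N₃) :- four :* (gᵣ :* N₂) :- two :* emb a :* (T₀ :* gₛ)) refl)
              (subring-- Int-isSubring (subring-- Int-isSubring (subring-- Int-isSubring (Z.P-* Z-2es Z-N₁) (Z.P-* Z-2er Z-N₃)) (Z.P-* (Z.P-⟪⟫ (pos 2)) (Z.P-* Z-2gᵣ Z-N₂))) (Z.P-* (Z.P-⟪⟫ a) (Z.P-* Z-T₀ Z-2gₛ)))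

        abstract
          -- For a = 5 the equation x² + 5y² = ±1 gives y = 0 and x = ±1, while Y = 0 makes X ≡ 5
          -- (mod 8).
          c≢1 : c ≢ 1ℤ
          c≢1 c≡1 = build unit-coordinates Z-p₀/2 Z-g Z-p′ Z-q′
            where
            a≡5 : a ≡ pos 5
            a≡5 = trans a≡ (cong (λ c → pos 4 ℤ.* c ℤ.+ 1ℤ) c≡1)
            build : UnitCoordinates → Int (er * er - ⟪ a ⟫ * (es * es) + ⟪ pos 2 ⟫ * ⟪ a ⟫ * (T₀ * N₂) + ⟪ pos 2 ⟫ * (N₁ * N₁ - ⟪ a ⟫ * (N₃ * N₃) - ⟪ a ⟫ * ((2· gᵣ) * (2· gₛ)))) → Int g → Int p′ → Int q′ → ⊥
            build (coordinates x y X≡ Y≡ n) (P , P≡) (k , g≡) (m , p′≡) (l , q′≡) =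
              five-obstruction m l P k (trans (⟪⟫-inj (trans (sym y≡) Y≡)) y≡0) (unit-norm {a} {x} y≡0 n) (trans (cong (λ a → pos 8 ℤ.* (m ℤ.* m ℤ.- a ℤ.* (l ℤ.* l)) ℤ.- (pos 2 ℤ.* P ℤ.* (pos 2 ℤ.* P) ℤ.- a ℤ.* (k ℤ.* k))) (sym a≡5)) (⟪⟫-inj (trans (sym x≡) X≡)))
              where
              p₀≡′ : p₀ ≡ ⟪ pos 2 ⟫ * ⟪ P ⟫
              p₀≡′ = trans p₀≡ (cong (⟪ pos 2 ⟫ *_) P≡)
              y≡ : Y ≡ ⟪ pos 16 ℤ.* (m ℤ.* l) ℤ.+ pos 2 ℤ.* (pos 2 ℤ.* P ℤ.* k) ⟫
              y≡ = trans (cong₂ _+_ (cong (⟪ pos 16 ⟫ *_) (cong₂ _*_ p′≡ q′≡)) (cong (⟪ pos 2 ⟫ *_) (cong₂ _*_ p₀≡′ g≡)))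
                (ring (m ∷ l ∷ P ∷ k ∷ []) [] (λ m l P k → let two = con (pos 2) in lit 16 :* (emb m :* emb l) :+ emb two :* (emb two :* emb P :* emb k) ⊜ emb (con (pos 16) :* (m :* l) :+ two :* (two :* P :* k))) refl)
              x≡ : X ≡ ⟪ pos 8 ℤ.* (m ℤ.* m ℤ.- a ℤ.* (l ℤ.* l)) ℤ.- (pos 2 ℤ.* P ℤ.* (pos 2 ℤ.* P) ℤ.- a ℤ.* (k ℤ.* k)) ⟫
              x≡ = trans (cong₂ _-_ (cong₂ (λ p q → ⟪ pos 8 ⟫ * (p * p - ⟪ a ⟫ * (q * q))) p′≡ q′≡) (cong₂ (λ p g → p * p - ⟪ a ⟫ * (g * g)) p₀≡′ g≡))
                (ring (a ∷ m ∷ l ∷ P ∷ k ∷ []) [] (λ a m l P k → let two = con (pos 2) in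
                  lit 8 :* (emb m :* emb m :- emb a :* (emb l :* emb l)) :- (emb two :* emb P :* (emb two :* emb P) :- emb a :* (emb k :* emb k)) ⊜
                  emb (con (pos 8) :* (m :* m :- a :* (l :* l)) :- (two :* P :* (two :* P) :- a :* (k :* k)))) refl)
              y≡0 : y ≡ 0ℤ
              y≡0 = norm-forces-zero 3 x y (subst (λ a → (x ℤ.* x ℤ.+ a ℤ.* (y ℤ.* y) ≡ 1ℤ) ⊎ (x ℤ.* x ℤ.+ a ℤ.* (y ℤ.* y) ≡ ℤ.- 1ℤ)) a≡5 n)

          c≡-1 : c ≡ ℤ.- 1ℤ
          c≡-1 = build c-value
            where
            build : c ≡ 1ℤ ⊎ c ≡ ℤ.- 1ℤ → c ≡ ℤ.- 1ℤ
            build (inj₁ e) = ⊥-elim (c≢1 e)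
            build (inj₂ e) = e

      -- a ≡ 1 (mod 8): the integral basis 1, ω, φ, χ of ℚ(⁴√a).

      module ChiBasis (δ : ℤ) (c≡ : c ≡ pos 2 ℤ.* δ) where

        private
          module Lᴺ = IsSubring DL-isSubring
          module Fᴺ = IsSubring DF-isSubring

        abstract
          ωω₂ : ω * ω ≡ ω + ⟪ pos 2 ℤ.* δ ⟫
          ωω₂ = trans ωω (cong (λ c → ω + ⟪ c ⟫) c≡)

          a≡₂ : a ≡ pos 4 ℤ.* (pos 2 ℤ.* δ) ℤ.+ 1ℤ
          a≡₂ = trans a≡ (cong (λ c → pos 4 ℤ.* c ℤ.+ 1ℤ) c≡)

        -- For even c the element ω(1 + φ)/2 is integral too; it is the only enlargement needed of
        -- the ring spanned by 1, ω, φ, ωφ.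
        χ : Carrier
        χ = ½ * (ω * (1# + φ))

        V : ℤ → ℤ → ℤ → ℤ → Carrier
        V k₀ k₁ k₂ k₃ = ⟪ k₀ ⟫ + ⟪ k₁ ⟫ * ω + ⟪ k₂ ⟫ * φ + ⟪ k₃ ⟫ * χ

        -- From χ² - χ = δ(1 + φ + ω): multiplying by χ² and using χφ = χ + 2δ and χω = χ + δ(1 + φ)
        -- gives χ⁴ - χ³ = 3δχ² + 4δ²χ + 2δ³.
        χ-coefficients : List ℤ
        χ-coefficients = ℤ.- (pos 2 ℤ.* (δ ℤ.* δ ℤ.* δ)) ∷ ℤ.- (pos 4 ℤ.* (δ ℤ.* δ)) ∷ ℤ.- (pos 3 ℤ.* δ) ∷ ℤ.- 1ℤ ∷ []

        record ChiForm (z : Carrier) : Set where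
          constructor chiForm
          field
            k₀ k₁ k₂ k₃ : ℤ
            z≡ : z ≡ V k₀ k₁ k₂ k₃

        abstract
          2χ : ⟪ pos 2 ⟫ * χ ≡ ω * (1# + φ)
          2χ = trans (sym (*-assoc ⟪ pos 2 ⟫ ½ (ω * (1# + φ)))) (trans (cong (_* (ω * (1# + φ))) 2½) (*-identityˡ _))

          φφ : φ * φ ≡ ⟪ pos 2 ⟫ * ω - 1#
          φφ = trans (sym ρ-def) ρ≡2ω-1

          ωφ : ω * φ ≡ ⟪ pos 2 ⟫ * χ - ω
          ωφ = sym (trans (cong (_- ω) 2χ) (ring [] (ω ∷ φ ∷ []) (λ w f → w :* (:1 :+ f) :- w ⊜ w :* f) refl))

          χφ : χ * φ ≡ χ + ⟪ pos 2 ℤ.* δ ⟫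
          χφ = cancel {pos 2} (λ ()) (begin
            ⟪ pos 2 ⟫ * (χ * φ)                            ≡⟨ sym (*-assoc ⟪ pos 2 ⟫ χ φ) ⟩
            ⟪ pos 2 ⟫ * χ * φ                              ≡⟨ cong (_* φ) 2χ ⟩
            ω * (1# + φ) * φ                               ≡⟨ lc₂ ω φφ ⟪ pos 2 ⟫ ωω₂ (ring (δ ∷ []) (ω ∷ φ ∷ []) (λ δ w f → let c = con (pos 2) :* δ ; two = lit 2 in
                w :* (:1 :+ f) :* f :+ (w :* (two :* w :- :1) :+ two :* (w :+ emb c)) ⊜ w :* (:1 :+ f) :+ two :* emb c :+ (w :* (f :* f) :+ two :* (w :* w))) refl) ⟩
            ω * (1# + φ) + ⟪ pos 2 ⟫ * ⟪ pos 2 ℤ.* δ ⟫     ≡⟨ cong (_+ ⟪ pos 2 ⟫ * ⟪ pos 2 ℤ.* δ ⟫) (sym 2χ) ⟩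
            ⟪ pos 2 ⟫ * χ + ⟪ pos 2 ⟫ * ⟪ pos 2 ℤ.* δ ⟫    ≡⟨ ring (pos 2 ℤ.* δ ∷ []) (χ ∷ []) (λ c x → lit 2 :* x :+ lit 2 :* emb c ⊜ lit 2 :* (x :+ emb c)) refl ⟩
            ⟪ pos 2 ⟫ * (χ + ⟪ pos 2 ℤ.* δ ⟫)              ∎)

          χω : χ * ω ≡ χ + ⟪ δ ⟫ * (1# + φ)
          χω = cancel {pos 2} (λ ()) (begin
            ⟪ pos 2 ⟫ * (χ * ω)                            ≡⟨ sym (*-assoc ⟪ pos 2 ⟫ χ ω) ⟩
            ⟪ pos 2 ⟫ * χ * ω                              ≡⟨ cong (_* ω) 2χ ⟩
            ω * (1# + φ) * ω                               ≡⟨ lc₁ (1# + φ) ωω₂ (ring (δ ∷ []) (ω ∷ φ ∷ []) (λ δ w f → w :* (:1 :+ f) :* w :+ (:1 :+ f) :* (w :+ emb (con (pos 2) :* δ)) ⊜ w :* (:1 :+ f) :+ lit 2 :* (emb δ :* (:1 :+ f)) :+ (:1 :+ f) :* (w :* w)) refl) ⟩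
            ω * (1# + φ) + ⟪ pos 2 ⟫ * (⟪ δ ⟫ * (1# + φ))  ≡⟨ cong (_+ ⟪ pos 2 ⟫ * (⟪ δ ⟫ * (1# + φ))) (sym 2χ) ⟩
            ⟪ pos 2 ⟫ * χ + ⟪ pos 2 ⟫ * (⟪ δ ⟫ * (1# + φ)) ≡⟨ ring (δ ∷ []) (χ ∷ φ ∷ []) (λ δ x f → lit 2 :* x :+ lit 2 :* (emb δ :* (:1 :+ f)) ⊜ lit 2 :* (x :+ emb δ :* (:1 :+ f))) refl ⟩
            ⟪ pos 2 ⟫ * (χ + ⟪ δ ⟫ * (1# + φ))             ∎)

          χχ : χ * χ ≡ χ + ⟪ δ ⟫ * (1# + φ + ω)
          χχ = cancel {pos 2} (λ ()) (begin
            ⟪ pos 2 ⟫ * (χ * χ)                                      ≡⟨ sym (*-assoc ⟪ pos 2 ⟫ χ χ) ⟩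
            ⟪ pos 2 ⟫ * χ * χ                                        ≡⟨ cong (_* χ) 2χ ⟩
            ω * (1# + φ) * χ                                         ≡⟨ ring [] (ω ∷ φ ∷ χ ∷ []) (λ w f x → w :* (:1 :+ f) :* x ⊜ x :* w :* (:1 :+ f)) refl ⟩
            χ * ω * (1# + φ)                                         ≡⟨ cong (_* (1# + φ)) χω ⟩
            (χ + ⟪ δ ⟫ * (1# + φ)) * (1# + φ)                        ≡⟨ lc₂ 1# χφ ⟪ δ ⟫ φφ (ring (δ ∷ []) (ω ∷ φ ∷ χ ∷ []) (λ δ w f x →
                (x :+ emb δ :* (:1 :+ f)) :* (:1 :+ f) :+ (:1 :* (x :+ emb (con (pos 2) :* δ)) :+ emb δ :* (lit 2 :* w :- :1)) ⊜
                lit 2 :* (x :+ emb δ :* (:1 :+ f :+ w)) :+ (:1 :* (x :* f) :+ emb δ :* (f :* f))) refl) ⟩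
            ⟪ pos 2 ⟫ * (χ + ⟪ δ ⟫ * (1# + φ + ω))                   ∎)

          χ-relation : χ ^ 4 + eval χ-coefficients χ ≡ 0#
          χ-relation = begin
            χ ^ 4 + (⟪ ℤ.- (pos 2 ℤ.* (δ ℤ.* δ ℤ.* δ)) ⟫ + χ * (⟪ ℤ.- (pos 4 ℤ.* (δ ℤ.* δ)) ⟫ + χ * (⟪ ℤ.- (pos 3 ℤ.* δ) ⟫ + χ * (⟪ ℤ.- 1ℤ ⟫ + χ * 0#))))
              ≡⟨ ring (δ ∷ []) (χ ∷ []) (λ δ x → let dd = δ :* δ in
                   x :^ 4 :+ (emb (:- (con (pos 2) :* (δ :* δ :* δ))) :+ x :* (emb (:- (con (pos 4) :* (δ :* δ))) :+ x :* (emb (:- (con (pos 3) :* δ)) :+ x :* (emb (con (ℤ.- 1ℤ)) :+ x :* :0)))) ⊜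
                   x :* x :* (x :* x :- x) :- emb (con (pos 3) :* δ) :* (x :* x) :- emb (con (pos 4) :* (δ :* δ)) :* x :- emb (con (pos 2) :* (δ :* δ :* δ))) refl ⟩
            χ * χ * (χ * χ - χ) - ⟪ pos 3 ℤ.* δ ⟫ * (χ * χ) - ⟪ pos 4 ℤ.* (δ ℤ.* δ) ⟫ * χ - ⟪ pos 2 ℤ.* (δ ℤ.* δ ℤ.* δ) ⟫
              ≡⟨ cong (λ y → χ * χ * (y - χ) - ⟪ pos 3 ℤ.* δ ⟫ * (χ * χ) - ⟪ pos 4 ℤ.* (δ ℤ.* δ) ⟫ * χ - ⟪ pos 2 ℤ.* (δ ℤ.* δ ℤ.* δ) ⟫) χχ ⟩
            χ * χ * (χ + ⟪ δ ⟫ * (1# + φ + ω) - χ) - ⟪ pos 3 ℤ.* δ ⟫ * (χ * χ) - ⟪ pos 4 ℤ.* (δ ℤ.* δ) ⟫ * χ - ⟪ pos 2 ℤ.* (δ ℤ.* δ ℤ.* δ) ⟫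
              ≡⟨ ring (δ ∷ []) (ω ∷ φ ∷ χ ∷ []) (λ δ w f x →
                   x :* x :* (x :+ emb δ :* (:1 :+ f :+ w) :- x) :- emb (con (pos 3) :* δ) :* (x :* x) :- emb (con (pos 4) :* (δ :* δ)) :* x :- emb (con (pos 2) :* (δ :* δ :* δ)) ⊜
                   emb δ :* (x :* (x :+ x :* f :+ x :* w)) :- emb (con (pos 3) :* δ) :* (x :* x) :- emb (con (pos 4) :* (δ :* δ)) :* x :- emb (con (pos 2) :* (δ :* δ :* δ))) refl ⟩
            ⟪ δ ⟫ * (χ * (χ + χ * φ + χ * ω)) - ⟪ pos 3 ℤ.* δ ⟫ * (χ * χ) - ⟪ pos 4 ℤ.* (δ ℤ.* δ) ⟫ * χ - ⟪ pos 2 ℤ.* (δ ℤ.* δ ℤ.* δ) ⟫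
              ≡⟨ cong₂ (λ y z → ⟪ δ ⟫ * (χ * (χ + y + z)) - ⟪ pos 3 ℤ.* δ ⟫ * (χ * χ) - ⟪ pos 4 ℤ.* (δ ℤ.* δ) ⟫ * χ - ⟪ pos 2 ℤ.* (δ ℤ.* δ ℤ.* δ) ⟫) χφ χω ⟩
            ⟪ δ ⟫ * (χ * (χ + (χ + ⟪ pos 2 ℤ.* δ ⟫) + (χ + ⟪ δ ⟫ * (1# + φ)))) - ⟪ pos 3 ℤ.* δ ⟫ * (χ * χ) - ⟪ pos 4 ℤ.* (δ ℤ.* δ) ⟫ * χ - ⟪ pos 2 ℤ.* (δ ℤ.* δ ℤ.* δ) ⟫
              ≡⟨ lc₁ (⟪ δ ⟫ * ⟪ δ ⟫) χφ (ring (δ ∷ []) (φ ∷ χ ∷ []) (λ δ f x →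
                   emb δ :* (x :* (x :+ (x :+ emb (con (pos 2) :* δ)) :+ (x :+ emb δ :* (:1 :+ f)))) :- emb (con (pos 3) :* δ) :* (x :* x) :- emb (con (pos 4) :* (δ :* δ)) :* x :- emb (con (pos 2) :* (δ :* δ :* δ)) :+ emb δ :* emb δ :* (x :+ emb (con (pos 2) :* δ)) ⊜
                   :0 :+ emb δ :* emb δ :* (x :* f)) refl) ⟩
            0# ∎

          I-χ : Integral χ
          I-χ = I-monic χ χ-coefficients χ-relation

          I-V : ∀ {k₀ k₁ k₂ k₃} → Integral (V k₀ k₁ k₂ k₃)
          I-V = I-+ (I-+ (I-+ (I-ι _) (I-* (I-ι _) I-ω)) (I-* (I-ι _) I-φ)) (I-* (I-ι _) I-χ)

          double-V : ∀ {z k₀ k₁ k₂ k₃} → z ≡ V k₀ k₁ k₂ k₃ → ⟪ pos 2 ⟫ * z ≡ ((pos 2 ℤ.* k₀) ⊹ (pos 2 ℤ.* k₁ ℤ.+ k₃) ω) + ((pos 2 ℤ.* k₂) ⊹ k₃ ω) * φ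
          double-V {z} {k₀} {k₁} {k₂} {k₃} e = trans (cong (⟪ pos 2 ⟫ *_) e) (lc₁ ⟪ k₃ ⟫ 2χ (ring (k₀ ∷ k₁ ∷ k₂ ∷ k₃ ∷ []) (ω ∷ φ ∷ χ ∷ []) (λ k₀ k₁ k₂ k₃ w f x → let two = con (pos 2) in
            emb two :* (emb k₀ :+ emb k₁ :* w :+ emb k₂ :* f :+ emb k₃ :* x) :+ emb k₃ :* (w :* (:1 :+ f)) ⊜
            (emb (two :* k₀) :+ emb (two :* k₁ :+ k₃) :* w) :+ (emb (two :* k₂) :+ emb k₃ :* w) :* f :+ emb k₃ :* (emb two :* x)) refl))

          V-inj : ∀ {k₀ k₁ k₂ k₃ j₀ j₁ j₂ j₃} → V k₀ k₁ k₂ k₃ ≡ V j₀ j₁ j₂ j₃ → (k₀ ≡ j₀ × k₁ ≡ j₁) × (k₂ ≡ j₂ × k₃ ≡ j₃)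
          V-inj {k₀} {k₁} {k₂} {k₃} {j₀} {j₁} {j₂} {j₃} e = finish (DF-split DF-+ω DF-+ω DF-+ω DF-+ω (trans (sym (double-V {k₀ = k₀} {k₁} {k₂} {k₃} refl)) (double-V {k₀ = j₀} {j₁} {j₂} {j₃} e)))
            where
            finish : ((pos 2 ℤ.* k₀) ⊹ (pos 2 ℤ.* k₁ ℤ.+ k₃) ω) ≡ ((pos 2 ℤ.* j₀) ⊹ (pos 2 ℤ.* j₁ ℤ.+ j₃) ω) × ((pos 2 ℤ.* k₂) ⊹ k₃ ω) ≡ ((pos 2 ℤ.* j₂) ⊹ j₃ ω) → (k₀ ≡ j₀ × k₁ ≡ j₁) × (k₂ ≡ j₂ × k₃ ≡ j₃)
            finish (p , q) = (halve {k₀} {j₀} (proj₁ (independentF p)) , halve {k₁} {j₁} (lem {pos 2 ℤ.* k₁} {pos 2 ℤ.* j₁} k₃≡ (proj₂ (independentF p)))) , (halve {k₂} {j₂} (proj₁ (independentF q)) , k₃≡)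
              where
              k₃≡ : k₃ ≡ j₃
              k₃≡ = proj₂ (independentF q)
              lem : ∀ {x y z w} → z ≡ w → x ℤ.+ z ≡ y ℤ.+ w → x ≡ y
              lem {x} {y} {z} refl h = trans (lem′ x z) (trans (cong (ℤ._- z) h) (sym (lem′ y z)))
                where lem′ : ∀ x z → x ≡ x ℤ.+ z ℤ.- z
                      lem′ = solve-∀

          -- p₀ and q₀ are even and p₁ ≡ q₁, so q₁ copies of χ absorb the odd parts of both
          -- ω-coordinates at once.
          chiForm-of : ∀ {z} → DL z → Integral z → ChiForm z
          chiForm-of {z} h I-z = build (integerOfL h I-z)
            where
            build : IntegerOfL z → ChiForm z
            build (intL p₀ p₁ q₀ q₁ e (Ep₀ , Eq₀ , Ed , _)) = finish p₀ p₁ q₀ q₁ e Ep₀ Eq₀ (even-difference p₁ q₁ Ed)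
              where
              finish : ∀ p₀ p₁ q₀ q₁ → ⟪ pos 2 ⟫ * z ≡ (p₀ ⊹ p₁ ω) + (q₀ ⊹ q₁ ω) * φ → Even p₀ → Even q₀ → (∃ λ v → p₁ ≡ q₁ ℤ.+ pos 2 ℤ.* v) → ChiForm z
              finish _ _ _ q₁ e (k₀ , refl) (k₂ , refl) (k₁ , refl) = chiForm k₀ k₁ k₂ q₁ (cancel {pos 2} (λ ()) (trans e (trans
                (cong (λ n → ((pos 2 ℤ.* k₀) ⊹ n ω) + ((pos 2 ℤ.* k₂) ⊹ q₁ ω) * φ) (ℤₚ.+-comm q₁ (pos 2 ℤ.* k₁))) (sym (double-V {k₀ = k₀} {k₁} {k₂} {q₁} refl)))))

          V-mul : ∀ k₀ k₁ k₂ k₃ j₀ j₁ j₂ j₃ → V k₀ k₁ k₂ k₃ * V j₀ j₁ j₂ j₃ ≡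
            V (mul₀ δ k₀ k₁ k₂ k₃ j₀ j₁ j₂ j₃) (mul₁ δ k₀ k₁ k₂ k₃ j₀ j₁ j₂ j₃) (mul₂ δ k₀ k₁ k₂ k₃ j₀ j₁ j₂ j₃) (mul₃ δ k₀ k₁ k₂ k₃ j₀ j₁ j₂ j₃)
          V-mul k₀ k₁ k₂ k₃ j₀ j₁ j₂ j₃ = begin
            V k₀ k₁ k₂ k₃ * V j₀ j₁ j₂ j₃
              ≡⟨ ring (k₀ ∷ k₁ ∷ k₂ ∷ k₃ ∷ j₀ ∷ j₁ ∷ j₂ ∷ j₃ ∷ []) (ω ∷ φ ∷ χ ∷ []) (λ k₀ k₁ k₂ k₃ j₀ j₁ j₂ j₃ w f x →
                   (emb k₀ :+ emb k₁ :* w :+ emb k₂ :* f :+ emb k₃ :* x) :* (emb j₀ :+ emb j₁ :* w :+ emb j₂ :* f :+ emb j₃ :* x) ⊜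
                   emb (k₀ :* j₀) :+ emb (k₀ :* j₁ :+ k₁ :* j₀) :* w :+ emb (k₀ :* j₂ :+ k₂ :* j₀) :* f :+ emb (k₀ :* j₃ :+ k₃ :* j₀) :* x :+
                   emb (k₁ :* j₁) :* (w :* w) :+ emb (k₁ :* j₂ :+ k₂ :* j₁) :* (w :* f) :+ emb (k₁ :* j₃ :+ k₃ :* j₁) :* (x :* w) :+
                   emb (k₂ :* j₂) :* (f :* f) :+ emb (k₂ :* j₃ :+ k₃ :* j₂) :* (x :* f) :+ emb (k₃ :* j₃) :* (x :* x)) refl ⟩
            sum (ω * ω) (ω * φ) (χ * ω) (φ * φ) (χ * φ) (χ * χ)
              ≡⟨ trans (cong₂ (λ p q → sum p q (χ * ω) (φ * φ) (χ * φ) (χ * χ)) ωω₂ ωφ) (trans (cong₂ (λ p q → sum (ω + ⟪ pos 2 ℤ.* δ ⟫) (⟪ pos 2 ⟫ * χ - ω) p q (χ * φ) (χ * χ)) χω φφ)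
                   (cong₂ (λ p q → sum (ω + ⟪ pos 2 ℤ.* δ ⟫) (⟪ pos 2 ⟫ * χ - ω) (χ + ⟪ δ ⟫ * (1# + φ)) (⟪ pos 2 ⟫ * ω - 1#) p q) χφ χχ)) ⟩
            sum (ω + ⟪ pos 2 ℤ.* δ ⟫) (⟪ pos 2 ⟫ * χ - ω) (χ + ⟪ δ ⟫ * (1# + φ)) (⟪ pos 2 ⟫ * ω - 1#) (χ + ⟪ pos 2 ℤ.* δ ⟫) (χ + ⟪ δ ⟫ * (1# + φ + ω))
              ≡⟨ ring (δ ∷ k₀ ∷ k₁ ∷ k₂ ∷ k₃ ∷ j₀ ∷ j₁ ∷ j₂ ∷ j₃ ∷ []) (ω ∷ φ ∷ χ ∷ []) (λ d k₀ k₁ k₂ k₃ j₀ j₁ j₂ j₃ w f x → let two = con (pos 2) in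
                   emb (k₀ :* j₀) :+ emb (k₀ :* j₁ :+ k₁ :* j₀) :* w :+ emb (k₀ :* j₂ :+ k₂ :* j₀) :* f :+ emb (k₀ :* j₃ :+ k₃ :* j₀) :* x :+
                   emb (k₁ :* j₁) :* (w :+ emb (two :* d)) :+ emb (k₁ :* j₂ :+ k₂ :* j₁) :* (emb two :* x :- w) :+ emb (k₁ :* j₃ :+ k₃ :* j₁) :* (x :+ emb d :* (:1 :+ f)) :+
                   emb (k₂ :* j₂) :* (emb two :* w :- :1) :+ emb (k₂ :* j₃ :+ k₃ :* j₂) :* (x :+ emb (two :* d)) :+ emb (k₃ :* j₃) :* (x :+ emb d :* (:1 :+ f :+ w)) ⊜
                   emb (k₀ :* j₀ :- k₂ :* j₂ :+ d :* (two :* (k₁ :* j₁ :+ k₂ :* j₃ :+ k₃ :* j₂) :+ k₁ :* j₃ :+ k₃ :* j₁ :+ k₃ :* j₃)) :+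
                   emb (k₀ :* j₁ :+ k₁ :* j₀ :+ k₁ :* j₁ :- (k₁ :* j₂ :+ k₂ :* j₁) :+ two :* (k₂ :* j₂) :+ d :* (k₃ :* j₃)) :* w :+
                   emb (k₀ :* j₂ :+ k₂ :* j₀ :+ d :* (k₁ :* j₃ :+ k₃ :* j₁ :+ k₃ :* j₃)) :* f :+
                   emb (k₀ :* j₃ :+ k₃ :* j₀ :+ two :* (k₁ :* j₂ :+ k₂ :* j₁) :+ k₁ :* j₃ :+ k₃ :* j₁ :+ k₂ :* j₃ :+ k₃ :* j₂ :+ k₃ :* j₃) :* x) refl ⟩
            V (mul₀ δ k₀ k₁ k₂ k₃ j₀ j₁ j₂ j₃) (mul₁ δ k₀ k₁ k₂ k₃ j₀ j₁ j₂ j₃) (mul₂ δ k₀ k₁ k₂ k₃ j₀ j₁ j₂ j₃) (mul₃ δ k₀ k₁ k₂ k₃ j₀ j₁ j₂ j₃) ∎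
            where
            sum : (ww wf xw ff xf xx : Carrier) → Carrier
            sum ww wf xw ff xf xx =
              ⟪ k₀ ℤ.* j₀ ⟫ + ⟪ k₀ ℤ.* j₁ ℤ.+ k₁ ℤ.* j₀ ⟫ * ω + ⟪ k₀ ℤ.* j₂ ℤ.+ k₂ ℤ.* j₀ ⟫ * φ + ⟪ k₀ ℤ.* j₃ ℤ.+ k₃ ℤ.* j₀ ⟫ * χ +
              ⟪ k₁ ℤ.* j₁ ⟫ * ww + ⟪ k₁ ℤ.* j₂ ℤ.+ k₂ ℤ.* j₁ ⟫ * wf + ⟪ k₁ ℤ.* j₃ ℤ.+ k₃ ℤ.* j₁ ⟫ * xw +
              ⟪ k₂ ℤ.* j₂ ⟫ * ff + ⟪ k₂ ℤ.* j₃ ℤ.+ k₃ ℤ.* j₂ ⟫ * xf + ⟪ k₃ ℤ.* j₃ ⟫ * xx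

          -- For odd c/2 all coordinates of 2B are even.
          δ-even : Even δ
          δ-even = build (parity δ) (chiForm-of DL-s I-s) (chiForm-of DL-2B I-2B) (chiForm-of DL-p I-p)
            where
            -- Here c ≡ 2 (mod 4), and none of 0, 1, -1, -4, 4 is.
            excluded : Odd δ → Exceptional (pos 2 ℤ.* δ) → ⊥
            excluded o (inj₁ e) = even-odd (0ℤ , halve e) o
            excluded o (inj₂ (inj₁ e)) = even-odd (δ , sym e) (0ℤ , refl)
            excluded o (inj₂ (inj₂ (inj₁ e))) = even-odd (δ , sym e) (ℤ.- 1ℤ , refl)
            excluded o (inj₂ (inj₂ (inj₂ (inj₁ e)))) = even-odd (ℤ.- 1ℤ , halve e) o
            excluded o (inj₂ (inj₂ (inj₂ (inj₂ e)))) = even-odd (1ℤ , halve e) o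
            build : Even δ ⊎ Odd δ → ChiForm s → ChiForm 2B → ChiForm p → Even δ
            build (inj₁ e) _ _ _ = e
            build (inj₂ o) (chiForm k₀ k₁ k₂ k₃ s≡) (chiForm j₀ j₁ j₂ j₃ y≡) (chiForm l₀ l₁ l₂ l₃ p≡′) =
              ⊥-elim (excluded o (subst Exceptional c≡ (UnitB.exceptional (I-B y≡ (ParityConsequences.all-even
                (chi-parity {δ} {k₀} {k₁} {k₂} {k₃} {j₀} {j₁} {j₂} {j₃} {l₀} {l₁} {l₂} {l₃}
                  (chi-equations δ k₀ k₁ k₂ k₃ j₀ j₁ j₂ j₃ {l₀} {l₁} {l₂} {l₃} (subst (λ c → NormEquations (pos 8) c (pos 2 ℤ.* k₀) (pos 2 ℤ.* k₁ ℤ.+ k₃) (pos 2 ℤ.* k₂) k₃ (pos 2 ℤ.* j₀) (pos 2 ℤ.* j₁ ℤ.+ j₃) (pos 2 ℤ.* j₂) j₃ (pos 2 ℤ.* l₀) (pos 2 ℤ.* l₁ ℤ.+ l₃) (pos 2 ℤ.* l₂) l₃) c≡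
                  (norm-equations {s} {2B} {p} (double-V s≡) (double-V y≡) (double-V p≡′) 4p)))) o)))))
              where
              I-B : ∀ {j₀ j₁ j₂ j₃} → 2B ≡ V j₀ j₁ j₂ j₃ → Even j₀ × Even j₁ × Even j₂ × Even j₃ → Integral B
              I-B e ((m₀ , refl) , (m₁ , refl) , (m₂ , refl) , (m₃ , refl)) = subst Integral (cancel {pos 2} (λ ()) (trans (ring (m₀ ∷ m₁ ∷ m₂ ∷ m₃ ∷ []) (ω ∷ φ ∷ χ ∷ []) (λ k₀ k₁ k₂ k₃ w f x → let two = con (pos 2) in
                emb two :* (emb k₀ :+ emb k₁ :* w :+ emb k₂ :* f :+ emb k₃ :* x) ⊜ emb (two :* k₀) :+ emb (two :* k₁) :* w :+ emb (two :* k₂) :* f :+ emb (two :* k₃) :* x) refl) (sym e))) (I-V {m₀} {m₁} {m₂} {m₃})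

        -- Roots modulo 2 of q = X² - sX + p, the minimal polynomial of t over ℚ(⁴√a).

        module Roots (Pχ : List ℤ) (Pχ≡ : eval Pχ t ≡ χ) where

          private
            module Lᴼ = IsSubring DL-isSubring
            module Kᴼ = IsSubring DK-isSubring

            -- The cofactor of r - t must stay in K as well as be integral, so that its product with
            -- its image under σ⁴ is an integer of L with coordinates in the basis 1, ω, φ, χ.
            Qᴼ : Carrier → Set
            Qᴼ z = Integral z × DK z

            abstract
              Q-isSubring : IsSubring Qᴼ
              Q-isSubring = record
                { P-⟪⟫ = λ z → I-ι z , Kᴼ.P-⟪⟫ z
                ; P-+ = λ (x , x′) (y , y′) → I-+ x y , Kᴼ.P-+ x′ y′
                ; P-* = λ (x , x′) (y , y′) → I-* x y , Kᴼ.P-* x′ y′ }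

              difference-in : ∀ P {x y} → Qᴼ x → Qᴼ y → ∃ λ h → Qᴼ h × eval P x - eval P y ≡ (x - y) * h
              difference-in []      {x} {y} qx qy = 0# , subst Qᴼ ⟪0⟫ (IsSubring.P-⟪⟫ Q-isSubring 0ℤ) , ring [] (x ∷ y ∷ []) (λ x y → :0 :- :0 ⊜ (x :- y) :* :0) refl
              difference-in (k ∷ P) {x} {y} qx qy = step (difference-in P qx qy)
                where
                step : (∃ λ h → Qᴼ h × eval P x - eval P y ≡ (x - y) * h) → ∃ λ h → Qᴼ h × (⟪ k ⟫ + x * eval P x) - (⟪ k ⟫ + y * eval P y) ≡ (x - y) * h
                step (h , qh , e) = eval P x + y * h , IsSubring.P-+ Q-isSubring (eval-∈ Q-isSubring qx P) (IsSubring.P-* Q-isSubring qy qh) ,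
                  lc₁ y e (ring (k ∷ []) (x ∷ y ∷ h ∷ eval P x ∷ eval P y ∷ []) (λ k x y h p q →
                    (emb k :+ x :* p) :- (emb k :+ y :* q) :+ y :* ((x :- y) :* h) ⊜ (x :- y) :* (p :+ y :* h) :+ y :* (p :- q)) refl)

              eval-value : ∀ P r → eval P ⟪ r ⟫ ≡ ⟪ value P r ⟫
              eval-value []      r = sym ⟪0⟫
              eval-value (k ∷ P) r = trans (cong (λ x → ⟪ k ⟫ + ⟪ r ⟫ * x) (eval-value P r)) (ring (k ∷ r ∷ value P r ∷ []) [] (λ k r v → emb k :+ emb r :* emb v ⊜ emb (k :+ r :* v)) refl)

              σ⁴-- : ∀ x y → σ⁴ (x - y) ≡ σ⁴ x - σ⁴ y
              σ⁴-- x y = trans (cong σ² (σ²-- x y)) (σ²-- (σ² x) (σ² y))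

              σ⁴-⟪⟫ : ∀ n → σ⁴ ⟪ n ⟫ ≡ ⟪ n ⟫
              σ⁴-⟪⟫ n = σ⁴-DL (Lᴼ.P-⟪⟫ n)

              σ⁴-norm-∈ : ∀ {h} → DK h → DL (h * σ⁴ h)
              σ⁴-norm-∈ {h} (adj x y dx dy h≡) = subst DL (sym hσ⁴h) (subring-- DL-isSubring (Lᴼ.P-* dx dx) (Lᴼ.P-* DL-φ (Lᴼ.P-* dy dy)))
                where
                σ⁴h : σ⁴ h ≡ x - y * θ
                σ⁴h = trans (cong σ⁴ h≡) (trans (trans (cong σ² (σ²-+ x (y * θ))) (σ²-+ (σ² x) (σ² (y * θ)))) (trans (cong₂ _+_ (σ⁴-DL dx) (trans (σ⁴-* y θ) (cong₂ _*_ (σ⁴-DL dy) σ⁴-θ)))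
                  (ring [] (x ∷ y ∷ θ ∷ []) (λ x y t → x :+ y :* (:- t) ⊜ x :- y :* t) refl)))
                hσ⁴h : h * σ⁴ h ≡ x * x - φ * (y * y)
                hσ⁴h = trans (cong₂ _*_ h≡ σ⁴h) (lc₁ (y * y) φ-def (ring [] (x ∷ y ∷ θ ∷ φ ∷ []) (λ A B t f → (A :+ B :* t) :* (A :- B :* t) :+ B :* B :* (t :* t) ⊜ A :* A :- f :* (B :* B) :+ B :* B :* f) refl))

              DL-χ : DL χ
              DL-χ = Lᴼ.P-* (adjoin-base DF-isSubring (adjoin-base Dyadic-isSubring D-½)) (Lᴼ.P-* (adjoin-base DF-isSubring DF-ω) (Lᴼ.P-+ Lᴼ.P-1 DL-φ))

              -- The relative norm of P(r) − ν = (r − t) h.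
              root-norm : ∀ P {ν} r → eval P t ≡ ν → σ⁴ ν ≡ ν → ∃ λ W → DL W × Integral W ×
                (⟪ value P r ⟫ - ν) * (⟪ value P r ⟫ - ν) ≡ (⟪ r ⟫ * ⟪ r ⟫ - ⟪ r ⟫ * s + p) * W
              root-norm P {ν} r Pt σν = build (difference-in P {⟪ r ⟫} {t} (I-ι r , Kᴼ.P-⟪⟫ r) (I-t , adj A B DL-A DL-B t≡))
                where
                build : (∃ λ h → Qᴼ h × eval P ⟪ r ⟫ - eval P t ≡ (⟪ r ⟫ - t) * h) → ∃ λ W → DL W × Integral W × (⟪ value P r ⟫ - ν) * (⟪ value P r ⟫ - ν) ≡ (⟪ r ⟫ * ⟪ r ⟫ - ⟪ r ⟫ * s + p) * W
                build (h , (I-h , K-h) , e) = h * σ⁴ h , σ⁴-norm-∈ K-h , I-* I-h (I-σ (I-σ (I-σ (I-σ I-h)))) , (begin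
                    (⟪ value P r ⟫ - ν) * (⟪ value P r ⟫ - ν)               ≡⟨ cong₂ _*_ e₀ e₁ ⟩
                    (⟪ r ⟫ - t) * h * ((⟪ r ⟫ - σ⁴ t) * σ⁴ h)               ≡⟨ ring (r ∷ []) (t ∷ σ⁴ t ∷ h ∷ σ⁴ h ∷ []) (λ r t t′ h h′ → (emb r :- t) :* h :* ((emb r :- t′) :* h′) ⊜ (emb r :* emb r :- emb r :* (t :+ t′) :+ t :* t′) :* (h :* h′)) refl ⟩
                    (⟪ r ⟫ * ⟪ r ⟫ - ⟪ r ⟫ * (t + σ⁴ t) + t * σ⁴ t) * (h * σ⁴ h) ≡⟨ cong₂ (λ s p → (⟪ r ⟫ * ⟪ r ⟫ - ⟪ r ⟫ * s + p) * (h * σ⁴ h)) s≡ p≡ ⟩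
                    (⟪ r ⟫ * ⟪ r ⟫ - ⟪ r ⟫ * s + p) * (h * σ⁴ h)            ∎)
                  where
                  s≡ : t + σ⁴ t ≡ s
                  s≡ = trans (cong₂ _+_ t≡ β₄≡) (ring [] (A ∷ B ∷ θ ∷ []) (λ A B t → A :+ B :* t :+ (A :- B :* t) ⊜ lit 2 :* A) refl)
                  e₀ : ⟪ value P r ⟫ - ν ≡ (⟪ r ⟫ - t) * h
                  e₀ = trans (cong₂ _-_ (sym (eval-value P r)) (sym Pt)) e
                  e₁ : ⟪ value P r ⟫ - ν ≡ (⟪ r ⟫ - σ⁴ t) * σ⁴ h
                  e₁ = trans (cong₂ _-_ (sym (σ⁴-⟪⟫ _)) (sym σν)) (trans (sym (σ⁴-- _ _)) (trans (cong σ⁴ e₀) (trans (σ⁴-* _ _) (cong (_* σ⁴ h) (trans (σ⁴-- _ _) (cong (_- σ⁴ t) (σ⁴-⟪⟫ r)))))))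

          module Residues (δ-even : Even δ) {k₀ k₁ k₂ k₃ l₀ l₁ l₂ l₃ : ℤ} (s≡ : s ≡ V k₀ k₁ k₂ k₃) (p≡ : p ≡ V l₀ l₁ l₂ l₃)
            (e-k₀ : Even k₀) (e-k₁ : Even k₁) (e-k₂ : Even k₂) where

            -- The value of q at r, reduced by one of the homomorphisms from the integers of L to
            -- 𝔽₂.
            λq : (w₁ w₃ r : ℤ) → ℤ
            λq w₁ w₃ r = λ⟨ w₁ , w₃ ⟩ (r ℤ.* r ℤ.- r ℤ.* k₀ ℤ.+ l₀) (l₁ ℤ.- r ℤ.* k₁) (l₂ ℤ.- r ℤ.* k₂) (l₃ ℤ.- r ℤ.* k₃)

            abstract
              -- Over 𝔽₂ the identity (P(r) - ν)² = q(r)W shows that a root r of the reduced q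
              -- forces P(r) to be the residue of ν. A root in 𝔽₂ thus determines the residues of ω
              -- and χ, so different homomorphisms cannot share one.
              residue : ∀ P {ν} ε₁ ε₃ w₁ w₃ r → eval P t ≡ ν → σ⁴ ν ≡ ν → (∀ n → ⟪ n ⟫ - ν ≡ V n ε₁ 0ℤ ε₃) → Even (w₃ ℤ.* (w₁ ℤ.- 1ℤ)) →
                Even (λq w₁ w₃ r) → Even (λ⟨ w₁ , w₃ ⟩ (value P r) ε₁ 0ℤ ε₃)
              residue P {ν} ε₁ ε₃ w₁ w₃ r Pt σν ν≡ hom e = build (root-norm P r Pt σν)
                where
                n q₀ q₁ q₂ q₃ : ℤ
                n = value P r
                q₀ = r ℤ.* r ℤ.- r ℤ.* k₀ ℤ.+ l₀
                q₁ = l₁ ℤ.- r ℤ.* k₁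
                q₂ = l₂ ℤ.- r ℤ.* k₂
                q₃ = l₃ ℤ.- r ℤ.* k₃
                q≡ : ⟪ r ⟫ * ⟪ r ⟫ - ⟪ r ⟫ * s + p ≡ V q₀ q₁ q₂ q₃
                q≡ = trans (cong₂ (λ s p → ⟪ r ⟫ * ⟪ r ⟫ - ⟪ r ⟫ * s + p) s≡ p≡) (ring (r ∷ k₀ ∷ k₁ ∷ k₂ ∷ k₃ ∷ l₀ ∷ l₁ ∷ l₂ ∷ l₃ ∷ []) (ω ∷ φ ∷ χ ∷ []) (λ r k₀ k₁ k₂ k₃ l₀ l₁ l₂ l₃ w f x →
                  emb r :* emb r :- emb r :* (emb k₀ :+ emb k₁ :* w :+ emb k₂ :* f :+ emb k₃ :* x) :+ (emb l₀ :+ emb l₁ :* w :+ emb l₂ :* f :+ emb l₃ :* x) ⊜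
                  emb (r :* r :- r :* k₀ :+ l₀) :+ emb (l₁ :- r :* k₁) :* w :+ emb (l₂ :- r :* k₂) :* f :+ emb (l₃ :- r :* k₃) :* x) refl)
                Goal : Set
                Goal = Even (λ⟨ w₁ , w₃ ⟩ n ε₁ 0ℤ ε₃)
                build : (∃ λ W → DL W × Integral W × (⟪ n ⟫ - ν) * (⟪ n ⟫ - ν) ≡ (⟪ r ⟫ * ⟪ r ⟫ - ⟪ r ⟫ * s + p) * W) → Goal
                build (W , L-W , I-W , eq) = finish (chiForm-of L-W I-W)
                  where
                  finish : ChiForm W → Goal
                  finish (chiForm j₀ j₁ j₂ j₃ W≡) = conclude (V-inj {mul₀ δ n ε₁ 0ℤ ε₃ n ε₁ 0ℤ ε₃} {mul₁ δ n ε₁ 0ℤ ε₃ n ε₁ 0ℤ ε₃} {mul₂ δ n ε₁ 0ℤ ε₃ n ε₁ 0ℤ ε₃} {mul₃ δ n ε₁ 0ℤ ε₃ n ε₁ 0ℤ ε₃}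
                      {mul₀ δ q₀ q₁ q₂ q₃ j₀ j₁ j₂ j₃} {mul₁ δ q₀ q₁ q₂ q₃ j₀ j₁ j₂ j₃} {mul₂ δ q₀ q₁ q₂ q₃ j₀ j₁ j₂ j₃} {mul₃ δ q₀ q₁ q₂ q₃ j₀ j₁ j₂ j₃}
                      (trans (sym (V-mul n ε₁ 0ℤ ε₃ n ε₁ 0ℤ ε₃)) (trans (cong (λ x → x * x) (sym (ν≡ n))) (trans eq (trans (cong₂ _*_ q≡ W≡) (V-mul q₀ q₁ q₂ q₃ j₀ j₁ j₂ j₃))))))
                    where
                    x y z w : ℤ
                    x = λ⟨ w₁ , w₃ ⟩ (mul₀ δ n ε₁ 0ℤ ε₃ n ε₁ 0ℤ ε₃) (mul₁ δ n ε₁ 0ℤ ε₃ n ε₁ 0ℤ ε₃) (mul₂ δ n ε₁ 0ℤ ε₃ n ε₁ 0ℤ ε₃) (mul₃ δ n ε₁ 0ℤ ε₃ n ε₁ 0ℤ ε₃)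
                    y = λq w₁ w₃ r
                    z = λ⟨ w₁ , w₃ ⟩ j₀ j₁ j₂ j₃
                    w = λ⟨ w₁ , w₃ ⟩ n ε₁ 0ℤ ε₃
                    conclude : (mul₀ δ n ε₁ 0ℤ ε₃ n ε₁ 0ℤ ε₃ ≡ mul₀ δ q₀ q₁ q₂ q₃ j₀ j₁ j₂ j₃ × mul₁ δ n ε₁ 0ℤ ε₃ n ε₁ 0ℤ ε₃ ≡ mul₁ δ q₀ q₁ q₂ q₃ j₀ j₁ j₂ j₃) ×
                               (mul₂ δ n ε₁ 0ℤ ε₃ n ε₁ 0ℤ ε₃ ≡ mul₂ δ q₀ q₁ q₂ q₃ j₀ j₁ j₂ j₃ × mul₃ δ n ε₁ 0ℤ ε₃ n ε₁ 0ℤ ε₃ ≡ mul₃ δ q₀ q₁ q₂ q₃ j₀ j₁ j₂ j₃) → Goal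
                    conclude ((m₀ , m₁) , (m₂ , m₃)) = parity-of (x ∷ y ∷ z ∷ w ∷ []) (λ x y z w → (x :- y :* z ∷ x :- w :* w ∷ y ∷ []) , w) refl
                      (subst (λ t → Even (t ℤ.- y ℤ.* z)) (sym x≡) (λ-mul {δ} {w₁} {w₃} q₀ q₁ q₂ q₃ j₀ j₁ j₂ j₃ δ-even hom) ∷ λ-mul {δ} {w₁} {w₃} n ε₁ 0ℤ ε₃ n ε₁ 0ℤ ε₃ δ-even hom ∷ e ∷ [])
                      where
                      x≡ : x ≡ λ⟨ w₁ , w₃ ⟩ (mul₀ δ q₀ q₁ q₂ q₃ j₀ j₁ j₂ j₃) (mul₁ δ q₀ q₁ q₂ q₃ j₀ j₁ j₂ j₃) (mul₂ δ q₀ q₁ q₂ q₃ j₀ j₁ j₂ j₃) (mul₃ δ q₀ q₁ q₂ q₃ j₀ j₁ j₂ j₃)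
                      x≡ = cong₂ ℤ._+_ (cong₂ ℤ._+_ (cong₂ (λ s t → s ℤ.+ w₁ ℤ.* t) m₀ m₁) m₂) (cong (w₃ ℤ.*_) m₃)

              root-ω : ∀ w₁ w₃ r → Even (w₃ ℤ.* (w₁ ℤ.- 1ℤ)) → Even (λq w₁ w₃ r) → Even (value Pω r ℤ.- w₁)
              root-ω w₁ w₃ r hom e = parity-of (value Pω r ∷ w₁ ∷ w₃ ∷ []) (λ n w₁ w₃ → (n :+ w₁ :* con (ℤ.- 1ℤ) :+ con 0ℤ :+ w₃ :* con 0ℤ ∷ []) , (n :- w₁)) refl
                (residue Pω (ℤ.- 1ℤ) 0ℤ w₁ w₃ r Pω≡ σ⁴-ω (λ n → ring (n ∷ []) (ω ∷ φ ∷ χ ∷ []) (λ n w f x → emb n :- w ⊜ emb n :+ emb (con (ℤ.- 1ℤ)) :* w :+ emb (con 0ℤ) :* f :+ emb (con 0ℤ) :* x) refl) hom e ∷ [])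

              root-χ : ∀ w₁ w₃ r → Even (w₃ ℤ.* (w₁ ℤ.- 1ℤ)) → Even (λq w₁ w₃ r) → Even (value Pχ r ℤ.- w₃)
              root-χ w₁ w₃ r hom e = parity-of (value Pχ r ∷ w₁ ∷ w₃ ∷ []) (λ n w₁ w₃ → (n :+ w₁ :* con 0ℤ :+ con 0ℤ :+ w₃ :* con (ℤ.- 1ℤ) ∷ []) , (n :- w₃)) refl
                (residue Pχ 0ℤ (ℤ.- 1ℤ) w₁ w₃ r Pχ≡ (σ⁴-DL DL-χ) (λ n → ring (n ∷ []) (ω ∷ φ ∷ χ ∷ []) (λ n w f x → emb n :- x ⊜ emb n :+ emb (con 0ℤ) :* w :+ emb (con 0ℤ) :* f :+ emb (con (ℤ.- 1ℤ)) :* x) refl) hom e ∷ [])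

            private
              hom₁₁ : Even (1ℤ ℤ.* (1ℤ ℤ.- 1ℤ))
              hom₁₁ = 0ℤ , refl
              hom₁₀ : Even (0ℤ ℤ.* (1ℤ ℤ.- 1ℤ))
              hom₁₀ = 0ℤ , refl
              hom₀₀ : Even (0ℤ ℤ.* (0ℤ ℤ.- 1ℤ))
              hom₀₀ = 0ℤ , refl
              ¬even-1 : ¬ Even 1ℤ
              ¬even-1 e = even-odd e (0ℤ , refl)

            abstract
              distinct : ∀ r → Even (λq 1ℤ 0ℤ r) → Even (λq 0ℤ 0ℤ r) → ⊥
              distinct r e f = ¬even-1 (parity-of (value Pω r ∷ []) (λ n → (n :- con 1ℤ ∷ n :- con 0ℤ ∷ []) , con 1ℤ) refl (root-ω 1ℤ 0ℤ r hom₁₀ e ∷ root-ω 0ℤ 0ℤ r hom₀₀ f ∷ []))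

              -- As k₀, k₁, k₂ are even, q reduces under (1,0) and (0,0) to X² plus a constant, the
              -- two constants differing by l₁. For even l₁ both would have the same root, 0 or 1
              -- according to l₀ + l₂, although ω has different residues.
              l₁-odd : Odd l₁
              l₁-odd = ¬even⇒odd even-impossible
                where
                even-impossible : ¬ Even l₁
                even-impossible e = cases (parity (l₀ ℤ.+ l₂))
                  where
                  cases : Even (l₀ ℤ.+ l₂) ⊎ Odd (l₀ ℤ.+ l₂) → ⊥
                  cases (inj₁ z) = distinct 0ℤ
                    (parity-of (k₀ ∷ k₁ ∷ k₂ ∷ k₃ ∷ l₀ ∷ l₁ ∷ l₂ ∷ l₃ ∷ []) (λ k₀ k₁ k₂ k₃ l₀ l₁ l₂ l₃ → (l₁ ∷ l₀ :+ l₂ ∷ []) , λE (con 1ℤ) (con 0ℤ) (con 0ℤ) k₀ k₁ k₂ k₃ l₀ l₁ l₂ l₃) refl (e ∷ z ∷ []))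
                    (parity-of (k₀ ∷ k₁ ∷ k₂ ∷ k₃ ∷ l₀ ∷ l₁ ∷ l₂ ∷ l₃ ∷ []) (λ k₀ k₁ k₂ k₃ l₀ l₁ l₂ l₃ → (l₁ ∷ l₀ :+ l₂ ∷ []) , λE (con 0ℤ) (con 0ℤ) (con 0ℤ) k₀ k₁ k₂ k₃ l₀ l₁ l₂ l₃) refl (e ∷ z ∷ []))
                  cases (inj₂ z) = distinct 1ℤ
                    (parity-of (k₀ ∷ k₁ ∷ k₂ ∷ k₃ ∷ l₀ ∷ l₁ ∷ l₂ ∷ l₃ ∷ []) (λ k₀ k₁ k₂ k₃ l₀ l₁ l₂ l₃ → (k₀ ∷ k₁ ∷ k₂ ∷ l₁ ∷ l₀ :+ l₂ :- con 1ℤ ∷ []) , λE (con 1ℤ) (con 0ℤ) (con 1ℤ) k₀ k₁ k₂ k₃ l₀ l₁ l₂ l₃) refl (e-k₀ ∷ e-k₁ ∷ e-k₂ ∷ e ∷ odd-pred z ∷ []))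
                    (parity-of (k₀ ∷ k₁ ∷ k₂ ∷ k₃ ∷ l₀ ∷ l₁ ∷ l₂ ∷ l₃ ∷ []) (λ k₀ k₁ k₂ k₃ l₀ l₁ l₂ l₃ → (k₀ ∷ k₁ ∷ k₂ ∷ l₁ ∷ l₀ :+ l₂ :- con 1ℤ ∷ []) , λE (con 0ℤ) (con 0ℤ) (con 1ℤ) k₀ k₁ k₂ k₃ l₀ l₁ l₂ l₃) refl (e-k₀ ∷ e-k₁ ∷ e-k₂ ∷ e ∷ odd-pred z ∷ []))

              -- The constants differ, so 0 and 1 are each a root under one of (1,0) and (0,0). In
              -- both cases χ has residue 0.
              Pχ-even : ∀ r → Even (value Pχ r)
              Pχ-even r = subst Even (ℤₚ.+-identityʳ (value Pχ r)) (cases (parity (λq 1ℤ 0ℤ r)))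
                where
                cases : Even (λq 1ℤ 0ℤ r) ⊎ Odd (λq 1ℤ 0ℤ r) → Even (value Pχ r ℤ.- 0ℤ)
                cases (inj₁ e) = root-χ 1ℤ 0ℤ r hom₁₀ e
                cases (inj₂ o) = root-χ 0ℤ 0ℤ r hom₀₀ (parity-of (r ∷ k₀ ∷ k₁ ∷ k₂ ∷ k₃ ∷ l₀ ∷ l₁ ∷ l₂ ∷ l₃ ∷ []) (λ r k₀ k₁ k₂ k₃ l₀ l₁ l₂ l₃ →
                  (k₁ ∷ l₁ :- con 1ℤ ∷ λE (con 1ℤ) (con 0ℤ) r k₀ k₁ k₂ k₃ l₀ l₁ l₂ l₃ :- con 1ℤ ∷ []) , λE (con 0ℤ) (con 0ℤ) r k₀ k₁ k₂ k₃ l₀ l₁ l₂ l₃) refl (e-k₁ ∷ odd-pred l₁-odd ∷ odd-pred o ∷ []))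

              -- No root is left for the homomorphism (1,1), where χ has residue 1; so q has no zero
              -- in 𝔽₂ there. This makes its constant term odd, and then k₃ odd.
              q-χ-odd : ∀ r → Odd (λq 1ℤ 1ℤ r)
              q-χ-odd r = ¬even⇒odd (λ e → ¬even-1 (parity-of (value Pχ r ∷ []) (λ n → (n :- con 1ℤ ∷ n ∷ []) , con 1ℤ) refl (root-χ 1ℤ 1ℤ r hom₁₁ e ∷ Pχ-even r ∷ [])))

              trace-odd : Odd (l₀ ℤ.+ l₁ ℤ.+ l₂ ℤ.+ l₃)
              trace-odd = odd-succ (parity-of (k₀ ∷ k₁ ∷ k₂ ∷ k₃ ∷ l₀ ∷ l₁ ∷ l₂ ∷ l₃ ∷ []) (λ k₀ k₁ k₂ k₃ l₀ l₁ l₂ l₃ →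
                (λE (con 1ℤ) (con 1ℤ) (con 0ℤ) k₀ k₁ k₂ k₃ l₀ l₁ l₂ l₃ :- con 1ℤ ∷ []) , (l₀ :+ l₁ :+ l₂ :+ l₃ :- con 1ℤ)) refl (odd-pred (q-χ-odd 0ℤ) ∷ []))

              k₃-odd : Odd k₃
              k₃-odd = odd-succ (parity-of (k₀ ∷ k₁ ∷ k₂ ∷ k₃ ∷ l₀ ∷ l₁ ∷ l₂ ∷ l₃ ∷ []) (λ k₀ k₁ k₂ k₃ l₀ l₁ l₂ l₃ →
                (k₀ ∷ k₁ ∷ k₂ ∷ l₀ :+ l₁ :+ l₂ :+ l₃ :- con 1ℤ ∷ λE (con 1ℤ) (con 1ℤ) (con 1ℤ) k₀ k₁ k₂ k₃ l₀ l₁ l₂ l₃ :- con 1ℤ ∷ []) , (k₃ :- con 1ℤ)) refl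
                (e-k₀ ∷ e-k₁ ∷ e-k₂ ∷ odd-pred trace-odd ∷ odd-pred (q-χ-odd 1ℤ) ∷ []))

          record Coordinates : Set where
            field
              k₀ k₁ k₂ k₃ j₀ j₁ j₂ j₃ l₀ l₁ l₂ l₃ : ℤ
              s≡        : s ≡ V k₀ k₁ k₂ k₃
              2B≡       : 2B ≡ V j₀ j₁ j₂ j₃
              p≡V       : p ≡ V l₀ l₁ l₂ l₃
              equations : ChiEquations δ k₀ k₁ k₂ k₃ j₀ j₁ j₂ j₃ l₀ l₁ l₂ l₃
              parities  : (Even k₀ × Even k₁ × Even k₂ × Odd k₃) × (Even j₀ × Even j₁ × Even j₂ × Odd j₃)
              l₁-odd    : Odd l₁
              trace-odd : Odd (l₀ ℤ.+ l₁ ℤ.+ l₂ ℤ.+ l₃)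

          abstract
            the-coordinates : Coordinates
            the-coordinates = build (chiForm-of DL-s I-s) (chiForm-of DL-2B I-2B) (chiForm-of DL-p I-p)
              where
              build : ChiForm s → ChiForm 2B → ChiForm p → Coordinates
              build (chiForm k₀ k₁ k₂ k₃ s≡) (chiForm j₀ j₁ j₂ j₃ y≡) (chiForm l₀ l₁ l₂ l₃ p≡′) = record
                { s≡ = s≡ ; 2B≡ = y≡ ; p≡V = p≡′ ; equations = equations
                ; parities = (C.e-k₀ δ-even , C.e-k₁ δ-even , C.e-k₂ δ-even , R.k₃-odd) , (C.e-j₀ δ-even , C.e-j₁ δ-even , C.e-j₂ δ-even ,
                    odd-succ (parity-of (k₃ ∷ j₃ ∷ []) (λ k j → (k :- con 1ℤ ∷ k :- j ∷ []) , (j :- con 1ℤ)) refl (odd-pred R.k₃-odd ∷ ChiParity.k₃-j₃ parities ∷ [])))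
                ; l₁-odd = R.l₁-odd ; trace-odd = R.trace-odd }
                where
                equations : ChiEquations δ k₀ k₁ k₂ k₃ j₀ j₁ j₂ j₃ l₀ l₁ l₂ l₃
                equations = chi-equations δ k₀ k₁ k₂ k₃ j₀ j₁ j₂ j₃ {l₀} {l₁} {l₂} {l₃} (subst (λ c → NormEquations (pos 8) c (pos 2 ℤ.* k₀) (pos 2 ℤ.* k₁ ℤ.+ k₃) (pos 2 ℤ.* k₂) k₃ (pos 2 ℤ.* j₀) (pos 2 ℤ.* j₁ ℤ.+ j₃) (pos 2 ℤ.* j₂) j₃ (pos 2 ℤ.* l₀) (pos 2 ℤ.* l₁ ℤ.+ l₃) (pos 2 ℤ.* l₂) l₃) c≡
                    (norm-equations {s} {2B} {p} (double-V s≡) (double-V y≡) (double-V p≡′) 4p))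
                parities : ChiParity δ k₀ k₁ k₂ k₃ j₀ j₁ j₂ j₃
                parities = chi-parity {δ} {k₀} {k₁} {k₂} {k₃} {j₀} {j₁} {j₂} {j₃} {l₀} {l₁} {l₂} {l₃} equations
                module C = ParityConsequences parities
                module R = Residues δ-even s≡ p≡′ (C.e-k₀ δ-even) (C.e-k₁ δ-even) (C.e-k₂ δ-even)

            -- This is a ≡ 1 (mod 32). The roots make l₀ + l₁ + l₂ + l₃ odd, the difference of two
            -- squares makes it even.
            δ≢4n : ∀ n → δ ≢ pos 4 ℤ.* n
            δ≢4n n δ≡ = build the-coordinates
              where
              build : Coordinates → ⊥
              build C = even-odd (trace-even n {l₀ = l₀} {l₁} {l₂} {l₃} parities (subst (λ d → ChiEquations d k₀ k₁ k₂ k₃ j₀ j₁ j₂ j₃ l₀ l₁ l₂ l₃) δ≡ equations)) trace-odd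
                where open Coordinates C

          -- a ≡ 17 (mod 32): r₀ and the norm of 2B modulo 2.

          module Ramified (n : ℤ) (δ≡ : δ ≡ pos 4 ℤ.* n ℤ.+ pos 2) where

            infix 4 _≋_
            _≋_ : Carrier → Carrier → Set
            x ≋ y = ∃ λ w → Integral w × x ≡ y + ⟪ pos 2 ⟫ * w

            abstract
              ≋-refl : ∀ {x} → x ≋ x
              ≋-refl {x} = 0# , I-0 , ring [] (x ∷ []) (λ x → x ⊜ x :+ lit 2 :* :0) refl

              ≋-reflexive : ∀ {x y} → x ≡ y → x ≋ y
              ≋-reflexive refl = ≋-refl

              ≋-trans : ∀ {x y z} → x ≋ y → y ≋ z → x ≋ z
              ≋-trans {z = z} (v , I-v , p) (w , I-w , q) = w + v , I-+ I-w I-v , trans p (trans (cong (_+ ⟪ pos 2 ⟫ * v) q) (ring [] (z ∷ w ∷ v ∷ []) (λ z w v → z :+ lit 2 :* w :+ lit 2 :* v ⊜ z :+ lit 2 :* (w :+ v)) refl))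

              ≋-+ : ∀ {x x′ y y′} → x ≋ x′ → y ≋ y′ → x + y ≋ x′ + y′
              ≋-+ {x′ = x′} {y′ = y′} (v , I-v , p) (w , I-w , q) = v + w , I-+ I-v I-w , trans (cong₂ _+_ p q) (ring [] (x′ ∷ y′ ∷ v ∷ w ∷ []) (λ x y v w → let two = lit 2 in x :+ two :* v :+ (y :+ two :* w) ⊜ x :+ y :+ two :* (v :+ w)) refl)

              ≋-- : ∀ {x x′ y y′} → x ≋ x′ → y ≋ y′ → x - y ≋ x′ - y′
              ≋-- {x′ = x′} {y′ = y′} (v , I-v , p) (w , I-w , q) = v - w , I-- I-v I-w , trans (cong₂ _-_ p q) (ring [] (x′ ∷ y′ ∷ v ∷ w ∷ []) (λ x y v w → let two = lit 2 in x :+ two :* v :- (y :+ two :* w) ⊜ x :- y :+ two :* (v :- w)) refl)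

              ≋-* : ∀ {x x′ y y′} → Integral x′ → Integral y′ → x ≋ x′ → y ≋ y′ → x * y ≋ x′ * y′
              ≋-* {x′ = x′} {y′ = y′} I-x I-y (v , I-v , p) (w , I-w , q) = x′ * w + v * y′ + ⟪ pos 2 ⟫ * (v * w) , I-+ (I-+ (I-* I-x I-w) (I-* I-v I-y)) (I-* (I-ι _) (I-* I-v I-w)) ,
                trans (cong₂ _*_ p q) (ring [] (x′ ∷ y′ ∷ v ∷ w ∷ []) (λ x y v w → let two = lit 2 in (x :+ two :* v) :* (y :+ two :* w) ⊜ x :* y :+ two :* (x :* w :+ v :* y :+ two :* (v :* w))) refl)

              ≋-σ : ∀ {x y} → x ≋ y → σ x ≋ σ y
              ≋-σ {x} {y} (w , I-w , p) = σ w , I-σ I-w , trans (cong σ p) (trans (σ-+ y (⟪ pos 2 ⟫ * w)) (cong (σ y +_) (trans (σ-* ⟪ pos 2 ⟫ w) (cong (_* σ w) (σ-⟪⟫ (pos 2))))))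

            -- v is idempotent modulo 2, and σ² exchanges v and 1 - v. The residue of r₀ is written
            -- in terms of it.
            χ′ v : Carrier
            χ′ = σ χ
            v = χ + χ′

            abstract
              σ²χ : σ² χ ≡ ω - χ
              σ²χ = cancel {pos 2} (λ ()) (begin
                ⟪ pos 2 ⟫ * σ² χ            ≡⟨ cong (_* σ² χ) (sym (trans (cong σ (σ-⟪⟫ (pos 2))) (σ-⟪⟫ (pos 2)))) ⟩
                σ² ⟪ pos 2 ⟫ * σ² χ         ≡⟨ trans (sym (σ²-* ⟪ pos 2 ⟫ χ)) (cong σ² 2χ) ⟩
                σ² (ω * (1# + φ))           ≡⟨ trans (σ²-* ω (1# + φ)) (cong₂ _*_ (σ²-DF DF-ω) (trans (σ²-+ 1# φ) (cong₂ _+_ (trans (cong σ σ-1) σ-1) σ²-φ))) ⟩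
                ω * (1# + - φ)              ≡⟨ lc₁ 1# 2χ (ring [] (ω ∷ φ ∷ χ ∷ []) (λ w f x → let two = lit 2 in w :* (:1 :+ :- f) :+ :1 :* (w :* (:1 :+ f)) ⊜ two :* (w :- x) :+ :1 :* (two :* x)) refl) ⟩
                ⟪ pos 2 ⟫ * (ω - χ)         ∎)

              I-χ′ : Integral χ′
              I-χ′ = I-σ I-χ
              I-v : Integral v
              I-v = I-+ I-χ I-χ′

              σχ′ : σ χ′ ≡ ω - χ
              σχ′ = σ²χ

              v+σ²v : σ² v ≡ 1# - v
              v+σ²v = trans (σ²-+ χ χ′) (trans (cong₂ _+_ σ²χ (trans (cong σ σ²χ) (trans (σ-- ω χ) (cong (_- χ′) σ-ω)))) (ring [] (ω ∷ χ ∷ χ′ ∷ []) (λ w x y → w :- x :+ (:1 :- w :- y) ⊜ :1 :- (x :+ y)) refl))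

              ⟪δ⟫ : ⟪ δ ⟫ ≡ ⟪ pos 2 ⟫ * ⟪ pos 2 ℤ.* n ℤ.+ 1ℤ ⟫
              ⟪δ⟫ = trans (cong ⟪_⟫ δ≡) (ring (n ∷ []) [] (λ n → emb (con (pos 4) :* n :+ con (pos 2)) ⊜ lit 2 :* emb (con (pos 2) :* n :+ con 1ℤ)) refl)

              I-1+φ : Integral (1# + φ)
              I-1+φ = I-+ I-1 I-φ

              χω≋ : χ * ω ≋ χ
              χω≋ = ⟪ pos 2 ℤ.* n ℤ.+ 1ℤ ⟫ * (1# + φ) , I-* (I-ι _) I-1+φ , trans χω (cong (χ +_) (trans (cong (_* (1# + φ)) ⟪δ⟫) (*-assoc _ _ _)))
              χφ≋ : χ * φ ≋ χ
              χφ≋ = ⟪ δ ⟫ , I-ι δ , trans χφ (cong (χ +_) (⟪⟫-* (pos 2) δ))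
              χχ≋ : χ * χ ≋ χ
              χχ≋ = ⟪ pos 2 ℤ.* n ℤ.+ 1ℤ ⟫ * (1# + φ + ω) , I-* (I-ι _) (I-+ I-1+φ I-ω) , trans χχ (cong (χ +_) (trans (cong (_* (1# + φ + ω)) ⟪δ⟫) (*-assoc _ _ _)))

              χ′ω≋ : χ′ * ω ≋ 0#
              χ′ω≋ = ≋-trans (≋-reflexive (ring [] (χ′ ∷ ω ∷ []) (λ x w → x :* w ⊜ x :- x :* (:1 :- w)) refl)) (≋-trans (≋-- {x = χ′} ≋-refl step) (≋-reflexive (ring [] (χ′ ∷ []) (λ x → x :- x ⊜ :0) refl)))
                where
                step : χ′ * (1# - ω) ≋ χ′
                step = ≋-trans (≋-reflexive (trans (cong (χ′ *_) (sym σ-ω)) (sym (σ-* χ ω)))) (≋-σ χω≋)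

              χ′φ≋ : χ′ * φ ≋ i * χ′
              χ′φ≋ = ≋-trans (≋-reflexive (lc₁ (χ′ * φ) ii (ring [] (χ′ ∷ φ ∷ i ∷ []) (λ x f i → x :* f :+ x :* f :* emb (con (ℤ.- 1ℤ)) ⊜ :- i :* (x :* (i :* f)) :+ x :* f :* (i :* i)) refl)))
                (≋-trans (≋-* (I-neg I-i) I-χ′ (≋-refl { - i }) (≋-trans (≋-reflexive (trans (cong (χ′ *_) (sym σ-φ)) (sym (σ-* χ φ)))) (≋-σ χφ≋)))
                (- i * χ′ , I-* (I-neg I-i) I-χ′ , ring [] (χ′ ∷ i ∷ []) (λ x i → :- i :* x ⊜ i :* x :+ lit 2 :* (:- i :* x)) refl))

              vv≋ : v * v ≋ v
              vv≋ = ≋-trans (χ * χ′ , I-* I-χ I-χ′ , ring [] (χ ∷ χ′ ∷ []) (λ x y → (x :+ y) :* (x :+ y) ⊜ x :* x :+ y :* y :+ lit 2 :* (x :* y)) refl)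
                (≋-+ χχ≋ (≋-trans (≋-reflexive (sym (σ-* χ χ))) (≋-σ χχ≋)))

              -- The resultant of two monic quadratics in terms of sums s and products p of their
              -- roots; with it r₀ depends on s and p only, whose residues modulo 2 are known.
              resultant : r₀ ≡ (σ p - p) * (σ p - p) + (s - σ s) * (s * σ p - σ s * p)
              resultant = trans (ring [] (t ∷ σ t ∷ σ⁴ t ∷ σ (σ⁴ t) ∷ []) (λ t t₁ t₄ t₅ → let s = t :+ t₄ ; p = t :* t₄ ; s′ = t₁ :+ t₅ ; p′ = t₁ :* t₅ in
                  (t :- t₁) :* (t :- t₅) :* ((t₄ :- t₁) :* (t₄ :- t₅)) ⊜ (p′ :- p) :* (p′ :- p) :+ (s :- s′) :* (s :* p′ :- s′ :* p)) refl)
                (trans (cong₂ (λ s′ p′ → (p′ - t * σ⁴ t) * (p′ - t * σ⁴ t) + (t + σ⁴ t - s′) * ((t + σ⁴ t) * p′ - s′ * (t * σ⁴ t))) (sym (σ-+ t (σ⁴ t))) (sym (σ-* t (σ⁴ t))))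
                (cong₂ (λ s p → (σ p - p) * (σ p - p) + (s - σ s) * (s * σ p - σ s * p)) s≡t p≡))
                where
                s≡t : t + σ⁴ t ≡ s
                s≡t = trans (cong₂ _+_ t≡ β₄≡) (ring [] (A ∷ B ∷ θ ∷ []) (λ A B t → A :+ B :* t :+ (A :- B :* t) ⊜ lit 2 :* A) refl)

              module _ (l : ℤ) where
                private
                  P₀ P₁ : Carrier
                  P₀ = ⟪ l ⟫ + ω + φ + ⟪ l ℤ.+ 1ℤ ⟫ * χ
                  P₁ = ⟪ l ⟫ + (1# - ω) + i * φ + ⟪ l ℤ.+ 1ℤ ⟫ * χ′

                σP₀ : σ P₀ ≡ P₁
                σP₀ = trans (σ-+ _ _) (cong₂ _+_ (trans (σ-+ _ _) (cong₂ _+_ (trans (σ-+ _ _) (cong₂ _+_ (σ-⟪⟫ l) σ-ω)) σ-φ)) (trans (σ-* _ _) (cong (_* χ′) (σ-⟪⟫ _))))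

                I-P₀ : Integral P₀
                I-P₀ = I-+ (I-+ (I-+ (I-ι l) I-ω) I-φ) (I-* (I-ι _) I-χ)
                I-P₁ : Integral P₁
                I-P₁ = subst Integral σP₀ (I-σ I-P₀)

                difference≋ : P₁ - P₀ ≋ 1# + (1# + i) * φ + ⟪ l ℤ.+ 1ℤ ⟫ * v
                difference≋ = - ω - φ - ⟪ l ℤ.+ 1ℤ ⟫ * χ , I-- (I-- (I-neg I-ω) I-φ) (I-* (I-ι _) I-χ) , ring (l ℤ.+ 1ℤ ∷ l ∷ []) (ω ∷ φ ∷ i ∷ χ ∷ χ′ ∷ []) (λ m l w f i x y →
                  emb l :+ (:1 :- w) :+ i :* f :+ emb m :* y :- (emb l :+ w :+ f :+ emb m :* x) ⊜ :1 :+ (:1 :+ i) :* f :+ emb m :* (x :+ y) :+ lit 2 :* (:- w :- f :- emb m :* x)) refl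

                square≋ : (P₁ - P₀) * (P₁ - P₀) ≋ 1# + ⟪ l ℤ.+ 1ℤ ⟫ * v
                square≋ = ≋-trans (≋-* I-d I-d difference≋ difference≋) (≋-trans
                  ((1# + i) * φ + ⟪ k′ ⟫ * v + (1# + i) * φ * (⟪ k′ ⟫ * v) + i * (φ * φ) , I-+ (I-+ (I-+ I-iφ I-mv) (I-* I-iφ I-mv)) (I-* I-i (I-* I-φ I-φ)) ,
                    lc₁ (φ * φ) ii (ring (k′ ∷ []) (φ ∷ i ∷ v ∷ []) (λ m f i v → let mv = emb m :* v ; g = (:1 :+ i) :* f in
                      (:1 :+ g :+ mv) :* (:1 :+ g :+ mv) :+ f :* f :* emb (con (ℤ.- 1ℤ)) ⊜ :1 :+ mv :* mv :+ lit 2 :* (g :+ mv :+ g :* mv :+ i :* (f :* f)) :+ f :* f :* (i :* i)) refl))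
                  (≋-+ ≋-refl (≋-trans (≋-reflexive (ring (k′ ∷ []) (v ∷ []) (λ m v → emb m :* v :* (emb m :* v) ⊜ emb (m :* m) :* (v :* v)) refl))
                    (≋-trans (≋-* (I-ι _) I-v ≋-refl vv≋) (mm≋ (parity-of (l ∷ []) (λ l → [] , ((l :+ con 1ℤ) :* (l :+ con 1ℤ) :- (l :+ con 1ℤ))) refl []))))))
                  where
                  k′ : ℤ
                  k′ = l ℤ.+ 1ℤ
                  I-iφ : Integral ((1# + i) * φ)
                  I-iφ = I-* (I-+ I-1 I-i) I-φ
                  I-mv : Integral (⟪ k′ ⟫ * v)
                  I-mv = I-* (I-ι k′) I-v
                  I-d : Integral (1# + (1# + i) * φ + ⟪ k′ ⟫ * v)
                  I-d = I-+ (I-+ I-1 I-iφ) I-mv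
                  mm≋ : Even (k′ ℤ.* k′ ℤ.- k′) → ⟪ k′ ℤ.* k′ ⟫ * v ≋ ⟪ k′ ⟫ * v
                  mm≋ (k , e) = ⟪ k ⟫ * v , I-* (I-ι k) I-v , trans (ring (k′ ∷ k′ ℤ.* k′ ∷ []) (v ∷ []) (λ m mm v → emb mm :* v ⊜ emb m :* v :+ emb (mm :- m) :* v) refl)
                    (cong (⟪ k′ ⟫ * v +_) (trans (cong (λ z → ⟪ z ⟫ * v) e) (ring (k ∷ []) (v ∷ []) (λ k v → emb (con (pos 2) :* k) :* v ⊜ lit 2 :* (emb k :* v)) refl)))

                cross≋ : χ * P₁ - χ′ * P₀ ≋ (⟪ l ⟫ + i) * v
                cross≋ = ≋-trans (≋-reflexive (ring (l ∷ l ℤ.+ 1ℤ ∷ []) (ω ∷ φ ∷ i ∷ χ ∷ χ′ ∷ []) (λ l m w f i x y →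
                    x :* (emb l :+ (:1 :- w) :+ i :* f :+ emb m :* y) :- y :* (emb l :+ w :+ f :+ emb m :* x) ⊜
                    (emb l :* x :+ x :- emb l :* y) :- x :* w :+ i :* (x :* f) :- y :* w :- y :* f) refl))
                  (≋-trans (≋-- (≋-- (≋-+ (≋-- (≋-refl {⟪ l ⟫ * χ + χ - ⟪ l ⟫ * χ′}) χω≋) (≋-* I-i I-χ (≋-refl {i}) χφ≋)) χ′ω≋) χ′φ≋)
                  (- (⟪ l ⟫ * χ′) - i * χ′ , I-- (I-neg (I-* (I-ι l) I-χ′)) (I-* I-i I-χ′) , ring (l ∷ []) (i ∷ χ ∷ χ′ ∷ []) (λ l i x y →
                    (emb l :* x :+ x :- emb l :* y) :- x :+ i :* x :- :0 :- i :* y ⊜ (emb l :+ i) :* (x :+ y) :+ lit 2 :* (:- (emb l :* y) :- i :* y)) refl))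

                -- The square contributes 1 + (l + 1)v, because (1 + i)² = 2i, and the product
                -- contributes (l + i)v² ≡ (l + i)v. In the sum the unknown l occurs as 2l and drops
                -- out.
                r₀≋ : s ≋ χ → p ≋ P₀ → r₀ ≋ 1# + (1# + i) * v
                r₀≋ s≋ p≋ = ≋-trans (≋-reflexive resultant) (≋-trans (≋-+ (≋-* I-d I-d d≋ d≋) (≋-* (I-- I-χ I-χ′) (I-- (I-* I-χ I-P₁) (I-* I-χ′ I-P₀)) (≋-- s≋ σs≋) (≋-- (≋-* I-χ I-P₁ s≋ σp≋) (≋-* I-χ′ I-P₀ σs≋ p≋))))
                  (≋-trans (≋-+ square≋ (≋-* I-v (I-* (I-+ (I-ι l) I-i) I-v) (- χ′ , I-neg I-χ′ , ring [] (χ ∷ χ′ ∷ []) (λ x y → x :- y ⊜ x :+ y :+ lit 2 :* (:- y)) refl) cross≋))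
                  (≋-trans (≋-+ ≋-refl (≋-trans (≋-reflexive (ring (l ∷ []) (i ∷ v ∷ []) (λ l i v → v :* ((emb l :+ i) :* v) ⊜ (emb l :+ i) :* (v :* v)) refl)) (≋-* (I-+ (I-ι l) I-i) I-v ≋-refl vv≋)))
                  (⟪ l ⟫ * v , I-* (I-ι l) I-v , ring (l ∷ []) (i ∷ v ∷ []) (λ l i v → :1 :+ emb (l :+ con 1ℤ) :* v :+ (emb l :+ i) :* v ⊜ :1 :+ (:1 :+ i) :* v :+ lit 2 :* (emb l :* v)) refl))))
                  where
                  σs≋ : σ s ≋ χ′
                  σs≋ = ≋-σ s≋
                  σp≋ : σ p ≋ P₁
                  σp≋ = ≋-trans (≋-σ p≋) (≋-reflexive σP₀)
                  d≋ : σ p - p ≋ P₁ - P₀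
                  d≋ = ≋-- σp≋ p≋
                  I-d : Integral (P₁ - P₀)
                  I-d = I-- I-P₁ I-P₀

                -- The product of 1 + (1 + i)v and 1 + (1 + i)(1 - v) is 2 + i + 2iv(1 - v).
                r₀σ²r₀≋i : s ≋ χ → p ≋ P₀ → r₀ * σ² r₀ ≋ i
                r₀σ²r₀≋i s≋ p≋ = ≋-trans (≋-* I-1iv (subst Integral σ²q (I-σ (I-σ I-1iv))) (r₀≋ s≋ p≋) (≋-trans (≋-σ (≋-σ (r₀≋ s≋ p≋))) (≋-reflexive σ²q)))
                  (1# + i * (v * (1# - v)) , I-+ I-1 (I-* I-i (I-* I-v (I-- I-1 I-v))) ,
                    lc₁ (v * (1# - v)) ii (ring [] (i ∷ v ∷ []) (λ i v → let w = v :* (:1 :- v) in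
                      (:1 :+ (:1 :+ i) :* v) :* (:1 :+ (:1 :+ i) :* (:1 :- v)) :+ w :* emb (con (ℤ.- 1ℤ)) ⊜ i :+ lit 2 :* (:1 :+ i :* w) :+ w :* (i :* i)) refl))
                  where
                  I-1iv : Integral (1# + (1# + i) * v)
                  I-1iv = I-+ I-1 (I-* (I-+ I-1 I-i) I-v)
                  σ²q : σ² (1# + (1# + i) * v) ≡ 1# + (1# + i) * (1# - v)
                  σ²q = trans (σ²-+ _ _) (cong₂ _+_ (trans (cong σ σ-1) σ-1) (trans (σ²-* _ _) (cong₂ _*_ (trans (σ²-+ 1# i) (cong₂ _+_ (trans (cong σ σ-1) σ-1) σ²-i)) v+σ²v)))

              -- If i = 1 + 2z with z integral, then i² = -1 gives 2z² = -i and hence 4z⁴ = -1, so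
              -- -1/4 would be an integer.
              odd≢i : ∀ {m} → Odd m → ⟪ m ⟫ ≋ i → ⊥
              odd≢i {m} (k , m≡) (w , I-w , e) = finish (rational {pos 4} { ℤ.- 1ℤ } (λ ()) (I-* (I-* I-z I-z) (I-* I-z I-z)) 4z⁴)
                where
                z : Carrier
                z = ⟪ k ⟫ - w
                I-z : Integral z
                I-z = I-- (I-ι k) I-w
                i≡ : i ≡ 1# + ⟪ pos 2 ⟫ * z
                i≡ = lc₁ (- 1#) (trans (cong ⟪_⟫ (sym m≡)) e) (ring (k ∷ []) (i ∷ w ∷ []) (λ k i w → let two = con (pos 2) in i :+ :- :1 :* (i :+ emb two :* w) ⊜ :1 :+ emb two :* (emb k :- w) :+ :- :1 :* emb (two :* k :+ con 1ℤ)) refl)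
                2z² : ⟪ pos 2 ⟫ * (z * z) ≡ - i
                2z² = cancel {pos 2} (λ ()) (trans (ring [] (z ∷ []) (λ z → let two = lit 2 in two :* (two :* (z :* z)) ⊜ (:1 :+ two :* z) :* (:1 :+ two :* z) :- two :* (:1 :+ two :* z) :+ :1) refl)
                  (trans (cong (λ j → j * j - ⟪ pos 2 ⟫ * j + 1#) (sym i≡)) (lc₁ 1# ii (ring [] (i ∷ []) (λ i → let two = lit 2 in i :* i :- two :* i :+ :1 :+ :1 :* emb (con (ℤ.- 1ℤ)) ⊜ two :* (:- i) :+ :1 :* (i :* i)) refl))))
                4z⁴ : ⟪ pos 4 ⟫ * (z * z * (z * z)) ≡ ⟪ ℤ.- 1ℤ ⟫
                4z⁴ = trans (ring [] (z ∷ []) (λ z → let two = lit 2 in lit 4 :* (z :* z :* (z :* z)) ⊜ two :* (z :* z) :* (two :* (z :* z))) refl)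
                  (trans (cong (λ j → j * j) 2z²) (trans (ring [] (i ∷ []) (λ i → :- i :* (:- i) ⊜ i :* i) refl) ii))
                finish : (∃ λ y → z * z * (z * z) ≡ ⟪ y ⟫ × pos 4 ℤ.* y ≡ ℤ.- 1ℤ) → ⊥
                finish (y , _ , q) = even-odd (pos 2 ℤ.* y , trans (sym q) (lem y)) (ℤ.- 1ℤ , refl)
                  where lem : ∀ y → pos 4 ℤ.* y ≡ pos 2 ℤ.* (pos 2 ℤ.* y)
                        lem = solve-∀

            -- 2B times its conjugate over F is 2Y′ with Y′ = 2P + Qω, and Y′σ(Y′) = 2N for N = 2P²
            -- + PQ - δQ². The cofactor w of 2B in 2 has the product z of its images under 1, σ, σ²,
            -- σ³, which gives Nz = 2.
            record NormOf2B (μ₀ μ₂ : ℤ) : Set where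
              field
                P Q z   : ℤ
                P-even  : Even (μ₀ ℤ.+ μ₂) → Even P
                w       : Carrier
                I-w     : Integral w
                2Bw≡2   : 2B * w ≡ ⟪ pos 2 ⟫
                Y≡      : 2B * σ² 2B ≡ ⟪ pos 2 ⟫ * ((pos 2 ℤ.* P) ⊹ Q ω)
                W≡      : (w * σ² w) * σ (w * σ² w) ≡ ⟪ z ⟫
                YW      : ((pos 2 ℤ.* P) ⊹ Q ω) * (w * σ² w) ≡ ⟪ pos 2 ⟫
                norm≡   : (pos 2 ℤ.* (P ℤ.* P) ℤ.+ P ℤ.* Q ℤ.- δ ℤ.* (Q ℤ.* Q)) ℤ.* z ≡ pos 2

            abstract
              σ²V : ∀ k₀ k₁ k₂ k₃ → σ² (V k₀ k₁ k₂ k₃) ≡ V k₀ (k₁ ℤ.+ k₃) (ℤ.- k₂) (ℤ.- k₃)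
              σ²V k₀ k₁ k₂ k₃ = begin
                σ² (⟪ k₀ ⟫ + ⟪ k₁ ⟫ * ω + ⟪ k₂ ⟫ * φ + ⟪ k₃ ⟫ * χ)
                  ≡⟨ trans (σ²-+ _ _) (cong₂ _+_ (trans (σ²-+ _ _) (cong₂ _+_ (trans (σ²-+ _ _) (cong₂ _+_ (σ²⟪⟫ k₀) (term k₁ (σ²-DF DF-ω)))) (term k₂ σ²-φ))) (term k₃ σ²χ)) ⟩
                ⟪ k₀ ⟫ + ⟪ k₁ ⟫ * ω + ⟪ k₂ ⟫ * (- φ) + ⟪ k₃ ⟫ * (ω - χ)
                  ≡⟨ ring (k₀ ∷ k₁ ∷ k₂ ∷ k₃ ∷ []) (ω ∷ φ ∷ χ ∷ []) (λ k₀ k₁ k₂ k₃ w f x → emb k₀ :+ emb k₁ :* w :+ emb k₂ :* (:- f) :+ emb k₃ :* (w :- x) ⊜ emb k₀ :+ emb (k₁ :+ k₃) :* w :+ emb (:- k₂) :* f :+ emb (:- k₃) :* x) refl ⟩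
                V k₀ (k₁ ℤ.+ k₃) (ℤ.- k₂) (ℤ.- k₃) ∎
                where
                σ²⟪⟫ : ∀ k → σ² ⟪ k ⟫ ≡ ⟪ k ⟫
                σ²⟪⟫ k = trans (cong σ (σ-⟪⟫ k)) (σ-⟪⟫ k)
                term : ∀ k {x y} → σ² x ≡ y → σ² (⟪ k ⟫ * x) ≡ ⟪ k ⟫ * y
                term k e = trans (σ²-* _ _) (cong₂ _*_ (σ²⟪⟫ k) e)

              norm-of-2B : ∀ μ₀ μ₁ μ₂ μ₃ → 2B ≡ V (pos 2 ℤ.* μ₀) (pos 2 ℤ.* μ₁) (pos 2 ℤ.* μ₂) (pos 2 ℤ.* μ₃ ℤ.+ 1ℤ) → NormOf2B μ₀ μ₂
              norm-of-2B μ₀ μ₁ μ₂ μ₃ 2B≡ = build 2B∣2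
                where
                P Q : ℤ
                P = μ₀ ℤ.* μ₀ ℤ.+ μ₂ ℤ.* μ₂ ℤ.+ pos 2 ℤ.* ((pos 2 ℤ.* n ℤ.+ 1ℤ) ℤ.* (pos 2 ℤ.* (μ₁ ℤ.* μ₁) ℤ.+ μ₁ ℤ.* (pos 2 ℤ.* μ₃ ℤ.+ 1ℤ) ℤ.- pos 2 ℤ.* (μ₂ ℤ.* (pos 2 ℤ.* μ₃ ℤ.+ 1ℤ))))
                Q = pos 4 ℤ.* (μ₀ ℤ.* μ₁) ℤ.+ pos 2 ℤ.* (μ₁ ℤ.* μ₁) ℤ.+ (pos 2 ℤ.* μ₃ ℤ.+ 1ℤ) ℤ.* μ₀ ℤ.+ (pos 2 ℤ.* μ₃ ℤ.+ 1ℤ) ℤ.* μ₁ ℤ.- pos 4 ℤ.* (μ₂ ℤ.* μ₂) ℤ.- μ₂ ℤ.* (pos 2 ℤ.* μ₃ ℤ.+ 1ℤ) ℤ.- (pos 2 ℤ.* n ℤ.+ 1ℤ) ℤ.* ((pos 2 ℤ.* μ₃ ℤ.+ 1ℤ) ℤ.* (pos 2 ℤ.* μ₃ ℤ.+ 1ℤ))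
                lem₀ : ∀ n μ₀ μ₁ μ₂ μ₃ → (pos 2 ℤ.* μ₀) ℤ.* (pos 2 ℤ.* μ₀) ℤ.- (pos 2 ℤ.* μ₂) ℤ.* (ℤ.- (pos 2 ℤ.* μ₂)) ℤ.+ (pos 4 ℤ.* n ℤ.+ pos 2) ℤ.* (pos 2 ℤ.* ((pos 2 ℤ.* μ₁) ℤ.* ((pos 2 ℤ.* μ₁) ℤ.+ (pos 2 ℤ.* μ₃ ℤ.+ 1ℤ)) ℤ.+ (pos 2 ℤ.* μ₂) ℤ.* (ℤ.- (pos 2 ℤ.* μ₃ ℤ.+ 1ℤ)) ℤ.+ (pos 2 ℤ.* μ₃ ℤ.+ 1ℤ) ℤ.* (ℤ.- (pos 2 ℤ.* μ₂))) ℤ.+ (pos 2 ℤ.* μ₁) ℤ.* (ℤ.- (pos 2 ℤ.* μ₃ ℤ.+ 1ℤ)) ℤ.+ (pos 2 ℤ.* μ₃ ℤ.+ 1ℤ) ℤ.* ((pos 2 ℤ.* μ₁) ℤ.+ (pos 2 ℤ.* μ₃ ℤ.+ 1ℤ)) ℤ.+ (pos 2 ℤ.* μ₃ ℤ.+ 1ℤ) ℤ.* (ℤ.- (pos 2 ℤ.* μ₃ ℤ.+ 1ℤ))) ≡ pos 2 ℤ.* (pos 2 ℤ.* (μ₀ ℤ.* μ₀ ℤ.+ μ₂ ℤ.* μ₂ ℤ.+ pos 2 ℤ.* ((pos 2 ℤ.* n ℤ.+ 1ℤ) ℤ.* (pos 2 ℤ.* (μ₁ ℤ.* μ₁) ℤ.+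 μ₁ ℤ.* (pos 2 ℤ.* μ₃ ℤ.+ 1ℤ) ℤ.- pos 2 ℤ.* (μ₂ ℤ.* (pos 2 ℤ.* μ₃ ℤ.+ 1ℤ))))))
                lem₀ = solve-∀
                lem₁ : ∀ n μ₀ μ₁ μ₂ μ₃ → (pos 2 ℤ.* μ₀) ℤ.* ((pos 2 ℤ.* μ₁) ℤ.+ (pos 2 ℤ.* μ₃ ℤ.+ 1ℤ)) ℤ.+ (pos 2 ℤ.* μ₁) ℤ.* (pos 2 ℤ.* μ₀) ℤ.+ (pos 2 ℤ.* μ₁) ℤ.* ((pos 2 ℤ.* μ₁) ℤ.+ (pos 2 ℤ.* μ₃ ℤ.+ 1ℤ)) ℤ.- ((pos 2 ℤ.* μ₁) ℤ.* (ℤ.- (pos 2 ℤ.* μ₂)) ℤ.+ (pos 2 ℤ.* μ₂) ℤ.* ((pos 2 ℤ.* μ₁) ℤ.+ (pos 2 ℤ.* μ₃ ℤ.+ 1ℤ))) ℤ.+ pos 2 ℤ.* ((pos 2 ℤ.* μ₂) ℤ.* (ℤ.- (pos 2 ℤ.* μ₂))) ℤ.+ (pos 4 ℤ.* n ℤ.+ pos 2) ℤ.* ((pos 2 ℤ.* μ₃ ℤ.+ 1ℤ) ℤ.* (ℤ.- (pos 2 ℤ.* μ₃ ℤ.+ 1ℤ))) ≡ pos 2 ℤ.* (pos 4 ℤ.* (μ₀ ℤ.* μ₁) ℤ.+ pos 2 ℤ.* (μ₁ ℤ.* μ₁) ℤ.+ (pos 2 ℤ.* μ₃ ℤ.+ 1ℤ)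 ℤ.* μ₀ ℤ.+ (pos 2 ℤ.* μ₃ ℤ.+ 1ℤ) ℤ.* μ₁ ℤ.- pos 4 ℤ.* (μ₂ ℤ.* μ₂) ℤ.- μ₂ ℤ.* (pos 2 ℤ.* μ₃ ℤ.+ 1ℤ) ℤ.- (pos 2 ℤ.* n ℤ.+ 1ℤ) ℤ.* ((pos 2 ℤ.* μ₃ ℤ.+ 1ℤ) ℤ.* (pos 2 ℤ.* μ₃ ℤ.+ 1ℤ)))
                lem₁ = solve-∀
                lem₂ : ∀ n μ₀ μ₁ μ₂ μ₃ → (pos 2 ℤ.* μ₀) ℤ.* (ℤ.- (pos 2 ℤ.* μ₂)) ℤ.+ (pos 2 ℤ.* μ₂) ℤ.* (pos 2 ℤ.* μ₀) ℤ.+ (pos 4 ℤ.* n ℤ.+ pos 2) ℤ.* ((pos 2 ℤ.* μ₁) ℤ.* (ℤ.- (pos 2 ℤ.* μ₃ ℤ.+ 1ℤ)) ℤ.+ (pos 2 ℤ.* μ₃ ℤ.+ 1ℤ) ℤ.* ((pos 2 ℤ.* μ₁) ℤ.+ (pos 2 ℤ.* μ₃ ℤ.+ 1ℤ)) ℤ.+ (pos 2 ℤ.* μ₃ ℤ.+ 1ℤ) ℤ.* (ℤ.- (pos 2 ℤ.* μ₃ ℤ.+ 1ℤ))) ≡ 0ℤ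
                lem₂ = solve-∀
                lem₃ : ∀ (n μ₀ μ₁ μ₂ μ₃ : ℤ) → (pos 2 ℤ.* μ₀) ℤ.* (ℤ.- (pos 2 ℤ.* μ₃ ℤ.+ 1ℤ)) ℤ.+ (pos 2 ℤ.* μ₃ ℤ.+ 1ℤ) ℤ.* (pos 2 ℤ.* μ₀) ℤ.+ pos 2 ℤ.* ((pos 2 ℤ.* μ₁) ℤ.* (ℤ.- (pos 2 ℤ.* μ₂)) ℤ.+ (pos 2 ℤ.* μ₂) ℤ.* ((pos 2 ℤ.* μ₁) ℤ.+ (pos 2 ℤ.* μ₃ ℤ.+ 1ℤ))) ℤ.+ (pos 2 ℤ.* μ₁) ℤ.* (ℤ.- (pos 2 ℤ.* μ₃ ℤ.+ 1ℤ)) ℤ.+ (pos 2 ℤ.* μ₃ ℤ.+ 1ℤ) ℤ.* ((pos 2 ℤ.* μ₁) ℤ.+ (pos 2 ℤ.* μ₃ ℤ.+ 1ℤ)) ℤ.+ (pos 2 ℤ.* μ₂) ℤ.* (ℤ.- (pos 2 ℤ.* μ₃ ℤ.+ 1ℤ)) ℤ.+ (pos 2 ℤ.* μ₃ ℤ.+ 1ℤ) ℤ.* (ℤ.- (pos 2 ℤ.* μ₂)) ℤ.+ (pos 2 ℤ.* μ₃ ℤ.+ 1ℤ) ℤ.* (ℤ.- (pos 2 ℤ.* μ₃ ℤ.+ 1ℤ)) ≡ 0ℤ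
                lem₃ = solve-∀
                Y≡ : 2B * σ² 2B ≡ ⟪ pos 2 ⟫ * ((pos 2 ℤ.* P) ⊹ Q ω)
                Y≡ = trans (trans (cong (λ x → x * σ² x) 2B≡) (trans (cong (V (pos 2 ℤ.* μ₀) (pos 2 ℤ.* μ₁) (pos 2 ℤ.* μ₂) (pos 2 ℤ.* μ₃ ℤ.+ 1ℤ) *_) (σ²V (pos 2 ℤ.* μ₀) (pos 2 ℤ.* μ₁) (pos 2 ℤ.* μ₂) (pos 2 ℤ.* μ₃ ℤ.+ 1ℤ))) (V-mul (pos 2 ℤ.* μ₀) (pos 2 ℤ.* μ₁) (pos 2 ℤ.* μ₂) (pos 2 ℤ.* μ₃ ℤ.+ 1ℤ) (pos 2 ℤ.* μ₀) (pos 2 ℤ.* μ₁ ℤ.+ (pos 2 ℤ.* μ₃ ℤ.+ 1ℤ)) (ℤ.- (pos 2 ℤ.* μ₂)) (ℤ.- (pos 2 ℤ.* μ₃ ℤ.+ 1ℤ)))))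
                  (trans (cong₂ (λ x y → ⟪ x ⟫ + ⟪ y ⟫ * ω + ⟪ mul₂ δ (pos 2 ℤ.* μ₀) (pos 2 ℤ.* μ₁) (pos 2 ℤ.* μ₂) (pos 2 ℤ.* μ₃ ℤ.+ 1ℤ) (pos 2 ℤ.* μ₀) ((pos 2 ℤ.* μ₁) ℤ.+ (pos 2 ℤ.* μ₃ ℤ.+ 1ℤ)) (ℤ.- (pos 2 ℤ.* μ₂)) (ℤ.- (pos 2 ℤ.* μ₃ ℤ.+ 1ℤ)) ⟫ * φ + ⟪ mul₃ δ (pos 2 ℤ.* μ₀) (pos 2 ℤ.* μ₁) (pos 2 ℤ.* μ₂) (pos 2 ℤ.* μ₃ ℤ.+ 1ℤ) (pos 2 ℤ.* μ₀) ((pos 2 ℤ.* μ₁) ℤ.+ (pos 2 ℤ.* μ₃ ℤ.+ 1ℤ)) (ℤ.- (pos 2 ℤ.* μ₂)) (ℤ.- (pos 2 ℤ.* μ₃ ℤ.+ 1ℤ)) ⟫ * χ) (trans (cong (λ (d : ℤ) → mul₀ d (pos 2 ℤ.* μ₀) (pos 2 ℤ.* μ₁) (pos 2 ℤ.* μ₂) (pos 2 ℤ.* μ₃ ℤ.+ 1ℤ) (pos 2 ℤ.* μ₀) ((pos 2 ℤ.* μ₁) ℤ.+ (pos 2 ℤ.* μ₃ ℤ.+ 1ℤ)) (ℤ.- (pos 2 ℤ.* μ₂)) (ℤ.- (pos 2 ℤ.* μ₃ ℤ.+ 1ℤ))) δ≡) (lem₀ n μ₀ μ₁ μ₂ μ₃))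 (trans (cong (λ (d : ℤ) → mul₁ d (pos 2 ℤ.* μ₀) (pos 2 ℤ.* μ₁) (pos 2 ℤ.* μ₂) (pos 2 ℤ.* μ₃ ℤ.+ 1ℤ) (pos 2 ℤ.* μ₀) ((pos 2 ℤ.* μ₁) ℤ.+ (pos 2 ℤ.* μ₃ ℤ.+ 1ℤ)) (ℤ.- (pos 2 ℤ.* μ₂)) (ℤ.- (pos 2 ℤ.* μ₃ ℤ.+ 1ℤ))) δ≡) (lem₁ n μ₀ μ₁ μ₂ μ₃)))
                  (trans (cong₂ (λ x y → ⟪ pos 2 ℤ.* (pos 2 ℤ.* P) ⟫ + ⟪ pos 2 ℤ.* Q ⟫ * ω + ⟪ x ⟫ * φ + ⟪ y ⟫ * χ) (trans (cong (λ (d : ℤ) → mul₂ d (pos 2 ℤ.* μ₀) (pos 2 ℤ.* μ₁) (pos 2 ℤ.* μ₂) (pos 2 ℤ.* μ₃ ℤ.+ 1ℤ) (pos 2 ℤ.* μ₀) ((pos 2 ℤ.* μ₁) ℤ.+ (pos 2 ℤ.* μ₃ ℤ.+ 1ℤ)) (ℤ.- (pos 2 ℤ.* μ₂)) (ℤ.- (pos 2 ℤ.* μ₃ ℤ.+ 1ℤ))) δ≡) (lem₂ n μ₀ μ₁ μ₂ μ₃)) (trans (cong (λ (d : ℤ) → mul₃ d (pos 2 ℤ.* μ₀) (pos 2 ℤ.* μ₁) (pos 2 ℤ.* μ₂) (pos 2 ℤ.* μ₃ ℤ.+ 1ℤ) (pos 2 ℤ.* μ₀) ((pos 2 ℤ.*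 μ₁) ℤ.+ (pos 2 ℤ.* μ₃ ℤ.+ 1ℤ)) (ℤ.- (pos 2 ℤ.* μ₂)) (ℤ.- (pos 2 ℤ.* μ₃ ℤ.+ 1ℤ))) δ≡) (lem₃ n μ₀ μ₁ μ₂ μ₃)))
                  (ring (pos 2 ℤ.* P ∷ Q ∷ []) (ω ∷ φ ∷ χ ∷ []) (λ P Q w f x → let two = con (pos 2) in emb (two :* P) :+ emb (two :* Q) :* w :+ emb (con 0ℤ) :* f :+ emb (con 0ℤ) :* x ⊜ emb two :* (emb P :+ emb Q :* w)) refl)))
                Y′ : Carrier
                Y′ = (pos 2 ℤ.* P) ⊹ Q ω
                Y′σY′ : Y′ * σ Y′ ≡ ⟪ pos 2 ℤ.* (pos 2 ℤ.* (P ℤ.* P) ℤ.+ P ℤ.* Q ℤ.- δ ℤ.* (Q ℤ.* Q)) ⟫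
                Y′σY′ = trans (cong (Y′ *_) (trans (σ-+ _ _) (cong₂ _+_ (σ-⟪⟫ _) (trans (σ-* _ _) (cong₂ _*_ (σ-⟪⟫ Q) σ-ω)))))
                  (lc₁ (- (⟪ Q ⟫ * ⟪ Q ⟫)) ωω₂ (ring (P ∷ Q ∷ δ ∷ []) (ω ∷ []) (λ P Q d w → let two = con (pos 2) in
                    (emb (two :* P) :+ emb Q :* w) :* (emb (two :* P) :+ emb Q :* (:1 :- w)) :+ :- (emb Q :* emb Q) :* (w :+ emb (two :* d)) ⊜ emb (two :* (two :* (P :* P) :+ P :* Q :- d :* (Q :* Q))) :+ :- (emb Q :* emb Q) :* (w :* w)) refl))
                build : (∃ λ w → Integral w × 2B * w ≡ ⟪ pos 2 ⟫) → NormOf2B μ₀ μ₂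
                build (w , I-w , e) = finish (rational {N₀} {pos 4} N₀≢0 (I-* I-W (I-σ I-W)) N₀W)
                  where
                  N₀ : ℤ
                  N₀ = pos 2 ℤ.* (pos 2 ℤ.* (P ℤ.* P) ℤ.+ P ℤ.* Q ℤ.- δ ℤ.* (Q ℤ.* Q))
                  Wʸ : Carrier
                  Wʸ = w * σ² w
                  I-W : Integral Wʸ
                  I-W = I-* I-w (I-σ (I-σ I-w))
                  YW : Y′ * Wʸ ≡ ⟪ pos 2 ⟫
                  YW = cancel {pos 2} (λ ()) (trans (sym (*-assoc _ _ _)) (trans (cong (_* Wʸ) (sym Y≡)) (trans (ring [] (2B ∷ σ² 2B ∷ w ∷ σ² w ∷ []) (λ b b′ w w′ → b :* b′ :* (w :* w′) ⊜ b :* w :* (b′ :* w′)) refl)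
                    (cong₂ _*_ e (trans (sym (σ²-* 2B w)) (trans (cong σ² e) (trans (cong σ (σ-⟪⟫ (pos 2))) (σ-⟪⟫ (pos 2)))))))))
                  N₀W : ⟪ N₀ ⟫ * (Wʸ * σ Wʸ) ≡ ⟪ pos 4 ⟫
                  N₀W = trans (cong (_* (Wʸ * σ Wʸ)) (sym Y′σY′)) (trans (ring [] (Y′ ∷ σ Y′ ∷ Wʸ ∷ σ Wʸ ∷ []) (λ b b′ w w′ → b :* b′ :* (w :* w′) ⊜ b :* w :* (b′ :* w′)) refl)
                    (trans (cong₂ _*_ YW (trans (sym (σ-* Y′ Wʸ)) (trans (cong σ YW) (σ-⟪⟫ (pos 2))))) (sym (⟪⟫-* (pos 2) (pos 2)))))
                  N₀≢0 : N₀ ≢ 0ℤ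
                  N₀≢0 N₀≡0 = 4≢0 (⟪⟫-inj (trans (sym N₀W) (trans (cong (λ N → ⟪ N ⟫ * (Wʸ * σ Wʸ)) N₀≡0) (trans (cong (_* (Wʸ * σ Wʸ)) ⟪0⟫) (trans (zeroˡ _) (sym ⟪0⟫))))))
                    where 4≢0 : pos 4 ≢ 0ℤ
                          4≢0 ()
                  finish : (∃ λ z → Wʸ * σ Wʸ ≡ ⟪ z ⟫ × N₀ ℤ.* z ≡ pos 4) → NormOf2B μ₀ μ₂
                  finish (z , W≡ , q) = record
                    { P = P ; Q = Q ; z = z ; w = w ; I-w = I-w ; 2Bw≡2 = e ; Y≡ = Y≡ ; W≡ = W≡ ; YW = YW
                    ; P-even = λ h → parity-of (μ₀ ∷ μ₂ ∷ X₀ ∷ []) (λ μ₀ μ₂ x → (μ₀ :+ μ₂ ∷ []) , (μ₀ :* μ₀ :+ μ₂ :* μ₂ :+ con (pos 2) :* x)) refl (h ∷ [])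
                    ; norm≡ = halve {N ℤ.* z} {pos 2} (trans (sym (ℤₚ.*-assoc (pos 2) N z)) q) }
                    where
                    X₀ N : ℤ
                    N = pos 2 ℤ.* (P ℤ.* P) ℤ.+ P ℤ.* Q ℤ.- δ ℤ.* (Q ℤ.* Q)
                    X₀ = ((pos 2 ℤ.* n ℤ.+ 1ℤ) ℤ.* (pos 2 ℤ.* (μ₁ ℤ.* μ₁) ℤ.+ μ₁ ℤ.* (pos 2 ℤ.* μ₃ ℤ.+ 1ℤ) ℤ.- pos 2 ℤ.* (μ₂ ℤ.* (pos 2 ℤ.* μ₃ ℤ.+ 1ℤ))))

            module Analysis {μ₀ μ₂ : ℤ} (nf : NormOf2B μ₀ μ₂) where
              open NormOf2B nf public
              private
                Wʸ : Carrier
                Wʸ = w * σ² w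
                N : ℤ
                N = pos 2 ℤ.* (P ℤ.* P) ℤ.+ P ℤ.* Q ℤ.- δ ℤ.* (Q ℤ.* Q)

              -- Nz = 2 leaves N = ±1 or N = ±2; in the second case z = ±1 and Q is even as well.
              data Cases : Set where
                norm-unit   : N ≡ 1ℤ ⊎ N ≡ ℤ.- 1ℤ → Cases
                norm-2×unit : ∀ q N′ → Q ≡ pos 2 ℤ.* q → N ≡ pos 2 ℤ.* N′ → N′ ≡ 1ℤ ⊎ N′ ≡ ℤ.- 1ℤ → Cases

              abstract
                -- If z = ±1, then Y′W = 2 and WσW = z give Y′/2 = zσW. So Y′/2 is an integer of F,
                -- and its ω-coordinate is Q/2.
                Q-even : z ℤ.* z ≡ 1ℤ → Even Q
                Q-even zz = build (integerOfF DF-½Y (subst Integral (sym ½Y≡) (I-* (I-ι z) (I-σ (I-* I-w (I-σ (I-σ I-w)))))))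
                  where
                  Y′ ½Y : Carrier
                  Y′ = (pos 2 ℤ.* P) ⊹ Q ω
                  ½Y = ½ * Y′
                  DF-½Y : DF ½Y
                  DF-½Y = IsSubring.P-* DF-isSubring (adjoin-base Dyadic-isSubring D-½) DF-+ω
                  2½Y : ⟪ pos 2 ⟫ * ½Y ≡ Y′
                  2½Y = trans (sym (*-assoc _ _ _)) (trans (cong (_* Y′) 2½) (*-identityˡ Y′))
                  ½Y≡ : ½Y ≡ ⟪ z ⟫ * σ Wʸ
                  ½Y≡ = cancel {pos 2} (λ ()) (begin
                    ⟪ pos 2 ⟫ * ½Y                   ≡⟨ 2½Y ⟩
                    Y′                               ≡⟨ sym (*-identityˡ Y′) ⟩
                    1# * Y′                          ≡⟨ cong (_* Y′) (sym (trans (sym (⟪⟫-* z z)) (trans (cong ⟪_⟫ zz) ⟪1⟫))) ⟩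
                    ⟪ z ⟫ * ⟪ z ⟫ * Y′               ≡⟨ cong (λ x → ⟪ z ⟫ * x * Y′) (sym W≡) ⟩
                    ⟪ z ⟫ * (Wʸ * σ Wʸ) * Y′           ≡⟨ ring (z ∷ []) (Wʸ ∷ σ Wʸ ∷ Y′ ∷ []) (λ z w w′ y → emb z :* (w :* w′) :* y ⊜ y :* w :* (emb z :* w′)) refl ⟩
                    Y′ * Wʸ * (⟪ z ⟫ * σ Wʸ)           ≡⟨ cong (_* (⟪ z ⟫ * σ Wʸ)) YW ⟩
                    ⟪ pos 2 ⟫ * (⟪ z ⟫ * σ Wʸ)        ∎)
                  build : IntegerOfF ½Y → Even Q
                  build (intF p q e) = q , proj₂ (independentF {pos 2 ℤ.* P} {Q} {pos 2 ℤ.* p} {pos 2 ℤ.* q} (trans (sym 2½Y) (trans (cong (⟪ pos 2 ⟫ *_) e)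
                    (ring (p ∷ q ∷ []) (ω ∷ []) (λ p q w → let two = con (pos 2) in emb two :* (emb p :+ emb q :* w) ⊜ emb (two :* p) :+ emb (two :* q) :* w) refl))))

                cases : Cases
                cases = split (parity z)
                  where
                  square : z ≡ 1ℤ ⊎ z ≡ ℤ.- 1ℤ → z ℤ.* z ≡ 1ℤ
                  square (inj₁ e) = cong (λ z → z ℤ.* z) e
                  square (inj₂ e) = cong (λ z → z ℤ.* z) e
                  split : Even z ⊎ Odd z → Cases
                  split (inj₁ (z′ , e)) = norm-unit (unit⇒±1 {N} {z′} (halve {N ℤ.* z′} {1ℤ} (trans (lem N z′) (trans (cong (N ℤ.*_) (sym e)) norm≡))))
                    where lem : ∀ N z → pos 2 ℤ.* (N ℤ.* z) ≡ N ℤ.* (pos 2 ℤ.* z)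
                          lem = solve-∀
                  split (inj₂ o) = halves (parity N)
                    where
                    halves : Even N ⊎ Odd N → Cases
                    halves (inj₂ o′) = ⊥-elim (even-odd (1ℤ , norm≡) (odd-* o′ o))
                    halves (inj₁ (N′ , N≡)) = result (Q-even (square (unit⇒±1 {z} {N′} (trans (ℤₚ.*-comm z N′) N′z))))
                      where
                      N′z : N′ ℤ.* z ≡ 1ℤ
                      N′z = halve {N′ ℤ.* z} {1ℤ} (trans (sym (ℤₚ.*-assoc (pos 2) N′ z)) (trans (cong (ℤ._* z) (sym N≡)) norm≡))
                      result : Even Q → Cases
                      result (q , Q≡) = norm-2×unit q N′ Q≡ N≡ (unit⇒±1 {N′} {z} N′z)

                -- An even sum makes P even. Then N is even, against N = ±1; or, with Q even too, N
                -- is divisible by 4, against N = ±2.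
                sum-odd : ¬ Even (μ₀ ℤ.+ μ₂)
                sum-odd h = contradiction cases
                  where
                  δ-e : Even δ
                  δ-e = δ-even
                  odd-unit : ∀ {m} → m ≡ 1ℤ ⊎ m ≡ ℤ.- 1ℤ → Odd m
                  odd-unit (inj₁ refl) = 0ℤ , refl
                  odd-unit (inj₂ refl) = ℤ.- 1ℤ , refl
                  contradiction : Cases → ⊥
                  contradiction (norm-unit e) = even-odd (parity-of (P ∷ Q ∷ δ ∷ []) (λ P Q d → (P ∷ d ∷ []) , (con (pos 2) :* (P :* P) :+ P :* Q :- d :* (Q :* Q))) refl (P-even h ∷ δ-e ∷ [])) (odd-unit e)
                  contradiction (norm-2×unit q N′ Q≡ N≡ e) = quarter-norm (P-even h)
                    where
                    quarter-norm : Even P → ⊥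
                    quarter-norm (p₁ , P≡) = even-odd (r , halve {N′} {pos 2 ℤ.* r} (trans (sym N≡) (trans (cong₂ (λ P Q → pos 2 ℤ.* (P ℤ.* P) ℤ.+ P ℤ.* Q ℤ.- δ ℤ.* (Q ℤ.* Q)) P≡ Q≡) (lem p₁ q δ)))) (odd-unit e)
                      where
                      r : ℤ
                      r = pos 2 ℤ.* (p₁ ℤ.* p₁) ℤ.+ p₁ ℤ.* q ℤ.- δ ℤ.* (q ℤ.* q)
                      lem : ∀ p q d → pos 2 ℤ.* (pos 2 ℤ.* p ℤ.* (pos 2 ℤ.* p)) ℤ.+ pos 2 ℤ.* p ℤ.* (pos 2 ℤ.* q) ℤ.- d ℤ.* (pos 2 ℤ.* q ℤ.* (pos 2 ℤ.* q)) ≡ pos 2 ℤ.* (pos 2 ℤ.* (pos 2 ℤ.* (p ℤ.* p) ℤ.+ p ℤ.* q ℤ.- d ℤ.* (q ℤ.* q)))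
                      lem = solve-∀

            abstract
              l₂-is-odd : ∀ {μ₀ μ₂} (C : Coordinates) → NormOf2B μ₀ μ₂ → Coordinates.j₀ C ≡ pos 2 ℤ.* μ₀ → Coordinates.j₂ C ≡ pos 2 ℤ.* μ₂ → Odd (Coordinates.l₂ C)
              l₂-is-odd {μ₀} {μ₂} C nf j₀≡ j₂≡ = ¬even⇒odd (λ e → Analysis.sum-odd nf
                  (l₂-parity n {k₀} {k₁} {k₂} {k₃} {j₀} {j₁} {j₂} {j₃} {l₀} {l₁} {l₂} {l₃} parities {μ₀} {μ₂} j₀≡ j₂≡ (subst (λ d → ChiEquations d k₀ k₁ k₂ k₃ j₀ j₁ j₂ j₃ l₀ l₁ l₂ l₃) δ≡ equations) e))
                where open Coordinates C

              -- For a < 0 the form P² + |a| Q² is definite and leaves only Y′ = ±2.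
              negative : ∀ k → a ≡ ℤ.- pos (15 ℕ.+ k) → ∀ {μ₀ μ₁ μ₂ μ₃} → 2B ≡ V (pos 2 ℤ.* μ₀) (pos 2 ℤ.* μ₁) (pos 2 ℤ.* μ₂) (pos 2 ℤ.* μ₃ ℤ.+ 1ℤ) → NormOf2B μ₀ μ₂ → ⊥
              negative k a≡- {μ₀} {μ₁} {μ₂} {μ₃} 2B≡ nf = contradiction cases
                where
                open Analysis nf
                N : ℤ
                N = pos 2 ℤ.* (P ℤ.* P) ℤ.+ P ℤ.* Q ℤ.- δ ℤ.* (Q ℤ.* Q)
                form : ∀ x y → x ℤ.* x ℤ.- (pos 4 ℤ.* (pos 2 ℤ.* δ) ℤ.+ 1ℤ) ℤ.* (y ℤ.* y) ≡ x ℤ.* x ℤ.+ pos (15 ℕ.+ k) ℤ.* (y ℤ.* y)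
                form x y = trans (cong (λ a → x ℤ.* x ℤ.- a ℤ.* (y ℤ.* y)) (trans (sym a≡₂) a≡-)) (lem (pos (15 ℕ.+ k)) x y)
                  where lem : ∀ b x y → x ℤ.* x ℤ.- ℤ.- b ℤ.* (y ℤ.* y) ≡ x ℤ.* x ℤ.+ b ℤ.* (y ℤ.* y)
                        lem = solve-∀
                vanish : ∀ x y {m z} → m ℕ.< 15 → x ℤ.* x ℤ.- (pos 4 ℤ.* (pos 2 ℤ.* δ) ℤ.+ 1ℤ) ℤ.* (y ℤ.* y) ≡ pos m ℤ.* z → z ≡ 1ℤ ⊎ z ≡ ℤ.- 1ℤ → y ≡ 0ℤ
                vanish x y {m} {z} m<15 e u = definite-form (15 ℕ.+ k) x y (ℕₚ.≤-trans (ℕ.s≤s (ℕₚ.≤-reflexive (trans (cong ℤ.∣_∣ (trans (sym (form x y)) e)) (trans (ℤₚ.abs-* (pos m) z) (trans (cong (m ℕ.*_) (abs u)) (ℕₚ.*-identityʳ m)))))) (ℕₚ.≤-trans m<15 (ℕₚ.m≤m+n 15 k)))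
                  where
                  abs : z ≡ 1ℤ ⊎ z ≡ ℤ.- 1ℤ → ℤ.∣ z ∣ ≡ 1
                  abs (inj₁ e) = cong ℤ.∣_∣ e
                  abs (inj₂ e) = cong ℤ.∣_∣ e
                odd-unit : ∀ {m} → m ≡ 1ℤ ⊎ m ≡ ℤ.- 1ℤ → Odd m
                odd-unit (inj₁ refl) = 0ℤ , refl
                odd-unit (inj₂ refl) = ℤ.- 1ℤ , refl
                contradiction : Cases → ⊥
                contradiction (norm-unit e) = even-odd (P ℤ.* P , trans (cong (λ Q → pos 2 ℤ.* (P ℤ.* P) ℤ.+ P ℤ.* Q ℤ.- δ ℤ.* (Q ℤ.* Q)) Q≡0) (lem₂ P δ)) (odd-unit e)
                  where
                  lem : ∀ P Q d → (pos 4 ℤ.* P ℤ.+ Q) ℤ.* (pos 4 ℤ.* P ℤ.+ Q) ℤ.- (pos 4 ℤ.* (pos 2 ℤ.* d) ℤ.+ 1ℤ) ℤ.* (Q ℤ.* Q) ≡ pos 8 ℤ.* (pos 2 ℤ.* (P ℤ.* P) ℤ.+ P ℤ.* Q ℤ.- d ℤ.* (Q ℤ.* Q))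
                  lem = solve-∀
                  lem₂ : ∀ P d → pos 2 ℤ.* (P ℤ.* P) ℤ.+ P ℤ.* 0ℤ ℤ.- d ℤ.* (0ℤ ℤ.* 0ℤ) ≡ pos 2 ℤ.* (P ℤ.* P)
                  lem₂ = solve-∀
                  Q≡0 : Q ≡ 0ℤ
                  -- Completing the square gives (4P + Q)² - aQ² = 8N, whose absolute value 8 is
                  -- below 15 ≤ -a. With Q = 0 the value N = 2P² would be even.
                  Q≡0 = vanish (pos 4 ℤ.* P ℤ.+ Q) Q {8} {N} (ℕₚ.m≤m+n 9 6) (lem P Q δ) e
                contradiction (norm-2×unit q N′ Q≡ N≡ e) = j₃-contradiction (chiForm-of DL-B I-B)
                  where
                  lem : ∀ P q d → pos 2 ℤ.* ((pos 2 ℤ.* P ℤ.+ q) ℤ.* (pos 2 ℤ.* P ℤ.+ q) ℤ.- (pos 4 ℤ.* (pos 2 ℤ.* d) ℤ.+ 1ℤ) ℤ.* (q ℤ.* q)) ≡ pos 4 ℤ.* (pos 2 ℤ.* (P ℤ.* P) ℤ.+ P ℤ.* (pos 2 ℤ.* q) ℤ.- d ℤ.* (pos 2 ℤ.* q ℤ.* (pos 2 ℤ.* q)))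
                  lem = solve-∀
                  lem₂ : ∀ N → pos 4 ℤ.* (pos 2 ℤ.* N) ≡ pos 2 ℤ.* (pos 4 ℤ.* N)
                  lem₂ = solve-∀
                  lem₃ : ∀ P d → pos 2 ℤ.* (P ℤ.* P) ℤ.+ P ℤ.* (pos 2 ℤ.* 0ℤ) ℤ.- d ℤ.* (pos 2 ℤ.* 0ℤ ℤ.* (pos 2 ℤ.* 0ℤ)) ≡ pos 2 ℤ.* (P ℤ.* P)
                  lem₃ = solve-∀
                  Nq : pos 2 ℤ.* (P ℤ.* P) ℤ.+ P ℤ.* (pos 2 ℤ.* q) ℤ.- δ ℤ.* (pos 2 ℤ.* q ℤ.* (pos 2 ℤ.* q)) ≡ pos 2 ℤ.* N′
                  Nq = trans (cong (λ Q → pos 2 ℤ.* (P ℤ.* P) ℤ.+ P ℤ.* Q ℤ.- δ ℤ.* (Q ℤ.* Q)) (sym Q≡)) N≡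
                  q≡0 : q ≡ 0ℤ
                  -- For Q = 2q the form becomes (2P + q)² - aq² = 4N′, of absolute value 4.
                  q≡0 = vanish (pos 2 ℤ.* P ℤ.+ q) q {4} {N′} (ℕₚ.m≤m+n 5 10) (halve {y = pos 4 ℤ.* N′} (trans (lem P q δ) (trans (cong (pos 4 ℤ.*_) Nq) (lem₂ N′)))) e
                  PP≡N′ : P ℤ.* P ≡ N′
                  PP≡N′ = halve {P ℤ.* P} {N′} (trans (sym (lem₃ P δ)) (trans (cong (λ q → pos 2 ℤ.* (P ℤ.* P) ℤ.+ P ℤ.* (pos 2 ℤ.* q) ℤ.- δ ℤ.* (pos 2 ℤ.* q ℤ.* (pos 2 ℤ.* q))) (sym q≡0)) Nq))
                  Y≡′ : 2B * σ² 2B ≡ ⟪ pos 4 ⟫ * ⟪ P ⟫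
                  Y≡′ = trans Y≡ (trans (cong (λ Q → ⟪ pos 2 ⟫ * ((pos 2 ℤ.* P) ⊹ Q ω)) (trans Q≡ (cong (pos 2 ℤ.*_) q≡0))) (ring (P ∷ []) (ω ∷ []) (λ P w → let two = con (pos 2) in emb two :* (emb (two :* P) :+ emb (con 0ℤ) :* w) ⊜ lit 4 :* emb P) refl))
                  I-B : Integral B
                  -- 2B·σ²(2B) = 4P and σ²(2B)·σ²(w) = 2 give B = Pσ²(w). So B is integral, and all
                  -- coordinates of 2B would be even although j₃ is odd.
                  I-B = subst Integral (sym (cancel {pos 4} (λ ()) (begin
                    ⟪ pos 4 ⟫ * B                     ≡⟨ ring [] (B ∷ []) (λ b → let two = lit 2 in lit 4 :* b ⊜ two :* b :* two) refl ⟩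
                    2B * ⟪ pos 2 ⟫                    ≡⟨ cong (2B *_) (trans (sym (trans (cong σ (σ-⟪⟫ (pos 2))) (σ-⟪⟫ (pos 2)))) (trans (cong σ² (sym 2Bw≡2)) (σ²-* 2B w))) ⟩
                    2B * (σ² 2B * σ² w)               ≡⟨ trans (sym (*-assoc _ _ _)) (cong (_* σ² w) Y≡′) ⟩
                    ⟪ pos 4 ⟫ * ⟪ P ⟫ * σ² w          ≡⟨ *-assoc _ _ _ ⟩
                    ⟪ pos 4 ⟫ * (⟪ P ⟫ * σ² w)        ∎))) (I-* (I-ι P) (I-σ (I-σ I-w)))
                  j₃-contradiction : ChiForm B → ⊥
                  j₃-contradiction (chiForm m₀ m₁ m₂ m₃ B≡) = even-odd (m₃ , proj₂ (proj₂ (V-inj {pos 2 ℤ.* μ₀} {pos 2 ℤ.* μ₁} {pos 2 ℤ.* μ₂} {pos 2 ℤ.* μ₃ ℤ.+ 1ℤ} {pos 2 ℤ.* m₀} {pos 2 ℤ.* m₁} {pos 2 ℤ.* m₂} {pos 2 ℤ.* m₃}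
                    (trans (sym 2B≡) (trans (cong (⟪ pos 2 ⟫ *_) B≡) (ring (m₀ ∷ m₁ ∷ m₂ ∷ m₃ ∷ []) (ω ∷ φ ∷ χ ∷ []) (λ k₀ k₁ k₂ k₃ w f x → let two = con (pos 2) in
                      emb two :* (emb k₀ :+ emb k₁ :* w :+ emb k₂ :* f :+ emb k₃ :* x) ⊜ emb (two :* k₀) :+ emb (two :* k₁) :* w :+ emb (two :* k₂) :* f :+ emb (two :* k₃) :* x) refl)))))) (μ₃ , refl)

              -- For a > 0 the unit ε is ±1, while r₀ σ²r₀ = a ε is congruent to i modulo 2.
              positive : ∀ k → a ≡ pos (2 ℕ.+ k) → (C : Coordinates) → Odd (Coordinates.l₂ C) → ⊥
              positive k a≡+ C l₂-odd = build unit-coordinates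
                where
                open Coordinates C
                s≋ : s ≋ χ
                s≋ = build′ (proj₁ parities)
                  where
                  build′ : Even k₀ × Even k₁ × Even k₂ × Odd k₃ → s ≋ χ
                  build′ ((m₀ , e₀) , (m₁ , e₁) , (m₂ , e₂) , (m₃ , e₃)) = V m₀ m₁ m₂ m₃ , I-V {m₀} {m₁} {m₂} {m₃} , trans s≡ (trans (cong₂ _+_ (cong₂ _+_ (cong₂ _+_ (cong ⟪_⟫ e₀) (cong (λ k → ⟪ k ⟫ * ω) e₁)) (cong (λ k → ⟪ k ⟫ * φ) e₂)) (cong (λ k → ⟪ k ⟫ * χ) e₃))
                    (ring (m₀ ∷ m₁ ∷ m₂ ∷ m₃ ∷ []) (ω ∷ φ ∷ χ ∷ []) (λ m₀ m₁ m₂ m₃ w f x → let two = con (pos 2) in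
                      emb (two :* m₀) :+ emb (two :* m₁) :* w :+ emb (two :* m₂) :* f :+ emb (two :* m₃ :+ con 1ℤ) :* x ⊜ x :+ emb two :* (emb m₀ :+ emb m₁ :* w :+ emb m₂ :* f :+ emb m₃ :* x)) refl))
                l₃-parity : Even (l₃ ℤ.- (l₀ ℤ.+ 1ℤ))
                l₃-parity = parity-of (l₀ ∷ l₁ ∷ l₂ ∷ l₃ ∷ []) (λ l₀ l₁ l₂ l₃ → (l₁ :- con 1ℤ ∷ l₂ :- con 1ℤ ∷ l₀ :+ l₁ :+ l₂ :+ l₃ :- con 1ℤ ∷ []) , (l₃ :- (l₀ :+ con 1ℤ))) refl (odd-pred l₁-odd ∷ odd-pred l₂-odd ∷ odd-pred trace-odd ∷ [])
                p≋ : p ≋ ⟪ l₀ ⟫ + ω + φ + ⟪ l₀ ℤ.+ 1ℤ ⟫ * χ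
                p≋ = build′ l₁-odd l₂-odd (even-difference l₃ (l₀ ℤ.+ 1ℤ) l₃-parity)
                  where
                  build′ : Odd l₁ → Odd l₂ → (∃ λ v → l₃ ≡ l₀ ℤ.+ 1ℤ ℤ.+ pos 2 ℤ.* v) → p ≋ ⟪ l₀ ⟫ + ω + φ + ⟪ l₀ ℤ.+ 1ℤ ⟫ * χ
                  build′ (m₁ , e₁) (m₂ , e₂) (m₃ , e₃) = V 0ℤ m₁ m₂ m₃ , I-V {0ℤ} {m₁} {m₂} {m₃} , trans p≡V (trans (cong₂ _+_ (cong₂ _+_ (cong (⟪ l₀ ⟫ +_) (cong (λ k → ⟪ k ⟫ * ω) e₁)) (cong (λ k → ⟪ k ⟫ * φ) e₂)) (cong (λ k → ⟪ k ⟫ * χ) e₃))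
                    (ring (l₀ ∷ m₁ ∷ m₂ ∷ m₃ ∷ []) (ω ∷ φ ∷ χ ∷ []) (λ l₀ m₁ m₂ m₃ w f x → let two = con (pos 2) ; one = con 1ℤ in
                      emb l₀ :+ emb (two :* m₁ :+ one) :* w :+ emb (two :* m₂ :+ one) :* f :+ emb (l₀ :+ one :+ two :* m₃) :* x ⊜ emb l₀ :+ w :+ f :+ emb (l₀ :+ one) :* x :+ emb two :* (emb (con 0ℤ) :+ emb m₁ :* w :+ emb m₂ :* f :+ emb m₃ :* x)) refl))
                build : UnitCoordinates → ⊥
                build (coordinates x y X≡ Y≡′ norm) = odd≢i (odd-* a-odd (odd-unit (unit-norm {a} {x} y≡0 norm))) (subst (_≋ i) ax (r₀σ²r₀≋i l₀ s≋ p≋))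
                  where
                  odd-unit : x ≡ 1ℤ ⊎ x ≡ ℤ.- 1ℤ → Odd x
                  odd-unit (inj₁ e) = 0ℤ , e
                  odd-unit (inj₂ e) = ℤ.- 1ℤ , e
                  y≡0 : y ≡ 0ℤ
                  y≡0 = norm-forces-zero k x y (subst (λ a → (x ℤ.* x ℤ.+ a ℤ.* (y ℤ.* y) ≡ 1ℤ) ⊎ (x ℤ.* x ℤ.+ a ℤ.* (y ℤ.* y) ≡ ℤ.- 1ℤ)) a≡+ norm)
                  ax : r₀ * σ² r₀ ≡ ⟪ a ℤ.* x ⟫
                  ax = trans r₀σ²r₀ (trans (cong (⟪ a ⟫ *_) (trans (cong₂ (λ p q → p + q * ι√) X≡ (trans Y≡′ (trans (cong ⟪_⟫ y≡0) ⟪0⟫))) (ring [] (⟪ x ⟫ ∷ ι√ ∷ []) (λ x y → x :+ :0 :* y ⊜ x) refl))) (sym (⟪⟫-* a x)))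

              impossible : ⊥
              impossible = build the-coordinates
                where
                build : Coordinates → ⊥
                build C = go (proj₂ (Coordinates.parities C))
                  where
                  open Coordinates C
                  go : Even j₀ × Even j₁ × Even j₂ × Odd j₃ → ⊥
                  go ((μ₀ , e₀) , (μ₁ , e₁) , (μ₂ , e₂) , (μ₃ , e₃)) = sign n refl
                    where
                    2B≡′ : 2B ≡ V (pos 2 ℤ.* μ₀) (pos 2 ℤ.* μ₁) (pos 2 ℤ.* μ₂) (pos 2 ℤ.* μ₃ ℤ.+ 1ℤ)
                    2B≡′ = trans 2B≡ (cong₂ _+_ (cong₂ _+_ (cong₂ _+_ (cong ⟪_⟫ e₀) (cong (λ k → ⟪ k ⟫ * ω) e₁)) (cong (λ k → ⟪ k ⟫ * φ) e₂)) (cong (λ k → ⟪ k ⟫ * χ) e₃))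
                    nf : NormOf2B μ₀ μ₂
                    nf = norm-of-2B μ₀ μ₁ μ₂ μ₃ 2B≡′
                    a-form : a ≡ pos 4 ℤ.* (pos 2 ℤ.* (pos 4 ℤ.* n ℤ.+ pos 2)) ℤ.+ 1ℤ
                    a-form = trans a≡₂ (cong (λ δ → pos 4 ℤ.* (pos 2 ℤ.* δ) ℤ.+ 1ℤ) δ≡)
                    lem₊ : ∀ m → pos 4 ℤ.* (pos 2 ℤ.* (pos 4 ℤ.* m ℤ.+ pos 2)) ℤ.+ 1ℤ ≡ pos 17 ℤ.+ pos 32 ℤ.* m
                    lem₊ = solve-∀
                    lem₋ : ∀ m → pos 4 ℤ.* (pos 2 ℤ.* (pos 4 ℤ.* (ℤ.- (1ℤ ℤ.+ m)) ℤ.+ pos 2)) ℤ.+ 1ℤ ≡ ℤ.- (pos 15 ℤ.+ pos 32 ℤ.* m)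
                    lem₋ = solve-∀
                    sign : ∀ m → n ≡ m → ⊥
                    sign (pos k) n≡ = positive (15 ℕ.+ 32 ℕ.* k) (trans a-form (trans (cong (λ n → pos 4 ℤ.* (pos 2 ℤ.* (pos 4 ℤ.* n ℤ.+ pos 2)) ℤ.+ 1ℤ) n≡) (trans (lem₊ (pos k)) (cong (λ m → pos 17 ℤ.+ m) (sym (ℤₚ.pos-* 32 k))))))
                      C (l₂-is-odd {μ₀} {μ₂} C nf e₀ e₂)
                    sign -[1+ k ] n≡ = negative (32 ℕ.* k) (trans a-form (trans (cong (λ n → pos 4 ℤ.* (pos 2 ℤ.* (pos 4 ℤ.* n ℤ.+ pos 2)) ℤ.+ 1ℤ) n≡) (trans (lem₋ (pos k)) (cong (λ m → ℤ.- (pos 15 ℤ.+ m)) (sym (ℤₚ.pos-* 32 k))))))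
                      {μ₀} {μ₁} {μ₂} {μ₃} 2B≡′ nf

    -- From a generator of ℤ_K to its coordinates and polynomials.

    module _ (θᴷ : K) (eθ : e θᴷ ≡ θ) (β : K) (R : RingOfIntegersIs m β) where

      abstract
        -- An element of K with an explicit monic equation belongs to ℤ_K, hence is an integer
        -- polynomial in β. This supplies the polynomials for ω, θ and χ.
        generates : ∀ {ν} v → e v ≡ ν → ∀ cs → ν ^ length cs + eval cs ν ≡ 0# → ∃ λ P → eval P (e β) ≡ ν
        generates {ν} v ev cs rel = build (proj₁ R v (integral⇐ {v} cs (subst (λ x → x ^ length cs + eval cs x ≡ 0#) (sym ev) rel)))
          where
          build : InZ[ m ] β v → ∃ λ P → eval P (e β) ≡ ν
          build (P , eq) = P , trans (sym (e-eval P β)) (trans (cong e eq) ev)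

        I-eβ : Integral (e β)
        I-eβ = integral⇒ {β} (proj₂ R β (0ℤ ∷ 1ℤ ∷ [] , e-inj (trans (e-eval (0ℤ ∷ 1ℤ ∷ []) β) (ring [] (e β ∷ []) (λ t → emb (con 0ℤ) :+ t :* (emb (con 1ℤ) :+ t :* :0) ⊜ t) refl))))

        half : ∃ λ r → q r ≡ ½
        half = build (inverse {pos 2} (λ ()))
          where
          build : (∃ λ r → q r * ⟪ pos 2 ⟫ ≡ 1#) → ∃ λ r → q r ≡ ½
          build (r , inv) = r , cancel {pos 2} (λ ()) (trans (*-comm ⟪ pos 2 ⟫ (q r)) (trans inv (sym 2½)))

        ωᴷ : Σ K λ v → e v ≡ ω
        ωᴷ = build half
          where
          build : (∃ λ r → q r ≡ ½) → Σ K λ v → e v ≡ ω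
          build (r , r≡) = scale r (𝟙 ⊕ powK m θᴷ 4) , cancel {pos 2} (λ ()) (begin
            ⟪ pos 2 ⟫ * e (scale r (𝟙 ⊕ powK m θᴷ 4))   ≡⟨ cong (⟪ pos 2 ⟫ *_) (trans (e-scale r (𝟙 ⊕ powK m θᴷ 4)) (cong₂ _*_ r≡ (trans (e-⊕ 𝟙 (powK m θᴷ 4)) (cong₂ _+_ e-𝟙 (trans (e-^ θᴷ 4) (cong (_^ 4) eθ)))))) ⟩
            ⟪ pos 2 ⟫ * (½ * (1# + θ ^ 4))              ≡⟨ trans (sym (*-assoc _ _ _)) (trans (cong (_* (1# + θ ^ 4)) 2½) (*-identityˡ _)) ⟩
            1# + θ ^ 4                                  ≡⟨ cong (1# +_) (trans (ring [] (θ ∷ []) (λ t → t :^ 4 ⊜ t :* t :* (t :* t)) refl) (trans (cong (λ f → f * f) (sym φ-def)) (sym ρ-def))) ⟩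
            1# + ρ                                      ≡⟨ sym 2ω ⟩
            ⟪ pos 2 ⟫ * ω                               ∎)

        generator-from : (∃ λ gs → length gs ≡ 8 × ⟪ pos 8 ⟫ * e β ≡ eval gs θ) → (∃ λ P → eval P (e β) ≡ ω) → (∃ λ P → eval P (e β) ≡ θ) → Σ Generator λ gen → Generator.t gen ≡ e β
        generator-from (g₀ ∷ g₁ ∷ g₂ ∷ g₃ ∷ g₄ ∷ g₅ ∷ g₆ ∷ g₇ ∷ [] , refl , 8t) (Pω , Pω≡) (Pθ , Pθ≡) = record
          -- Since θ⁴ = ρ, the coefficients of θʲ and θ^(j+4) are uⱼ and vⱼ; the factor ½³ undoes
          -- the multiplication by 8.
          { t = e β ; u₀ = c₈ g₀ ; v₀ = c₈ g₄ ; u₁ = c₈ g₁ ; v₁ = c₈ g₅ ; u₂ = c₈ g₂ ; v₂ = c₈ g₆ ; u₃ = c₈ g₃ ; v₃ = c₈ g₇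
          ; Du₀ = D₈ g₀ ; Dv₀ = D₈ g₄ ; Du₁ = D₈ g₁ ; Dv₁ = D₈ g₅ ; Du₂ = D₈ g₂ ; Dv₂ = D₈ g₆ ; Du₃ = D₈ g₃ ; Dv₃ = D₈ g₇
          ; t≡ = cancel {pos 8} (λ ()) (trans 8t (sym (begin
              ⟪ pos 8 ⟫ * (((c₈ g₀ + c₈ g₄ * ρ) + (c₈ g₂ + c₈ g₆ * ρ) * φ) + ((c₈ g₁ + c₈ g₅ * ρ) + (c₈ g₃ + c₈ g₇ * ρ) * φ) * θ)
                ≡⟨ ring (g₀ ∷ g₁ ∷ g₂ ∷ g₃ ∷ g₄ ∷ g₅ ∷ g₆ ∷ g₇ ∷ []) (½ ∷ ρ ∷ φ ∷ θ ∷ []) (λ g₀ g₁ g₂ g₃ g₄ g₅ g₆ g₇ h r f t → let two = lit 2 ; k = λ (g : Expr 8 4) → h :* h :* h :* g in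
                   lit 8 :* (((k (emb g₀) :+ k (emb g₄) :* r) :+ (k (emb g₂) :+ k (emb g₆) :* r) :* f) :+ ((k (emb g₁) :+ k (emb g₅) :* r) :+ (k (emb g₃) :+ k (emb g₇) :* r) :* f) :* t) ⊜
                   (two :* h) :* (two :* h) :* (two :* h) :* (((emb g₀ :+ emb g₄ :* r) :+ (emb g₂ :+ emb g₆ :* r) :* f) :+ ((emb g₁ :+ emb g₅ :* r) :+ (emb g₃ :+ emb g₇ :* r) :* f) :* t)) refl ⟩
              (⟪ pos 2 ⟫ * ½) * (⟪ pos 2 ⟫ * ½) * (⟪ pos 2 ⟫ * ½) * sum ρ φ
                ≡⟨ cong₂ (λ x y → x * x * x * y) 2½ (cong₂ sum (trans ρ-def (cong (λ f → f * f) φ-def)) φ-def) ⟩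
              1# * 1# * 1# * sum (θ * θ * (θ * θ)) (θ * θ)
                ≡⟨ ring (g₀ ∷ g₁ ∷ g₂ ∷ g₃ ∷ g₄ ∷ g₅ ∷ g₆ ∷ g₇ ∷ []) (θ ∷ []) (λ g₀ g₁ g₂ g₃ g₄ g₅ g₆ g₇ t → let f = t :* t ; r = f :* f in
                   :1 :* :1 :* :1 :* (((emb g₀ :+ emb g₄ :* r) :+ (emb g₂ :+ emb g₆ :* r) :* f) :+ ((emb g₁ :+ emb g₅ :* r) :+ (emb g₃ :+ emb g₇ :* r) :* f) :* t) ⊜
                   emb g₀ :+ t :* (emb g₁ :+ t :* (emb g₂ :+ t :* (emb g₃ :+ t :* (emb g₄ :+ t :* (emb g₅ :+ t :* (emb g₆ :+ t :* (emb g₇ :+ t :* :0)))))))) refl ⟩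
              eval (g₀ ∷ g₁ ∷ g₂ ∷ g₃ ∷ g₄ ∷ g₅ ∷ g₆ ∷ g₇ ∷ []) θ ∎)))
          ; I-t = I-eβ ; Pω = Pω ; Pθ = Pθ ; Pω≡ = Pω≡ ; Pθ≡ = Pθ≡ } , refl
          where
          c₈ : ℤ → Carrier
          c₈ g = ½ * ½ * ½ * ⟪ g ⟫
          D₈ : ∀ g → Dyadic (c₈ g)
          D₈ g = D.P-* (D.P-* (D.P-* D-½ D-½) D-½) (D.P-⟪⟫ g)
            where module D = IsSubring Dyadic-isSubring
          sum : Carrier → Carrier → Carrier
          sum r f = ((⟪ g₀ ⟫ + ⟪ g₄ ⟫ * r) + (⟪ g₂ ⟫ + ⟪ g₆ ⟫ * r) * f) + ((⟪ g₁ ⟫ + ⟪ g₅ ⟫ * r) + (⟪ g₃ ⟫ + ⟪ g₇ ⟫ * r) * f) * θ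

        generator : Σ Generator λ gen → Generator.t gen ≡ e β
        generator = generator-from (clear-8 (InK-e β) I-eβ)
          (build ωᴷ)
          (generates θᴷ eθ (ℤ.- a ∷ 0ℤ ∷ 0ℤ ∷ 0ℤ ∷ 0ℤ ∷ 0ℤ ∷ 0ℤ ∷ 0ℤ ∷ []) (lc₁ 1# θ⁸ (ring (a ∷ []) (θ ∷ []) (λ a t → let z = emb (con 0ℤ) in
            t :^ 8 :+ (emb (:- a) :+ t :* (z :+ t :* (z :+ t :* (z :+ t :* (z :+ t :* (z :+ t :* (z :+ t :* (z :+ t :* :0)))))))) :+ :1 :* emb a ⊜ :0 :+ :1 :* t :^ 8) refl)))
          where
          build : (Σ K λ v → e v ≡ ω) → ∃ λ P → eval P (e β) ≡ ω
          build (v , ev) = generates v ev (ℤ.- c ∷ ℤ.- 1ℤ ∷ []) (lc₁ 1# ωω (ring (c ∷ []) (ω ∷ []) (λ c w → w :^ 2 :+ (emb (:- c) :+ w :* (emb (con (ℤ.- 1ℤ)) :+ w :* :0)) :+ :1 :* (w :+ emb c) ⊜ :0 :+ :1 :* (w :* w)) refl))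

    abstract
      even-case : ∀ δ (c≡ : c ≡ pos 2 ℤ.* δ) θᴷ → e θᴷ ≡ θ → ∀ β → RingOfIntegersIs m β → ⊥
      even-case δ c≡ θᴷ eθ β R = build (generator θᴷ eθ β R)
        where
        build : (Σ Generator λ gen → Generator.t gen ≡ e β) → ⊥
        build (gen , t≡β) = with-χ (χᴷ half′ (ωᴷ θᴷ eθ β R))
          where
          half′ : ∃ λ r → q r ≡ ½
          half′ = half θᴷ eθ β R
          χᴷ : (∃ λ r → q r ≡ ½) → (Σ K λ v → e v ≡ ω) → Σ K λ v → e v ≡ (RelativeNorm.ChiBasis.χ gen δ c≡)
          χᴷ (r , r≡) (w , ew) = scale r (mulK m w (𝟙 ⊕ powK m θᴷ 2)) , trans (e-scale r (mulK m w (𝟙 ⊕ powK m θᴷ 2))) (cong₂ _*_ r≡ (trans (e-* w (𝟙 ⊕ powK m θᴷ 2)) (cong₂ _*_ ew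
            (trans (e-⊕ 𝟙 (powK m θᴷ 2)) (cong₂ _+_ e-𝟙 (trans (e-^ θᴷ 2) (trans (cong (_^ 2) eθ) (trans (ring [] (θ ∷ []) (λ t → t :^ 2 ⊜ t :* t) refl) (sym φ-def)))))))))
          with-χ : (Σ K λ v → e v ≡ (RelativeNorm.ChiBasis.χ gen δ c≡)) → ⊥
          with-χ (v , ev) = with-Pχ (generates θᴷ eθ β R v ev (RelativeNorm.ChiBasis.χ-coefficients gen δ c≡) (RelativeNorm.ChiBasis.χ-relation gen δ c≡))
            where
            with-Pχ : (∃ λ P → eval P (e β) ≡ (RelativeNorm.ChiBasis.χ gen δ c≡)) → ⊥
            with-Pχ (Pχ , Pχ≡) = residue-4 (RelativeNorm.ChiBasis.δ-even gen δ c≡)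
              where
              Pχ≡′ : eval Pχ (Generator.t gen) ≡ (RelativeNorm.ChiBasis.χ gen δ c≡)
              Pχ≡′ = trans (cong (eval Pχ) t≡β) Pχ≡
              residue-4 : Even δ → ⊥
              residue-4 (η , δ≡) = split (parity η)
                where
                lem₀ : ∀ n → pos 2 ℤ.* (pos 2 ℤ.* n) ≡ pos 4 ℤ.* n
                lem₀ = solve-∀
                lem₂ : ∀ n → pos 2 ℤ.* (pos 2 ℤ.* n ℤ.+ 1ℤ) ≡ pos 4 ℤ.* n ℤ.+ pos 2
                lem₂ = solve-∀
                split : Even η ⊎ Odd η → ⊥
                split (inj₁ (n , η≡)) = RelativeNorm.ChiBasis.Roots.δ≢4n gen δ c≡ Pχ Pχ≡′ n (trans δ≡ (trans (cong (pos 2 ℤ.*_) η≡) (lem₀ n)))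
                split (inj₂ (n , η≡)) = RelativeNorm.ChiBasis.Roots.Ramified.impossible gen δ c≡ Pχ Pχ≡′ n (trans δ≡ (trans (cong (pos 2 ℤ.*_) η≡) (lem₂ n)))

      odd-case : Odd c → ∀ θᴷ → e θᴷ ≡ θ → ∀ β → RingOfIntegersIs m β → c ≡ ℤ.- 1ℤ
      odd-case c-odd θᴷ eθ β R = build (generator θᴷ eθ β R)
        where
        build : (Σ Generator λ gen → Generator.t gen ≡ e β) → c ≡ ℤ.- 1ℤ
        build (gen , _) = RelativeNorm.OddCase.c≡-1 gen c-odd

      not-monogenic : ∀ {x y} → u ℕ.* x ≡ 8 ℕ.* y ℕ.+ 1 → a ≢ ℤ.- pos 3 → ¬ Monogenic m
      not-monogenic {x} {y} ux a≢-3 (β , R) = build (root-of-a {x} {y} ux)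
        where
        build : (Σ K λ θᴷ → e θᴷ ≡ θ) → ⊥
        build (θᴷ , eθ) = split (parity c)
          where
          split : Even c ⊎ Odd c → ⊥
          split (inj₁ (δ , c≡)) = even-case δ c≡ θᴷ eθ β R
          split (inj₂ o) = a≢-3 (trans a≡ (cong (λ c → pos 4 ℤ.* c ℤ.+ 1ℤ) (odd-case o θᴷ eθ β R)))

-- Residues of a modulo 4 and the two statements.

one-mod-4 : ∀ {a} → pos 4 ℤ∣.∣ a ℤ.- 1ℤ → ∃ λ c → a ≡ pos 4 ℤ.* c ℤ.+ 1ℤ
one-mod-4 {a} h = build (∣-abs {pos 4} {a ℤ.- 1ℤ} h)
  where
  lem : ∀ a → a ≡ a ℤ.- 1ℤ ℤ.+ 1ℤ
  lem = solve-∀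
  build : pos 4 ∣ᶻ a ℤ.- 1ℤ → ∃ λ c → a ≡ pos 4 ℤ.* c ℤ.+ 1ℤ
  build (divides c e) = c , trans (lem a) (cong (ℤ._+ 1ℤ) e)

data Not1Mod4 (a : ℤ) : Set where
  twice-odd : ∀ b → Odd b → a ≡ pos 2 ℤ.* b → Not1Mod4 a
  three     : ∀ c → a ≡ pos 4 ℤ.* c ℤ.+ pos 3 → Not1Mod4 a

not-one-mod-4 : ∀ {a} → SquareFree a → ¬ (pos 4 ℤ∣.∣ a ℤ.- 1ℤ) → Not1Mod4 a
not-one-mod-4 {a} sf h = split (parity a)
  where
  split : Even a ⊎ Odd a → Not1Mod4 a
  split (inj₁ (b , a≡)) = even (parity b)
    where
    even : Even b ⊎ Odd b → Not1Mod4 a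
    even (inj₂ o) = twice-odd b o a≡
    even (inj₁ (c , b≡)) = ⊥-elim (absurd (sf 2 (abs-∣ {pos 4} {a} (divides c (trans a≡ (trans (cong (pos 2 ℤ.*_) b≡) (sym (ℤₚ.*-assoc (pos 2) (pos 2) c))))))))
      where absurd : 2 ≡ 1 → ⊥
            absurd ()
  split (inj₂ (b , a≡)) = odd (parity b)
    where
    lem₁ : ∀ c → pos 2 ℤ.* (pos 2 ℤ.* c) ℤ.+ 1ℤ ℤ.- 1ℤ ≡ pos 4 ℤ.* c
    lem₁ = solve-∀
    lem₃ : ∀ c → pos 2 ℤ.* (pos 2 ℤ.* c ℤ.+ 1ℤ) ℤ.+ 1ℤ ≡ pos 4 ℤ.* c ℤ.+ pos 3
    lem₃ = solve-∀
    odd : Even b ⊎ Odd b → Not1Mod4 a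
    odd (inj₁ (c , b≡)) = ⊥-elim (h (abs-∣ {pos 4} {a ℤ.- 1ℤ} (divides c (trans (cong (ℤ._- 1ℤ) (trans a≡ (cong (λ b → pos 2 ℤ.* b ℤ.+ 1ℤ) b≡))) (lem₁ c)))))
    odd (inj₂ (c , b≡)) = three c (trans a≡ (trans (cong (λ b → pos 2 ℤ.* b ℤ.+ 1ℤ) b≡) (lem₃ c)))

record Exponent (u : ℕ) : Set where
  constructor exponent
  field
    odd : (ℤ.- 1ℤ) ℤ.^ u ≡ ℤ.- 1ℤ
    x y : ℕ
    ux  : u ℕ.* x ≡ 8 ℕ.* y ℕ.+ 1

-- Odd squares are 1 modulo 8, so x = u solves ux = 8y + 1.
exponent-of : ∀ {u} → u ≡ 3 ⊎ u ≡ 5 ⊎ u ≡ 7 → Exponent u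
exponent-of (inj₁ refl)        = exponent refl 3 1 refl
exponent-of (inj₂ (inj₁ refl)) = exponent refl 5 3 refl
exponent-of (inj₂ (inj₂ refl)) = exponent refl 7 6 refl

module Statements {a : ℤ} (sf : SquareFree a) (S : OcticTower a) {u : ℕ} (E : Exponent u) where
  open Exponent E

  abstract
    generated : Not1Mod4 a → ∀ θᴷ → Part₁.e sf S u odd θᴷ ≡ OcticTower.θ S → RingOfIntegersIs (a ℤ.^ u) θᴷ
    generated (twice-odd b o a≡) = Part₁.ring-of-integers sf S u odd (Part₁.maximal-even sf S u odd {b} o a≡)
    generated (three c a≡)       = Part₁.ring-of-integers sf S u odd (Part₁.maximal-3-mod-4 sf S u odd {c} a≡)

    monogenic : Not1Mod4 a → Monogenic (a ℤ.^ u)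
    monogenic h = build (Part₁.root-of-a sf S u odd {x} {y} ux)
      where
      build : (Σ K λ θᴷ → Part₁.e sf S u odd θᴷ ≡ OcticTower.θ S) → Monogenic (a ℤ.^ u)
      build (θᴷ , eθ) = θᴷ , generated h θᴷ eθ

    generated-by-root : Not1Mod4 a → ∀ x y → u ℕ.* x ≡ 8 ℕ.* y ℕ.+ 1 → ∀ θᴷ → scale (ι (a ℤ.^ y)) θᴷ ≡ powK (a ℤ.^ u) αK x → RingOfIntegersIs (a ℤ.^ u) θᴷ
    generated-by-root h x y ux θᴷ e = generated h θᴷ (Part₁.e-θ sf S u odd {x} {y} ux θᴷ e)

    not-monogenic′ : pos 4 ℤ∣.∣ a ℤ.- 1ℤ → a ≢ ℤ.- pos 3 → ¬ Monogenic (a ℤ.^ u)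
    not-monogenic′ h a≢-3 = build (one-mod-4 {a} h)
      where
      build : (∃ λ c → a ≡ pos 4 ℤ.* c ℤ.+ 1ℤ) → ¬ Monogenic (a ℤ.^ u)
      build (c , a≡) = Part₁.Generators.not-monogenic sf S u odd c a≡ {x} {y} ux a≢-3

open import Data.Nat using (_<_)
open import Data.Integer using (+_; -_; ∣_∣; _^_; _-_)
open import Data.Integer.Divisibility using (_∣_)

theorem2p5 : (a : ℤ) → SquareFree a → ∣ a ∣ ≢ 1 →
    (u : ℕ) → (u ≡ 3 ⊎ u ≡ 5 ⊎ u ≡ 7) →
    ((¬ (+ 4 ∣ (a - + 1))) →
    Monogenic (a ^ u) ×
    ((x y : ℕ) → x < 8 → u ℕ.* x ≡ 8 ℕ.* y ℕ.+ 1 →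
    (θ : K) → scale (ι (a ^ y)) θ ≡ powK (a ^ u) αK x →
    RingOfIntegersIs (a ^ u) θ))
    × ((+ 4 ∣ (a - + 1)) → a ≢ - (+ 3) → ¬ Monogenic (a ^ u))
theorem2p5 a sf _ u u∈ = main (octicTower a)
  where
  main : OcticTower a → _
  main S = (λ h → M.monogenic (not-one-mod-4 sf h) , λ x y _ → M.generated-by-root (not-one-mod-4 sf h) x y) , M.not-monogenic′
    where module M = Statements sf S (exponent-of u∈)
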